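{- Let $\xi \in \mathbb{R}\setminus\mathbb{Q}$ be badly approximable, and let $n$ be a positive integer. Then there exist positive constants $c_1, c_2, c_3, c_4$, depending only on $\xi$ and $n$, such that for each real number $X \ge 1$: (a) there is an algebraic number $\alpha$ of degree $n$ with $\max_{\bar\alpha} |\xi - \bar\alpha| \le c_1 H(\alpha)^{ -2/n}$ (maximum over all conjugates $\bar\alpha$ of $\alpha$) and $c_3 X \le H(\alpha) \le c_4 X$; (b) there is an algebraic integer $\alpha$ of degree $n+1$ with $\max_{\bar\alpha\ne\alpha} |\xi - \bar\alpha| \le c_2 H(\alpha)^{ -2/n}$ (maximum over all conjugates $\bar\alpha$ of $\alpha$ different from $\alpha$) and $c_3 X \le H(\alpha) \le c_4 X$.
   Context: An irrational real number $\xi$ is badly approximable if there exists a constant $c>0$ such that $|\xi - p/q| \ge c q^{ -2}$ for all rational numbers $p/q$ (with $q\ge1$). The height $H(P)$ of a polynomial $P \in \mathbb{R}[T]$ is the largest absolute value of its coefficients. The height $H(\alpha)$ of an algebraic number $\alpha \in \mathbb{C}$ is the height of its irreducible (minimal) polynomial in $\mathbb{Z}[T]$. Conjugates of $\alpha$ are the roots of its minimal polynomial over $\mathbb{Q}$. -}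

module Defs where

open import Algebra.Bundles.Raw using (RawSemiring)
import Algebra.Definitions.RawSemiring as RawSemiringDefs
open import Data.Empty using (⊥-elim)
open import Data.Integer.Base as ℤ using (ℤ; +_)
import Data.Integer.Properties as ℤ
open import Data.List.Base using (List; []; _∷_; map; foldr)
open import Data.Nat.Base as ℕ using (ℕ; zero; suc; NonZero)
import Data.Nat.Properties as ℕ
open import Data.Product using (_×_; _,_; ∃; proj₁; proj₂)
open import Data.Rational.Base as ℚ using (ℚ; 0ℚ; 1ℚ; ½)
import Data.Rational.Properties as ℚ
open import Data.Rational.Solver using (module +-*-Solver)
import Data.Rational.Unnormalised.Base as ℚᵘ
import Data.Rational.Unnormalised.Properties as ℚᵘ
open import Data.Sum.Base using (inj₁; inj₂; [_,_]′)
open import Function.Base using (_∘_)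
open import Level using (0ℓ)
open import Relation.Binary.PropositionalEquality
  using (_≡_; _≢_; refl; sym; trans; cong; cong₂; subst; subst₂)
open import Relation.Nullary using (¬_; Dec; yes; no)

open RawSemiringDefs ℚ.+-*-rawSemiring public using () renaming (_^_ to _^ℚ_)

------------------------------------------------------------------------
-- Rational lemmas

private
  0<½ : 0ℚ ℚ.< ½
  0<½ = ℚ.positive⁻¹ ½

  0≤1ℚ : 0ℚ ℚ.≤ 1ℚ
  0≤1ℚ = ℚ.nonNegative⁻¹ 1ℚ

  *-nonneg : ∀ {p q} → 0ℚ ℚ.≤ p → 0ℚ ℚ.≤ q → 0ℚ ℚ.≤ p ℚ.* q
  *-nonneg {p} {q} 0≤p 0≤q = ℚ.nonNegative⁻¹ (p ℚ.* q)
    {{ℚ.nonNeg*nonNeg⇒nonNeg p {{ℚ.nonNegative 0≤p}} q {{ℚ.nonNegative 0≤q}}}}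

  *-pos : ∀ {p q} → 0ℚ ℚ.< p → 0ℚ ℚ.< q → 0ℚ ℚ.< p ℚ.* q
  *-pos {p} {q} 0<p 0<q = ℚ.positive⁻¹ (p ℚ.* q)
    {{ℚ.pos*pos⇒pos p {{ℚ.positive 0<p}} q {{ℚ.positive 0<q}}}}

  +-nonneg : ∀ {p q} → 0ℚ ℚ.≤ p → 0ℚ ℚ.≤ q → 0ℚ ℚ.≤ p ℚ.+ q
  +-nonneg 0≤p 0≤q = ℚ.+-mono-≤ 0≤p 0≤q

  *-mono-≤ : ∀ {p q r s} → 0ℚ ℚ.≤ p → 0ℚ ℚ.≤ s → p ℚ.≤ q → r ℚ.≤ s →
             p ℚ.* r ℚ.≤ q ℚ.* s
  *-mono-≤ {p} {q} {r} {s} 0≤p 0≤s p≤q r≤s = ℚ.≤-trans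
    (ℚ.*-monoˡ-≤-nonNeg p {{ℚ.nonNegative 0≤p}} r≤s)
    (ℚ.*-monoʳ-≤-nonNeg s {{ℚ.nonNegative 0≤s}} p≤q)

  half+half : ∀ p → ½ ℚ.* p ℚ.+ ½ ℚ.* p ≡ p
  half+half p = trans (sym (ℚ.*-distribʳ-+ p ½ ½)) (ℚ.*-identityˡ p)

  half-pos : ∀ {p} → 0ℚ ℚ.< p → 0ℚ ℚ.< ½ ℚ.* p
  half-pos = *-pos 0<½

  p≤p+q : ∀ {p q} → 0ℚ ℚ.≤ q → p ℚ.≤ p ℚ.+ q
  p≤p+q {p} {q} 0≤q =
    subst (ℚ._≤ p ℚ.+ q) (ℚ.+-identityʳ p) (ℚ.+-monoʳ-≤ p 0≤q)

  p≤∣p∣ : ∀ p → p ℚ.≤ ℚ.∣ p ∣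
  p≤∣p∣ p with ℚ.≤-total 0ℚ p
  ... | inj₁ 0≤p = ℚ.≤-reflexive (sym (ℚ.0≤p⇒∣p∣≡p 0≤p))
  ... | inj₂ p≤0 = ℚ.≤-trans p≤0 (ℚ.0≤∣p∣ p)

  ∣p-q∣≡∣q-p∣ : ∀ p q → ℚ.∣ p ℚ.- q ∣ ≡ ℚ.∣ q ℚ.- p ∣
  ∣p-q∣≡∣q-p∣ p q = trans (sym (ℚ.∣-p∣≡∣p∣ (p ℚ.- q))) (cong ℚ.∣_∣ (neg-sub p q))
    where
    open +-*-Solver
    neg-sub : ∀ a b → ℚ.- (a ℚ.- b) ≡ b ℚ.- a
    neg-sub = solve 2 (λ a b → :- (a :- b) := b :- a) refl

  a≡b+[a-b] : ∀ a b → a ≡ b ℚ.+ (a ℚ.- b)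
  a≡b+[a-b] = solve 2 (λ a b → a := b :+ (a :- b)) refl
    where open +-*-Solver

  ∣p∣≤∣q∣+∣p-q∣ : ∀ p q → ℚ.∣ p ∣ ℚ.≤ ℚ.∣ q ∣ ℚ.+ ℚ.∣ p ℚ.- q ∣
  ∣p∣≤∣q∣+∣p-q∣ p q = subst (λ r → ℚ.∣ r ∣ ℚ.≤ ℚ.∣ q ∣ ℚ.+ ℚ.∣ p ℚ.- q ∣)
    (sym (a≡b+[a-b] p q)) (ℚ.∣p+q∣≤∣p∣+∣q∣ q (p ℚ.- q))

  p≤q+∣p-q∣ : ∀ p q → p ℚ.≤ q ℚ.+ ℚ.∣ p ℚ.- q ∣
  p≤q+∣p-q∣ p q = subst (ℚ._≤ q ℚ.+ ℚ.∣ p ℚ.- q ∣) (sym (a≡b+[a-b] p q))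
    (ℚ.+-monoʳ-≤ q (p≤∣p∣ (p ℚ.- q)))

  p≤q+r⇒p-q≤r : ∀ {p q r} → p ℚ.≤ q ℚ.+ r → p ℚ.- q ℚ.≤ r
  p≤q+r⇒p-q≤r {p} {q} {r} h =
    subst (p ℚ.- q ℚ.≤_) (lemma q r) (ℚ.+-monoˡ-≤ (ℚ.- q) h)
    where
    open +-*-Solver
    lemma : ∀ q r → (q ℚ.+ r) ℚ.- q ≡ r
    lemma = solve 2 (λ q r → (q :+ r) :- q := r) refl

  ∣p-q∣≤ : ∀ {p q r} → p ℚ.≤ q ℚ.+ r → q ℚ.≤ p ℚ.+ r → ℚ.∣ p ℚ.- q ∣ ℚ.≤ r
  ∣p-q∣≤ {p} {q} {r} h₁ h₂ with ℚ.≤-total 0ℚ (p ℚ.- q)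
  ... | inj₁ 0≤d =
    subst (ℚ._≤ r) (sym (ℚ.0≤p⇒∣p∣≡p 0≤d)) (p≤q+r⇒p-q≤r h₁)
  ... | inj₂ d≤0 = subst (ℚ._≤ r)
    (sym (trans (∣p-q∣≡∣q-p∣ p q) (ℚ.0≤p⇒∣p∣≡p 0≤q-p))) (p≤q+r⇒p-q≤r h₂)
    where
    neg-sub : ∀ a b → ℚ.- (a ℚ.- b) ≡ b ℚ.- a
    neg-sub = solve 2 (λ a b → :- (a :- b) := b :- a) refl
      where open +-*-Solver
    0≤q-p : 0ℚ ℚ.≤ q ℚ.- p
    0≤q-p = subst (0ℚ ℚ.≤_) (neg-sub p q) (ℚ.neg-antimono-≤ d≤0)

  ^-nonneg : ∀ {p} k → 0ℚ ℚ.≤ p → 0ℚ ℚ.≤ p ^ℚ k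
  ^-nonneg zero    0≤p = 0≤1ℚ
  ^-nonneg (suc k) 0≤p = *-nonneg 0≤p (^-nonneg k 0≤p)

  ^-pos : ∀ {p} k → 0ℚ ℚ.< p → 0ℚ ℚ.< p ^ℚ k
  ^-pos zero    0<p = ℚ.positive⁻¹ 1ℚ
  ^-pos (suc k) 0<p = *-pos 0<p (^-pos k 0<p)

  ^-monoˡ-≤ : ∀ {p q} k → 0ℚ ℚ.≤ p → p ℚ.≤ q → p ^ℚ k ℚ.≤ q ^ℚ k
  ^-monoˡ-≤ zero    0≤p p≤q = ℚ.≤-refl
  ^-monoˡ-≤ (suc k) 0≤p p≤q =
    *-mono-≤ 0≤p (^-nonneg k (ℚ.≤-trans 0≤p p≤q)) p≤q (^-monoˡ-≤ k 0≤p p≤q)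

  ^-superadditive : ∀ {p q} k .{{_ : NonZero k}} → 0ℚ ℚ.≤ p → 0ℚ ℚ.≤ q →
                    p ^ℚ k ℚ.+ q ^ℚ k ℚ.≤ (p ℚ.+ q) ^ℚ k
  ^-superadditive {p} {q} (suc zero) 0≤p 0≤q =
    ℚ.≤-reflexive (sym (ℚ.*-distribʳ-+ 1ℚ p q))
  ^-superadditive {p} {q} (suc k@(suc _)) 0≤p 0≤q = ℚ.≤-trans
    (ℚ.+-mono-≤
      (ℚ.*-monoˡ-≤-nonNeg p {{ℚ.nonNegative 0≤p}} (p≤p+q (^-nonneg k 0≤q)))
      (ℚ.*-monoˡ-≤-nonNeg q {{ℚ.nonNegative 0≤q}} (q≤p+q (^-nonneg k 0≤p))))
    (ℚ.≤-trans (ℚ.≤-reflexive (sym (ℚ.*-distribʳ-+ (p ^ℚ k ℚ.+ q ^ℚ k) p q)))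
      (ℚ.*-monoˡ-≤-nonNeg (p ℚ.+ q) {{ℚ.nonNegative (+-nonneg 0≤p 0≤q)}}
        (^-superadditive k 0≤p 0≤q)))
    where
    q≤p+q : ∀ {p q} → 0ℚ ℚ.≤ p → q ℚ.≤ p ℚ.+ q
    q≤p+q {p} {q} 0≤p = subst (q ℚ.≤_) (ℚ.+-comm q p) (p≤p+q 0≤p)

  p≤p^k : ∀ {p} k .{{_ : NonZero k}} → 1ℚ ℚ.≤ p → p ℚ.≤ p ^ℚ k
  p≤p^k {p} (suc k) 1≤p = subst (ℚ._≤ p ℚ.* p ^ℚ k) (ℚ.*-identityʳ p)
    (ℚ.*-monoˡ-≤-nonNeg p {{ℚ.nonNegative (ℚ.≤-trans 0≤1ℚ 1≤p)}} (1≤p^ k))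
    where
    1≤p^ : ∀ k → 1ℚ ℚ.≤ p ^ℚ k
    1≤p^ zero    = ℚ.≤-refl
    1≤p^ (suc k) = subst (ℚ._≤ p ℚ.* p ^ℚ k) (ℚ.*-identityʳ 1ℚ)
      (*-mono-≤ 0≤1ℚ (ℚ.≤-trans 0≤1ℚ (1≤p^ k)) 1≤p (1≤p^ k))

  reciprocal : ∀ p → 0ℚ ℚ.< p → ∃ λ r → 0ℚ ℚ.< r × p ℚ.* r ≡ 1ℚ
  reciprocal p 0<p = ℚ.1/ p , ℚ.positive⁻¹ _ {{ℚ.1/pos⇒pos p}} , ℚ.*-inverseʳ p
    where
    instance
      _ : ℚ.Positive p
      _ = ℚ.positive 0<p
      _ : ℚ.NonZero p
      _ = ℚ.pos⇒nonZero p

  toℚᵘ-/ : ∀ i m → ℚ.toℚᵘ (i ℚ./ suc m) ℚᵘ.≃ ℚᵘ.mkℚᵘ i m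
  toℚᵘ-/ i m = ℚ.toℚᵘ-fromℚᵘ (ℚᵘ.mkℚᵘ i m)

  /-≤ : ∀ {i m j n} → i ℤ.* + suc n ℤ.≤ j ℤ.* + suc m →
        i ℚ./ suc m ℚ.≤ j ℚ./ suc n
  /-≤ {i} {m} {j} {n} h = ℚ.toℚᵘ-cancel-≤
    (ℚᵘ.≤-respˡ-≃ (ℚᵘ.≃-sym (toℚᵘ-/ i m))
      (ℚᵘ.≤-respʳ-≃ (ℚᵘ.≃-sym (toℚᵘ-/ j n)) (ℚᵘ.*≤* h)))

  /-nonneg : ∀ j m → 0ℚ ℚ.≤ + j ℚ./ suc m
  /-nonneg j m = /-≤ {+ 0} {0} {+ j} {m}
    (subst (ℤ._≤ + j ℤ.* + 1) (sym (ℤ.*-zeroˡ (+ suc m)))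
      (subst (+ 0 ℤ.≤_) (sym (ℤ.*-identityʳ (+ j))) (ℤ.+≤+ ℕ.z≤n)))

  /-suc : ∀ j m → + suc j ℚ./ suc m ≡ + j ℚ./ suc m ℚ.+ + 1 ℚ./ suc m
  /-suc j m = ℚ.toℚᵘ-injective (begin
    ℚ.toℚᵘ (+ suc j ℚ./ suc m)                            ≈⟨ toℚᵘ-/ (+ suc j) m ⟩
    ℚᵘ.mkℚᵘ (+ suc j) m                                   ≈⟨ ℚᵘ.*≡* eq ⟩
    ℚᵘ.mkℚᵘ (+ j) m ℚᵘ.+ ℚᵘ.mkℚᵘ (+ 1) m
      ≈⟨ ℚᵘ.+-cong (toℚᵘ-/ (+ j) m) (toℚᵘ-/ (+ 1) m) ⟨
    ℚ.toℚᵘ (+ j ℚ./ suc m) ℚᵘ.+ ℚ.toℚᵘ (+ 1 ℚ./ suc m)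
      ≈⟨ ℚ.toℚᵘ-homo-+ (+ j ℚ./ suc m) (+ 1 ℚ./ suc m) ⟨
    ℚ.toℚᵘ (+ j ℚ./ suc m ℚ.+ + 1 ℚ./ suc m)              ∎)
    where
    open import Relation.Binary.Reasoning.Setoid ℚᵘ.≃-setoid
    eq : + suc j ℤ.* + (suc m ℕ.* suc m) ≡
         (+ j ℤ.* + suc m ℤ.+ + 1 ℤ.* + suc m) ℤ.* + suc m
    eq = trans (cong (+ suc j ℤ.*_) (ℤ.pos-* (suc m) (suc m)))
      (trans (sym (ℤ.*-assoc (+ suc j) (+ suc m) (+ suc m)))
        (cong (ℤ._* + suc m)
          (trans (cong (ℤ._* + suc m) (ℤ.+-comm (+ 1) (+ j)))
            (ℤ.*-distribʳ-+ (+ suc m) (+ j) (+ 1)))))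

------------------------------------------------------------------------
-- Real numbers: Cauchy sequences of rationals with a modulus of
-- convergence, compared up to the equivalence _≈ℝ_.

Eventually : (ℕ → Set) → Set
Eventually P = ∃ λ N → ∀ n → N ℕ.≤ n → P n

IsCauchy : (ℕ → ℚ) → Set
IsCauchy s = ∀ ε → 0ℚ ℚ.< ε →
  ∃ λ N → ∀ m n → N ℕ.≤ m → N ℕ.≤ n → ℚ.∣ s m ℚ.- s n ∣ ℚ.≤ ε

record ℝ : Set where
  constructor mkℝ
  field
    seq    : ℕ → ℚ
    cauchy : IsCauchy seq

open ℝ public

infix 4 _≈ℝ_ _≤ℝ_ _<ℝ_

record _≈ℝ_ (x y : ℝ) : Set where
  constructor mk≈
  field
    un≈ : ∀ ε → 0ℚ ℚ.< ε → Eventually λ n → ℚ.∣ seq x n ℚ.- seq y n ∣ ℚ.≤ ε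

record _≤ℝ_ (x y : ℝ) : Set where
  constructor mk≤
  field
    un≤ : ∀ ε → 0ℚ ℚ.< ε → Eventually λ n → seq x n ℚ.≤ seq y n ℚ.+ ε

record _<ℝ_ (x y : ℝ) : Set where
  constructor mk<
  field
    gap     : ℚ
    gap-pos : 0ℚ ℚ.< gap
    un<     : Eventually λ n → seq x n ℚ.+ gap ℚ.≤ seq y n

open _≈ℝ_ public
open _≤ℝ_ public
open _<ℝ_ public

opaque
  const-cauchy : ∀ q → IsCauchy (λ _ → q)
  const-cauchy q ε 0<ε = 0 , λ _ _ _ _ →
    subst (ℚ._≤ ε) (sym (cong ℚ.∣_∣ (ℚ.+-inverseʳ q))) (ℚ.<⇒≤ 0<ε)

fromℚ : ℚ → ℝ
fromℚ q = mkℝ (λ _ → q) (const-cauchy q)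

fromℤ : ℤ → ℝ
fromℤ i = fromℚ (i ℚ./ 1)

fromℕ : ℕ → ℝ
fromℕ n = fromℤ (+ n)

0ℝ 1ℝ : ℝ
0ℝ = fromℚ 0ℚ
1ℝ = fromℚ 1ℚ

infixl 6 _+ℝ_ _-ℝ_
infixl 7 _*ℝ_
infix  8 -ℝ_

opaque
  +-cauchy : ∀ x y → IsCauchy (λ n → seq x n ℚ.+ seq y n)
  +-cauchy x y ε 0<ε =
    let M , hx = cauchy x (½ ℚ.* ε) (half-pos 0<ε)
        N , hy = cauchy y (½ ℚ.* ε) (half-pos 0<ε)
    in M ℕ.⊔ N , λ m n m≥ n≥ → subst₂ (λ a b → ℚ.∣ a ∣ ℚ.≤ b)
      (sym (rearrange (seq x m) _ _ _)) (half+half ε)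
      (ℚ.≤-trans (ℚ.∣p+q∣≤∣p∣+∣q∣ (seq x m ℚ.- seq x n) (seq y m ℚ.- seq y n))
        (ℚ.+-mono-≤
          (hx m n (ℕ.m⊔n≤o⇒m≤o M N m≥) (ℕ.m⊔n≤o⇒m≤o M N n≥))
          (hy m n (ℕ.m⊔n≤o⇒n≤o M N m≥) (ℕ.m⊔n≤o⇒n≤o M N n≥))))
    where
    rearrange : ∀ a b c d → (a ℚ.+ b) ℚ.- (c ℚ.+ d) ≡ (a ℚ.- c) ℚ.+ (b ℚ.- d)
    rearrange = solve 4 (λ a b c d → (a :+ b) :- (c :+ d) := (a :- c) :+ (b :- d)) refl
      where open +-*-Solver

_+ℝ_ : ℝ → ℝ → ℝ
x +ℝ y = mkℝ (λ n → seq x n ℚ.+ seq y n) (+-cauchy x y)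

opaque
  neg-cauchy : ∀ x → IsCauchy (λ n → ℚ.- seq x n)
  neg-cauchy x ε 0<ε =
    let N , h = cauchy x ε 0<ε
    in N , λ m n m≥ n≥ →
      subst (ℚ._≤ ε) (sym (same (seq x m) (seq x n))) (h m n m≥ n≥)
    where
    same : ∀ a b → ℚ.∣ (ℚ.- a) ℚ.- (ℚ.- b) ∣ ≡ ℚ.∣ a ℚ.- b ∣
    same a b = trans (cong ℚ.∣_∣ (sym (ℚ.neg-distrib-+ a (ℚ.- b)))) (ℚ.∣-p∣≡∣p∣ (a ℚ.- b))

-ℝ_ : ℝ → ℝ
-ℝ x = mkℝ (λ n → ℚ.- seq x n) (neg-cauchy x)

_-ℝ_ : ℝ → ℝ → ℝ
x -ℝ y = x +ℝ (-ℝ y)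

private
  bounded : ∀ x → ∃ λ B → 0ℚ ℚ.< B × Eventually λ n → ℚ.∣ seq x n ∣ ℚ.≤ B
  bounded x with cauchy x 1ℚ (ℚ.positive⁻¹ 1ℚ)
  ... | N , h = ℚ.∣ seq x N ∣ ℚ.+ 1ℚ ,
    ℚ.+-mono-≤-< (ℚ.0≤∣p∣ (seq x N)) (ℚ.positive⁻¹ 1ℚ) , N , λ n n≥ →
      ℚ.≤-trans (∣p∣≤∣q∣+∣p-q∣ (seq x n) (seq x N))
        (ℚ.+-monoʳ-≤ ℚ.∣ seq x N ∣ (h n N n≥ ℕ.≤-refl))

  scale : ∀ B ε → 0ℚ ℚ.< B → 0ℚ ℚ.< ε → ∃ λ δ → 0ℚ ℚ.< δ × B ℚ.* δ ≡ ε
  scale B ε 0<B 0<ε with reciprocal B 0<B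
  ... | r , 0<r , Br≡1 = r ℚ.* ε , *-pos 0<r 0<ε ,
    trans (sym (ℚ.*-assoc B r ε)) (trans (cong (ℚ._* ε) Br≡1) (ℚ.*-identityˡ ε))

private
  *-close : ∀ a b c d {A B δ η} → ℚ.∣ a ∣ ℚ.≤ A → ℚ.∣ d ∣ ℚ.≤ B →
    0ℚ ℚ.≤ δ → 0ℚ ℚ.≤ η → ℚ.∣ b ℚ.- d ∣ ℚ.≤ δ → ℚ.∣ a ℚ.- c ∣ ℚ.≤ η →
    ℚ.∣ a ℚ.* b ℚ.- c ℚ.* d ∣ ℚ.≤ A ℚ.* δ ℚ.+ B ℚ.* η
  *-close a b c d a≤A d≤B 0≤δ 0≤η b-d≤δ a-c≤η =
    subst (λ r → ℚ.∣ r ∣ ℚ.≤ _) (sym (rearrange a b c d))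
      (ℚ.≤-trans (ℚ.∣p+q∣≤∣p∣+∣q∣ (a ℚ.* (b ℚ.- d)) (d ℚ.* (a ℚ.- c)))
        (ℚ.+-mono-≤ (bound a (b ℚ.- d) a≤A 0≤δ b-d≤δ) (bound d (a ℚ.- c) d≤B 0≤η a-c≤η)))
    where
    rearrange : ∀ a b c d →
      a ℚ.* b ℚ.- c ℚ.* d ≡ a ℚ.* (b ℚ.- d) ℚ.+ d ℚ.* (a ℚ.- c)
    rearrange = solve 4 (λ a b c d →
      a :* b :- c :* d := a :* (b :- d) :+ d :* (a :- c)) refl
      where open +-*-Solver
    bound : ∀ p q {C γ} → ℚ.∣ p ∣ ℚ.≤ C → 0ℚ ℚ.≤ γ → ℚ.∣ q ∣ ℚ.≤ γ →
            ℚ.∣ p ℚ.* q ∣ ℚ.≤ C ℚ.* γ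
    bound p q {C} {γ} p≤C 0≤γ q≤γ = subst (ℚ._≤ C ℚ.* γ) (sym (ℚ.∣p*q∣≡∣p∣*∣q∣ p q))
      (*-mono-≤ (ℚ.0≤∣p∣ p) 0≤γ p≤C q≤γ)

opaque
  *-cauchy : ∀ x y → IsCauchy (λ n → seq x n ℚ.* seq y n)
  *-cauchy x y ε 0<ε =
    let A , 0<A , M₁ , x≤A = bounded x
        B , 0<B , M₂ , y≤B = bounded y
        δ , 0<δ , Aδ = scale A (½ ℚ.* ε) 0<A (half-pos 0<ε)
        η , 0<η , Bη = scale B (½ ℚ.* ε) 0<B (half-pos 0<ε)
        N₁ , hy = cauchy y δ 0<δ
        N₂ , hx = cauchy x η 0<η
    in (M₁ ℕ.⊔ M₂) ℕ.⊔ (N₁ ℕ.⊔ N₂) , λ m n m≥ n≥ →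
      let m≥M = ℕ.m⊔n≤o⇒m≤o (M₁ ℕ.⊔ M₂) (N₁ ℕ.⊔ N₂) m≥
          n≥M = ℕ.m⊔n≤o⇒m≤o (M₁ ℕ.⊔ M₂) (N₁ ℕ.⊔ N₂) n≥
          m≥N = ℕ.m⊔n≤o⇒n≤o (M₁ ℕ.⊔ M₂) (N₁ ℕ.⊔ N₂) m≥
          n≥N = ℕ.m⊔n≤o⇒n≤o (M₁ ℕ.⊔ M₂) (N₁ ℕ.⊔ N₂) n≥
      in ℚ.≤-trans
        (*-close (seq x m) (seq y m) (seq x n) (seq y n)
          (x≤A m (ℕ.m⊔n≤o⇒m≤o M₁ M₂ m≥M)) (y≤B n (ℕ.m⊔n≤o⇒n≤o M₁ M₂ n≥M))
          (ℚ.<⇒≤ 0<δ) (ℚ.<⇒≤ 0<η)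
          (hy m n (ℕ.m⊔n≤o⇒m≤o N₁ N₂ m≥N) (ℕ.m⊔n≤o⇒m≤o N₁ N₂ n≥N))
          (hx m n (ℕ.m⊔n≤o⇒n≤o N₁ N₂ m≥N) (ℕ.m⊔n≤o⇒n≤o N₁ N₂ n≥N)))
        (ℚ.≤-reflexive (trans (cong₂ ℚ._+_ Aδ Bη) (half+half ε)))

_*ℝ_ : ℝ → ℝ → ℝ
x *ℝ y = mkℝ (λ n → seq x n ℚ.* seq y n) (*-cauchy x y)

opaque
  abs-cauchy : ∀ x → IsCauchy (λ n → ℚ.∣ seq x n ∣)
  abs-cauchy x ε 0<ε =
    let N , h = cauchy x ε 0<ε
    in N , λ m n m≥ n≥ → ℚ.≤-trans
      (∣p-q∣≤ (∣p∣≤∣q∣+∣p-q∣ (seq x m) (seq x n))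
        (subst (λ d → ℚ.∣ seq x n ∣ ℚ.≤ ℚ.∣ seq x m ∣ ℚ.+ d)
          (∣p-q∣≡∣q-p∣ (seq x n) (seq x m)) (∣p∣≤∣q∣+∣p-q∣ (seq x n) (seq x m))))
      (h m n m≥ n≥)

∣_∣ℝ : ℝ → ℝ
∣ x ∣ℝ = mkℝ (λ n → ℚ.∣ seq x n ∣) (abs-cauchy x)

------------------------------------------------------------------------
-- root k x is the nonnegative k-th root of max(x, 0). Its m-th
-- approximation is the largest multiple of 1/(m+1) whose k-th power is
-- at most max(xₘ, 0).

positivePart : ℚ → ℚ
positivePart q = 0ℚ ℚ.⊔ q

greatestBelow : {P : ℕ → Set} → (∀ j → Dec (P j)) → ℕ → ℕ
greatestBelow P? zero = zero
greatestBelow P? (suc b) with P? b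
... | yes _ = b
... | no  _ = greatestBelow P? b

RootBelow : ℕ → ℚ → ℕ → ℕ → Set
RootBelow k q m j = (+ j ℚ./ suc m) ^ℚ k ℚ.≤ positivePart q

rootBelow? : ∀ k q m j → Dec (RootBelow k q m j)
rootBelow? k q m j = (+ j ℚ./ suc m) ^ℚ k ℚ.≤? positivePart q

-- The search bound exceeds every candidate: for k ≥ 1,
-- (searchBound q m / (m + 1)) ^ k ≥ ∣ numerator of q ∣ + 1 > max(q, 0).
searchBound : ℚ → ℕ → ℕ
searchBound q m = suc ℤ.∣ ℚ.↥ q ∣ ℕ.* suc m

rootNumerator : ℕ → ℚ → ℕ → ℕ
rootNumerator k q m = greatestBelow (rootBelow? k q m) (searchBound q m)

rootApprox : ℕ → ℚ → ℕ → ℚ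
rootApprox k q m = + rootNumerator k q m ℚ./ suc m

private
  greatestBelow-holds : ∀ {P : ℕ → Set} (P? : ∀ j → Dec (P j)) b → P 0 →
                        P (greatestBelow P? b)
  greatestBelow-holds P? zero    p0 = p0
  greatestBelow-holds P? (suc b) p0 with P? b
  ... | yes p = p
  ... | no  _ = greatestBelow-holds P? b p0

  greatestBelow-max : ∀ {P : ℕ → Set} (P? : ∀ j → Dec (P j)) b → P 0 → ¬ P b →
                      ¬ P (suc (greatestBelow P? b))
  greatestBelow-max P? zero    p0 ¬p = ⊥-elim (¬p p0)
  greatestBelow-max P? (suc b) p0 ¬p with P? b
  ... | yes _   = ¬p
  ... | no  ¬p′ = greatestBelow-max P? b p0 ¬p′

0≤positivePart : ∀ q → 0ℚ ℚ.≤ positivePart q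
0≤positivePart q = ℚ.p≤p⊔q 0ℚ q

rootApprox-nonneg : ∀ k q m → 0ℚ ℚ.≤ rootApprox k q m
rootApprox-nonneg k q m = /-nonneg (rootNumerator k q m) m

private
  0^k≤ : ∀ k .{{_ : NonZero k}} q m → RootBelow k q m 0
  0^k≤ (suc k) q m = subst (ℚ._≤ positivePart q)
    (sym (trans (cong (ℚ._* (+ 0 ℚ./ suc m) ^ℚ k) 0/suc≡0) (ℚ.*-zeroˡ ((+ 0 ℚ./ suc m) ^ℚ k))))
    (0≤positivePart q)
    where
    0/suc≡0 : + 0 ℚ./ suc m ≡ 0ℚ
    0/suc≡0 = ℚ.≤-antisym
      (/-≤ {+ 0} {m} {+ 0} {0} (ℤ.+≤+ ℕ.z≤n)) (/-nonneg 0 m)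

  searchBound-fails : ∀ k .{{_ : NonZero k}} q m → ¬ RootBelow k q m (searchBound q m)
  searchBound-fails k q m h = ℚ.<-irrefl refl (ℚ.<-≤-trans q⁺<b
    (ℚ.≤-trans (ℚ.≤-trans b≤B (p≤p^k k (ℚ.≤-trans 1≤b b≤B))) h))
    where
    a = ℤ.∣ ℚ.↥ q ∣
    b = + suc a ℚ./ 1
    b≤B : b ℚ.≤ + searchBound q m ℚ./ suc m
    b≤B = /-≤ {+ suc a} {0} {+ searchBound q m} {m}
      (ℤ.≤-reflexive (trans (sym (ℤ.pos-* (suc a) (suc m)))
        (sym (ℤ.*-identityʳ (+ searchBound q m)))))
    1≤b : 1ℚ ℚ.≤ b
    1≤b = /-≤ {+ 1} {0} {+ suc a} {0} (ℤ.+≤+ (ℕ.s≤s ℕ.z≤n))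
    a/1≤ : 0ℚ ℚ.≤ + a ℚ./ 1
    a/1≤ = /-nonneg a 0
    q≤a : q ℚ.≤ + a ℚ./ 1
    q≤a = ℚ.≤-trans (p≤∣p∣ q) (ℚ.toℚᵘ-cancel-≤
      (ℚᵘ.≤-respʳ-≃ (ℚᵘ.≃-sym (toℚᵘ-/ (+ a) 0)) (abs≤ q)))
      where
      abs≤ : ∀ q → ℚ.toℚᵘ ℚ.∣ q ∣ ℚᵘ.≤ ℚᵘ.mkℚᵘ (+ ℤ.∣ ℚ.↥ q ∣) 0
      abs≤ (ℚ.mkℚ n d _) = ℚᵘ.*≤* (subst₂ ℤ._≤_
        (ℤ.pos-* ℤ.∣ n ∣ 1) (ℤ.pos-* ℤ.∣ n ∣ (suc d))
        (ℤ.+≤+ (ℕ.*-monoʳ-≤ ℤ.∣ n ∣ (ℕ.s≤s ℕ.z≤n))))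
    q⁺<b : positivePart q ℚ.< b
    q⁺<b = ℚ.≤-<-trans (ℚ.⊔-lub a/1≤ q≤a)
      (subst (+ a ℚ./ 1 ℚ.<_) (sym (/-suc a 0))
        (subst (ℚ._< + a ℚ./ 1 ℚ.+ 1ℚ) (ℚ.+-identityʳ (+ a ℚ./ 1))
          (ℚ.+-monoʳ-< (+ a ℚ./ 1) (ℚ.positive⁻¹ 1ℚ))))

rootApprox-lower : ∀ k .{{_ : NonZero k}} q m →
                   rootApprox k q m ^ℚ k ℚ.≤ positivePart q
rootApprox-lower k q m =
  greatestBelow-holds (rootBelow? k q m) (searchBound q m) (0^k≤ k q m)

rootApprox-upper : ∀ k .{{_ : NonZero k}} q m →
                   positivePart q ℚ.< (rootApprox k q m ℚ.+ + 1 ℚ./ suc m) ^ℚ k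
rootApprox-upper k q m = subst (λ r → positivePart q ℚ.< r ^ℚ k)
  (/-suc (rootNumerator k q m) m)
  (ℚ.≰⇒> (greatestBelow-max (rootBelow? k q m) (searchBound q m)
    (0^k≤ k q m) (searchBound-fails k q m)))

1/n→0 : ∀ ε → 0ℚ ℚ.< ε → Eventually λ n → + 1 ℚ./ suc n ℚ.≤ ε
1/n→0 ε@(ℚ.mkℚ (+ suc a) d _) 0<ε = d , λ n d≤n → ℚ.toℚᵘ-cancel-≤
  (ℚᵘ.≤-respˡ-≃ (ℚᵘ.≃-sym (toℚᵘ-/ (+ 1) n)) (ℚᵘ.*≤*
    (subst₂ ℤ._≤_ (ℤ.pos-* 1 (suc d)) (ℤ.pos-* (suc a) (suc n))
      (ℤ.+≤+ (ℕ.*-mono-≤ {1} {suc a} (ℕ.s≤s ℕ.z≤n) (ℕ.s≤s d≤n))))))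
1/n→0 (ℚ.mkℚ (+ 0) d _) 0<ε =
  ⊥-elim (ℤ.<-irrefl (sym (ℤ.*-zeroˡ (+ 1))) (ℚ.drop-*<* 0<ε))
1/n→0 (ℚ.mkℚ (ℤ.-[1+ a ]) d _) (ℚ.*<* ())

private
  rootApprox-close : ∀ k .{{_ : NonZero k}} p q m n ε → 0ℚ ℚ.< ε →
    p ℚ.≤ q ℚ.+ (½ ℚ.* ε) ^ℚ k → + 1 ℚ./ suc n ℚ.≤ ½ ℚ.* ε →
    rootApprox k p m ℚ.≤ rootApprox k q n ℚ.+ ε
  rootApprox-close k p q m n ε 0<ε p≤ δ≤ = ℚ.≮⇒≥ λ s+ε<r →
    ℚ.<-irrefl refl (ℚ.<-≤-trans p⁺<
      (ℚ.≤-trans (^-monoˡ-≤ k 0≤s+ε (ℚ.<⇒≤ s+ε<r)) (rootApprox-lower k p m)))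
    where
    s = rootApprox k q n
    h = ½ ℚ.* ε
    0≤h : 0ℚ ℚ.≤ h
    0≤h = ℚ.<⇒≤ (half-pos 0<ε)
    0≤s : 0ℚ ℚ.≤ s
    0≤s = rootApprox-nonneg k q n
    0≤s+ε : 0ℚ ℚ.≤ s ℚ.+ ε
    0≤s+ε = +-nonneg 0≤s (ℚ.<⇒≤ 0<ε)
    p⁺≤ : positivePart p ℚ.≤ positivePart q ℚ.+ h ^ℚ k
    p⁺≤ = ℚ.⊔-lub (+-nonneg (0≤positivePart q) (^-nonneg k 0≤h))
      (ℚ.≤-trans p≤ (ℚ.+-monoˡ-≤ (h ^ℚ k) (ℚ.p≤q⊔p 0ℚ q)))
    p⁺< : positivePart p ℚ.< (s ℚ.+ ε) ^ℚ k
    p⁺< = ℚ.≤-<-trans p⁺≤ (ℚ.<-≤-trans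
      (ℚ.+-monoˡ-< (h ^ℚ k) (ℚ.<-≤-trans (rootApprox-upper k q n)
        (^-monoˡ-≤ k (+-nonneg 0≤s (/-nonneg 1 n)) (ℚ.+-monoʳ-≤ s δ≤))))
      (subst ((s ℚ.+ h) ^ℚ k ℚ.+ h ^ℚ k ℚ.≤_)
        (cong (_^ℚ k) (trans (ℚ.+-assoc s h h) (cong (s ℚ.+_) (half+half ε))))
        (^-superadditive k (+-nonneg 0≤s 0≤h) 0≤h)))

opaque
  root-cauchy : ∀ k .{{_ : NonZero k}} x → IsCauchy (λ m → rootApprox k (seq x m) m)
  root-cauchy k x ε 0<ε =
    let M , hx = cauchy x ((½ ℚ.* ε) ^ℚ k) (^-pos k (half-pos 0<ε))
        N , hδ = 1/n→0 (½ ℚ.* ε) (half-pos 0<ε)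
        close : ∀ m n → M ℕ.≤ m → M ℕ.≤ n → N ℕ.≤ n →
          rootApprox k (seq x m) m ℚ.≤ rootApprox k (seq x n) n ℚ.+ ε
        close m n m≥M n≥M n≥N = rootApprox-close k (seq x m) (seq x n) m n ε 0<ε
          (ℚ.≤-trans (p≤q+∣p-q∣ (seq x m) (seq x n))
            (ℚ.+-monoʳ-≤ (seq x n) (hx m n m≥M n≥M)))
          (hδ n n≥N)
    in M ℕ.⊔ N , λ m n m≥ n≥ →
      let m≥M = ℕ.m⊔n≤o⇒m≤o M N m≥
          n≥M = ℕ.m⊔n≤o⇒m≤o M N n≥
      in ∣p-q∣≤ (close m n m≥M n≥M (ℕ.m⊔n≤o⇒n≤o M N n≥))
                (close n m n≥M m≥M (ℕ.m⊔n≤o⇒n≤o M N m≥))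

root : (k : ℕ) .{{_ : NonZero k}} → ℝ → ℝ
root k x = mkℝ (λ m → rootApprox k (seq x m) m) (root-cauchy k x)

infix 8 _^-2/_
_^-2/_ : (h : ℕ) .{{_ : NonZero h}} (n : ℕ) .{{_ : NonZero n}} → ℝ
h ^-2/ n = root n (fromℚ ((+ 1 ℚ./ h) ^ℚ 2))

------------------------------------------------------------------------
-- Diophantine properties of real numbers

Irrational : ℝ → Set
Irrational ξ = ∀ r → ¬ ξ ≈ℝ fromℚ r

BadlyApproximable : ℝ → Set
BadlyApproximable ξ = Irrational ξ × ∃ λ c → 0ℝ <ℝ c ×
  (∀ (p : ℤ) (q : ℕ) .{{_ : NonZero q}} →
    c *ℝ fromℚ ((+ 1 ℚ./ q) ^ℚ 2) ≤ℝ ∣ ξ -ℝ fromℚ (p ℚ./ q) ∣ℝ)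

------------------------------------------------------------------------
-- Complex numbers

infixl 6 _+i_

record ℂ : Set where
  constructor _+i_
  field
    re : ℝ
    im : ℝ

open ℂ public

infix 4 _≈ℂ_ _≉ℂ_

record _≈ℂ_ (z w : ℂ) : Set where
  constructor mk≈ℂ
  field
    re-≈ : re z ≈ℝ re w
    im-≈ : im z ≈ℝ im w

open _≈ℂ_ public

_≉ℂ_ : ℂ → ℂ → Set
z ≉ℂ w = ¬ z ≈ℂ w

fromℝ : ℝ → ℂ
fromℝ x = x +i 0ℝ

0ℂ : ℂ
0ℂ = fromℝ 0ℝ

infixl 6 _+ℂ_ _-ℂ_
infixl 7 _*ℂ_

_+ℂ_ _-ℂ_ _*ℂ_ : ℂ → ℂ → ℂ
z +ℂ w = (re z +ℝ re w) +i (im z +ℝ im w)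
z -ℂ w = (re z -ℝ re w) +i (im z -ℝ im w)
z *ℂ w = (re z *ℝ re w -ℝ im z *ℝ im w) +i (re z *ℝ im w +ℝ im z *ℝ re w)

∣_∣ℂ : ℂ → ℝ
∣ z ∣ℂ = root 2 (re z *ℝ re z +ℝ im z *ℝ im z)

------------------------------------------------------------------------
-- Integer polynomials, as coefficient lists starting with the constant
-- term. Trailing zeros are allowed, so equality is coefficientwise.

ℤ[T] : Set
ℤ[T] = List ℤ

coeff : ℤ[T] → ℕ → ℤ
coeff []      _       = + 0
coeff (a ∷ p) zero    = a
coeff (a ∷ p) (suc i) = coeff p i

infix  4 _≈ₚ_
infixl 6 _+ₚ_
infixl 7 _*ₚ_

record _≈ₚ_ (p q : ℤ[T]) : Set where
  constructor mk≈ₚ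
  field
    coeff-≡ : ∀ i → coeff p i ≡ coeff q i

open _≈ₚ_ public

_+ₚ_ : ℤ[T] → ℤ[T] → ℤ[T]
[]      +ₚ q       = q
(a ∷ p) +ₚ []      = a ∷ p
(a ∷ p) +ₚ (b ∷ q) = a ℤ.+ b ∷ p +ₚ q

_*ₚ_ : ℤ[T] → ℤ[T] → ℤ[T]
[]      *ₚ q = []
(a ∷ p) *ₚ q = map (a ℤ.*_) q +ₚ (+ 0 ∷ p *ₚ q)

ℤ[T]-rawSemiring : RawSemiring 0ℓ 0ℓ
ℤ[T]-rawSemiring = record
  { Carrier = ℤ[T]
  ; _≈_     = _≈ₚ_
  ; _+_     = _+ₚ_
  ; _*_     = _*ₚ_
  ; 0#      = []
  ; 1#      = + 1 ∷ []
  }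

open RawSemiringDefs ℤ[T]-rawSemiring public using (Irreducible; mkIrred)

HasDegree : ℤ[T] → ℕ → Set
HasDegree p d = coeff p d ≢ + 0 × (∀ i → d ℕ.< i → coeff p i ≡ + 0)

Monic : ℤ[T] → Set
Monic p = ∃ λ d → coeff p d ≡ + 1 × (∀ i → d ℕ.< i → coeff p i ≡ + 0)

polyHeight : ℤ[T] → ℕ
polyHeight = foldr (λ a h → ℤ.∣ a ∣ ℕ.⊔ h) 0

eval : ℤ[T] → ℂ → ℂ
eval p z = foldr (λ a w → fromℝ (fromℤ a) +ℂ z *ℂ w) 0ℂ p

polyHeight≡0⇒≈0 : ∀ p → polyHeight p ≡ 0 → p ≈ₚ []
polyHeight≡0⇒≈0 p h≡0 = mk≈ₚ (go p h≡0)
  where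
  go : ∀ p → polyHeight p ≡ 0 → ∀ i → coeff p i ≡ + 0
  go []      _   i = refl
  go (a ∷ p) h≡0 zero = ℤ.∣i∣≡0⇒i≡0 (ℕ.n≤0⇒n≡0
    (subst (ℤ.∣ a ∣ ℕ.≤_) h≡0 (ℕ.m≤m⊔n ℤ.∣ a ∣ (polyHeight p))))
  go (a ∷ p) h≡0 (suc i) = go p (ℕ.n≤0⇒n≡0
    (subst (polyHeight p ℕ.≤_) h≡0 (ℕ.m≤n⊔m ℤ.∣ a ∣ (polyHeight p)))) i

irreducible⇒height≢0 : ∀ {p} → Irreducible p → polyHeight p ≢ 0
irreducible⇒height≢0 {p} (mkIrred _ split) h≡0 = [ []∤1 , []∤1 ]′
  (split {[]} {[]} (polyHeight≡0⇒≈0 p h≡0))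
  where
  open RawSemiringDefs ℤ[T]-rawSemiring using (_∣_; _∤_)
  open import Algebra.Definitions.RawMagma
    (RawSemiring.*-rawMagma ℤ[T]-rawSemiring) using (_,_)
  coeff-*[] : ∀ q i → coeff (q *ₚ []) i ≡ + 0
  coeff-*[] []      i       = refl
  coeff-*[] (_ ∷ q) zero    = refl
  coeff-*[] (_ ∷ q) (suc i) = coeff-*[] q i
  []∤1 : [] ∤ (+ 1 ∷ [])
  []∤1 (q , q*0≈1) with trans (sym (coeff-*[] q 0)) (coeff-≡ q*0≈1 0)
  ... | ()

------------------------------------------------------------------------
-- Algebraic numbers

-- An algebraic number is presented with its irreducible polynomial in
-- ℤ[T], which is determined up to sign. Irreducibility in the ring ℤ[T]
-- includes primitivity, as the height requires.
record AlgebraicNumber : Set where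
  field
    value       : ℂ
    minPoly     : ℤ[T]
    irreducible : Irreducible minPoly
    isRoot      : eval minPoly value ≈ℂ 0ℂ

open AlgebraicNumber public

Degree : AlgebraicNumber → ℕ → Set
Degree α = HasDegree (minPoly α)

height : AlgebraicNumber → ℕ
height α = polyHeight (minPoly α)

height-nonZero : ∀ α → NonZero (height α)
height-nonZero α = ℕ.≢-nonZero (irreducible⇒height≢0 (irreducible α))

height^-2/ : AlgebraicNumber → (n : ℕ) .{{_ : NonZero n}} → ℝ
height^-2/ α n = _^-2/_ (height α) {{height-nonZero α}} n

Conjugate : AlgebraicNumber → ℂ → Set
Conjugate α z = eval (minPoly α) z ≈ℂ 0ℂ

AlgebraicInteger : AlgebraicNumber → Set
AlgebraicInteger α = ∃ λ p → Monic p × eval p (value α) ≈ℂ 0ℂ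

{-# OPTIONS --safe #-}

-- Bad approximability makes the denominators q, q′ of every Stern-Brocot interval
-- around ξ comparable, so ξ has pairs of approximations p/q, p′/q′ of determinant
-- ±1 with q of any prescribed size up to constants, one of them with an even
-- numerator p. Put A = q T - p and B = q′ T - p′. A form Σ eⱼ Aⁿ⁻ʲ Bʲ with bounded
-- coefficients has height ≪ qⁿ, and in the variable x = q (q T - p) it is q⁻ⁿ times
-- a polynomial with bounded coefficients, so its zeros lie within ≪ q⁻² of ξ as
-- soon as its leading coefficient is ≫ qⁿ.
--
-- For (a) the form is 2 Kⁿ Bⁿ - Aⁿ, for a large odd K. For (b) one writes
-- Tⁿ⁺¹ = (A/q)ⁿ⁺¹ + Σ tⱼ Aⁿ⁻ʲ Bʲ with rational tⱼ and rounds: adding integer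
-- multiples of the Aⁿ⁻ʲ Bʲ replaces the tⱼ by bounded eⱼ ≥ 0. In u = 1/x the zeros
-- of the resulting monic polynomial solve u Σ eⱼ (κ - s u)ʲ = -q⁻ⁿ⁻² (κ = q′/q,
-- s = ±1); the left side is injective near u = 0, so exactly one zero is far from ξ.
-- Parities are arranged so that both polynomials are Eisenstein at 2, and a real
-- zero of each is found by bisection. Statements about complex zeros are reduced to
-- their approximations in ℚ(i), with the norm |Re| + |Im|.

module Submission where

open import Defs
import Algebra.Definitions.RawMagma as RawMagmaDefs
import Algebra.Definitions.RawSemiring as RawSemiringDefs
import Algebra.Solver.Ring.AlmostCommutativeRing as ACR
import Algebra.Solver.Ring.Simple as RingSolver
open import Algebra.Bundles using (CommutativeRing; module Semiring)
open import Algebra.Bundles.Raw using (module RawSemiring)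
open import Data.Bool.Base using (Bool; true; false)
open import Data.Empty using (⊥; ⊥-elim)
open import Data.Integer.Base as ℤ using (ℤ; +_; -[1+_])
import Data.Integer.DivMod as ℤ
import Data.Integer.Divisibility.Signed as ℤ
open import Data.Integer.Divisibility.Signed using (divides)
import Data.Integer.Properties as ℤ
import Data.Integer.Solver as ℤSolver
open import Data.List.Base using (List; []; _∷_; map; length; zipWith)
open import Data.List.Properties using (length-map; length-zipWith)
open import Data.List.Relation.Unary.All as All using (All; []; _∷_)
open import Data.Nat.Base as ℕ using (ℕ; zero; suc; NonZero)
import Data.Nat.Divisibility as ℕ
open import Data.Nat.Primality using (euclidsLemma; prime[2])
import Data.Nat.Properties as ℕ
open import Data.Product using (_×_; _,_; ∃; ∃-syntax; proj₁; proj₂)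
open import Data.Rational.Base as ℚ using (ℚ; 0ℚ; 1ℚ; ½; _+_; _*_; _-_; -_; _≤_; _<_; ∣_∣)
import Data.Rational.Properties as ℚ
open import Data.Rational.Solver using (module +-*-Solver)
import Data.Rational.Unnormalised.Base as ℚᵘ
import Data.Rational.Unnormalised.Properties as ℚᵘ
open import Data.Sum.Base using (_⊎_; inj₁; inj₂; [_,_]′)
open import Level using (0ℓ)
open import Relation.Binary.Definitions using (tri<; tri≈; tri>)
open import Relation.Binary.PropositionalEquality
  using (_≡_; _≢_; refl; sym; trans; cong; cong₂; subst; subst₂; isEquivalence; module ≡-Reasoning)
open import Relation.Nullary using (¬_; Dec; yes; no)
open +-*-Solver using (solve; _:=_; _:+_; _:*_; _:-_; :-_; con)
open ℤSolver.+-*-Solver using ()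
  renaming (solve to solveᶻ; con to conᶻ; _:=_ to _:=ᶻ_; _:+_ to _:+ᶻ_; _:*_ to _:*ᶻ_; _:-_ to _:-ᶻ_; :-_ to :⊖ᶻ_)

-- Rational arithmetic

-- The exponent -2/n balances two scales: a form of degree n in A and B has height of order qⁿ,
-- while its zeros sit at distance of order q⁻². The obstacle is that a zero is known only through
-- rational approximations, and no factorisation is used to count zeros. So a zero is placed near ξ
-- by bounding the polynomial from below at every Gaussian rational far from ξ, and uniqueness of
-- the far zero in (b) becomes a quantitative statement about approximate zeros. Both polynomials
-- have the shape ε Aⁿ⁺¹ + Σ eⱼ Aⁿ⁻ʲ Bʲ, with ε = 0 in (a) and ε = q⁻ⁿ⁻¹ in (b), so this analysis is
-- done once. It needs E(y) = Σ eⱼ yʲ to stay away from 0 at y = κ, where only 1/C ≤ κ ≤ C is known: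
-- in (a) a large K makes 2 (K κ)ⁿ - 1 at least 1; in (b) the rounding is arranged so that all eⱼ ≥
-- 0 and eₙ ≥ 1, hence E(κ) ≥ κⁿ. The same signs exclude cancellation in the coefficient of Tⁿ,
-- which has to carry the height in (b) because the leading coefficient is 1.

≤-by-difference : ∀ {p q} d → 0ℚ ≤ d → q ≡ p + d → p ≤ q
≤-by-difference {p} {q} d 0≤d eq = subst₂ _≤_ (ℚ.+-identityʳ p) (sym eq) (ℚ.+-monoʳ-≤ p 0≤d)

<-by-difference : ∀ {p q} d → 0ℚ < d → q ≡ p + d → p < q
<-by-difference {p} {q} d 0<d eq = subst₂ _<_ (ℚ.+-identityʳ p) (sym eq) (ℚ.+-monoʳ-< p 0<d)

-- Together with `≤-by-difference` this turns an inequality into one ring identity: the difference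
-- of the two sides is written as a sum of terms that are nonnegative by hypothesis.
0≤difference : ∀ {p q} → p ≤ q → 0ℚ ≤ q - p
0≤difference {p} {q} h = subst (_≤ q - p) (ℚ.+-inverseʳ p) (ℚ.+-monoˡ-≤ (- p) h)

0<difference : ∀ {p q} → p < q → 0ℚ < q - p
0<difference {p} {q} h = subst (_< q - p) (ℚ.+-inverseʳ p) (ℚ.+-monoˡ-< (- p) h)

0<1ℚ : 0ℚ < 1ℚ
0<1ℚ = ℚ.positive⁻¹ 1ℚ

0≤1ℚ : 0ℚ ≤ 1ℚ
0≤1ℚ = ℚ.<⇒≤ 0<1ℚ

+-nonneg : ∀ {p q} → 0ℚ ≤ p → 0ℚ ≤ q → 0ℚ ≤ p + q
+-nonneg 0≤p 0≤q = ℚ.+-mono-≤ 0≤p 0≤q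

+-pos : ∀ {p q} → 0ℚ < p → 0ℚ < q → 0ℚ < p + q
+-pos 0<p 0<q = ℚ.+-mono-< 0<p 0<q

*-nonneg : ∀ {p q} → 0ℚ ≤ p → 0ℚ ≤ q → 0ℚ ≤ p * q
*-nonneg {p} {q} 0≤p 0≤q = ℚ.nonNegative⁻¹ (p * q)
  {{ℚ.nonNeg*nonNeg⇒nonNeg p {{ℚ.nonNegative 0≤p}} q {{ℚ.nonNegative 0≤q}}}}

*-pos : ∀ {p q} → 0ℚ < p → 0ℚ < q → 0ℚ < p * q
*-pos {p} {q} 0<p 0<q = ℚ.positive⁻¹ (p * q)
  {{ℚ.pos*pos⇒pos p {{ℚ.positive 0<p}} q {{ℚ.positive 0<q}}}}

*-monoˡ : ∀ p {q r} → 0ℚ ≤ p → q ≤ r → p * q ≤ p * r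
*-monoˡ p 0≤p = ℚ.*-monoˡ-≤-nonNeg p {{ℚ.nonNegative 0≤p}}

*-monoʳ : ∀ p {q r} → 0ℚ ≤ p → q ≤ r → q * p ≤ r * p
*-monoʳ p 0≤p = ℚ.*-monoʳ-≤-nonNeg p {{ℚ.nonNegative 0≤p}}

*-mono : ∀ {p q r s} → 0ℚ ≤ p → 0ℚ ≤ s → p ≤ q → r ≤ s → p * r ≤ q * s
*-mono {p} {q} {r} {s} 0≤p 0≤s p≤q r≤s = ℚ.≤-trans (*-monoˡ p 0≤p r≤s) (*-monoʳ s 0≤s p≤q)

*-cancelˡ : ∀ p {q r} → 0ℚ < p → p * q ≤ p * r → q ≤ r
*-cancelˡ p 0<p = ℚ.*-cancelˡ-≤-pos p {{ℚ.positive 0<p}}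

*-cancel-<ˡ : ∀ p {q r} → 0ℚ < p → p * q < p * r → q < r
*-cancel-<ˡ p 0<p = ℚ.*-cancelˡ-<-nonNeg p {{ℚ.nonNegative (ℚ.<⇒≤ 0<p)}}

*-cancelʳ : ∀ p {q r} → 0ℚ < p → q * p ≤ r * p → q ≤ r
*-cancelʳ p 0<p = ℚ.*-cancelʳ-≤-pos p {{ℚ.positive 0<p}}

p≤p+q : ∀ {p q} → 0ℚ ≤ q → p ≤ p + q
p≤p+q {p} {q} 0≤q = ≤-by-difference q 0≤q refl

q≤p+q : ∀ {p q} → 0ℚ ≤ p → q ≤ p + q
q≤p+q {p} {q} 0≤p = ≤-by-difference p 0≤p (ℚ.+-comm p q)

p≤∣p∣ : ∀ p → p ≤ ∣ p ∣
p≤∣p∣ p with ℚ.≤-total 0ℚ p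
... | inj₁ 0≤p = ℚ.≤-reflexive (sym (ℚ.0≤p⇒∣p∣≡p 0≤p))
... | inj₂ p≤0 = ℚ.≤-trans p≤0 (ℚ.0≤∣p∣ p)

-p≤∣p∣ : ∀ p → - p ≤ ∣ p ∣
-p≤∣p∣ p = subst (- p ≤_) (ℚ.∣-p∣≡∣p∣ p) (p≤∣p∣ (- p))

∣p∣≤ : ∀ {p b} → p ≤ b → - p ≤ b → ∣ p ∣ ≤ b
∣p∣≤ {p} {b} h₁ h₂ with ℚ.∣p∣≡p∨∣p∣≡-p p
... | inj₁ eq = subst (_≤ b) (sym eq) h₁
... | inj₂ eq = subst (_≤ b) (sym eq) h₂

∣p-q∣≡∣q-p∣ : ∀ p q → ∣ p - q ∣ ≡ ∣ q - p ∣
∣p-q∣≡∣q-p∣ p q = trans (sym (ℚ.∣-p∣≡∣p∣ (p - q)))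
  (cong ∣_∣ (solve 2 (λ a b → :- (a :- b) := b :- a) refl p q))

∣p*q∣≤ : ∀ p q {b c} → 0ℚ ≤ c → ∣ p ∣ ≤ b → ∣ q ∣ ≤ c → ∣ p * q ∣ ≤ b * c
∣p*q∣≤ p q 0≤c h₁ h₂ = subst (_≤ _) (sym (ℚ.∣p*q∣≡∣p∣*∣q∣ p q)) (*-mono (ℚ.0≤∣p∣ p) 0≤c h₁ h₂)

∣p+q∣≤ : ∀ p q {b c} → ∣ p ∣ ≤ b → ∣ q ∣ ≤ c → ∣ p + q ∣ ≤ b + c
∣p+q∣≤ p q h₁ h₂ = ℚ.≤-trans (ℚ.∣p+q∣≤∣p∣+∣q∣ p q) (ℚ.+-mono-≤ h₁ h₂)

∣p∣-upper : ∀ {p b} → ∣ p ∣ ≤ b → p ≤ b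
∣p∣-upper {p} = ℚ.≤-trans (p≤∣p∣ p)

∣p-q∣-upper : ∀ {p q b} → ∣ p - q ∣ ≤ b → p ≤ q + b
∣p-q∣-upper {p} {q} {b} h = ≤-by-difference (b - (p - q)) (0≤difference (∣p∣-upper h))
  (solve 3 (λ p q b → q :+ b := p :+ (b :- (p :- q))) refl p q b)

∣p-q∣-lower : ∀ {p q b} → ∣ p - q ∣ ≤ b → q ≤ p + b
∣p-q∣-lower {p} {q} {b} h = ∣p-q∣-upper (subst (_≤ b) (∣p-q∣≡∣q-p∣ p q) h)

^-nonneg : ∀ {p} k → 0ℚ ≤ p → 0ℚ ≤ p ^ℚ k
^-nonneg zero    0≤p = 0≤1ℚ
^-nonneg (suc k) 0≤p = *-nonneg 0≤p (^-nonneg k 0≤p)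

^-pos : ∀ {p} k → 0ℚ < p → 0ℚ < p ^ℚ k
^-pos zero    0<p = 0<1ℚ
^-pos (suc k) 0<p = *-pos 0<p (^-pos k 0<p)

^-mono : ∀ {p q} k → 0ℚ ≤ p → p ≤ q → p ^ℚ k ≤ q ^ℚ k
^-mono zero    0≤p p≤q = ℚ.≤-refl
^-mono (suc k) 0≤p p≤q = *-mono 0≤p (^-nonneg k (ℚ.≤-trans 0≤p p≤q)) p≤q (^-mono k 0≤p p≤q)

^-cancel-≤ : ∀ {p q} k .{{_ : NonZero k}} → 0ℚ ≤ q → p ^ℚ k ≤ q ^ℚ k → p ≤ q
^-cancel-≤ {p} {q} (suc k) 0≤q h = ℚ.≮⇒≥ λ q<p → ℚ.<-irrefl refl (ℚ.<-≤-trans (lt q<p) h)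
  where
  lt : q < p → q ^ℚ suc k < p ^ℚ suc k
  lt q<p = ℚ.≤-<-trans (*-monoˡ q 0≤q (^-mono k 0≤q (ℚ.<⇒≤ q<p)))
    (ℚ.*-monoˡ-<-pos (p ^ℚ k) {{ℚ.positive (^-pos k (ℚ.≤-<-trans 0≤q q<p))}} q<p)

^-distrib-* : ∀ p q k → (p * q) ^ℚ k ≡ p ^ℚ k * q ^ℚ k
^-distrib-* p q zero    = sym (ℚ.*-identityˡ 1ℚ)
^-distrib-* p q (suc k) = trans (cong (p * q *_) (^-distrib-* p q k))
  (solve 4 (λ p q a b → p :* q :* (a :* b) := p :* a :* (q :* b)) refl p q (p ^ℚ k) (q ^ℚ k))

1^ : ∀ k → 1ℚ ^ℚ k ≡ 1ℚ
1^ zero    = refl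
1^ (suc k) = trans (ℚ.*-identityˡ _) (1^ k)

1≤^ : ∀ {p} k → 1ℚ ≤ p → 1ℚ ≤ p ^ℚ k
1≤^ {p} k 1≤p = subst (_≤ p ^ℚ k) (1^ k) (^-mono k 0≤1ℚ 1≤p)

p≤p^ : ∀ {p} k .{{_ : NonZero k}} → 1ℚ ≤ p → p ≤ p ^ℚ k
p≤p^ {p} (suc k) 1≤p = subst (_≤ p ^ℚ suc k) (ℚ.*-identityʳ p)
  (*-monoˡ p (ℚ.≤-trans 0≤1ℚ 1≤p) (1≤^ k 1≤p))

opaque
  reciprocal : ∀ {p} → 0ℚ < p → ∃ λ r → 0ℚ < r × p * r ≡ 1ℚ
  reciprocal {p} 0<p = ℚ.1/ p , ℚ.positive⁻¹ _ {{ℚ.1/pos⇒pos p}} , ℚ.*-inverseʳ p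
    where
    instance
      _ : ℚ.Positive p
      _ = ℚ.positive 0<p
      _ : ℚ.NonZero p
      _ = ℚ.pos⇒nonZero p

-- The embedding of the integers in the rationals

opaque
  ι : ℤ → ℚ
  ι i = i ℚ./ 1

  ι≡/1 : ∀ i → ι i ≡ i ℚ./ 1
  ι≡/1 i = refl

  ι-0 : ι (+ 0) ≡ 0ℚ
  ι-0 = refl

  ι-1 : ι (+ 1) ≡ 1ℚ
  ι-1 = refl

  ι≃ : ∀ i → ℚ.toℚᵘ (ι i) ℚᵘ.≃ ℚᵘ.mkℚᵘ i 0
  ι≃ i = ℚ.toℚᵘ-fromℚᵘ (ℚᵘ.mkℚᵘ i 0)

  ι-+ : ∀ i j → ι (i ℤ.+ j) ≡ ι i + ι j
  ι-+ i j = ℚ.toℚᵘ-injective (begin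
    ℚ.toℚᵘ (ι (i ℤ.+ j))              ≈⟨ ι≃ (i ℤ.+ j) ⟩
    ℚᵘ.mkℚᵘ (i ℤ.+ j) 0               ≈⟨ ℚᵘ.*≡* (cong (ℤ._* + 1)
      (cong₂ ℤ._+_ (sym (ℤ.*-identityʳ i)) (sym (ℤ.*-identityʳ j)))) ⟩
    ℚᵘ.mkℚᵘ i 0 ℚᵘ.+ ℚᵘ.mkℚᵘ j 0      ≈⟨ ℚᵘ.+-cong (ι≃ i) (ι≃ j) ⟨
    ℚ.toℚᵘ (ι i) ℚᵘ.+ ℚ.toℚᵘ (ι j)    ≈⟨ ℚ.toℚᵘ-homo-+ (ι i) (ι j) ⟨
    ℚ.toℚᵘ (ι i + ι j)                ∎)
    where open import Relation.Binary.Reasoning.Setoid ℚᵘ.≃-setoid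

  ι-* : ∀ i j → ι (i ℤ.* j) ≡ ι i * ι j
  ι-* i j = ℚ.toℚᵘ-injective (begin
    ℚ.toℚᵘ (ι (i ℤ.* j))              ≈⟨ ι≃ (i ℤ.* j) ⟩
    ℚᵘ.mkℚᵘ i 0 ℚᵘ.* ℚᵘ.mkℚᵘ j 0      ≈⟨ ℚᵘ.*-cong (ι≃ i) (ι≃ j) ⟨
    ℚ.toℚᵘ (ι i) ℚᵘ.* ℚ.toℚᵘ (ι j)    ≈⟨ ℚ.toℚᵘ-homo-* (ι i) (ι j) ⟨
    ℚ.toℚᵘ (ι i * ι j)                ∎)
    where open import Relation.Binary.Reasoning.Setoid ℚᵘ.≃-setoid

  ι-mono-≤ : ∀ {i j} → i ℤ.≤ j → ι i ≤ ι j
  ι-mono-≤ {i} {j} h = ℚ.toℚᵘ-cancel-≤ (ℚᵘ.≤-respˡ-≃ (ℚᵘ.≃-sym (ι≃ i))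
    (ℚᵘ.≤-respʳ-≃ (ℚᵘ.≃-sym (ι≃ j)) (ℚᵘ.*≤* (ℤ.*-monoʳ-≤-nonNeg (+ 1) h))))

  ι-cancel-< : ∀ {i j} → ι i < ι j → i ℤ.< j
  ι-cancel-< {i} {j} h = ℤ.≰⇒> λ j≤i → ℚ.<-irrefl refl (ℚ.<-≤-trans h (ι-mono-≤ j≤i))

  ι-cancel-≤ : ∀ {i j} → ι i ≤ ι j → i ℤ.≤ j
  ι-cancel-≤ {i} {j} h with ℚᵘ.≤-respˡ-≃ (ι≃ i) (ℚᵘ.≤-respʳ-≃ (ι≃ j) (ℚ.toℚᵘ-mono-≤ h))
  ... | ℚᵘ.*≤* le = subst₂ ℤ._≤_ (ℤ.*-identityʳ i) (ℤ.*-identityʳ j) le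

ι-neg : ∀ i → ι (ℤ.- i) ≡ - ι i
ι-neg i = trans (solve 2 (λ a b → a := b :+ a :- b) refl (ι (ℤ.- i)) (ι i))
  (trans (cong (_- ι i) (trans (sym (ι-+ i (ℤ.- i))) (trans (cong ι (ℤ.+-inverseʳ i)) ι-0)))
    (ℚ.+-identityˡ (- ι i)))

ιₙ : ℕ → ℚ
ιₙ n = ι (+ n)

ιₙ-nonneg : ∀ n → 0ℚ ≤ ιₙ n
ιₙ-nonneg n = subst (_≤ ιₙ n) ι-0 (ι-mono-≤ (ℤ.+≤+ ℕ.z≤n))

ι-∣∣ : ∀ i → ∣ ι i ∣ ≡ ι (+ ℤ.∣ i ∣)
ι-∣∣ (+ n)      = ℚ.0≤p⇒∣p∣≡p (ιₙ-nonneg n)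
ι-∣∣ i@(-[1+ n ]) = trans (sym (ℚ.∣-p∣≡∣p∣ (ι i)))
  (trans (cong ∣_∣ (sym (ι-neg i))) (ℚ.0≤p⇒∣p∣≡p (ιₙ-nonneg (suc n))))

ιₙ-mono : ∀ {m n} → m ℕ.≤ n → ιₙ m ≤ ιₙ n
ιₙ-mono h = ι-mono-≤ (ℤ.+≤+ h)

1≤ιₙ : ∀ {n} → 1 ℕ.≤ n → 1ℚ ≤ ιₙ n
1≤ιₙ {n} h = subst (_≤ ιₙ n) ι-1 (ιₙ-mono h)

ιₙ-pos : ∀ {n} → 1 ℕ.≤ n → 0ℚ < ιₙ n
ιₙ-pos h = ℚ.<-≤-trans 0<1ℚ (1≤ιₙ h)

ιₙ-+ : ∀ m n → ιₙ (m ℕ.+ n) ≡ ιₙ m + ιₙ n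
ιₙ-+ m n = trans (cong ι (ℤ.pos-+ m n)) (ι-+ (+ m) (+ n))

ιₙ-* : ∀ m n → ιₙ (m ℕ.* n) ≡ ιₙ m * ιₙ n
ιₙ-* m n = trans (cong ι (ℤ.pos-* m n)) (ι-* (+ m) (+ n))

ιₙ-^ : ∀ m k → ιₙ (m ℕ.^ k) ≡ ιₙ m ^ℚ k
ιₙ-^ m zero    = ι-1
ιₙ-^ m (suc k) = trans (ιₙ-* m (m ℕ.^ k)) (cong (ιₙ m *_) (ιₙ-^ m k))

/-* : ∀ i n .{{_ : NonZero n}} → (i ℚ./ n) * ιₙ n ≡ ι i
/-* i n@(suc m) = ℚ.toℚᵘ-injective (begin
    ℚ.toℚᵘ ((i ℚ./ n) * ιₙ n)               ≈⟨ ℚ.toℚᵘ-homo-* (i ℚ./ n) (ιₙ n) ⟩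
    ℚ.toℚᵘ (i ℚ./ n) ℚᵘ.* ℚ.toℚᵘ (ιₙ n)     ≈⟨ ℚᵘ.*-cong (ℚ.toℚᵘ-fromℚᵘ (ℚᵘ.mkℚᵘ i m)) (ι≃ (+ n)) ⟩
    ℚᵘ.mkℚᵘ i m ℚᵘ.* ℚᵘ.mkℚᵘ (+ n) 0        ≈⟨ ℚᵘ.*≡* (trans (ℤ.*-identityʳ _)
      (cong (i ℤ.*_) (cong +_ (sym (ℕ.*-identityʳ n))))) ⟩
    ℚᵘ.mkℚᵘ i 0                             ≈⟨ ι≃ i ⟨
    ℚ.toℚᵘ (ι i)                            ∎)
    where open import Relation.Binary.Reasoning.Setoid ℚᵘ.≃-setoid

-- The denominator is at least 1, so the absolute value of the numerator is a bound.
ceiling : ∀ p → ∃ λ n → p ≤ ιₙ n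
ceiling p = ℤ.∣ ℚ.↥ p ∣ , ℚ.≤-trans (p≤∣p∣ p) (ℚ.toℚᵘ-cancel-≤
  (ℚᵘ.≤-respʳ-≃ (ℚᵘ.≃-sym (ι≃ (+ ℤ.∣ ℚ.↥ p ∣))) (abs≤ p)))
  where
  abs≤ : ∀ q → ℚ.toℚᵘ ∣ q ∣ ℚᵘ.≤ ℚᵘ.mkℚᵘ (+ ℤ.∣ ℚ.↥ q ∣) 0
  abs≤ (ℚ.mkℚ n d _) = ℚᵘ.*≤* (subst₂ ℤ._≤_
    (ℤ.pos-* ℤ.∣ n ∣ 1) (ℤ.pos-* ℤ.∣ n ∣ (suc d))
    (ℤ.+≤+ (ℕ.*-monoʳ-≤ ℤ.∣ n ∣ (ℕ.s≤s ℕ.z≤n))))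

-- Integer polynomials and Eisenstein's criterion at 2

coeff-+ : ∀ p q i → coeff (p +ₚ q) i ≡ coeff p i ℤ.+ coeff q i
coeff-+ []      q       i       = sym (ℤ.+-identityˡ (coeff q i))
coeff-+ (a ∷ p) []      i       = sym (ℤ.+-identityʳ (coeff (a ∷ p) i))
coeff-+ (a ∷ p) (b ∷ q) zero    = refl
coeff-+ (a ∷ p) (b ∷ q) (suc i) = coeff-+ p q i

coeff-map : ∀ a p i → coeff (map (a ℤ.*_) p) i ≡ a ℤ.* coeff p i
coeff-map a []      i       = sym (ℤ.*-zeroʳ a)
coeff-map a (b ∷ p) zero    = refl
coeff-map a (b ∷ p) (suc i) = coeff-map a p i

coeff-*-∷ : ∀ a f g k → coeff ((a ∷ f) *ₚ g) k ≡ a ℤ.* coeff g k ℤ.+ coeff (+ 0 ∷ f *ₚ g) k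
coeff-*-∷ a f g k = trans (coeff-+ (map (a ℤ.*_) g) (+ 0 ∷ f *ₚ g) k)
  (cong (ℤ._+ coeff (+ 0 ∷ f *ₚ g) k) (coeff-map a g k))

private
  a*0+b : ∀ a {b c} → b ≡ + 0 → a ℤ.* b ℤ.+ c ≡ c
  a*0+b a {c = c} refl = trans (cong (ℤ._+ c) (ℤ.*-zeroʳ a)) (ℤ.+-identityˡ c)

  +≡0 : ∀ {a b} → a ≡ + 0 → b ≡ + 0 → a ℤ.+ b ≡ + 0
  +≡0 refl refl = refl

zero-*ₚ : ∀ f g → (∀ i → coeff f i ≡ + 0) → ∀ k → coeff (f *ₚ g) k ≡ + 0
zero-*ₚ []      g h k = refl
zero-*ₚ (a ∷ f) g h k = trans (coeff-*-∷ a f g k)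
  (+≡0 (trans (cong (ℤ._* coeff g k) (h 0)) (ℤ.*-zeroˡ (coeff g k))) (rest k))
  where
  rest : ∀ k → coeff (+ 0 ∷ f *ₚ g) k ≡ + 0
  rest zero    = refl
  rest (suc k) = zero-*ₚ f g (λ i → h (suc i)) k

constant-*ₚ : ∀ f g → (∀ i → coeff f (suc i) ≡ + 0) →
  ∀ k → coeff (f *ₚ g) k ≡ coeff f 0 ℤ.* coeff g k
constant-*ₚ []      g h k = sym (ℤ.*-zeroˡ (coeff g k))
constant-*ₚ (a ∷ f) g h k = trans (coeff-*-∷ a f g k)
  (trans (cong (λ z → a ℤ.* coeff g k ℤ.+ z) (rest k)) (ℤ.+-identityʳ _))
  where
  rest : ∀ k → coeff (+ 0 ∷ f *ₚ g) k ≡ + 0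
  rest zero    = refl
  rest (suc k) = zero-*ₚ f g h k

*ₚ-constant : ∀ f g → (∀ i → coeff g (suc i) ≡ + 0) →
  ∀ k → coeff (f *ₚ g) k ≡ coeff f k ℤ.* coeff g 0
*ₚ-constant []      g h k       = sym (ℤ.*-zeroˡ (coeff g 0))
*ₚ-constant (a ∷ f) g h zero    = trans (coeff-*-∷ a f g 0) (ℤ.+-identityʳ _)
*ₚ-constant (a ∷ f) g h (suc k) =
  trans (coeff-*-∷ a f g (suc k)) (trans (a*0+b a (h k)) (*ₚ-constant f g h k))

-- `d` and `e` need only bound the degrees from above. `degrees-add` uses this freedom with `n ∸ e`
-- in place of the degree of `f`: the coefficient there vanishes, so a product of too small degree
-- has no term of degree n.
leading-*ₚ : ∀ f g d e → (∀ i → d ℕ.< i → coeff f i ≡ + 0) →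
  (∀ j → e ℕ.< j → coeff g j ≡ + 0) →
  coeff (f *ₚ g) (d ℕ.+ e) ≡ coeff f d ℤ.* coeff g e
leading-*ₚ []      g d       e hf hg = sym (ℤ.*-zeroˡ (coeff g e))
leading-*ₚ (a ∷ f) g zero    e hf hg = constant-*ₚ (a ∷ f) g (λ i → hf (suc i) (ℕ.s≤s ℕ.z≤n)) e
leading-*ₚ (a ∷ f) g (suc d) e hf hg = trans (coeff-*-∷ a f g (suc (d ℕ.+ e)))
  (trans (a*0+b a (hg (suc (d ℕ.+ e)) (ℕ.s≤s (ℕ.m≤n+m e d))))
    (leading-*ₚ f g d e (λ i d<i → hf (suc i) (ℕ.s≤s d<i)) hg))

∣-coeff-*ₚ : ∀ m f g k → (∀ i → i ℕ.≤ k → m ℤ.∣ coeff g i) → m ℤ.∣ coeff (f *ₚ g) k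
∣-coeff-*ₚ m []      g k       h = divides (+ 0) (sym (ℤ.*-zeroˡ m))
∣-coeff-*ₚ m (a ∷ f) g k       h = subst (m ℤ.∣_) (sym (coeff-*-∷ a f g k))
  (ℤ.∣m∣n⇒∣m+n (ℤ.∣n⇒∣m*n a (h k ℕ.≤-refl)) (rest k h))
  where
  rest : ∀ k → (∀ i → i ℕ.≤ k → m ℤ.∣ coeff g i) → m ℤ.∣ coeff (+ 0 ∷ f *ₚ g) k
  rest zero    h = divides (+ 0) (sym (ℤ.*-zeroˡ m))
  rest (suc k) h = ∣-coeff-*ₚ m f g k (λ i i≤k → h i (ℕ.m≤n⇒m≤1+n i≤k))

-- Every other product contributing to this coefficient contains a factor of index below `i` or
-- below `j`. This is the counterpart of `leading-*ₚ` at the low end: the first odd coefficients of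
-- two factors yield an odd coefficient of their product.
lowest-*ₚ : ∀ m f g i j → (∀ k → k ℕ.< i → m ℤ.∣ coeff f k) →
  (∀ k → k ℕ.< j → m ℤ.∣ coeff g k) →
  ∃ λ r → m ℤ.∣ r × coeff (f *ₚ g) (i ℕ.+ j) ≡ coeff f i ℤ.* coeff g j ℤ.+ r
lowest-*ₚ m []      g i j hf hg = + 0 , divides (+ 0) (sym (ℤ.*-zeroˡ m)) ,
  sym (trans (ℤ.+-identityʳ _) (ℤ.*-zeroˡ (coeff g j)))
lowest-*ₚ m (a ∷ f) g zero    j hf hg = coeff (+ 0 ∷ f *ₚ g) j , rest j hg , coeff-*-∷ a f g j
  where
  rest : ∀ j → (∀ k → k ℕ.< j → m ℤ.∣ coeff g k) → m ℤ.∣ coeff (+ 0 ∷ f *ₚ g) j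
  rest zero    hg = divides (+ 0) (sym (ℤ.*-zeroˡ m))
  rest (suc j) hg = ∣-coeff-*ₚ m f g j (λ i i≤j → hg i (ℕ.s≤s i≤j))
lowest-*ₚ m (a ∷ f) g (suc i) j hf hg
  with lowest-*ₚ m f g i j (λ k k<i → hf (suc k) (ℕ.s≤s k<i)) hg
... | r , m∣r , eq = a ℤ.* b ℤ.+ r ,
  ℤ.∣m∣n⇒∣m+n (ℤ.∣m⇒∣m*n b (hf 0 (ℕ.s≤s ℕ.z≤n))) m∣r ,
  trans (coeff-*-∷ a f g (suc (i ℕ.+ j))) (trans (cong (λ z → a ℤ.* b ℤ.+ z) eq)
    (solveᶻ 3 (λ x y z → x :+ᶻ (y :+ᶻ z) :=ᶻ y :+ᶻ (x :+ᶻ z)) refl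
      (a ℤ.* b) (coeff f i ℤ.* coeff g j) r))
  where b = coeff g (suc (i ℕ.+ j))

degree? : ∀ f → (∀ i → coeff f i ≡ + 0) ⊎ ∃ (HasDegree f)
degree? []      = inj₁ λ _ → refl
degree? (a ∷ f) with degree? f
... | inj₂ (d , f_d≢0 , above) = inj₂ (suc d , f_d≢0 , λ where (suc i) (ℕ.s≤s d<i) → above i d<i)
... | inj₁ f≡0 with a ℤ.≟ + 0
...   | yes a≡0 = inj₁ λ where zero → a≡0 ; (suc i) → f≡0 i
...   | no  a≢0 = inj₂ (0 , a≢0 , λ where (suc i) _ → f≡0 i)

firstNonMultiple : ∀ m f → (∀ i → m ℤ.∣ coeff f i) ⊎
  ∃ λ i → ¬ m ℤ.∣ coeff f i × (∀ k → k ℕ.< i → m ℤ.∣ coeff f k)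
firstNonMultiple m []      = inj₁ λ _ → divides (+ 0) (sym (ℤ.*-zeroˡ m))
firstNonMultiple m (a ∷ f) with m ℤ.∣? a
... | no  m∤a = inj₂ (0 , m∤a , λ _ ())
... | yes m∣a with firstNonMultiple m f
...   | inj₁ all = inj₁ λ where zero → m∣a ; (suc i) → all i
...   | inj₂ (i , ∤ , below) =
  inj₂ (suc i , ∤ , λ where zero _ → m∣a ; (suc k) (ℕ.s≤s k<i) → below k k<i)

2∣*⇒2∣⊎2∣ : ∀ a b → + 2 ℤ.∣ a ℤ.* b → + 2 ℤ.∣ a ⊎ + 2 ℤ.∣ b
2∣*⇒2∣⊎2∣ a b h = [ (λ x → inj₁ (ℤ.∣ᵤ⇒∣ x)) , (λ x → inj₂ (ℤ.∣ᵤ⇒∣ x)) ]′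
  (euclidsLemma ℤ.∣ a ∣ ℤ.∣ b ∣ prime[2] (subst (2 ℕ.∣_) (ℤ.abs-* a b) (ℤ.∣⇒∣ᵤ h)))

∣0 : ∀ m → m ℤ.∣ + 0
∣0 m = divides (+ 0) (sym (ℤ.*-zeroˡ m))

private
  module Div = RawMagmaDefs (RawSemiring.*-rawMagma ℤ[T]-rawSemiring)

constant-unit : ∀ f → (∀ i → coeff f (suc i) ≡ + 0) → coeff f 0 ℤ.∣ + 1 → f Div.∣ (+ 1 ∷ [])
constant-unit f h (divides w 1≡w*f₀) = (w ∷ []) Div., mk≈ₚ λ where
  zero    → trans (constant-*ₚ (w ∷ []) f (λ _ → refl) 0) (sym 1≡w*f₀)
  (suc i) → trans (constant-*ₚ (w ∷ []) f (λ _ → refl) (suc i))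
    (trans (cong (w ℤ.*_) (h i)) (ℤ.*-zeroʳ w))

Primitive : ℤ[T] → Set
Primitive P = ∀ c → (∀ i → c ℤ.∣ coeff P i) → c ℤ.∣ + 1

-- For n = 1 the condition on the constant coefficient is void: a primitive
-- linear polynomial is irreducible.
eisenstein₂ : ∀ P n → 1 ℕ.≤ n → (∀ i → n ℕ.< i → coeff P i ≡ + 0) →
  ¬ + 2 ℤ.∣ coeff P n → (∀ i → i ℕ.< n → + 2 ℤ.∣ coeff P i) →
  (2 ℕ.≤ n → ¬ + 4 ℤ.∣ coeff P 0) → Primitive P → Irreducible P
eisenstein₂ P n 1≤n above lead below const prim = mkIrred P∤1 split
  where
  P_n≢0 : coeff P n ≢ + 0
  P_n≢0 eq = lead (subst (+ 2 ℤ.∣_) (sym eq) (∣0 (+ 2)))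

  degrees-add : ∀ f g → P ≈ₚ f *ₚ g → ∀ {d e} → HasDegree f d → HasDegree g e → d ℕ.+ e ≡ n
  degrees-add f g P≈ {d} {e} (fd , >d) (ge , >e) with ℕ.<-cmp (d ℕ.+ e) n
  ... | tri≈ _ eq _ = eq
  ... | tri> _ _ n< = ⊥-elim ([ fd , ge ]′ (ℤ.i*j≡0⇒i≡0∨j≡0 (coeff f d)
        (trans (sym (leading-*ₚ f g d e >d >e)) (trans (sym (coeff-≡ P≈ _)) (above _ n<)))))
  ... | tri< <n _ _ = ⊥-elim (P_n≢0 (trans (coeff-≡ P≈ n) (subst (λ k → coeff (f *ₚ g) k ≡ + 0)
        (ℕ.m∸n+n≡m (ℕ.≤-trans (ℕ.m≤n+m e d) (ℕ.<⇒≤ <n)))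
        (trans (leading-*ₚ f g (n ℕ.∸ e) e (λ i h → >d i (ℕ.<-trans d<n∸e h)) >e)
          (trans (cong (ℤ._* coeff g e) (>d _ d<n∸e)) (ℤ.*-zeroˡ (coeff g e)))))))
    where
    d<n∸e : d ℕ.< n ℕ.∸ e
    d<n∸e = subst (ℕ._< n ℕ.∸ e) (ℕ.m+n∸n≡m d e) (ℕ.∸-monoˡ-< <n (ℕ.m≤n+m e d))

  P∤1 : P Div.∤ (+ 1 ∷ [])
  P∤1 (q Div., q*P≈1) with degree? q
  ... | inj₁ q≡0 with trans (sym (zero-*ₚ q P q≡0 0)) (coeff-≡ q*P≈1 0)
  ...   | ()
  P∤1 (q Div., q*P≈1) | inj₂ (d , qd , >d) = [ qd , P_n≢0 ]′ (ℤ.i*j≡0⇒i≡0∨j≡0 (coeff q d)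
    (trans (sym (leading-*ₚ q P d n >d above)) (trans (coeff-≡ q*P≈1 (d ℕ.+ n)) (1-above (d ℕ.+ n)
      (ℕ.≤-trans 1≤n (ℕ.m≤n+m n d))))))
    where
    1-above : ∀ i → 1 ℕ.≤ i → coeff (+ 1 ∷ []) i ≡ + 0
    1-above (suc i) _ = refl

  split : ∀ {f g} → P ≈ₚ f *ₚ g → f Div.∣ (+ 1 ∷ []) ⊎ g Div.∣ (+ 1 ∷ [])
  split {f} {g} P≈ with degree? f | degree? g
  ... | inj₁ f≡0 | _ = ⊥-elim (P_n≢0 (trans (coeff-≡ P≈ n) (zero-*ₚ f g f≡0 n)))
  ... | inj₂ _ | inj₁ g≡0 = ⊥-elim (P_n≢0 (trans (coeff-≡ P≈ n)
        (trans (*ₚ-constant f g (λ i → g≡0 (suc i)) n)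
          (trans (cong (coeff f n ℤ.*_) (g≡0 0)) (ℤ.*-zeroʳ (coeff f n))))))
  ... | inj₂ (zero , _ , >0) | inj₂ _ = inj₁ (constant-unit f f₊ (prim (coeff f 0) λ i →
        subst (coeff f 0 ℤ.∣_) (sym (trans (coeff-≡ P≈ i) (constant-*ₚ f g f₊ i)))
          (ℤ.∣m⇒∣m*n (coeff g i) ℤ.∣-refl)))
    where
    f₊ : ∀ i → coeff f (suc i) ≡ + 0
    f₊ i = >0 (suc i) (ℕ.s≤s ℕ.z≤n)
  ... | inj₂ (suc _ , _) | inj₂ (zero , _ , >0) = inj₂ (constant-unit g g₊ (prim (coeff g 0) λ i →
        subst (coeff g 0 ℤ.∣_) (sym (trans (coeff-≡ P≈ i) (*ₚ-constant f g g₊ i)))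
          (ℤ.∣n⇒∣m*n (coeff f i) ℤ.∣-refl)))
    where
    g₊ : ∀ i → coeff g (suc i) ≡ + 0
    g₊ i = >0 (suc i) (ℕ.s≤s ℕ.z≤n)
  -- Both factors are nonconstant. Neither is even throughout, and their first odd coefficients
  -- produce an odd coefficient of `P` at i + j, so i + j ≥ n. Hence i and j are the full degrees
  -- and positive; both constant coefficients are then even, which forces a factor 4 into that of
  -- `P`.
  ... | inj₂ (suc d , fd) | inj₂ (suc e , ge)
    with firstNonMultiple (+ 2) f | firstNonMultiple (+ 2) g
  ...   | inj₁ even | _ = ⊥-elim (lead (subst (+ 2 ℤ.∣_)
          (sym (trans (coeff-≡ P≈ n) (trans (cong (coeff (f *ₚ g)) (sym d+e≡n))
            (leading-*ₚ f g (suc d) (suc e) (proj₂ fd) (proj₂ ge)))))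
          (ℤ.∣m⇒∣m*n (coeff g (suc e)) (even (suc d)))))
    where d+e≡n = degrees-add f g P≈ fd ge
  ...   | inj₂ _ | inj₁ even = ⊥-elim (lead (subst (+ 2 ℤ.∣_) (sym (coeff-≡ P≈ n))
          (∣-coeff-*ₚ (+ 2) f g n (λ i _ → even i))))
  ...   | inj₂ (i , fi , <i) | inj₂ (j , gj , <j)
    with lowest-*ₚ (+ 2) f g i j <i <j
  ...     | r , 2∣r , eq = ⊥-elim (const 2≤n (subst (+ 4 ℤ.∣_) (sym P₀)
            (ℤ.∣-trans (ℤ.*-monoʳ-∣ (+ 2) 2∣g₀) (ℤ.*-monoˡ-∣ (coeff g 0) 2∣f₀))))
    where
    odd : ¬ + 2 ℤ.∣ coeff P (i ℕ.+ j)
    odd h = [ fi , gj ]′ (2∣*⇒2∣⊎2∣ (coeff f i) (coeff g j)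
      (ℤ.∣m+n∣n⇒∣m (subst (+ 2 ℤ.∣_) (trans (coeff-≡ P≈ (i ℕ.+ j)) eq) h) 2∣r))
    d+e≡n : suc d ℕ.+ suc e ≡ n
    d+e≡n = degrees-add f g P≈ fd ge
    i≤d : i ℕ.≤ suc d
    i≤d = ℕ.≮⇒≥ λ d<i → fi (subst (+ 2 ℤ.∣_) (sym (proj₂ fd i d<i)) (∣0 (+ 2)))
    j≤e : j ℕ.≤ suc e
    j≤e = ℕ.≮⇒≥ λ e<j → gj (subst (+ 2 ℤ.∣_) (sym (proj₂ ge j e<j)) (∣0 (+ 2)))
    n≤i+j : n ℕ.≤ i ℕ.+ j
    n≤i+j = ℕ.≮⇒≥ λ i+j<n → odd (below (i ℕ.+ j) i+j<n)
    0<i : 0 ℕ.< i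
    0<i = ℕ.≰⇒> λ i≤0 → ℕ.<⇒≱ (ℕ.<-≤-trans (ℕ.+-mono-<-≤ (ℕ.s≤s i≤0) j≤e)
      (ℕ.≤-trans (ℕ.+-monoˡ-≤ (suc e) (ℕ.s≤s ℕ.z≤n)) (ℕ.≤-reflexive d+e≡n))) n≤i+j
    0<j : 0 ℕ.< j
    0<j = ℕ.≰⇒> λ j≤0 → ℕ.<⇒≱ (ℕ.<-≤-trans (ℕ.+-mono-≤-< i≤d (ℕ.s≤s j≤0))
      (ℕ.≤-trans (ℕ.+-monoʳ-≤ (suc d) (ℕ.s≤s ℕ.z≤n)) (ℕ.≤-reflexive d+e≡n))) n≤i+j
    2∣f₀ : + 2 ℤ.∣ coeff f 0
    2∣f₀ = <i 0 0<i
    2∣g₀ : + 2 ℤ.∣ coeff g 0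
    2∣g₀ = <j 0 0<j
    P₀ : coeff P 0 ≡ coeff f 0 ℤ.* coeff g 0
    P₀ = trans (coeff-≡ P≈ 0) (coeff-*₀ f)
      where
      coeff-*₀ : ∀ f → coeff (f *ₚ g) 0 ≡ coeff f 0 ℤ.* coeff g 0
      coeff-*₀ []      = refl
      coeff-*₀ (a ∷ f) = trans (coeff-*-∷ a f g 0) (ℤ.+-identityʳ _)
    2≤n : 2 ℕ.≤ n
    2≤n = ℕ.≤-trans (ℕ.+-mono-≤ (ℕ.s≤s (ℕ.z≤n {d})) (ℕ.s≤s (ℕ.z≤n {e}))) (ℕ.≤-reflexive d+e≡n)

-- Gaussian rationals

infix 5 _⊹_
record 𝔾 : Set where
  constructor _⊹_
  field
    Re Im : ℚ
open 𝔾

infix  8 ⊖_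
infixl 6 _+ᵍ_ _-ᵍ_
infixl 7 _*ᵍ_
_+ᵍ_ _*ᵍ_ : 𝔾 → 𝔾 → 𝔾
z +ᵍ w = Re z + Re w ⊹ Im z + Im w
z *ᵍ w = Re z * Re w - Im z * Im w ⊹ Re z * Im w + Im z * Re w

⊖_ : 𝔾 → 𝔾
⊖ z = - Re z ⊹ - Im z

_-ᵍ_ : 𝔾 → 𝔾 → 𝔾
z -ᵍ w = z +ᵍ (⊖ w)

⌜_⌝ : ℚ → 𝔾
⌜ c ⌝ = c ⊹ 0ℚ

0ᵍ 1ᵍ : 𝔾
0ᵍ = ⌜ 0ℚ ⌝
1ᵍ = ⌜ 1ℚ ⌝

private
  lift : ∀ {z w} → Re z ≡ Re w → Im z ≡ Im w → z ≡ w
  lift = cong₂ _⊹_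

  𝔾-ring : CommutativeRing 0ℓ 0ℓ
  𝔾-ring = record
    { Carrier = 𝔾 ; _≈_ = _≡_ ; _+_ = _+ᵍ_ ; _*_ = _*ᵍ_ ; -_ = ⊖_ ; 0# = 0ᵍ ; 1# = 1ᵍ
    ; isCommutativeRing = record
      { isRing = record
        { +-isAbelianGroup = record
          { isGroup = record
            { isMonoid = record
              { isSemigroup = record
                { isMagma = record { isEquivalence = isEquivalence ; ∙-cong = cong₂ _+ᵍ_ }
                ; assoc = λ x y z → lift (ℚ.+-assoc (Re x) (Re y) (Re z)) (ℚ.+-assoc (Im x) (Im y) (Im z)) }
              ; identity = (λ x → lift (ℚ.+-identityˡ (Re x)) (ℚ.+-identityˡ (Im x)))
                         , (λ x → lift (ℚ.+-identityʳ (Re x)) (ℚ.+-identityʳ (Im x))) }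
            ; inverse = (λ x → lift (ℚ.+-inverseˡ (Re x)) (ℚ.+-inverseˡ (Im x)))
                      , (λ x → lift (ℚ.+-inverseʳ (Re x)) (ℚ.+-inverseʳ (Im x)))
            ; ⁻¹-cong = cong ⊖_ }
          ; comm = λ x y → lift (ℚ.+-comm (Re x) (Re y)) (ℚ.+-comm (Im x) (Im y)) }
        ; *-cong = cong₂ _*ᵍ_
        ; *-assoc = λ x y z → lift
            (solve 6 (λ a b c d e f → (a :* c :- b :* d) :* e :- (a :* d :+ b :* c) :* f
              := a :* (c :* e :- d :* f) :- b :* (c :* f :+ d :* e)) refl
              (Re x) (Im x) (Re y) (Im y) (Re z) (Im z))
            (solve 6 (λ a b c d e f → (a :* c :- b :* d) :* f :+ (a :* d :+ b :* c) :* e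
              := a :* (c :* f :+ d :* e) :+ b :* (c :* e :- d :* f)) refl
              (Re x) (Im x) (Re y) (Im y) (Re z) (Im z))
        ; *-identity = (λ x → lift
            (solve 2 (λ a b → con 1ℚ :* a :- con 0ℚ :* b := a) refl (Re x) (Im x))
            (solve 2 (λ a b → con 1ℚ :* b :+ con 0ℚ :* a := b) refl (Re x) (Im x)))
          , (λ x → lift
            (solve 2 (λ a b → a :* con 1ℚ :- b :* con 0ℚ := a) refl (Re x) (Im x))
            (solve 2 (λ a b → a :* con 0ℚ :+ b :* con 1ℚ := b) refl (Re x) (Im x)))
        ; distrib = (λ x y z → lift
            (solve 6 (λ a b c d e f → a :* (c :+ e) :- b :* (d :+ f)
              := (a :* c :- b :* d) :+ (a :* e :- b :* f)) refl
              (Re x) (Im x) (Re y) (Im y) (Re z) (Im z))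
            (solve 6 (λ a b c d e f → a :* (d :+ f) :+ b :* (c :+ e)
              := (a :* d :+ b :* c) :+ (a :* f :+ b :* e)) refl
              (Re x) (Im x) (Re y) (Im y) (Re z) (Im z)))
          , (λ x y z → lift
            (solve 6 (λ a b c d e f → (c :+ e) :* a :- (d :+ f) :* b
              := (c :* a :- d :* b) :+ (e :* a :- f :* b)) refl
              (Re x) (Im x) (Re y) (Im y) (Re z) (Im z))
            (solve 6 (λ a b c d e f → (c :+ e) :* b :+ (d :+ f) :* a
              := (c :* b :+ d :* a) :+ (e :* b :+ f :* a)) refl
              (Re x) (Im x) (Re y) (Im y) (Re z) (Im z))) }
      ; *-comm = λ x y → lift
          (solve 4 (λ a b c d → a :* c :- b :* d := c :* a :- d :* b) refl (Re x) (Im x) (Re y) (Im y))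
          (solve 4 (λ a b c d → a :* d :+ b :* c := c :* b :+ d :* a) refl (Re x) (Im x) (Re y) (Im y)) } }

  _≟ᵍ_ : (z w : 𝔾) → Dec (z ≡ w)
  (a ⊹ b) ≟ᵍ (c ⊹ d) with a ℚ.≟ c | b ℚ.≟ d
  ... | yes refl | yes refl = yes refl
  ... | no a≢c   | _        = no λ where refl → a≢c refl
  ... | yes _    | no b≢d   = no λ where refl → b≢d refl

open RingSolver (ACR.fromCommutativeRing 𝔾-ring) _≟ᵍ_ public using ()
  renaming (solve to solveᵍ; con to conᵍ; _:=_ to _:=ᵍ_; _:+_ to _:+ᵍ_; _:*_ to _:*ᵍ_; _:-_ to _:-ᵍ_; :-_ to :⊖_)
open CommutativeRing 𝔾-ring public using ()
  renaming (*-comm to *ᵍ-comm; *-assoc to *ᵍ-assoc; *-identityˡ to *ᵍ-identityˡ; zeroˡ to *ᵍ-zeroˡ; zeroʳ to *ᵍ-zeroʳ;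
    +-identityʳ to +ᵍ-identityʳ; +-identityˡ to +ᵍ-identityˡ)
open RawSemiringDefs (Semiring.rawSemiring (CommutativeRing.semiring 𝔾-ring)) public using () renaming (_^_ to _^ᵍ_)

⌜⌝-+ : ∀ a b → ⌜ a + b ⌝ ≡ ⌜ a ⌝ +ᵍ ⌜ b ⌝
⌜⌝-+ a b = lift refl (sym (ℚ.+-identityʳ 0ℚ))

⌜⌝-neg : ∀ a → ⌜ - a ⌝ ≡ ⊖ ⌜ a ⌝
⌜⌝-neg a = lift refl refl

⌜⌝-* : ∀ a b → ⌜ a * b ⌝ ≡ ⌜ a ⌝ *ᵍ ⌜ b ⌝
⌜⌝-* a b = lift (solve 2 (λ a b → a :* b := a :* b :- con 0ℚ :* con 0ℚ) refl a b)
  (solve 2 (λ a b → con 0ℚ := a :* con 0ℚ :+ con 0ℚ :* b) refl a b)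

⌜⌝-^ : ∀ a k → ⌜ a ^ℚ k ⌝ ≡ ⌜ a ⌝ ^ᵍ k
⌜⌝-^ a zero    = refl
⌜⌝-^ a (suc k) = trans (⌜⌝-* a (a ^ℚ k)) (cong (⌜ a ⌝ *ᵍ_) (⌜⌝-^ a k))

^ᵍ-distrib-* : ∀ z w k → (z *ᵍ w) ^ᵍ k ≡ z ^ᵍ k *ᵍ w ^ᵍ k
^ᵍ-distrib-* z w zero    = sym (*ᵍ-identityˡ 1ᵍ)
^ᵍ-distrib-* z w (suc k) = trans (cong (z *ᵍ w *ᵍ_) (^ᵍ-distrib-* z w k))
  (solveᵍ 4 (λ p q a b → p :*ᵍ q :*ᵍ (a :*ᵍ b) :=ᵍ p :*ᵍ a :*ᵍ (q :*ᵍ b)) refl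
    z w (z ^ᵍ k) (w ^ᵍ k))

-- The Euclidean modulus would leave `ℚ`. This norm is rational and submultiplicative, and `‖*‖≥`
-- reverses the latter up to a factor 2.
‖_‖ : 𝔾 → ℚ
‖ z ‖ = ∣ Re z ∣ + ∣ Im z ∣

‖‖-nonneg : ∀ z → 0ℚ ≤ ‖ z ‖
‖‖-nonneg z = +-nonneg (ℚ.0≤∣p∣ (Re z)) (ℚ.0≤∣p∣ (Im z))

‖+‖≤ : ∀ z w → ‖ z +ᵍ w ‖ ≤ ‖ z ‖ + ‖ w ‖
‖+‖≤ z w = ℚ.≤-trans (ℚ.+-mono-≤ (ℚ.∣p+q∣≤∣p∣+∣q∣ (Re z) (Re w)) (ℚ.∣p+q∣≤∣p∣+∣q∣ (Im z) (Im w)))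
  (ℚ.≤-reflexive (solve 4 (λ a b c d → (a :+ b) :+ (c :+ d) := (a :+ c) :+ (b :+ d)) refl
    (∣ Re z ∣) (∣ Re w ∣) (∣ Im z ∣) (∣ Im w ∣)))

‖-‖ : ∀ z → ‖ ⊖ z ‖ ≡ ‖ z ‖
‖-‖ z = cong₂ _+_ (ℚ.∣-p∣≡∣p∣ (Re z)) (ℚ.∣-p∣≡∣p∣ (Im z))

‖*‖≤ : ∀ z w → ‖ z *ᵍ w ‖ ≤ ‖ z ‖ * ‖ w ‖
‖*‖≤ (a ⊹ b) (c ⊹ d) = ℚ.≤-trans
  (ℚ.+-mono-≤
    (subst (∣ a * c - b * d ∣ ≤_) (cong₂ _+_ (ℚ.∣p*q∣≡∣p∣*∣q∣ a c) (ℚ.∣p*q∣≡∣p∣*∣q∣ b d))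
      (ℚ.∣p-q∣≤∣p∣+∣q∣ (a * c) (b * d)))
    (subst (∣ a * d + b * c ∣ ≤_) (cong₂ _+_ (ℚ.∣p*q∣≡∣p∣*∣q∣ a d) (ℚ.∣p*q∣≡∣p∣*∣q∣ b c))
      (ℚ.∣p+q∣≤∣p∣+∣q∣ (a * d) (b * c))))
  (ℚ.≤-reflexive (solve 4 (λ a b c d → (a :* c :+ b :* d) :+ (a :* d :+ b :* c)
    := (a :+ b) :* (c :+ d)) refl (∣ a ∣) (∣ b ∣) (∣ c ∣) (∣ d ∣)))

‖⌜⌝‖ : ∀ c → ‖ ⌜ c ⌝ ‖ ≡ ∣ c ∣
‖⌜⌝‖ c = ℚ.+-identityʳ ∣ c ∣

‖⌜⌝*‖ : ∀ c z → ‖ ⌜ c ⌝ *ᵍ z ‖ ≡ ∣ c ∣ * ‖ z ‖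
‖⌜⌝*‖ c (a ⊹ b) = trans
  (cong₂ (λ x y → ∣ x ∣ + ∣ y ∣)
    (solve 3 (λ c a b → c :* a :- con 0ℚ :* b := c :* a) refl c a b)
    (solve 3 (λ c a b → c :* b :+ con 0ℚ :* a := c :* b) refl c a b))
  (trans (cong₂ _+_ (ℚ.∣p*q∣≡∣p∣*∣q∣ c a) (ℚ.∣p*q∣≡∣p∣*∣q∣ c b))
    (sym (ℚ.*-distribˡ-+ (∣ c ∣) (∣ a ∣) (∣ b ∣))))

conj : 𝔾 → 𝔾
conj z = Re z ⊹ - Im z

normSq : 𝔾 → ℚ
normSq z = Re z * Re z + Im z * Im z

square-nonneg : ∀ p → 0ℚ ≤ p * p
square-nonneg p = subst (0ℚ ≤_) eq (*-nonneg (ℚ.0≤∣p∣ p) (ℚ.0≤∣p∣ p))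
  where
  eq : ∣ p ∣ * ∣ p ∣ ≡ p * p
  eq with ℚ.∣p∣≡p∨∣p∣≡-p p
  ... | inj₁ h = cong₂ _*_ h h
  ... | inj₂ h = trans (cong₂ _*_ h h) (solve 1 (λ p → (:- p) :* (:- p) := p :* p) refl p)

∣p∣² : ∀ p → ∣ p ∣ * ∣ p ∣ ≡ p * p
∣p∣² p = trans (sym (ℚ.∣p*q∣≡∣p∣*∣q∣ p p)) (ℚ.0≤p⇒∣p∣≡p (square-nonneg p))

normSq-nonneg : ∀ z → 0ℚ ≤ normSq z
normSq-nonneg z = +-nonneg (square-nonneg (Re z)) (square-nonneg (Im z))

‖‖²≤2normSq : ∀ z → ‖ z ‖ * ‖ z ‖ ≤ normSq z + normSq z
‖‖²≤2normSq (a ⊹ b) = ≤-by-difference ((∣ a ∣ - ∣ b ∣) * (∣ a ∣ - ∣ b ∣)) (square-nonneg (∣ a ∣ - ∣ b ∣))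
  (trans (cong₂ (λ x y → (x + y) + (x + y)) (sym (∣p∣² a)) (sym (∣p∣² b)))
    (solve 2 (λ a b → (a :* a :+ b :* b) :+ (a :* a :+ b :* b)
      := (a :+ b) :* (a :+ b) :+ (a :- b) :* (a :- b)) refl (∣ a ∣) (∣ b ∣)))

normSq≤‖‖² : ∀ z → normSq z ≤ ‖ z ‖ * ‖ z ‖
normSq≤‖‖² (a ⊹ b) = ≤-by-difference (∣ a ∣ * ∣ b ∣ + ∣ a ∣ * ∣ b ∣) (+-nonneg ab ab)
  (trans (solve 2 (λ a b → (a :+ b) :* (a :+ b) := (a :* a :+ b :* b) :+ (a :* b :+ a :* b)) refl (∣ a ∣) (∣ b ∣))
    (cong (_+ (∣ a ∣ * ∣ b ∣ + ∣ a ∣ * ∣ b ∣)) (cong₂ _+_ (∣p∣² a) (∣p∣² b))))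
  where ab = *-nonneg (ℚ.0≤∣p∣ a) (ℚ.0≤∣p∣ b)

conj-* : ∀ z → conj z *ᵍ z ≡ ⌜ normSq z ⌝
conj-* (a ⊹ b) = lift
  (solve 2 (λ a b → a :* a :- (:- b) :* b := a :* a :+ b :* b) refl a b)
  (solve 2 (λ a b → a :* b :+ (:- b) :* a := con 0ℚ) refl a b)

-- Multiplying z w by the conjugate of z gives N(z) ‖w‖ ≤ ‖z‖ ‖z w‖ with N = `normSq`, and ‖z‖² ≤ 2
-- N(z); one factor ‖z‖ is then cancelled.
‖*‖≥ : ∀ z w → ‖ z ‖ * ‖ w ‖ ≤ ‖ z *ᵍ w ‖ + ‖ z *ᵍ w ‖
‖*‖≥ z w with ℚ.<-cmp 0ℚ ‖ z ‖
... | tri> _ _ neg = ⊥-elim (ℚ.<-irrefl refl (ℚ.<-≤-trans neg (‖‖-nonneg z)))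
... | tri≈ _ eq _ = ℚ.≤-trans
  (ℚ.≤-reflexive (trans (cong (_* ‖ w ‖) (sym eq)) (ℚ.*-zeroˡ ‖ w ‖)))
  (+-nonneg (‖‖-nonneg (z *ᵍ w)) (‖‖-nonneg (z *ᵍ w)))
... | tri< pos _ _ = *-cancelˡ ‖ z ‖ pos (ℚ.≤-trans
  (ℚ.≤-trans (ℚ.≤-reflexive (sym (ℚ.*-assoc (‖ z ‖) (‖ z ‖) (‖ w ‖)))) (*-monoʳ ‖ w ‖ (‖‖-nonneg w) (‖‖²≤2normSq z)))
  (ℚ.≤-trans (ℚ.≤-reflexive (ℚ.*-distribʳ-+ ‖ w ‖ (normSq z) (normSq z)))
    (ℚ.≤-trans (ℚ.+-mono-≤ half half) (ℚ.≤-reflexive (sym (ℚ.*-distribˡ-+ (‖ z ‖) _ _))))))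
  where
  half : normSq z * ‖ w ‖ ≤ ‖ z ‖ * ‖ z *ᵍ w ‖
  half = subst₂ _≤_
    (trans (cong ‖_‖ (trans (sym (*ᵍ-assoc (conj z) z w)) (cong (_*ᵍ w) (conj-* z))))
      (trans (‖⌜⌝*‖ (normSq z) w) (cong (_* ‖ w ‖) (ℚ.0≤p⇒∣p∣≡p (normSq-nonneg z)))))
    (cong (_* ‖ z *ᵍ w ‖) (cong (λ x → ∣ Re z ∣ + x) (ℚ.∣-p∣≡∣p∣ (Im z))))
    (‖*‖≤ (conj z) (z *ᵍ w))

opaque
  inverseᵍ : ∀ z → 0ℚ < ‖ z ‖ → ∃ λ u → z *ᵍ u ≡ 1ᵍ
  inverseᵍ z 0<‖z‖ = ⌜ r ⌝ *ᵍ conj z , (begin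
    z *ᵍ (⌜ r ⌝ *ᵍ conj z)
      ≡⟨ solveᵍ 3 (λ z r c → z :*ᵍ (r :*ᵍ c) :=ᵍ (c :*ᵍ z) :*ᵍ r) refl z ⌜ r ⌝ (conj z) ⟩
    (conj z *ᵍ z) *ᵍ ⌜ r ⌝ ≡⟨ cong (_*ᵍ ⌜ r ⌝) (conj-* z) ⟩
    ⌜ normSq z ⌝ *ᵍ ⌜ r ⌝       ≡⟨ ⌜⌝-* (normSq z) r ⟨
    ⌜ normSq z * r ⌝            ≡⟨ cong ⌜_⌝ Nr≡1 ⟩
    1ᵍ                     ∎)
    where
    open ≡-Reasoning
    0<N : 0ℚ < normSq z
    0<N = ℚ.≰⇒> λ N≤0 → ℚ.<-irrefl refl (ℚ.<-≤-trans (*-pos 0<‖z‖ 0<‖z‖)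
      (ℚ.≤-trans (‖‖²≤2normSq z) (ℚ.+-mono-≤ {normSq z} {0ℚ} {normSq z} {0ℚ} N≤0 N≤0)))
    r : ℚ
    r = proj₁ (reciprocal 0<N)
    Nr≡1 : normSq z * r ≡ 1ℚ
    Nr≡1 = proj₂ (proj₂ (reciprocal 0<N))

‖^‖≤1 : ∀ {z} k → ‖ z ‖ ≤ 1ℚ → ‖ z ^ᵍ k ‖ ≤ 1ℚ
‖^‖≤1 zero    h = ℚ.≤-reflexive (‖⌜⌝‖ 1ℚ)
‖^‖≤1 {z} (suc k) h = ℚ.≤-trans (‖*‖≤ z (z ^ᵍ k))
  (*-mono (‖‖-nonneg z) 0≤1ℚ h (‖^‖≤1 k h))

-- Values of polynomials with bounded coefficients on a disc

horner : List ℚ → 𝔾 → 𝔾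
horner []       y = 0ᵍ
horner (e ∷ es) y = ⌜ e ⌝ +ᵍ y *ᵍ horner es y

module _ (S ρ : ℚ) where

  -- Only the number of coefficients, their size `S` and the radius `ρ` enter, so the constants of
  -- the theorem can be fixed before any polynomial is known.
  hornerBound : ℕ → ℚ
  hornerBound zero    = 0ℚ
  hornerBound (suc m) = S + ρ * hornerBound m

  hornerLipschitz : ℕ → ℚ
  hornerLipschitz zero    = 0ℚ
  hornerLipschitz (suc m) = hornerBound m + ρ * hornerLipschitz m

module _ (S ρ : ℚ) (0≤S : 0ℚ ≤ S) (0≤ρ : 0ℚ ≤ ρ) where

  hornerBound-nonneg : ∀ m → 0ℚ ≤ hornerBound S ρ m
  hornerBound-nonneg zero    = ℚ.≤-refl
  hornerBound-nonneg (suc m) = +-nonneg 0≤S (*-nonneg 0≤ρ (hornerBound-nonneg m))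

  hornerLipschitz-nonneg : ∀ m → 0ℚ ≤ hornerLipschitz S ρ m
  hornerLipschitz-nonneg zero    = ℚ.≤-refl
  hornerLipschitz-nonneg (suc m) =
    +-nonneg (hornerBound-nonneg m) (*-nonneg 0≤ρ (hornerLipschitz-nonneg m))

  horner-bound : ∀ {es} → All (λ e → ∣ e ∣ ≤ S) es → ∀ {y} → ‖ y ‖ ≤ ρ →
    ‖ horner es y ‖ ≤ hornerBound S ρ (length es)
  horner-bound []       y≤ = ℚ.≤-refl
  horner-bound {e ∷ es} (e≤ ∷ es≤) {y} y≤ = ℚ.≤-trans (‖+‖≤ ⌜ e ⌝ (y *ᵍ horner es y))
    (ℚ.+-mono-≤ (subst (_≤ S) (sym (‖⌜⌝‖ e)) e≤)
      (ℚ.≤-trans (‖*‖≤ y (horner es y))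
        (*-mono (‖‖-nonneg y) (hornerBound-nonneg (length es)) y≤ (horner-bound es≤ y≤))))

  -- The product rule y p - w q = (y - w) p + w (p - q) is the recursion that defines
  -- `hornerLipschitz`.
  horner-lipschitz : ∀ {es} → All (λ e → ∣ e ∣ ≤ S) es → ∀ {y w} → ‖ y ‖ ≤ ρ → ‖ w ‖ ≤ ρ →
    ‖ horner es y -ᵍ horner es w ‖ ≤ hornerLipschitz S ρ (length es) * ‖ y -ᵍ w ‖
  horner-lipschitz [] {y} {w} _ _ = ℚ.≤-reflexive (sym (ℚ.*-zeroˡ ‖ y -ᵍ w ‖))
  horner-lipschitz {e ∷ es} (_ ∷ es≤) {y} {w} y≤ w≤ = subst₂ _≤_
    (cong ‖_‖ (solveᵍ 5 (λ e y w p q → (y :-ᵍ w) :*ᵍ p :+ᵍ w :*ᵍ (p :-ᵍ q)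
      :=ᵍ (e :+ᵍ y :*ᵍ p) :-ᵍ (e :+ᵍ w :*ᵍ q)) refl ⌜ e ⌝ y w p q))
    (solve 4 (λ d b r l → d :* b :+ r :* (l :* d) := (b :+ r :* l) :* d) refl
      (‖ y -ᵍ w ‖) (hornerBound S ρ m) ρ (hornerLipschitz S ρ m))
    (ℚ.≤-trans (‖+‖≤ ((y -ᵍ w) *ᵍ p) (w *ᵍ (p -ᵍ q))) (ℚ.+-mono-≤
      (ℚ.≤-trans (‖*‖≤ (y -ᵍ w) p) (*-monoˡ ‖ y -ᵍ w ‖ (‖‖-nonneg (y -ᵍ w)) (horner-bound es≤ y≤)))
      (ℚ.≤-trans (‖*‖≤ w (p -ᵍ q)) (*-mono (‖‖-nonneg w)
        (*-nonneg (hornerLipschitz-nonneg m) (‖‖-nonneg (y -ᵍ w))) w≤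
        (horner-lipschitz es≤ y≤ w≤)))))
    where
    m = length es
    p = horner es y
    q = horner es w

-- The zeros of ε + ψ u, where ψ u = u E (κ - s u), are the reciprocals of the
-- zeros of the polynomial in the variable x = q (q z - p).
module _ (E : 𝔾 → 𝔾) (κ s : 𝔾) where
  ψ : 𝔾 → 𝔾
  ψ u = u *ᵍ E (κ -ᵍ s *ᵍ u)

  -- Let p and q be the values of E at κ - s u and κ - s v. Then ψ u - ψ v = g (u - v) + (u - v) (p
  -- - g) + v (p - q), and each of the last two terms is at most Λ δ ‖u - v‖. So near 0 the map ψ is
  -- multiplication by g up to a small relative error: a quantitative inverse function theorem.
  ψ-expanding : ∀ (g Λ δ : ℚ) → 0ℚ ≤ Λ → ‖ s ‖ ≤ 1ℚ → E κ ≡ ⌜ g ⌝ →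
    (∀ y w → ‖ y -ᵍ κ ‖ ≤ 1ℚ → ‖ w -ᵍ κ ‖ ≤ 1ℚ → ‖ E y -ᵍ E w ‖ ≤ Λ * ‖ y -ᵍ w ‖) → δ ≤ 1ℚ →
    ∀ u v → ‖ u ‖ ≤ δ → ‖ v ‖ ≤ δ →
    ∣ g ∣ * ‖ u -ᵍ v ‖ ≤ ‖ ψ u -ᵍ ψ v ‖ + (Λ * δ + Λ * δ) * ‖ u -ᵍ v ‖
  ψ-expanding g Λ δ 0≤Λ ‖s‖≤1 Eκ lip δ≤1 u v u≤ v≤ = subst (_≤ _) (‖⌜⌝*‖ g (u -ᵍ v)) (subst (_≤ _)
      (cong ‖_‖ (solveᵍ 5 (λ g u v p q → (u :*ᵍ p :-ᵍ v :*ᵍ q) :+ᵍ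
          (:⊖ ((u :-ᵍ v) :*ᵍ (p :-ᵍ g) :+ᵍ v :*ᵍ (p :-ᵍ q)))
        :=ᵍ g :*ᵍ (u :-ᵍ v)) refl ⌜ g ⌝ u v p q))
      (ℚ.≤-trans (‖+‖≤ (ψ u -ᵍ ψ v) (⊖ ((u -ᵍ v) *ᵍ (p -ᵍ ⌜ g ⌝) +ᵍ v *ᵍ (p -ᵍ q))))
        (ℚ.+-monoʳ-≤ ‖ ψ u -ᵍ ψ v ‖ error)))
    where
    p = E (κ -ᵍ s *ᵍ u)
    q = E (κ -ᵍ s *ᵍ v)
    d = ‖ u -ᵍ v ‖
    s*≤ : ∀ w → ‖ s *ᵍ w ‖ ≤ ‖ w ‖
    s*≤ w = ℚ.≤-trans (‖*‖≤ s w) (subst (‖ s ‖ * ‖ w ‖ ≤_) (ℚ.*-identityˡ ‖ w ‖)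
      (*-monoʳ ‖ w ‖ (‖‖-nonneg w) ‖s‖≤1))
    shift≡ : ∀ w → ‖ (κ -ᵍ s *ᵍ w) -ᵍ κ ‖ ≡ ‖ s *ᵍ w ‖
    shift≡ w = trans (cong ‖_‖ (solveᵍ 2 (λ k x → (k :-ᵍ x) :-ᵍ k :=ᵍ :⊖ x) refl κ (s *ᵍ w)))
      (‖-‖ (s *ᵍ w))
    shift≤ : ∀ w → ‖ w ‖ ≤ δ → ‖ (κ -ᵍ s *ᵍ w) -ᵍ κ ‖ ≤ δ
    shift≤ w w≤ = subst (_≤ δ) (sym (shift≡ w)) (ℚ.≤-trans (s*≤ w) w≤)
    near : ∀ w → ‖ w ‖ ≤ δ → ‖ (κ -ᵍ s *ᵍ w) -ᵍ κ ‖ ≤ 1ℚ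
    near w w≤ = ℚ.≤-trans (shift≤ w w≤) δ≤1
    p-g≤ : ‖ p -ᵍ ⌜ g ⌝ ‖ ≤ Λ * δ
    p-g≤ = subst (λ e → ‖ p -ᵍ e ‖ ≤ Λ * δ) Eκ (ℚ.≤-trans
      (lip (κ -ᵍ s *ᵍ u) κ (near u u≤) (subst (_≤ 1ℚ)
        (cong ‖_‖ (solveᵍ 1 (λ k → conᵍ 0ᵍ :=ᵍ k :-ᵍ k) refl κ)) 0≤1ℚ))
      (*-monoˡ Λ 0≤Λ (shift≤ u u≤)))
    p-q≤ : ‖ p -ᵍ q ‖ ≤ Λ * d
    p-q≤ = ℚ.≤-trans (lip (κ -ᵍ s *ᵍ u) (κ -ᵍ s *ᵍ v) (near u u≤) (near v v≤))
      (*-monoˡ Λ 0≤Λ (ℚ.≤-trans (ℚ.≤-reflexive (trans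
        (cong ‖_‖ (solveᵍ 4 (λ k s u v → (k :-ᵍ s :*ᵍ u) :-ᵍ (k :-ᵍ s :*ᵍ v)
          :=ᵍ :⊖ (s :*ᵍ (u :-ᵍ v))) refl κ s u v)) (‖-‖ (s *ᵍ (u -ᵍ v)))))
        (s*≤ (u -ᵍ v))))
    error : ‖ ⊖ ((u -ᵍ v) *ᵍ (p -ᵍ ⌜ g ⌝) +ᵍ v *ᵍ (p -ᵍ q)) ‖ ≤ (Λ * δ + Λ * δ) * d
    error = subst₂ _≤_ (sym (‖-‖ ((u -ᵍ v) *ᵍ (p -ᵍ ⌜ g ⌝) +ᵍ v *ᵍ (p -ᵍ q))))
      (solve 3 (λ d l e → d :* (l :* e) :+ e :* (l :* d) := (l :* e :+ l :* e) :* d) refl d Λ δ)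
      (ℚ.≤-trans (‖+‖≤ ((u -ᵍ v) *ᵍ (p -ᵍ ⌜ g ⌝)) (v *ᵍ (p -ᵍ q))) (ℚ.+-mono-≤
        (ℚ.≤-trans (‖*‖≤ (u -ᵍ v) (p -ᵍ ⌜ g ⌝)) (*-monoˡ d (‖‖-nonneg (u -ᵍ v)) p-g≤))
        (ℚ.≤-trans (‖*‖≤ v (p -ᵍ q))
          (*-mono (‖‖-nonneg v) (*-nonneg 0≤Λ (‖‖-nonneg (u -ᵍ v))) v≤ p-q≤))))

-- Binary forms in two linear polynomials

linear : ℤ → ℤ → ℤ[T]
linear q p = ℤ.- p ∷ q ∷ []

linear^ : ℤ → ℤ → ℕ → ℤ[T]
linear^ q p zero    = + 1 ∷ []
linear^ q p (suc n) = linear q p *ₚ linear^ q p n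

T^ : ℕ → ℤ[T]
T^ zero    = + 1 ∷ []
T^ (suc n) = + 0 ∷ T^ n

-- The coefficients of (x A + y B) Σ tⱼ Aⁿ⁻ʲ Bʲ + c Aⁿ⁺¹ as a form in A and B.
mulLinear : ℚ → ℚ → ℚ → List ℚ → List ℚ
mulLinear x y c []       = c ∷ []
mulLinear x y c (t ∷ ts) = c + x * t ∷ mulLinear x y (y * t) ts

length-mulLinear : ∀ x y c ts → length (mulLinear x y c ts) ≡ suc (length ts)
length-mulLinear x y c []       = refl
length-mulLinear x y c (t ∷ ts) = cong suc (length-mulLinear x y (y * t) ts)

-- The coefficients of Σ Tⁱ (c A)ⁿ⁻ⁱ as a form in A and B, where T = x A + y B.
powerSum : ℚ → ℚ → ℚ → ℕ → List ℚ
powerSum x y c zero    = 1ℚ ∷ []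
powerSum x y c (suc n) = mulLinear x y (c ^ℚ suc n) (powerSum x y c n)

length-powerSum : ∀ x y c n → length (powerSum x y c n) ≡ suc n
length-powerSum x y c zero    = refl
length-powerSum x y c (suc n) = trans (length-mulLinear x y (c ^ℚ suc n) (powerSum x y c n)) (cong suc (length-powerSum x y c n))

-- A ℚ[T]-module of functions I → ℚ with a distinguished element. It is used
-- for coefficient sequences and for ℚ(i) with T acting as a number z.
record Module : Set₁ where
  field
    I        : Set
    T        : (I → ℚ) → I → ℚ
    one      : I → ℚ
    T-cong   : ∀ {f g} → (∀ i → f i ≡ g i) → ∀ i → T f i ≡ T g i
    T-linear : ∀ a b f g i → T (λ j → a * f j + b * g j) i ≡ a * T f i + b * T g i

module Evaluation (M : Module) where
  open Module M public

  ev : ℤ[T] → I → ℚ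
  ev []      i = 0ℚ
  ev (a ∷ p) i = ι a * one i + T (ev p) i

  T-+ : ∀ f g i → T (λ j → f j + g j) i ≡ T f i + T g i
  T-+ f g i = trans
    (T-cong (λ j → sym (cong₂ _+_ (ℚ.*-identityˡ (f j)) (ℚ.*-identityˡ (g j)))) i)
    (trans (T-linear 1ℚ 1ℚ f g i) (cong₂ _+_ (ℚ.*-identityˡ (T f i)) (ℚ.*-identityˡ (T g i))))

  T-* : ∀ a f i → T (λ j → a * f j) i ≡ a * T f i
  T-* a f i = trans
    (T-cong (λ j → solve 2 (λ a x → a :* x := a :* x :+ con 0ℚ :* x) refl a (f j)) i)
    (trans (T-linear a 0ℚ f f i) (solve 2 (λ a x → a :* x :+ con 0ℚ :* x := a :* x) refl a (T f i)))

  T-0 : ∀ i → T (λ _ → 0ℚ) i ≡ 0ℚ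
  T-0 i = trans (T-cong (λ j → sym (ℚ.*-zeroˡ 0ℚ)) i)
    (trans (T-* 0ℚ (λ _ → 0ℚ) i) (ℚ.*-zeroˡ (T (λ _ → 0ℚ) i)))

  ev-+ : ∀ p q i → ev (p +ₚ q) i ≡ ev p i + ev q i
  ev-+ []      q       i = sym (ℚ.+-identityˡ (ev q i))
  ev-+ (a ∷ p) []      i = sym (ℚ.+-identityʳ (ev (a ∷ p) i))
  ev-+ (a ∷ p) (b ∷ q) i = trans
    (cong₂ (λ x y → x * one i + y) (ι-+ a b) (trans (T-cong (ev-+ p q) i) (T-+ (ev p) (ev q) i)))
    (solve 5 (λ a b o x y → (a :+ b) :* o :+ (x :+ y) := (a :* o :+ x) :+ (b :* o :+ y)) refl
      (ι a) (ι b) (one i) (T (ev p) i) (T (ev q) i))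

  ev-map : ∀ a p i → ev (map (a ℤ.*_) p) i ≡ ι a * ev p i
  ev-map a []      i = sym (ℚ.*-zeroʳ (ι a))
  ev-map a (b ∷ p) i = trans
    (cong₂ (λ x y → x * one i + y) (ι-* a b) (trans (T-cong (ev-map a p) i) (T-* (ι a) (ev p) i)))
    (solve 4 (λ a b o x → a :* b :* o :+ a :* x := a :* (b :* o :+ x)) refl
      (ι a) (ι b) (one i) (T (ev p) i))

  ev-0∷ : ∀ p i → ev (+ 0 ∷ p) i ≡ T (ev p) i
  ev-0∷ p i = trans (cong (λ x → x * one i + T (ev p) i) ι-0)
    (solve 2 (λ o x → con 0ℚ :* o :+ x := x) refl (one i) (T (ev p) i))

  ev-1 : ∀ i → ev (+ 1 ∷ []) i ≡ one i
  ev-1 i = trans (cong₂ (λ x y → x * one i + y) ι-1 (T-0 i))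
    (solve 1 (λ o → con 1ℚ :* o :+ con 0ℚ := o) refl (one i))

  lin : ℚ → ℚ → (I → ℚ) → I → ℚ
  lin q p f i = q * T f i - p * f i

  lin-cong : ∀ q p {f g} → (∀ i → f i ≡ g i) → ∀ i → lin q p f i ≡ lin q p g i
  lin-cong q p f≗g i = cong₂ (λ x y → q * x - p * y) (T-cong f≗g i) (f≗g i)

  lin-linear : ∀ q p a b f g i → lin q p (λ j → a * f j + b * g j) i ≡ a * lin q p f i + b * lin q p g i
  lin-linear q p a b f g i = trans (cong (λ x → q * x - p * (a * f i + b * g i)) (T-linear a b f g i))
    (solve 8 (λ q p a b x y f g → q :* (a :* x :+ b :* y) :- p :* (a :* f :+ b :* g)
      := a :* (q :* x :- p :* f) :+ b :* (q :* y :- p :* g)) refl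
      q p a b (T f i) (T g i) (f i) (g i))

  T-lin : ∀ q p f i → T (lin q p f) i ≡ q * T (T f) i - p * T f i
  T-lin q p f i = trans
    (T-cong (λ j → solve 4 (λ q p x y → q :* x :- p :* y := q :* x :+ (:- p) :* y) refl q p (T f j) (f j)) i)
    (trans (T-linear q (- p) (T f) f i)
      (solve 4 (λ q p x y → q :* x :+ (:- p) :* y := q :* x :- p :* y) refl q p (T (T f) i) (T f i)))

  lin-comm : ∀ q p q′ p′ f i → lin q p (lin q′ p′ f) i ≡ lin q′ p′ (lin q p f) i
  lin-comm q p q′ p′ f i = trans (cong (λ x → q * x - p * lin q′ p′ f i) (T-lin q′ p′ f i))
    (trans (solve 7 (λ q p r s x y z → q :* (r :* x :- s :* y) :- p :* (r :* y :- s :* z)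
        := r :* (q :* x :- p :* y) :- s :* (q :* y :- p :* z)) refl q p q′ p′ (T (T f) i) (T f i) (f i))
      (cong (λ x → q′ * x - p′ * lin q p f i) (sym (T-lin q p f i))))

  ev-linear : ∀ q p f i → ev (linear q p *ₚ f) i ≡ lin (ι q) (ι p) (ev f) i
  ev-linear q p f i = begin
    ev (map ((ℤ.- p) ℤ.*_) f +ₚ (+ 0 ∷ (map (q ℤ.*_) f +ₚ (+ 0 ∷ [])))) i
      ≡⟨ ev-+ (map ((ℤ.- p) ℤ.*_) f) (+ 0 ∷ (map (q ℤ.*_) f +ₚ (+ 0 ∷ []))) i ⟩
    ev (map ((ℤ.- p) ℤ.*_) f) i + ev (+ 0 ∷ (map (q ℤ.*_) f +ₚ (+ 0 ∷ []))) i
      ≡⟨ cong₂ _+_ (ev-map (ℤ.- p) f i) (trans (ev-0∷ (map (q ℤ.*_) f +ₚ (+ 0 ∷ [])) i) (T-cong inner i)) ⟩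
    ι (ℤ.- p) * ev f i + T (λ j → ι q * ev f j) i
      ≡⟨ cong₂ (λ x y → x * ev f i + y) (ι-neg p) (T-* (ι q) (ev f) i) ⟩
    (- ι p) * ev f i + ι q * T (ev f) i
      ≡⟨ solve 4 (λ p q x y → (:- p) :* x :+ q :* y := q :* y :- p :* x) refl (ι p) (ι q) (ev f i) (T (ev f) i) ⟩
    lin (ι q) (ι p) (ev f) i ∎
    where
    open ≡-Reasoning
    inner : ∀ j → ev (map (q ℤ.*_) f +ₚ (+ 0 ∷ [])) j ≡ ι q * ev f j
    inner j = trans (ev-+ (map (q ℤ.*_) f) (+ 0 ∷ []) j) (trans
      (cong₂ _+_ (ev-map q f j) (trans (ev-0∷ [] j) (T-0 j))) (ℚ.+-identityʳ (ι q * ev f j)))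

  lin^ : ℚ → ℚ → ℕ → I → ℚ
  lin^ q p zero    = one
  lin^ q p (suc n) = lin q p (lin^ q p n)

  ev-linear^ : ∀ q p n i → ev (linear^ q p n) i ≡ lin^ (ι q) (ι p) n i
  ev-linear^ q p zero    i = ev-1 i
  ev-linear^ q p (suc n) i = trans (ev-linear q p (linear^ q p n) i)
    (lin-cong (ι q) (ι p) (ev-linear^ q p n) i)

  module Form (qA pA qB pB : ℚ) where
    A B : (I → ℚ) → I → ℚ
    A = lin qA pA
    B = lin qB pB

    A^ : ℕ → I → ℚ
    A^ = lin^ qA pA

    -- The list is read by increasing powers of B. The degree of the form is one less than its
    -- length, so the tail is again a form, one degree lower.
    form : List ℚ → I → ℚ
    form []       i = 0ℚ
    form (t ∷ ts) i = t * A^ (length ts) i + B (form ts) i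

    form-scale : ∀ r ts i → r * form ts i ≡ form (map (r *_) ts) i
    form-scale r []       i = ℚ.*-zeroʳ r
    form-scale r (t ∷ ts) i = begin
      r * (t * A^ (length ts) i + (qB * T (form ts) i - pB * form ts i))
        ≡⟨ solve 7 (λ r t a q x p y → r :* (t :* a :+ (q :* x :- p :* y))
          := r :* t :* a :+ (q :* (r :* x) :- p :* (r :* y))) refl
          r t (A^ (length ts) i) qB (T (form ts) i) pB (form ts i) ⟩
      r * t * A^ (length ts) i + (qB * (r * T (form ts) i) - pB * (r * form ts i))
        ≡⟨ cong₂ (λ x y → r * t * A^ (length ts) i + (qB * x - pB * y))
          (trans (sym (T-* r (form ts) i)) (T-cong (form-scale r ts) i)) (form-scale r ts i) ⟩
      r * t * A^ (length ts) i + B (form (map (r *_) ts)) i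
        ≡⟨ cong (λ n → r * t * A^ n i + B (form (map (r *_) ts)) i) (sym (length-map (r *_) ts)) ⟩
      form (map (r *_) (t ∷ ts)) i ∎
      where
      open ≡-Reasoning

    form-zipWith : ∀ ts us → length ts ≡ length us → ∀ i →
      form (zipWith _+_ ts us) i ≡ form ts i + form us i
    form-zipWith []       []       eq i = sym (ℚ.+-identityʳ 0ℚ)
    form-zipWith (t ∷ ts) (u ∷ us) eq i = begin
      (t + u) * A^ (length (zipWith _+_ ts us)) i + B (form (zipWith _+_ ts us)) i
        ≡⟨ cong₂ (λ n x → (t + u) * A^ n i + x)
          (trans (length-zipWith _+_ ts us) (trans (cong (length ts ℕ.⊓_) (sym eq′)) (ℕ.⊓-idem (length ts))))
          (trans (lin-cong qB pB (λ j → trans (form-zipWith ts us eq′ j)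
              (sym (cong₂ _+_ (ℚ.*-identityˡ (form ts j)) (ℚ.*-identityˡ (form us j))))) i)
            (lin-linear qB pB 1ℚ 1ℚ (form ts) (form us) i)) ⟩
      (t + u) * A^ (length ts) i + (1ℚ * B (form ts) i + 1ℚ * B (form us) i)
        ≡⟨ solve 5 (λ t u a x y → (t :+ u) :* a :+ (con 1ℚ :* x :+ con 1ℚ :* y)
          := (t :* a :+ x) :+ (u :* a :+ y)) refl t u (A^ (length ts) i) (B (form ts) i) (B (form us) i) ⟩
      form (t ∷ ts) i + (u * A^ (length ts) i + B (form us) i)
        ≡⟨ cong (λ n → form (t ∷ ts) i + (u * A^ n i + B (form us) i)) eq′ ⟩
      form (t ∷ ts) i + form (u ∷ us) i ∎
      where
      open ≡-Reasoning
      eq′ : length ts ≡ length us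
      eq′ = ℕ.suc-injective eq

    lin-0 : ∀ q p i → lin q p (λ _ → 0ℚ) i ≡ 0ℚ
    lin-0 q p i = trans (cong (λ x → q * x - p * 0ℚ) (T-0 i))
      (solve 2 (λ q p → q :* con 0ℚ :- p :* con 0ℚ := con 0ℚ) refl q p)

    -- For a form t Aⁿ + B h one has (x A + y B) (t Aⁿ + B h) + c Aⁿ⁺¹ = (c + x t) Aⁿ⁺¹ + B ((x A +
    -- y B) h + y t Aⁿ). The bracket is an instance of the claim for the tail, with y t in the role
    -- of c.
    form-mulLinear : ∀ x y c ts i → form (mulLinear x y c ts) i
      ≡ c * A^ (length ts) i + (x * A (form ts) i + y * B (form ts) i)
    form-mulLinear x y c []       i = cong (λ z → c * one i + z) (trans (lin-0 qB pB i)
      (sym (trans (cong₂ (λ u v → x * u + y * v) (lin-0 qA pA i) (lin-0 qB pB i))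
        (solve 2 (λ x y → x :* con 0ℚ :+ y :* con 0ℚ := con 0ℚ) refl x y))))
    form-mulLinear x y c (t ∷ ts) i = begin
      (c + x * t) * A^ (length (mulLinear x y (y * t) ts)) i + B (form (mulLinear x y (y * t) ts)) i
        ≡⟨ cong₂ (λ m z → (c + x * t) * A^ m i + z) (length-mulLinear x y (y * t) ts)
          (trans (lin-cong qB pB (λ j → trans (form-mulLinear x y (y * t) ts j)
              (solve 6 (λ y t a x u v → y :* t :* a :+ (x :* u :+ y :* v)
                := con 1ℚ :* (x :* u) :+ y :* (t :* a :+ v)) refl
                y t (A^ n j) x (A (form ts) j) (B (form ts) j))) i)
            (trans (lin-linear qB pB 1ℚ y (λ j → x * A (form ts) j) (form (t ∷ ts)) i)
              (cong (λ z → 1ℚ * z + y * B (form (t ∷ ts)) i)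
                (trans (lin-* qB pB x (A (form ts)) i) (cong (x *_) (lin-comm qB pB qA pA (form ts) i)))))) ⟩
      (c + x * t) * A^ (suc n) i + (1ℚ * (x * A (B (form ts)) i) + y * B (form (t ∷ ts)) i)
        ≡⟨ solve 7 (λ c x t a u y v → (c :+ x :* t) :* a :+ (con 1ℚ :* (x :* u) :+ y :* v)
          := c :* a :+ (x :* (t :* a :+ con 1ℚ :* u) :+ y :* v)) refl
          c x t (A^ (suc n) i) (A (B (form ts)) i) y (B (form (t ∷ ts)) i) ⟩
      c * A^ (suc n) i + (x * (t * A^ (suc n) i + 1ℚ * A (B (form ts)) i) + y * B (form (t ∷ ts)) i)
        ≡⟨ cong (λ z → c * A^ (suc n) i + (x * z + y * B (form (t ∷ ts)) i))
          (trans (sym (lin-linear qA pA t 1ℚ (A^ n) (B (form ts)) i))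
            (lin-cong qA pA (λ j → cong (λ z → t * A^ n j + z) (ℚ.*-identityˡ (B (form ts) j))) i)) ⟩
      c * A^ (suc n) i + (x * A (form (t ∷ ts)) i + y * B (form (t ∷ ts)) i) ∎
      where
      open ≡-Reasoning
      n = length ts
      lin-* : ∀ q p a f i → lin q p (λ j → a * f j) i ≡ a * lin q p f i
      lin-* q p a f i = trans (cong (λ x → q * x - p * (a * f i)) (T-* a f i))
        (solve 5 (λ q p a x y → q :* (a :* x) :- p :* (a :* y) := a :* (q :* x :- p :* y)) refl
          q p a (T f i) (f i))

    -- Since T = c A + r, the geometric sum gives Tⁿ⁺¹ - (c A)ⁿ⁺¹ = r Σ Tⁱ (c A)ⁿ⁻ⁱ. Writing T as x
    -- A + y B inside the sum keeps it a form of degree n. The induction uses both expressions of T: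
    -- `byA` on the power of A and `byAB` on the form.
    T-power : ∀ {x y c r} → c * qA ≡ 1ℚ → c * pA ≡ r →
      x * qA + y * qB ≡ 1ℚ → x * pA + y * pB ≡ 0ℚ → ∀ n i →
      ev (T^ (suc n)) i ≡ c ^ℚ suc n * A^ (suc n) i + r * form (powerSum x y c n) i
    T-power {x} {y} {c} {r} cqA cpA xy₁ xy₀ = go
      where
      open ≡-Reasoning
      byA : ∀ f i → T f i ≡ c * A f i + r * f i
      byA f i = sym (begin
        c * (qA * T f i - pA * f i) + r * f i
          ≡⟨ solve 6 (λ c q x p y r → c :* (q :* x :- p :* y) :+ r :* y
            := c :* q :* x :+ (r :- c :* p) :* y) refl c qA (T f i) pA (f i) r ⟩
        c * qA * T f i + (r - c * pA) * f i
          ≡⟨ cong₂ (λ u v → u * T f i + (r - v) * f i) cqA cpA ⟩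
        1ℚ * T f i + (r - r) * f i
          ≡⟨ solve 3 (λ x y r → con 1ℚ :* x :+ (r :- r) :* y := x) refl (T f i) (f i) r ⟩
        T f i ∎)
      byAB : ∀ f i → x * A f i + y * B f i ≡ T f i
      byAB f i = begin
        x * (qA * T f i - pA * f i) + y * (qB * T f i - pB * f i)
          ≡⟨ solve 8 (λ x y q p s t u v → x :* (q :* u :- p :* v) :+ y :* (s :* u :- t :* v)
            := (x :* q :+ y :* s) :* u :- (x :* p :+ y :* t) :* v) refl x y qA pA qB pB (T f i) (f i) ⟩
        (x * qA + y * qB) * T f i - (x * pA + y * pB) * f i
          ≡⟨ cong₂ (λ u v → u * T f i - v * f i) xy₁ xy₀ ⟩
        1ℚ * T f i - 0ℚ * f i
          ≡⟨ solve 2 (λ u v → con 1ℚ :* u :- con 0ℚ :* v := u) refl (T f i) (f i) ⟩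
        T f i ∎
      go : ∀ n i → ev (T^ (suc n)) i ≡ c ^ℚ suc n * A^ (suc n) i + r * form (powerSum x y c n) i
      go zero i = begin
        ev (+ 0 ∷ + 1 ∷ []) i            ≡⟨ trans (ev-0∷ (+ 1 ∷ []) i) (T-cong ev-1 i) ⟩
        T one i                          ≡⟨ byA one i ⟩
        c * A one i + r * one i
          ≡⟨ cong₂ (λ u v → u * A one i + r * v) (sym (ℚ.*-identityʳ c))
            (solve 1 (λ o → o := con 1ℚ :* o :+ con 0ℚ) refl (one i)) ⟩
        c * 1ℚ * A one i + r * (1ℚ * one i + 0ℚ)
          ≡⟨ cong (λ z → c * 1ℚ * A one i + r * (1ℚ * one i + z)) (sym (lin-0 qB pB i)) ⟩
        c * 1ℚ * A one i + r * (1ℚ * one i + B (λ _ → 0ℚ) i) ∎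
      go (suc n) i = begin
        ev (+ 0 ∷ T^ (suc n)) i
          ≡⟨ trans (ev-0∷ (T^ (suc n)) i) (T-cong (go n) i) ⟩
        T (λ j → cⁿ * A^ (suc n) j + r * h j) i
          ≡⟨ T-linear cⁿ r (A^ (suc n)) h i ⟩
        cⁿ * T (A^ (suc n)) i + r * T h i
          ≡⟨ cong₂ (λ u v → cⁿ * u + r * v) (byA (A^ (suc n)) i) (sym (byAB h i)) ⟩
        cⁿ * (c * A^ (suc (suc n)) i + r * A^ (suc n) i) + r * (x * A h i + y * B h i)
          ≡⟨ solve 6 (λ d c a r b e → d :* (c :* a :+ r :* b) :+ r :* e
            := c :* d :* a :+ r :* (d :* b :+ e)) refl cⁿ c (A^ (suc (suc n)) i) r (A^ (suc n) i) (x * A h i + y * B h i) ⟩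
        c * cⁿ * A^ (suc (suc n)) i + r * (cⁿ * A^ (suc n) i + (x * A h i + y * B h i))
          ≡⟨ cong (λ m → c * cⁿ * A^ (suc (suc n)) i + r * (cⁿ * A^ m i + (x * A h i + y * B h i)))
            (sym (length-powerSum x y c n)) ⟩
        c * cⁿ * A^ (suc (suc n)) i + r * (cⁿ * A^ (length (powerSum x y c n)) i + (x * A h i + y * B h i))
          ≡⟨ cong (λ z → c * cⁿ * A^ (suc (suc n)) i + r * z)
            (sym (form-mulLinear x y cⁿ (powerSum x y c n) i)) ⟩
        c * cⁿ * A^ (suc (suc n)) i + r * form (powerSum x y c (suc n)) i ∎
        where
        cⁿ = c ^ℚ suc n
        h = form (powerSum x y c n)

module _ (qA pA qB pB : ℤ) where
  formₚ : List ℤ → ℤ[T]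
  formₚ []       = []
  formₚ (y ∷ ys) = map (y ℤ.*_) (linear^ qA pA (length ys)) +ₚ linear qB pB *ₚ formₚ ys

  module _ (M : Module) where
    open Evaluation M
    open Form (ι qA) (ι pA) (ι qB) (ι pB)

    ev-formₚ : ∀ ys i → ev (formₚ ys) i ≡ form (map ι ys) i
    ev-formₚ []       i = refl
    ev-formₚ (y ∷ ys) i = trans
      (ev-+ (map (y ℤ.*_) (linear^ qA pA (length ys))) (linear qB pB *ₚ formₚ ys) i)
      (cong₂ _+_
        (trans (ev-map y (linear^ qA pA (length ys)) i) (cong (ι y *_)
          (trans (ev-linear^ qA pA (length ys) i) (cong (λ n → A^ n i) (sym (length-map ι ys))))))
        (trans (ev-linear qB pB (formₚ ys) i) (lin-cong (ι qB) (ι pB) (ev-formₚ ys) i)))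

-- Zeros in the far zone

evalᵍ : ℤ[T] → 𝔾 → 𝔾
evalᵍ []      z = 0ᵍ
evalᵍ (a ∷ p) z = ⌜ ι a ⌝ +ᵍ z *ᵍ evalᵍ p z

formᵍ : 𝔾 → 𝔾 → List ℚ → 𝔾
formᵍ a b []       = 0ᵍ
formᵍ a b (t ∷ ts) = ⌜ t ⌝ *ᵍ a ^ᵍ length ts +ᵍ b *ᵍ formᵍ a b ts

-- Multiplication by z on pairs; `true` indexes the real part and `false` the imaginary part.
numberModule : 𝔾 → Module
numberModule z = record
  { I = Bool
  ; T = λ f → λ where
      true  → Re z * f true - Im z * f false
      false → Re z * f false + Im z * f true
  ; one = λ where true → 1ℚ ; false → 0ℚ
  ; T-cong = λ f≗g → λ where
      true  → cong₂ (λ x y → Re z * x - Im z * y) (f≗g true) (f≗g false)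
      false → cong₂ (λ x y → Re z * x + Im z * y) (f≗g false) (f≗g true)
  ; T-linear = λ a b f g → λ where
      true  → solve 8 (λ x y a b f f′ g g′ → x :* (a :* f :+ b :* g) :- y :* (a :* f′ :+ b :* g′)
        := a :* (x :* f :- y :* f′) :+ b :* (x :* g :- y :* g′)) refl
        (Re z) (Im z) a b (f true) (f false) (g true) (g false)
      false → solve 8 (λ x y a b f f′ g g′ → x :* (a :* f′ :+ b :* g′) :+ y :* (a :* f :+ b :* g)
        := a :* (x :* f′ :+ y :* f) :+ b :* (x :* g′ :+ y :* g)) refl
        (Re z) (Im z) a b (f true) (f false) (g true) (g false)
  }

module _ (z : 𝔾) where
  open Evaluation (numberModule z)

  toᵍ : (Bool → ℚ) → 𝔾
  toᵍ f = f true ⊹ f false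

  ev-evalᵍ : ∀ p → toᵍ (ev p) ≡ evalᵍ p z
  ev-evalᵍ []      = refl
  ev-evalᵍ (a ∷ p) = trans
    (cong₂ _⊹_ (cong (_+ T (ev p) true) (ℚ.*-identityʳ (ι a)))
      (cong (_+ T (ev p) false) (ℚ.*-zeroʳ (ι a))))
    (cong (λ w → ⌜ ι a ⌝ +ᵍ z *ᵍ w) (ev-evalᵍ p))

  lin-toᵍ : ∀ q p f → toᵍ (lin q p f) ≡ (⌜ q ⌝ *ᵍ z -ᵍ ⌜ p ⌝) *ᵍ toᵍ f
  lin-toᵍ q p f = cong₂ _⊹_
    (solve 6 (λ q p x y f g → q :* (x :* f :- y :* g) :- p :* f
      := ((q :* x :- con 0ℚ :* y) :- p) :* f :- ((q :* y :+ con 0ℚ :* x) :- con 0ℚ) :* g) refl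
      q p (Re z) (Im z) (f true) (f false))
    (solve 6 (λ q p x y f g → q :* (x :* g :+ y :* f) :- p :* g
      := ((q :* x :- con 0ℚ :* y) :- p) :* g :+ ((q :* y :+ con 0ℚ :* x) :- con 0ℚ) :* f) refl
      q p (Re z) (Im z) (f true) (f false))

  lin^-toᵍ : ∀ q p n → toᵍ (lin^ q p n) ≡ (⌜ q ⌝ *ᵍ z -ᵍ ⌜ p ⌝) ^ᵍ n
  lin^-toᵍ q p zero    = refl
  lin^-toᵍ q p (suc n) = trans (lin-toᵍ q p (lin^ q p n)) (cong ((⌜ q ⌝ *ᵍ z -ᵍ ⌜ p ⌝) *ᵍ_) (lin^-toᵍ q p n))

  toᵍ-axpy : ∀ a f g → toᵍ (λ i → a * f i + g i) ≡ ⌜ a ⌝ *ᵍ toᵍ f +ᵍ toᵍ g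
  toᵍ-axpy a f g = cong₂ _⊹_
    (solve 4 (λ a f f′ g → a :* f :+ g := (a :* f :- con 0ℚ :* f′) :+ g) refl a (f true) (f false) (g true))
    (solve 4 (λ a f f′ g → a :* f′ :+ g := (a :* f′ :+ con 0ℚ :* f) :+ g) refl a (f true) (f false) (g false))

  module _ (qA pA qB pB : ℚ) where
    open Form qA pA qB pB

    private
      a = ⌜ qA ⌝ *ᵍ z -ᵍ ⌜ pA ⌝
      b = ⌜ qB ⌝ *ᵍ z -ᵍ ⌜ pB ⌝

    form-toᵍ : ∀ ts → toᵍ (form ts) ≡ formᵍ a b ts
    form-toᵍ []       = refl
    form-toᵍ (t ∷ ts) = trans (toᵍ-axpy t (A^ (length ts)) (B (form ts)))
      (cong₂ (λ x y → ⌜ t ⌝ *ᵍ x +ᵍ y) (lin^-toᵍ qA pA (length ts))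
        (trans (lin-toᵍ qB pB (form ts)) (cong (b *ᵍ_) (form-toᵍ ts))))

    evalᵍ-form : ∀ P e k ts → (∀ i → ev P i ≡ e * A^ k i + form ts i) →
      evalᵍ P z ≡ ⌜ e ⌝ *ᵍ a ^ᵍ k +ᵍ formᵍ a b ts
    evalᵍ-form P e k ts h = trans (sym (ev-evalᵍ P)) (trans (cong₂ _⊹_ (h true) (h false))
      (trans (toᵍ-axpy e (A^ k) (form ts)) (cong₂ (λ x y → ⌜ e ⌝ *ᵍ x +ᵍ y) (lin^-toᵍ qA pA k) (form-toᵍ ts))))

formᵍ-horner : ∀ a b y → b ≡ a *ᵍ y → ∀ t ts → formᵍ a b (t ∷ ts) ≡ a ^ᵍ length ts *ᵍ horner (t ∷ ts) y
formᵍ-horner a b y b≡ay t []        =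
  solveᵍ 3 (λ t b y → t :*ᵍ conᵍ 1ᵍ :+ᵍ b :*ᵍ conᵍ 0ᵍ :=ᵍ conᵍ 1ᵍ :*ᵍ (t :+ᵍ y :*ᵍ conᵍ 0ᵍ)) refl ⌜ t ⌝ b y
formᵍ-horner a b y b≡ay t (t′ ∷ ts) = trans
  (cong₂ (λ u v → ⌜ t ⌝ *ᵍ a ^ᵍ suc (length ts) +ᵍ u *ᵍ v) b≡ay (formᵍ-horner a b y b≡ay t′ ts))
  (solveᵍ 5 (λ t a y c h → t :*ᵍ (a :*ᵍ c) :+ᵍ (a :*ᵍ y) :*ᵍ (c :*ᵍ h) :=ᵍ (a :*ᵍ c) :*ᵍ (t :+ᵍ y :*ᵍ h)) refl
    ⌜ t ⌝ a y (a ^ᵍ length ts) (horner (t′ ∷ ts) y))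

norm-1 : ∀ z → z ≡ 1ᵍ → ‖ z ‖ ≡ 1ℚ
norm-1 z z≡1 = trans (cong ‖_‖ z≡1) (‖⌜⌝‖ 1ℚ)

1ᵍ^ : ∀ n → 1ᵍ ^ᵍ n ≡ 1ᵍ
1ᵍ^ zero    = refl
1ᵍ^ (suc n) = trans (*ᵍ-identityˡ (1ᵍ ^ᵍ n)) (1ᵍ^ n)

-- Here c = 1/q and κ = q′/q, and s is the determinant. The number g = E(κ) is real and bounded away
-- from 0 by g₀. The radius δ in the variable u = 1/x is so small that ψ expands there, and the far
-- zone is ‖x‖ ≥ V = 2/δ. The term with ε is absent in (a) and is what remains of Tⁿ⁺¹ in (b).
module FarZone (q p q′ p′ c s κ : ℚ) (0<q : 0ℚ < q) (cq≡1 : c * q ≡ 1ℚ) (κ≡ : κ ≡ q′ * c)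
  (det : q * p′ - q′ * p ≡ s) (∣s∣≤1 : ∣ s ∣ ≤ 1ℚ)
  (e₀ : ℚ) (es : List ℚ) (n : ℕ) (len : length es ≡ n) (S ρ : ℚ) (0≤S : 0ℚ ≤ S) (e≤S : All (λ e → ∣ e ∣ ≤ S) (e₀ ∷ es))
  (κ+1≤ρ : ∣ κ ∣ + 1ℚ ≤ ρ)
  (Λ : ℚ) (L≤Λ : hornerLipschitz S ρ (suc (length es)) ≤ Λ)
  (g g₀ : ℚ) (Eκ≡g : horner (e₀ ∷ es) ⌜ κ ⌝ ≡ ⌜ g ⌝) (0<g₀ : 0ℚ < g₀) (g₀≤∣g∣ : g₀ ≤ ∣ g ∣)
  (δ V : ℚ) (0<δ : 0ℚ < δ) (δ≤1 : δ ≤ 1ℚ) (Λδ≤g₀ : (Λ * δ + Λ * δ) + (Λ * δ + Λ * δ) ≤ g₀)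
  (Vδ≡2 : V * δ ≡ 1ℚ + 1ℚ)
  (P : ℤ[T]) (ε : ℚ)
  (evP : ∀ z → evalᵍ P z ≡ ⌜ ε ⌝ *ᵍ (⌜ q ⌝ *ᵍ z -ᵍ ⌜ p ⌝) ^ᵍ suc n
    +ᵍ formᵍ (⌜ q ⌝ *ᵍ z -ᵍ ⌜ p ⌝) (⌜ q′ ⌝ *ᵍ z -ᵍ ⌜ p′ ⌝) (e₀ ∷ es)) where

  E : 𝔾 → 𝔾
  E = horner (e₀ ∷ es)

  private
    a : 𝔾 → 𝔾
    a z = ⌜ q ⌝ *ᵍ z -ᵍ ⌜ p ⌝

    Ψ : 𝔾 → 𝔾
    Ψ = ψ E ⌜ κ ⌝ ⌜ s ⌝

    0≤ρ : 0ℚ ≤ ρ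
    0≤ρ = ℚ.≤-trans (+-nonneg (ℚ.0≤∣p∣ κ) 0≤1ℚ) κ+1≤ρ

    0≤q : 0ℚ ≤ q
    0≤q = ℚ.<⇒≤ 0<q

    0≤qⁿ : 0ℚ ≤ q ^ℚ n
    0≤qⁿ = ^-nonneg n 0≤q

  x : 𝔾 → 𝔾
  x z = ⌜ q ⌝ *ᵍ a z

  -- Put a = q z - p and b = q′ z - p′. From x u = q a u = 1 follows a u = c, and the determinant
  -- gives b = κ a - s c = a (κ - s u). The form becomes aⁿ E(κ - s u), and the powers of q, a and u
  -- cancel.
  identity : ∀ z u → x z *ᵍ u ≡ 1ᵍ → ⌜ q ^ℚ n ⌝ *ᵍ (u ^ᵍ suc n *ᵍ evalᵍ P z) ≡ ⌜ ε * c ⌝ +ᵍ Ψ u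
  identity z u xu≡1 = begin
    ⌜ q ^ℚ n ⌝ *ᵍ (u ^ᵍ suc n *ᵍ evalᵍ P z)
      ≡⟨ cong₂ (λ X Y → X *ᵍ (u ^ᵍ suc n *ᵍ Y)) (⌜⌝-^ q n)
        (trans (evP z) (cong (⌜ ε ⌝ *ᵍ a z ^ᵍ suc n +ᵍ_) (trans (formᵍ-horner (a z) b y b≡ay e₀ es)
          (cong (λ m → a z ^ᵍ m *ᵍ E y) len)))) ⟩
    ⌜ q ⌝ ^ᵍ n *ᵍ (u ^ᵍ suc n *ᵍ (⌜ ε ⌝ *ᵍ a z ^ᵍ suc n +ᵍ a z ^ᵍ n *ᵍ E y))
      ≡⟨ solveᵍ 7 (λ X u U e a A E → X :*ᵍ (u :*ᵍ U :*ᵍ (e :*ᵍ (a :*ᵍ A) :+ᵍ A :*ᵍ E))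
        :=ᵍ X :*ᵍ (U :*ᵍ A) :*ᵍ (e :*ᵍ (a :*ᵍ u) :+ᵍ u :*ᵍ E)) refl
        (⌜ q ⌝ ^ᵍ n) u (u ^ᵍ n) ⌜ ε ⌝ (a z) (a z ^ᵍ n) (E y) ⟩
    ⌜ q ⌝ ^ᵍ n *ᵍ (u ^ᵍ n *ᵍ a z ^ᵍ n) *ᵍ (⌜ ε ⌝ *ᵍ (a z *ᵍ u) +ᵍ u *ᵍ E y)
      ≡⟨ cong₂ (λ X Y → X *ᵍ (⌜ ε ⌝ *ᵍ Y +ᵍ u *ᵍ E y)) qua≡1 au≡c ⟩
    1ᵍ *ᵍ (⌜ ε ⌝ *ᵍ ⌜ c ⌝ +ᵍ u *ᵍ E y)
      ≡⟨ *ᵍ-identityˡ (⌜ ε ⌝ *ᵍ ⌜ c ⌝ +ᵍ u *ᵍ E y) ⟩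
    ⌜ ε ⌝ *ᵍ ⌜ c ⌝ +ᵍ u *ᵍ E y
      ≡⟨ cong (_+ᵍ u *ᵍ E y) (sym (⌜⌝-* ε c)) ⟩
    ⌜ ε * c ⌝ +ᵍ Ψ u ∎
    where
    open ≡-Reasoning
    b = ⌜ q′ ⌝ *ᵍ z -ᵍ ⌜ p′ ⌝
    y = ⌜ κ ⌝ -ᵍ ⌜ s ⌝ *ᵍ u
    au≡c : a z *ᵍ u ≡ ⌜ c ⌝
    au≡c = begin
      a z *ᵍ u                        ≡⟨ *ᵍ-identityˡ (a z *ᵍ u) ⟨
      1ᵍ *ᵍ (a z *ᵍ u)                ≡⟨ cong (_*ᵍ (a z *ᵍ u)) (trans (cong ⌜_⌝ (sym cq≡1)) (⌜⌝-* c q)) ⟩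
      ⌜ c ⌝ *ᵍ ⌜ q ⌝ *ᵍ (a z *ᵍ u)    ≡⟨ solveᵍ 4 (λ c q a u → c :*ᵍ q :*ᵍ (a :*ᵍ u) :=ᵍ (q :*ᵍ a) :*ᵍ u :*ᵍ c)
                                          refl ⌜ c ⌝ ⌜ q ⌝ (a z) u ⟩
      x z *ᵍ u *ᵍ ⌜ c ⌝               ≡⟨ cong (_*ᵍ ⌜ c ⌝) xu≡1 ⟩
      1ᵍ *ᵍ ⌜ c ⌝                     ≡⟨ *ᵍ-identityˡ ⌜ c ⌝ ⟩
      ⌜ c ⌝                           ∎
    qua≡1 : ⌜ q ⌝ ^ᵍ n *ᵍ (u ^ᵍ n *ᵍ a z ^ᵍ n) ≡ 1ᵍ
    qua≡1 = begin
      ⌜ q ⌝ ^ᵍ n *ᵍ (u ^ᵍ n *ᵍ a z ^ᵍ n)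
        ≡⟨ cong (⌜ q ⌝ ^ᵍ n *ᵍ_) (sym (^ᵍ-distrib-* u (a z) n)) ⟩
      ⌜ q ⌝ ^ᵍ n *ᵍ (u *ᵍ a z) ^ᵍ n   ≡⟨ sym (^ᵍ-distrib-* ⌜ q ⌝ (u *ᵍ a z) n) ⟩
      (⌜ q ⌝ *ᵍ (u *ᵍ a z)) ^ᵍ n
        ≡⟨ cong (_^ᵍ n) (trans (solveᵍ 3 (λ q u a → q :*ᵍ (u :*ᵍ a) :=ᵍ (q :*ᵍ a) :*ᵍ u) refl ⌜ q ⌝ u (a z)) xu≡1) ⟩
      1ᵍ ^ᵍ n                         ≡⟨ 1ᵍ^ n ⟩
      1ᵍ                              ∎
    κq≡q′ : κ * q ≡ q′
    κq≡q′ = trans (cong (_* q) κ≡) (trans (ℚ.*-assoc q′ c q) (trans (cong (q′ *_) cq≡1) (ℚ.*-identityʳ q′)))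
    p′≡ : κ * p + s * c ≡ p′
    p′≡ = trans (cong₂ (λ u v → u * p + v * c) κ≡ (sym det))
      (trans (solve 5 (λ q p r t c → r :* c :* p :+ (q :* t :- r :* p) :* c := c :* q :* t) refl q p q′ p′ c)
        (trans (cong (_* p′) cq≡1) (ℚ.*-identityˡ p′)))
    b≡ay : b ≡ a z *ᵍ y
    b≡ay = sym (begin
      a z *ᵍ (⌜ κ ⌝ -ᵍ ⌜ s ⌝ *ᵍ u)
        ≡⟨ solveᵍ 6 (λ q z p k s u → (q :*ᵍ z :-ᵍ p) :*ᵍ (k :-ᵍ s :*ᵍ u)
          :=ᵍ (k :*ᵍ q) :*ᵍ z :-ᵍ (k :*ᵍ p :+ᵍ s :*ᵍ ((q :*ᵍ z :-ᵍ p) :*ᵍ u))) refl ⌜ q ⌝ z ⌜ p ⌝ ⌜ κ ⌝ ⌜ s ⌝ u ⟩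
      ⌜ κ ⌝ *ᵍ ⌜ q ⌝ *ᵍ z -ᵍ (⌜ κ ⌝ *ᵍ ⌜ p ⌝ +ᵍ ⌜ s ⌝ *ᵍ (a z *ᵍ u))
        ≡⟨ cong (λ w → ⌜ κ ⌝ *ᵍ ⌜ q ⌝ *ᵍ z -ᵍ (⌜ κ ⌝ *ᵍ ⌜ p ⌝ +ᵍ ⌜ s ⌝ *ᵍ w)) au≡c ⟩
      ⌜ κ ⌝ *ᵍ ⌜ q ⌝ *ᵍ z -ᵍ (⌜ κ ⌝ *ᵍ ⌜ p ⌝ +ᵍ ⌜ s ⌝ *ᵍ ⌜ c ⌝)
        ≡⟨ cong₂ (λ v w → v *ᵍ z -ᵍ w) (trans (sym (⌜⌝-* κ q)) (cong ⌜_⌝ κq≡q′))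
          (trans (cong₂ _+ᵍ_ (sym (⌜⌝-* κ p)) (sym (⌜⌝-* s c)))
            (trans (sym (⌜⌝-+ (κ * p) (s * c))) (cong ⌜_⌝ p′≡))) ⟩
      b ∎)

  -- The choice 4 Λ δ ≤ g₀ lets the error of `ψ-expanding` consume at most half of the factor g₀ ≤
  -- |g|.
  expanding : ∀ u v → ‖ u ‖ ≤ δ → ‖ v ‖ ≤ δ → g₀ * ‖ u -ᵍ v ‖ ≤ ‖ Ψ u -ᵍ Ψ v ‖ + ‖ Ψ u -ᵍ Ψ v ‖
  expanding u v u≤ v≤ = ≤-by-difference
    ((X + 2Λδ * d - ∣ g ∣ * d) + (X + 2Λδ * d - ∣ g ∣ * d) + ((∣ g ∣ - g₀) * d + ((∣ g ∣ - g₀) * d + (g₀ - (2Λδ + 2Λδ)) * d)))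
    (+-nonneg (+-nonneg h h) (+-nonneg g-g₀ (+-nonneg g-g₀ (*-nonneg (0≤difference Λδ≤g₀) (‖‖-nonneg (u -ᵍ v))))))
    (solve 5 (λ X l d g h → X :+ X := h :* d :+
      ((X :+ l :* d :- g :* d) :+ (X :+ l :* d :- g :* d) :+ ((g :- h) :* d :+ ((g :- h) :* d :+ (h :- (l :+ l)) :* d)))) refl
      X 2Λδ d (∣ g ∣) g₀)
    where
    X = ‖ Ψ u -ᵍ Ψ v ‖
    d = ‖ u -ᵍ v ‖
    2Λδ = Λ * δ + Λ * δ
    g-g₀ : 0ℚ ≤ (∣ g ∣ - g₀) * d
    g-g₀ = *-nonneg (0≤difference g₀≤∣g∣) (‖‖-nonneg (u -ᵍ v))
    ‖κ‖+1≤ρ : ∀ y → ‖ y -ᵍ ⌜ κ ⌝ ‖ ≤ 1ℚ → ‖ y ‖ ≤ ρ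
    ‖κ‖+1≤ρ y y≤ = ℚ.≤-trans (ℚ.≤-trans
      (ℚ.≤-reflexive (cong ‖_‖ (solveᵍ 2 (λ y k → y :=ᵍ k :+ᵍ (y :-ᵍ k)) refl y ⌜ κ ⌝)))
      (‖+‖≤ ⌜ κ ⌝ (y -ᵍ ⌜ κ ⌝))) (ℚ.≤-trans (ℚ.+-mono-≤ (ℚ.≤-reflexive (‖⌜⌝‖ κ)) y≤) κ+1≤ρ)
    h : 0ℚ ≤ X + 2Λδ * d - ∣ g ∣ * d
    h = 0≤difference (ψ-expanding E ⌜ κ ⌝ ⌜ s ⌝ g Λ δ
      (ℚ.≤-trans (hornerLipschitz-nonneg S ρ 0≤S 0≤ρ (suc (length es))) L≤Λ)
      (ℚ.≤-trans (ℚ.≤-reflexive (‖⌜⌝‖ s)) ∣s∣≤1) Eκ≡g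
      (λ y w y≤ w≤ → ℚ.≤-trans (horner-lipschitz S ρ 0≤S 0≤ρ e≤S {y} {w} (‖κ‖+1≤ρ y y≤) (‖κ‖+1≤ρ w w≤))
        (*-monoʳ ‖ y -ᵍ w ‖ (‖‖-nonneg (y -ᵍ w)) L≤Λ))
      δ≤1 u v u≤ v≤)

  private
    0<V : 0ℚ < V
    0<V = ℚ.≰⇒> λ V≤0 → ℚ.<-irrefl refl (ℚ.<-≤-trans (+-pos 0<1ℚ 0<1ℚ)
      (subst₂ _≤_ Vδ≡2 (ℚ.*-zeroˡ δ) (*-monoʳ δ (ℚ.<⇒≤ 0<δ) V≤0)))

    inverse : ∀ z → V ≤ ‖ x z ‖ → ∃ λ u → x z *ᵍ u ≡ 1ᵍ × ‖ u ‖ ≤ δ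
    inverse z V≤ = u , xu≡1 , *-cancelˡ V 0<V (ℚ.≤-trans (*-monoʳ ‖ u ‖ (‖‖-nonneg u) V≤)
      (subst (‖ x z ‖ * ‖ u ‖ ≤_) (trans (cong (λ a → a + a) (norm-1 (x z *ᵍ u) xu≡1)) (sym Vδ≡2)) (‖*‖≥ (x z) u)))
      where
      u = proj₁ (inverseᵍ (x z) (ℚ.<-≤-trans 0<V V≤))
      xu≡1 : x z *ᵍ u ≡ 1ᵍ
      xu≡1 = proj₂ (inverseᵍ (x z) (ℚ.<-≤-trans 0<V V≤))

    small : ∀ z u → ‖ u ‖ ≤ δ → ‖ ⌜ q ^ℚ n ⌝ *ᵍ (u ^ᵍ suc n *ᵍ evalᵍ P z) ‖ ≤ ‖ u ‖ * (q ^ℚ n * ‖ evalᵍ P z ‖)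
    small z u u≤ = ℚ.≤-trans
      (ℚ.≤-reflexive (trans (‖⌜⌝*‖ (q ^ℚ n) (u ^ᵍ suc n *ᵍ evalᵍ P z))
        (cong (_* ‖ u ^ᵍ suc n *ᵍ evalᵍ P z ‖) (ℚ.0≤p⇒∣p∣≡p 0≤qⁿ))))
      (ℚ.≤-trans (*-monoˡ (q ^ℚ n) 0≤qⁿ (ℚ.≤-trans (‖*‖≤ (u ^ᵍ suc n) (evalᵍ P z))
          (*-monoʳ ‖ evalᵍ P z ‖ (‖‖-nonneg (evalᵍ P z)) (ℚ.≤-trans (‖*‖≤ u (u ^ᵍ n))
            (subst (‖ u ‖ * ‖ u ^ᵍ n ‖ ≤_) (ℚ.*-identityʳ ‖ u ‖)
              (*-monoˡ ‖ u ‖ (‖‖-nonneg u) (‖^‖≤1 n (ℚ.≤-trans u≤ δ≤1))))))))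
        (ℚ.≤-reflexive (solve 3 (λ a b c → a :* (b :* c) := b :* (a :* c)) refl (q ^ℚ n) (‖ u ‖) (‖ evalᵍ P z ‖))))

  -- For ε = 0 there are no zeros in the far zone: compare u with ψ 0 = 0.
  no-far-zero : ε ≡ 0ℚ → ∀ z → V ≤ ‖ x z ‖ → g₀ ≤ q ^ℚ n * ‖ evalᵍ P z ‖ + q ^ℚ n * ‖ evalᵍ P z ‖
  no-far-zero refl z V≤ = *-cancelˡ ‖ u ‖ 0<‖u‖ (ℚ.≤-trans
    (ℚ.≤-reflexive (trans (ℚ.*-comm ‖ u ‖ g₀) (cong (λ w → g₀ * ‖ w ‖) u-0)))
    (ℚ.≤-trans (expanding u 0ᵍ u≤ (ℚ.<⇒≤ 0<δ)) (ℚ.≤-trans (ℚ.+-mono-≤ bound bound)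
      (ℚ.≤-reflexive (sym (ℚ.*-distribˡ-+ (‖ u ‖) (q ^ℚ n * ‖ evalᵍ P z ‖) (q ^ℚ n * ‖ evalᵍ P z ‖)))))))
    where
    u = proj₁ (inverse z V≤)
    xu≡1 : x z *ᵍ u ≡ 1ᵍ
    xu≡1 = proj₁ (proj₂ (inverse z V≤))
    u≤ : ‖ u ‖ ≤ δ
    u≤ = proj₂ (proj₂ (inverse z V≤))
    u-0 : u ≡ u -ᵍ 0ᵍ
    u-0 = solveᵍ 1 (λ u → u :=ᵍ u :-ᵍ conᵍ 0ᵍ) refl u
    bound : ‖ Ψ u -ᵍ Ψ 0ᵍ ‖ ≤ ‖ u ‖ * (q ^ℚ n * ‖ evalᵍ P z ‖)
    bound = subst (λ w → ‖ w ‖ ≤ ‖ u ‖ * (q ^ℚ n * ‖ evalᵍ P z ‖)) (trans (identity z u xu≡1)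
      (trans (cong (λ w → ⌜ w ⌝ +ᵍ Ψ u) (ℚ.*-zeroˡ c))
        (solveᵍ 2 (λ X e → conᵍ 0ᵍ :+ᵍ X :=ᵍ X :-ᵍ conᵍ 0ᵍ :*ᵍ e) refl
          (Ψ u) (E (⌜ κ ⌝ -ᵍ ⌜ s ⌝ *ᵍ 0ᵍ)))))
      (small z u u≤)
    0<‖u‖ : 0ℚ < ‖ u ‖
    0<‖u‖ = ℚ.≰⇒> λ u≤0 → ℚ.<-irrefl refl (ℚ.<-≤-trans 0<1ℚ
      (ℚ.≤-trans (ℚ.≤-reflexive (sym (norm-1 (x z *ᵍ u) xu≡1)))
        (ℚ.≤-trans (‖*‖≤ (x z) u) (ℚ.≤-trans (*-monoˡ ‖ x z ‖ (‖‖-nonneg (x z)) u≤0)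
          (ℚ.≤-reflexive (ℚ.*-zeroʳ ‖ x z ‖))))))

  -- Passing to reciprocals, q² (z - w) = x(z) - x(w) = - x(z) x(w) (u - v), and `expanding` bounds
  -- u - v by ψ u - ψ v, in which the constant ε c cancels. The values of P are kept in the bound
  -- because z and w will be approximations of zeros.
  far-zeros-close : ∀ z w → V ≤ ‖ x z ‖ → V ≤ ‖ x w ‖ →
    g₀ * ((q * q) * ‖ z -ᵍ w ‖) ≤
      (‖ x z ‖ * ‖ x w ‖) * ((q ^ℚ n * ‖ evalᵍ P z ‖ + q ^ℚ n * ‖ evalᵍ P w ‖)
        + (q ^ℚ n * ‖ evalᵍ P z ‖ + q ^ℚ n * ‖ evalᵍ P w ‖))
  far-zeros-close z w V≤z V≤w = ℚ.≤-trans (*-monoˡ g₀ (ℚ.<⇒≤ 0<g₀) q²z-w≤)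
    (ℚ.≤-trans (ℚ.≤-reflexive (solve 3 (λ g X d → g :* (X :* d) := X :* (g :* d)) refl
        g₀ (‖ x z ‖ * ‖ x w ‖) (‖ u -ᵍ v ‖)))
      (*-monoˡ (‖ x z ‖ * ‖ x w ‖) (*-nonneg (‖‖-nonneg (x z)) (‖‖-nonneg (x w)))
        (ℚ.≤-trans (expanding u v u≤ v≤) (ℚ.+-mono-≤ bound bound))))
    where
    u = proj₁ (inverse z V≤z)
    xu≡1 : x z *ᵍ u ≡ 1ᵍ
    xu≡1 = proj₁ (proj₂ (inverse z V≤z))
    u≤ : ‖ u ‖ ≤ δ
    u≤ = proj₂ (proj₂ (inverse z V≤z))
    v = proj₁ (inverse w V≤w)
    xv≡1 : x w *ᵍ v ≡ 1ᵍ
    xv≡1 = proj₁ (proj₂ (inverse w V≤w))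
    v≤ : ‖ v ‖ ≤ δ
    v≤ = proj₂ (proj₂ (inverse w V≤w))
    q²z-w≤ : (q * q) * ‖ z -ᵍ w ‖ ≤ (‖ x z ‖ * ‖ x w ‖) * ‖ u -ᵍ v ‖
    q²z-w≤ = ℚ.≤-trans (ℚ.≤-reflexive (trans
        (trans (cong (_* ‖ z -ᵍ w ‖) (sym (ℚ.0≤p⇒∣p∣≡p (*-nonneg 0≤q 0≤q)))) (sym (‖⌜⌝*‖ (q * q) (z -ᵍ w))))
        (trans (cong ‖_‖ eq) (‖-‖ (x z *ᵍ x w *ᵍ (u -ᵍ v))))))
      (ℚ.≤-trans (‖*‖≤ (x z *ᵍ x w) (u -ᵍ v)) (*-monoʳ ‖ u -ᵍ v ‖ (‖‖-nonneg (u -ᵍ v)) (‖*‖≤ (x z) (x w))))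
      where
      open ≡-Reasoning
      eq : ⌜ q * q ⌝ *ᵍ (z -ᵍ w) ≡ ⊖ (x z *ᵍ x w *ᵍ (u -ᵍ v))
      eq = begin
        ⌜ q * q ⌝ *ᵍ (z -ᵍ w) ≡⟨ cong (_*ᵍ (z -ᵍ w)) (⌜⌝-* q q) ⟩
        ⌜ q ⌝ *ᵍ ⌜ q ⌝ *ᵍ (z -ᵍ w)
          ≡⟨ solveᵍ 4 (λ q z w p → q :*ᵍ q :*ᵍ (z :-ᵍ w)
            :=ᵍ q :*ᵍ (q :*ᵍ z :-ᵍ p) :*ᵍ conᵍ 1ᵍ :-ᵍ q :*ᵍ (q :*ᵍ w :-ᵍ p) :*ᵍ conᵍ 1ᵍ) refl ⌜ q ⌝ z w ⌜ p ⌝ ⟩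
        x z *ᵍ 1ᵍ -ᵍ x w *ᵍ 1ᵍ
          ≡⟨ cong₂ (λ s t → x z *ᵍ s -ᵍ x w *ᵍ t) (sym xv≡1) (sym xu≡1) ⟩
        x z *ᵍ (x w *ᵍ v) -ᵍ x w *ᵍ (x z *ᵍ u)
          ≡⟨ solveᵍ 4 (λ X Y u v → X :*ᵍ (Y :*ᵍ v) :-ᵍ Y :*ᵍ (X :*ᵍ u) :=ᵍ :⊖ (X :*ᵍ Y :*ᵍ (u :-ᵍ v))) refl (x z) (x w) u v ⟩
        ⊖ (x z *ᵍ x w *ᵍ (u -ᵍ v)) ∎
    value≤ : ∀ z u → x z *ᵍ u ≡ 1ᵍ → ‖ u ‖ ≤ δ → ‖ ⌜ ε * c ⌝ +ᵍ Ψ u ‖ ≤ q ^ℚ n * ‖ evalᵍ P z ‖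
    value≤ z u xu≡1 u≤ = ℚ.≤-trans (ℚ.≤-reflexive (cong ‖_‖ (sym (identity z u xu≡1))))
      (ℚ.≤-trans (small z u u≤) (subst (‖ u ‖ * (q ^ℚ n * ‖ evalᵍ P z ‖) ≤_) (ℚ.*-identityˡ (q ^ℚ n * ‖ evalᵍ P z ‖))
        (*-monoʳ (q ^ℚ n * ‖ evalᵍ P z ‖) (*-nonneg 0≤qⁿ (‖‖-nonneg (evalᵍ P z))) (ℚ.≤-trans u≤ δ≤1))))
    bound : ‖ Ψ u -ᵍ Ψ v ‖ ≤ q ^ℚ n * ‖ evalᵍ P z ‖ + q ^ℚ n * ‖ evalᵍ P w ‖
    bound = ℚ.≤-trans
      (ℚ.≤-reflexive (cong ‖_‖ (solveᵍ 3 (λ e X Y → X :-ᵍ Y :=ᵍ (e :+ᵍ X) :+ᵍ (:⊖ (e :+ᵍ Y))) refl ⌜ ε * c ⌝ (Ψ u) (Ψ v))))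
      (ℚ.≤-trans (‖+‖≤ (⌜ ε * c ⌝ +ᵍ Ψ u) (⊖ (⌜ ε * c ⌝ +ᵍ Ψ v)))
        (ℚ.+-mono-≤ (value≤ z u xu≡1 u≤) (ℚ.≤-trans (ℚ.≤-reflexive (‖-‖ (⌜ ε * c ⌝ +ᵍ Ψ v))) (value≤ w v xv≡1 v≤))))

-- Zeros as real and complex numbers

both : ∀ {P Q : ℕ → Set} → Eventually P → Eventually Q → Eventually λ n → P n × Q n
both (M , p) (N , q) = M ℕ.⊔ N , λ n h →
  p n (ℕ.m⊔n≤o⇒m≤o M N h) , q n (ℕ.m⊔n≤o⇒n≤o M N h)

eventually-map : ∀ {P Q : ℕ → Set} → (∀ n → P n → Q n) → Eventually P → Eventually Q
eventually-map f (N , p) = N , λ n h → f n (p n h)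

eventually-once : ∀ {P : ℕ → Set} → Eventually P → ∃ P
eventually-once (N , p) = N , p N ℕ.≤-refl

½+½ : ∀ p → ½ * p + ½ * p ≡ p
½+½ p = trans (sym (ℚ.*-distribʳ-+ p ½ ½)) (ℚ.*-identityˡ p)

0<½ : 0ℚ < ½
0<½ = ℚ.positive⁻¹ ½

opaque
  quotient : ∀ {a} b → 0ℚ < a → 0ℚ < b → ∃ λ x → 0ℚ < x × a * x ≡ b
  quotient {a} b 0<a 0<b = r * b , *-pos (proj₁ (proj₂ (reciprocal 0<a))) 0<b ,
    trans (sym (ℚ.*-assoc a r b)) (trans (cong (_* b) (proj₂ (proj₂ (reciprocal 0<a)))) (ℚ.*-identityˡ b))
    where
    r : ℚ
    r = proj₁ (reciprocal 0<a)

at : ℂ → ℕ → 𝔾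
at z m = seq (re z) m ⊹ seq (im z) m

-- The operations on `ℝ` act termwise on sequences, so the m-th approximation of a value is exactly
-- the value at the m-th approximation. This is what reduces complex zeros to `𝔾`.
at-eval : ∀ P z m → at (eval P z) m ≡ evalᵍ P (at z m)
at-eval []      z m = refl
at-eval (a ∷ P) z m = cong₂ (λ c w → ⌜ c ⌝ +ᵍ at z m *ᵍ w) (sym (ι≡/1 a)) (at-eval P z m)

≈0⇒small : ∀ {w} → w ≈ℂ 0ℂ → ∀ ε → 0ℚ < ε → Eventually λ m → ‖ at w m ‖ ≤ ε
≈0⇒small {w} w≈0 ε 0<ε = eventually-map
  (λ m h → subst (‖ at w m ‖ ≤_) (½+½ ε) (ℚ.+-mono-≤ (drop (seq (re w) m) (proj₁ h)) (drop (seq (im w) m) (proj₂ h))))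
  (both (un≈ (re-≈ w≈0) (½ * ε) (*-pos 0<½ 0<ε)) (un≈ (im-≈ w≈0) (½ * ε) (*-pos 0<½ 0<ε)))
  where
  drop : ∀ p → ∣ p - 0ℚ ∣ ≤ ½ * ε → ∣ p ∣ ≤ ½ * ε
  drop p = subst (λ x → ∣ x ∣ ≤ ½ * ε) (solve 1 (λ p → p :- con 0ℚ := p) refl p)

root⇒small : ∀ {P z} → eval P z ≈ℂ 0ℂ → ∀ ε → 0ℚ < ε → Eventually λ m → ‖ evalᵍ P (at z m) ‖ ≤ ε
root⇒small {P} {z} h ε 0<ε = eventually-map (λ m → subst (λ w → ‖ w ‖ ≤ ε) (at-eval P z m)) (≈0⇒small {eval P z} h ε 0<ε)

small⇒≈0 : ∀ w → (∀ ε → 0ℚ < ε → Eventually λ m → ‖ at w m ‖ ≤ ε) → w ≈ℂ 0ℂ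
small⇒≈0 w h = mk≈ℂ
  (mk≈ λ ε 0<ε → eventually-map (λ m le → undrop (seq (re w) m) (ℚ.≤-trans (p≤p+q (ℚ.0≤∣p∣ (seq (im w) m))) le)) (h ε 0<ε))
  (mk≈ λ ε 0<ε → eventually-map (λ m le → undrop (seq (im w) m) (ℚ.≤-trans (q≤p+q (ℚ.0≤∣p∣ (seq (re w) m))) le)) (h ε 0<ε))
  where
  undrop : ∀ {ε} p → ∣ p ∣ ≤ ε → ∣ p - 0ℚ ∣ ≤ ε
  undrop {ε} p = subst (λ x → ∣ x ∣ ≤ ε) (solve 1 (λ p → p := p :- con 0ℚ) refl p)

close⇒≈ : ∀ z w → (∀ ε → 0ℚ < ε → Eventually λ m → ‖ at z m -ᵍ at w m ‖ ≤ ε) → z ≈ℂ w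
close⇒≈ z w h = mk≈ℂ
  (mk≈ λ ε 0<ε → eventually-map (λ m le → ℚ.≤-trans (p≤p+q (ℚ.0≤∣p∣ (seq (im z) m - seq (im w) m))) le) (h ε 0<ε))
  (mk≈ λ ε 0<ε → eventually-map (λ m le → ℚ.≤-trans (q≤p+q (ℚ.0≤∣p∣ (seq (re z) m - seq (re w) m))) le) (h ε 0<ε))

cauchyᵍ : ∀ z ε → 0ℚ < ε → ∃ λ N → ∀ m → N ℕ.≤ m → ‖ at z m -ᵍ at z N ‖ ≤ ε
cauchyᵍ z ε 0<ε = K , λ m K≤m → ℚ.≤-trans
  (ℚ.+-mono-≤
    (proj₂ hr m K (ℕ.m⊔n≤o⇒m≤o (proj₁ hr) (proj₁ hi) K≤m) (ℕ.m≤m⊔n (proj₁ hr) (proj₁ hi)))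
    (proj₂ hi m K (ℕ.m⊔n≤o⇒n≤o (proj₁ hr) (proj₁ hi) K≤m) (ℕ.m≤n⊔m (proj₁ hr) (proj₁ hi))))
  (≤-by-difference (½ * ε) (ℚ.<⇒≤ (*-pos 0<½ 0<ε))
    (solve 1 (λ e → e := (con ½ :* con ½ :* e :+ con ½ :* con ½ :* e) :+ con ½ :* e) refl ε))
  where
  0<ε/4 : 0ℚ < ½ * ½ * ε
  0<ε/4 = *-pos (*-pos 0<½ 0<½) 0<ε
  hr = cauchy (re z) (½ * ½ * ε) 0<ε/4
  hi = cauchy (im z) (½ * ½ * ε) 0<ε/4
  K = proj₁ hr ℕ.⊔ proj₁ hi

module Zeros (P : ℤ[T]) (x : 𝔾 → 𝔾) (Q V : ℚ) (0<Q : 0ℚ < Q)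
  (x-scale : ∀ z w → ‖ x z -ᵍ x w ‖ ≡ Q * ‖ z -ᵍ w ‖) where

  -- The values at the approximations of a zero are eventually at most η/2, and the far zone only
  -- has values of size at least η.
  zeros-near : (η : ℚ) → 0ℚ < η → (∀ z → V ≤ ‖ x z ‖ → η ≤ ‖ evalᵍ P z ‖) →
    ∀ z → eval P z ≈ℂ 0ℂ → Eventually λ m → ‖ x (at z m) ‖ ≤ V
  zeros-near η 0<η far z Pz≈0 = eventually-map
    (λ m small → ℚ.≮⇒≥ λ V< → ℚ.<-irrefl refl (ℚ.<-≤-trans (half< η 0<η) (ℚ.≤-trans (far (at z m) (ℚ.<⇒≤ V<)) small)))
    (root⇒small {P} {z} Pz≈0 (½ * η) (*-pos 0<½ 0<η))
    where
    half< : ∀ η → 0ℚ < η → ½ * η < η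
    half< η 0<η = <-by-difference (½ * η) (*-pos 0<½ 0<η) (sym (½+½ η))

  private
    norm≤ : ∀ z w → ‖ z ‖ ≤ ‖ w ‖ + ‖ z -ᵍ w ‖
    norm≤ z w = ℚ.≤-trans (ℚ.≤-reflexive (cong ‖_‖ (solveᵍ 2 (λ z w → z :=ᵍ w :+ᵍ (z :-ᵍ w)) refl z w)))
      (‖+‖≤ w (z -ᵍ w))

    norm-sym : ∀ z w → ‖ z -ᵍ w ‖ ≡ ‖ w -ᵍ z ‖
    norm-sym z w = trans (sym (‖-‖ (z -ᵍ w)))
      (cong ‖_‖ (solveᵍ 2 (λ z w → :⊖ (z :-ᵍ w) :=ᵍ w :-ᵍ z) refl z w))

    settle : ∀ z → ∃ λ N → ∀ m → N ℕ.≤ m → ‖ x (at z m) -ᵍ x (at z N) ‖ ≤ 1ℚ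
    settle z = proj₁ (cauchyᵍ z δ 0<δ) , λ m N≤m →
      subst₂ _≤_ (sym (x-scale (at z m) (at z (proj₁ (cauchyᵍ z δ 0<δ))))) Qδ≡1
        (*-monoˡ Q (ℚ.<⇒≤ 0<Q) (proj₂ (cauchyᵍ z δ 0<δ) m N≤m))
      where
      δ = proj₁ (quotient 1ℚ 0<Q 0<1ℚ)
      0<δ : 0ℚ < δ
      0<δ = proj₁ (proj₂ (quotient 1ℚ 0<Q 0<1ℚ))
      Qδ≡1 : Q * δ ≡ 1ℚ
      Qδ≡1 = proj₂ (proj₂ (quotient 1ℚ 0<Q 0<1ℚ))

  -- Once x has settled to within 1, a single rational comparison of ‖x‖ with V + 1 decides. If it
  -- is at most V + 1, the tail stays within V + 2. Otherwise the whole tail stays in the far zone,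
  -- where ‖x‖ is bounded along both sequences, so `close` drives the distance to α to 0 and
  -- contradicts `z ≉ℂ α`.
  other-zeros-near : (g K : ℚ) → 0ℚ < g → 0ℚ < K →
    (∀ z w → V ≤ ‖ x z ‖ → V ≤ ‖ x w ‖ →
      g * ‖ z -ᵍ w ‖ ≤ (‖ x z ‖ * ‖ x w ‖) * (K * (‖ evalᵍ P z ‖ + ‖ evalᵍ P w ‖))) →
    ∀ α → eval P α ≈ℂ 0ℂ → (∀ m → V ≤ ‖ x (at α m) ‖) →
    ∀ z → eval P z ≈ℂ 0ℂ → z ≉ℂ α → Eventually λ m → ‖ x (at z m) ‖ ≤ V + 1ℚ + 1ℚ
  other-zeros-near g K 0<g 0<K close α Pα≈0 far z Pz≈0 z≉α = decide (settle z) (settle α)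
    where
    decide : (∃ λ N → ∀ m → N ℕ.≤ m → ‖ x (at z m) -ᵍ x (at z N) ‖ ≤ 1ℚ) →
      (∃ λ N → ∀ m → N ℕ.≤ m → ‖ x (at α m) -ᵍ x (at α N) ‖ ≤ 1ℚ) →
      Eventually λ m → ‖ x (at z m) ‖ ≤ V + 1ℚ + 1ℚ
    decide (N , hz) (N′ , hα) = [ near , (λ V+1≤ → ⊥-elim (z≉α (close⇒≈ z α (z→α V+1≤)))) ]′
      (ℚ.≤-total ‖ x (at z N) ‖ (V + 1ℚ))
      where
      near : ‖ x (at z N) ‖ ≤ V + 1ℚ → Eventually λ m → ‖ x (at z m) ‖ ≤ V + 1ℚ + 1ℚ
      near ≤V+1 = N , λ m N≤m → ℚ.≤-trans (norm≤ (x (at z m)) (x (at z N)))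
        (ℚ.+-mono-≤ ≤V+1 (hz m N≤m))
      V≤xz : V + 1ℚ ≤ ‖ x (at z N) ‖ → ∀ m → N ℕ.≤ m → V ≤ ‖ x (at z m) ‖
      V≤xz V+1≤ m N≤m = ≤-by-difference
        ((‖ x (at z m) ‖ + 1ℚ - ‖ x (at z N) ‖) + (‖ x (at z N) ‖ - (V + 1ℚ)))
        (+-nonneg (0≤difference (ℚ.≤-trans (norm≤ (x (at z N)) (x (at z m)))
            (ℚ.+-monoʳ-≤ ‖ x (at z m) ‖ (subst (_≤ 1ℚ) (norm-sym (x (at z m)) (x (at z N))) (hz m N≤m)))))
          (0≤difference V+1≤))
        (solve 3 (λ a b v → a := v :+ ((a :+ con 1ℚ :- b) :+ (b :- (v :+ con 1ℚ)))) refl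
          (‖ x (at z m) ‖) (‖ x (at z N) ‖) V)
      Z = ‖ x (at z N) ‖ + 1ℚ
      W = ‖ x (at α N′) ‖ + 1ℚ
      0<Z : 0ℚ < Z
      0<Z = ℚ.+-mono-≤-< (‖‖-nonneg (x (at z N))) 0<1ℚ
      0<W : 0ℚ < W
      0<W = ℚ.+-mono-≤-< (‖‖-nonneg (x (at α N′))) 0<1ℚ
      z→α : V + 1ℚ ≤ ‖ x (at z N) ‖ → ∀ ε → 0ℚ < ε → Eventually λ m → ‖ at z m -ᵍ at α m ‖ ≤ ε
      z→α V+1≤ ε 0<ε = eventually-map step
        (both (both (N , λ m h → h) (N′ , λ m h → h))
          (both (root⇒small {P} {z} Pz≈0 (½ * η) (*-pos 0<½ 0<η)) (root⇒small {P} {α} Pα≈0 (½ * η) (*-pos 0<½ 0<η))))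
        where
        solution = quotient (g * ε) (*-pos (*-pos 0<Z 0<W) 0<K) (*-pos 0<g 0<ε)
        η = proj₁ solution
        0<η : 0ℚ < η
        0<η = proj₁ (proj₂ solution)
        ZWKη≡gε : Z * W * K * η ≡ g * ε
        ZWKη≡gε = proj₂ (proj₂ solution)
        step : ∀ m → (N ℕ.≤ m × N′ ℕ.≤ m) × (‖ evalᵍ P (at z m) ‖ ≤ ½ * η × ‖ evalᵍ P (at α m) ‖ ≤ ½ * η) →
          ‖ at z m -ᵍ at α m ‖ ≤ ε
        step m ((N≤m , N′≤m) , (Pz≤ , Pα≤)) = *-cancelˡ g 0<g (ℚ.≤-trans
          (close (at z m) (at α m) (V≤xz V+1≤ m N≤m) (far m))
          (ℚ.≤-trans
            (*-mono (*-nonneg (‖‖-nonneg (x (at z m))) (‖‖-nonneg (x (at α m)))) (ℚ.<⇒≤ (*-pos 0<K 0<η))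
              (*-mono (‖‖-nonneg (x (at z m))) (ℚ.<⇒≤ 0<W)
                (ℚ.≤-trans (norm≤ (x (at z m)) (x (at z N))) (ℚ.+-monoʳ-≤ ‖ x (at z N) ‖ (hz m N≤m)))
                (ℚ.≤-trans (norm≤ (x (at α m)) (x (at α N′))) (ℚ.+-monoʳ-≤ ‖ x (at α N′) ‖ (hα m N′≤m))))
              (*-monoˡ K (ℚ.<⇒≤ 0<K) (subst (‖ evalᵍ P (at z m) ‖ + ‖ evalᵍ P (at α m) ‖ ≤_) (½+½ η)
                (ℚ.+-mono-≤ Pz≤ Pα≤))))
            (ℚ.≤-reflexive (trans (sym (ℚ.*-assoc (Z * W) K η)) ZWKη≡gε))))

-- Distances in terms of the height

1/n*n : ∀ H .{{_ : NonZero H}} → (+ 1 ℚ./ H) * ιₙ H ≡ 1ℚ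
1/n*n H = trans (/-* (+ 1) H) ι-1

∣∣ℂ≤ : ∀ w m → seq (∣ w ∣ℂ) m ≤ ‖ at w m ‖
∣∣ℂ≤ w m = root≤ (normSq (at w m)) ‖ at w m ‖ (‖‖-nonneg (at w m)) (normSq≤‖‖² (at w m))
  where
  root≤ : ∀ a b → 0ℚ ≤ b → a ≤ b * b → rootApprox 2 a m ≤ b
  root≤ a b 0≤b a≤b² = ^-cancel-≤ 2 0≤b (ℚ.≤-trans (rootApprox-lower 2 a m)
    (ℚ.⊔-lub (^-nonneg 2 0≤b) (ℚ.≤-trans a≤b² (ℚ.≤-reflexive (cong (b *_) (sym (ℚ.*-identityʳ b)))))))

-- Comparison of n-th powers: (v²)ⁿ ≤ h² < (r + 1/(m + 1))ⁿ. The grid approximation misses the root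
-- by less than one mesh, hence the extra term.
square≤rootApprox : ∀ n .{{_ : NonZero n}} v h m → 0ℚ ≤ v → v ^ℚ n ≤ h →
  v * v ≤ rootApprox n (h ^ℚ 2) m + + 1 ℚ./ suc m
square≤rootApprox n v h m 0≤v v^≤h = ^-cancel-≤ n 0≤r+1/m (ℚ.≤-trans v²^≤h² (ℚ.≤-trans h²≤h²⁺ (ℚ.<⇒≤ h²⁺<)))
  where
  r = rootApprox n (h ^ℚ 2) m
  1/m = + 1 ℚ./ suc m
  0≤1/m : 0ℚ ≤ 1/m
  0≤1/m = ℚ.<⇒≤ (ℚ.positive⁻¹ 1/m {{ℚ.normalize-pos 1 (suc m)}})
  0≤r+1/m : 0ℚ ≤ r + 1/m
  0≤r+1/m = +-nonneg (rootApprox-nonneg n (h ^ℚ 2) m) 0≤1/m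
  0≤v^ : 0ℚ ≤ v ^ℚ n
  0≤v^ = ^-nonneg n 0≤v
  v²^≤h² : (v * v) ^ℚ n ≤ h ^ℚ 2
  v²^≤h² = subst₂ _≤_ (sym (^-distrib-* v v n)) (cong (h *_) (sym (ℚ.*-identityʳ h)))
    (*-mono 0≤v^ (ℚ.≤-trans 0≤v^ v^≤h) v^≤h v^≤h)
  h²≤h²⁺ : h ^ℚ 2 ≤ positivePart (h ^ℚ 2)
  h²≤h²⁺ = ℚ.p≤q⊔p 0ℚ (h ^ℚ 2)
  h²⁺< : positivePart (h ^ℚ 2) < (r + 1/m) ^ℚ n
  h²⁺< = rootApprox-upper n (h ^ℚ 2) m

root-bound : ∀ (w : ℂ) n .{{_ : NonZero n}} (h H q G W c : ℚ) → W * (G * G) ≡ c → h * H ≡ 1ℚ → 0ℚ ≤ H → 0ℚ < q → 1ℚ ≤ G → 0ℚ < W →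
  H ≤ G * q ^ℚ n → Eventually (λ m → q * q * ‖ at w m ‖ ≤ W) →
  ∣ w ∣ℂ ≤ℝ fromℚ c *ℝ root n (fromℚ (h ^ℚ 2))
root-bound w n h H q G W c WGG≡c hH≡1 0≤H 0<q 1≤G 0<W H≤ near = mk≤ bound
  where
  0<G : 0ℚ < G
  0<G = ℚ.<-≤-trans 0<1ℚ 1≤G
  0<c : 0ℚ < c
  0<c = subst (0ℚ <_) WGG≡c (*-pos 0<W (*-pos 0<G 0<G))
  Gq = G * q
  v = proj₁ (reciprocal (*-pos 0<G 0<q))
  0<v : 0ℚ < v
  0<v = proj₁ (proj₂ (reciprocal (*-pos 0<G 0<q)))
  Gqv≡1 : Gq * v ≡ 1ℚ
  Gqv≡1 = proj₂ (proj₂ (reciprocal (*-pos 0<G 0<q)))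
  0<h : 0ℚ < h
  0<h = ℚ.≰⇒> λ h≤0 → ℚ.<-irrefl refl (ℚ.<-≤-trans 0<1ℚ
    (subst₂ _≤_ hH≡1 (ℚ.*-zeroˡ H) (*-monoʳ H 0≤H h≤0)))
  -- `1 ≤ G` enters here: H ≤ G qⁿ ≤ (G q)ⁿ, and v is the reciprocal of G q.
  v^≤h : v ^ℚ n ≤ h
  v^≤h = subst₂ _≤_
    (trans (ℚ.*-comm (v ^ℚ n) 1ℚ) (ℚ.*-identityˡ (v ^ℚ n)))
    eq
    (*-monoˡ (v ^ℚ n) (^-nonneg n (ℚ.<⇒≤ 0<v)) (ℚ.≤-trans (ℚ.≤-reflexive (sym hH≡1))
      (*-monoˡ h (ℚ.<⇒≤ 0<h) (ℚ.≤-trans H≤ (*-monoʳ (q ^ℚ n) (^-nonneg n (ℚ.<⇒≤ 0<q)) (p≤p^ n 1≤G))))))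
    where
    open ≡-Reasoning
    eq : v ^ℚ n * (h * (G ^ℚ n * q ^ℚ n)) ≡ h
    eq = begin
      v ^ℚ n * (h * (G ^ℚ n * q ^ℚ n))
        ≡⟨ cong (λ z → v ^ℚ n * (h * z)) (sym (^-distrib-* G q n)) ⟩
      v ^ℚ n * (h * Gq ^ℚ n)
        ≡⟨ solve 3 (λ v h g → v :* (h :* g) := (g :* v) :* h) refl (v ^ℚ n) h (Gq ^ℚ n) ⟩
      Gq ^ℚ n * v ^ℚ n * h
        ≡⟨ cong (_* h) (trans (sym (^-distrib-* Gq v n)) (trans (cong (_^ℚ n) Gqv≡1) (1^ n))) ⟩
      1ℚ * h ≡⟨ ℚ.*-identityˡ h ⟩
      h ∎
  q²cv²≡W : q * q * (c * (v * v)) ≡ W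
  q²cv²≡W = trans (cong (λ z → q * q * (z * (v * v))) (sym WGG≡c)) (trans (solve 4 (λ q w g v → q :* q :* (w :* (g :* g) :* (v :* v)) := w :* ((g :* q :* v) :* (g :* q :* v))) refl q W G v)
    (trans (cong (λ z → W * (z * z)) Gqv≡1) (trans (cong (W *_) (ℚ.*-identityˡ 1ℚ)) (ℚ.*-identityʳ W))))
  bound : ∀ ε → 0ℚ < ε → Eventually λ m → seq (∣ w ∣ℂ) m ≤ c * rootApprox n (h ^ℚ 2) m + ε
  bound ε 0<ε = eventually-map step (both near (1/n→0 η 0<η))
    where
    η = proj₁ (quotient ε 0<c 0<ε)
    0<η : 0ℚ < η
    0<η = proj₁ (proj₂ (quotient ε 0<c 0<ε))
    cη≡ε : c * η ≡ ε
    cη≡ε = proj₂ (proj₂ (quotient ε 0<c 0<ε))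
    combine : ∀ t r d T → t ≤ T → q * q * T ≤ W → v * v ≤ r + d → d ≤ η → t ≤ c * r + ε
    combine t r d T t≤T near vv≤ d≤η = ℚ.≤-trans t≤T (ℚ.≤-trans
      (*-cancelˡ (q * q) (*-pos 0<q 0<q) (ℚ.≤-trans near (ℚ.≤-reflexive (sym q²cv²≡W))))
      (ℚ.≤-trans (*-monoˡ c (ℚ.<⇒≤ 0<c) (ℚ.≤-trans vv≤ (ℚ.+-monoʳ-≤ r d≤η)))
        (ℚ.≤-reflexive (trans (ℚ.*-distribˡ-+ c r η) (cong (λ z → c * r + z) cη≡ε)))))
    step : ∀ m → q * q * ‖ at w m ‖ ≤ W × + 1 ℚ./ suc m ≤ η → seq (∣ w ∣ℂ) m ≤ c * rootApprox n (h ^ℚ 2) m + ε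
    step m (near , 1/m≤η) = combine (seq (∣ w ∣ℂ) m) (rootApprox n (h ^ℚ 2) m) (+ 1 ℚ./ suc m) ‖ at w m ‖ (∣∣ℂ≤ w m) near
      (square≤rootApprox n v h m (ℚ.<⇒≤ 0<v) v^≤h) 1/m≤η

-- ‖ · ‖ ≤ W/q² and H ≤ G qⁿ give the bound W G² H^(-2/n), because
-- (G q)⁻² ≤ H^(-2/n).
distance-bound : ∀ (w : ℂ) n .{{_ : NonZero n}} α (q G W c : ℚ) → W * (G * G) ≡ c →
  0ℚ < q → 1ℚ ≤ G → 0ℚ < W → ιₙ (height α) ≤ G * q ^ℚ n → Eventually (λ m → q * q * ‖ at w m ‖ ≤ W) →
  ∣ w ∣ℂ ≤ℝ fromℚ c *ℝ height^-2/ α n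
distance-bound w n α q G W c WGG≡c 0<q 1≤G 0<W H≤ near =
  bound ((+ 1 ℚ./ height α) {{height-nonZero α}}) (1/n*n (height α) {{height-nonZero α}}) (height^-2/ α n) refl
  where
  bound : ∀ h → h * ιₙ (height α) ≡ 1ℚ → ∀ r → r ≡ root n (fromℚ (h ^ℚ 2)) → ∣ w ∣ℂ ≤ℝ fromℚ c *ℝ r
  bound h hH≡1 r r≡ = subst (λ r → ∣ w ∣ℂ ≤ℝ fromℚ c *ℝ r) (sym r≡)
    (root-bound w n h (ιₙ (height α)) q G W c WGG≡c hH≡1 (ιₙ-nonneg (height α)) 0<q 1≤G 0<W H≤ near)

-- Stern-Brocot intervals around ξ

ℕ^-distrib-* : ∀ a b k → (a ℕ.* b) ℕ.^ k ≡ a ℕ.^ k ℕ.* b ℕ.^ k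
ℕ^-distrib-* a b zero    = refl
ℕ^-distrib-* a b (suc k) = trans (cong (a ℕ.* b ℕ.*_) (ℕ^-distrib-* a b k))
  (ℕ.[m*n]*[o*p]≡[m*o]*[n*p] a b (a ℕ.^ k) (b ℕ.^ k))

-- The fractions p/q below and above ξ, with the margin c/q² of bad
-- approximability, multiplied by q².
module Sides (ξ : ℝ) (c : ℚ) where
  Below Above : ℤ → ℕ → Set
  Below p q = Eventually λ m → ι p * ιₙ q + c ≤ ιₙ q * ιₙ q * seq ξ m
  Above p q = Eventually λ m → ιₙ q * ιₙ q * seq ξ m + c ≤ ι p * ιₙ q

module _ (ξ : ℝ) (cℝ : ℝ) (0<cℝ : 0ℝ <ℝ cℝ)
  (apart : ∀ (p : ℤ) (q : ℕ) .{{_ : NonZero q}} →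
    cℝ *ℝ fromℚ ((+ 1 ℚ./ q) ^ℚ 2) ≤ℝ ∣ ξ -ℝ fromℚ (p ℚ./ q) ∣ℝ) where

  private
    g = gap 0<cℝ
    0<g : 0ℚ < g
    0<g = gap-pos 0<cℝ

  margin : ℚ
  margin = ½ * g

  margin-pos : 0ℚ < margin
  margin-pos = *-pos 0<½ 0<g

  open Sides ξ margin

  private
    apart′ : ∀ p q .{{_ : NonZero q}} → ∀ ε → 0ℚ < ε →
      Eventually λ m → seq cℝ m * ((+ 1 ℚ./ q) ^ℚ 2) ≤ ∣ seq ξ m - p ℚ./ q ∣ + ε
    apart′ p q = un≤ (apart p q)

    scaled : ∀ (i P Q C x ε : ℚ) → i * Q ≡ 1ℚ → 0ℚ ≤ Q → g ≤ C →
      C * (i * (i * 1ℚ)) ≤ ∣ x - i * P ∣ + ε → g ≤ ∣ Q * Q * x - P * Q ∣ + Q * Q * ε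
    scaled i P Q C x ε iQ≡1 0≤Q g≤C h = ℚ.≤-trans g≤C (ℚ.≤-trans (ℚ.≤-reflexive eq₁)
      (ℚ.≤-trans (*-monoˡ (Q * Q) (*-nonneg 0≤Q 0≤Q) h) (ℚ.≤-reflexive eq₂)))
      where
      eq₁ : C ≡ Q * Q * (C * (i * (i * 1ℚ)))
      eq₁ = sym (trans (solve 3 (λ Q C i → Q :* Q :* (C :* (i :* (i :* con 1ℚ))) := C :* ((i :* Q) :* (i :* Q))) refl Q C i)
        (trans (cong (λ z → C * (z * z)) iQ≡1) (trans (cong (C *_) (ℚ.*-identityˡ 1ℚ)) (ℚ.*-identityʳ C))))
      eq₂ : Q * Q * (∣ x - i * P ∣ + ε) ≡ ∣ Q * Q * x - P * Q ∣ + Q * Q * ε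
      eq₂ = trans (ℚ.*-distribˡ-+ (Q * Q) (∣ x - i * P ∣) ε) (cong (_+ Q * Q * ε)
        (trans (cong (_* ∣ x - i * P ∣) (sym (ℚ.0≤p⇒∣p∣≡p (*-nonneg 0≤Q 0≤Q))))
          (trans (sym (ℚ.∣p*q∣≡∣p∣*∣q∣ (Q * Q) (x - i * P))) (cong ∣_∣
            (trans (solve 4 (λ Q x i P → Q :* Q :* (x :- i :* P) := Q :* Q :* x :- (i :* Q) :* (P :* Q)) refl Q x i P)
              (trans (cong (λ z → Q * Q * x - z * (P * Q)) iQ≡1) (cong (λ z → Q * Q * x - z) (ℚ.*-identityˡ (P * Q)))))))))

    /≡ : ∀ p q .{{_ : NonZero q}} → p ℚ./ q ≡ (+ 1 ℚ./ q) * ι p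
    /≡ p q = begin
      p ℚ./ q                                 ≡⟨ ℚ.*-identityʳ (p ℚ./ q) ⟨
      (p ℚ./ q) * 1ℚ                          ≡⟨ cong ((p ℚ./ q) *_) (sym (1/n*n q)) ⟩
      (p ℚ./ q) * ((+ 1 ℚ./ q) * ιₙ q)        ≡⟨ solve 3 (λ a b c → a :* (b :* c) := b :* (a :* c)) refl (p ℚ./ q) (+ 1 ℚ./ q) (ιₙ q) ⟩
      (+ 1 ℚ./ q) * ((p ℚ./ q) * ιₙ q)        ≡⟨ cong ((+ 1 ℚ./ q) *_) (/-* p q) ⟩
      (+ 1 ℚ./ q) * ι p                       ∎
      where open ≡-Reasoning

    -- With y = q² ξ - p q, |y| is eventually at least 3g/4 and y varies by at
    -- most g/4, so the sign of one term decides the side.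
    side′ : ∀ (P Q ε : ℚ) → Q * Q * ε ≡ ½ * (½ * g) →
      0ℚ ≤ Q → (Eventually λ m → g ≤ ∣ Q * Q * seq ξ m - P * Q ∣ + Q * Q * ε) →
      (∃ λ N → ∀ m n → N ℕ.≤ m → N ℕ.≤ n → ∣ seq ξ m - seq ξ n ∣ ≤ ε) →
      (Eventually λ m → P * Q + margin ≤ Q * Q * seq ξ m) ⊎ (Eventually λ m → Q * Q * seq ξ m + margin ≤ P * Q)
    side′ P Q ε QQε 0≤Q (N₁ , away) (N₂ , near) = [ (λ h → inj₁ (below h)) , (λ h → inj₂ (above h)) ]′ (ℚ.≤-total 0ℚ (y N))
      where
      N = N₁ ℕ.⊔ N₂
      y : ℕ → ℚ
      y m = Q * Q * seq ξ m - P * Q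
      away-N : g ≤ ∣ y N ∣ + ½ * (½ * g)
      away-N = subst (λ z → g ≤ ∣ y N ∣ + z) QQε (away N (ℕ.m≤m⊔n N₁ N₂))
      near-N : ∀ m → N ℕ.≤ m → Q * Q * ∣ seq ξ m - seq ξ N ∣ ≤ ½ * (½ * g)
      near-N m N≤m = subst (Q * Q * ∣ seq ξ m - seq ξ N ∣ ≤_) QQε (*-monoˡ (Q * Q) (*-nonneg 0≤Q 0≤Q)
        (near m N (ℕ.≤-trans (ℕ.m≤n⊔m N₁ N₂) N≤m) (ℕ.m≤n⊔m N₁ N₂)))
      near₁ : ∀ m → N ℕ.≤ m → Q * Q * (seq ξ m - seq ξ N) ≤ ½ * (½ * g)
      near₁ m N≤m = ℚ.≤-trans (*-monoˡ (Q * Q) (*-nonneg 0≤Q 0≤Q) (p≤∣p∣ (seq ξ m - seq ξ N))) (near-N m N≤m)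
      near₂ : ∀ m → N ℕ.≤ m → Q * Q * - (seq ξ m - seq ξ N) ≤ ½ * (½ * g)
      near₂ m N≤m = ℚ.≤-trans (*-monoˡ (Q * Q) (*-nonneg 0≤Q 0≤Q) (-p≤∣p∣ (seq ξ m - seq ξ N))) (near-N m N≤m)
      below : 0ℚ ≤ y N → Eventually λ m → P * Q + margin ≤ Q * Q * seq ξ m
      below 0≤y = N , λ m N≤m → ≤-by-difference
        ((y N + ½ * (½ * g) - g) + (½ * (½ * g) - Q * Q * - (seq ξ m - seq ξ N)))
        (+-nonneg (0≤difference (subst (λ z → g ≤ z + ½ * (½ * g)) (ℚ.0≤p⇒∣p∣≡p 0≤y) away-N)) (0≤difference (near₂ m N≤m)))
        (solve 5 (λ P Q g x z → Q :* Q :* x := (P :* Q :+ con ½ :* g) :+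
          ((Q :* Q :* z :- P :* Q :+ con ½ :* (con ½ :* g) :- g) :+ (con ½ :* (con ½ :* g) :- Q :* Q :* (:- (x :- z))))) refl
          P Q g (seq ξ m) (seq ξ N))
      above : y N ≤ 0ℚ → Eventually λ m → Q * Q * seq ξ m + margin ≤ P * Q
      above y≤0 = N , λ m N≤m → ≤-by-difference
        ((- y N + ½ * (½ * g) - g) + (½ * (½ * g) - Q * Q * (seq ξ m - seq ξ N)))
        (+-nonneg (0≤difference (subst (λ z → g ≤ z + ½ * (½ * g))
            (trans (sym (ℚ.∣-p∣≡∣p∣ (y N))) (ℚ.0≤p⇒∣p∣≡p (ℚ.neg-antimono-≤ y≤0))) away-N))
          (0≤difference (near₁ m N≤m)))
        (solve 5 (λ P Q g x z → P :* Q := (Q :* Q :* x :+ con ½ :* g) :+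
          ((:- (Q :* Q :* z :- P :* Q) :+ con ½ :* (con ½ :* g) :- g) :+ (con ½ :* (con ½ :* g) :- Q :* Q :* (x :- z)))) refl
          P Q g (seq ξ m) (seq ξ N))

  -- Bad approximability makes the order of ξ and p/q decidable, because it keeps them a known
  -- distance apart. The same ε = g/(4 q²) serves as tolerance in the hypothesis and as Cauchy
  -- precision of ξ.
  side : ∀ p q → 1 ℕ.≤ q → Below p q ⊎ Above p q
  side p q@(suc _) 1≤q = side′ (ι p) (ιₙ q) ε QQε (ιₙ-nonneg q)
    (eventually-map (λ m h → scaled (+ 1 ℚ./ q) (ι p) (ιₙ q) (seq cℝ m) (seq ξ m) ε (1/n*n q) (ιₙ-nonneg q)
        (subst (_≤ seq cℝ m) (ℚ.+-identityˡ g) (proj₁ h))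
        (subst (λ z → seq cℝ m * ((+ 1 ℚ./ q) ^ℚ 2) ≤ ∣ seq ξ m - z ∣ + ε) (/≡ p q) (proj₂ h)))
      (both (un< 0<cℝ) (apart′ p q ε 0<ε)))
    (cauchy ξ ε 0<ε)
    where
    0<Q : 0ℚ < ιₙ q
    0<Q = ιₙ-pos 1≤q
    solution = quotient (½ * (½ * g)) (*-pos 0<Q 0<Q) (*-pos 0<½ (*-pos 0<½ 0<g))
    ε = proj₁ solution
    0<ε : 0ℚ < ε
    0<ε = proj₁ (proj₂ solution)
    QQε : ιₙ q * ιₙ q * ε ≡ ½ * (½ * g)
    QQε = proj₂ (proj₂ solution)

record Bracket (ξ : ℝ) (c : ℚ) : Set where
  open Sides ξ c
  field
    p p′ : ℤ
    q q′ : ℕ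
    1≤q  : 1 ℕ.≤ q
    1≤q′ : 1 ℕ.≤ q′
    det  : p′ ℤ.* + q ℤ.- p ℤ.* + q′ ≡ + 1
    below : Below p q
    above : Above p′ q′

  -- This is the denominator of the mediant. It grows in every step and at most doubles, whichever
  -- end is replaced, whereas a single denominator may stay fixed for several steps.
  width : ℕ
  width = q ℕ.+ q′

module _ where
  open Bracket

  module Farey (ξ : ℝ) (c : ℚ) (0<c : 0ℚ < c)
    (side : ∀ p q → 1 ℕ.≤ q → Sides.Below ξ c p q ⊎ Sides.Above ξ c p q) where
    open Sides ξ c

    private
      State = Bracket ξ c

    bounded : ∃ λ B → Eventually λ m → ∣ seq ξ m ∣ ≤ ιₙ B
    bounded = proj₁ B , N , λ m N≤m → ℚ.≤-trans
      (∣p∣≤ (∣p-q∣-upper′ (proj₂ c₁ m N N≤m ℕ.≤-refl)) (neg-upper (proj₂ c₁ m N N≤m ℕ.≤-refl))) (proj₂ B)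
      where
      c₁ = cauchy ξ 1ℚ 0<1ℚ
      N = proj₁ c₁
      B = ceiling (∣ seq ξ N ∣ + 1ℚ)
      ∣p-q∣-upper′ : ∀ {a b} → ∣ a - b ∣ ≤ 1ℚ → a ≤ ∣ b ∣ + 1ℚ
      ∣p-q∣-upper′ {a} {b} h = ℚ.≤-trans (∣p-q∣-upper h) (ℚ.+-monoˡ-≤ 1ℚ (p≤∣p∣ b))
      neg-upper : ∀ {a b} → ∣ a - b ∣ ≤ 1ℚ → - a ≤ ∣ b ∣ + 1ℚ
      neg-upper {a} {b} h = ≤-by-difference ((∣ b ∣ - - b) + (a + 1ℚ - b))
        (+-nonneg (0≤difference (-p≤∣p∣ b)) (0≤difference (∣p-q∣-lower {a} {b} h)))
        (solve 3 (λ a b x → x :+ con 1ℚ := (:- a) :+ ((x :- :- b) :+ (a :+ con 1ℚ :- b))) refl a b (∣ b ∣))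

    private
      -- A walk through the integers upwards from one below ξ; `suc k` is the distance to an integer
      -- known to lie above.
      search : ∀ k a → Below a 1 → Above (a ℤ.+ + suc k) 1 → ∃ λ a → Below a 1 × Above (a ℤ.+ + 1) 1
      search zero    a below above = a , below , above
      search (suc k) a below above = [ (λ b → search k (a ℤ.+ + 1) b
          (subst (λ z → Above z 1) (sym (ℤ.+-assoc a (+ 1) (+ suc k))) above)) , (λ b → a , below , b) ]′
        (side (a ℤ.+ + 1) 1 ℕ.≤-refl)

      B = proj₁ bounded

      lower : Below (ℤ.- + suc B) 1
      lower = [ (λ b → b) , (λ ab → ⊥-elim (absurd (eventually-once (both ab (proj₂ bounded))))) ]′
        (side (ℤ.- + suc B) 1 ℕ.≤-refl)
        where
        absurd : ¬ (∃ λ m → ιₙ 1 * ιₙ 1 * seq ξ m + c ≤ ι (ℤ.- + suc B) * ιₙ 1 × ∣ seq ξ m ∣ ≤ ιₙ B)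
        absurd (m , h , bd) = ℚ.<-irrefl refl (ℚ.<-≤-trans
          (<-by-difference (c + 1ℚ + (ιₙ B - - x)) (ℚ.<-≤-trans 0<c (ℚ.≤-trans (p≤p+q 0≤1ℚ)
            (p≤p+q (0≤difference (ℚ.≤-trans (-p≤∣p∣ x) bd)))))
            (solve 3 (λ c x b → con 1ℚ :* con 1ℚ :* x :+ c := (:- (con 1ℚ :+ b)) :* con 1ℚ :+ (c :+ con 1ℚ :+ (b :- :- x))) refl c x (ιₙ B)))
          (subst₂ (λ o z → o * o * x + c ≤ z * o) ι-1 (trans (ι-neg (+ suc B)) (cong -_ (trans (ιₙ-+ 1 B) (cong (_+ ιₙ B) ι-1)))) h))
          where x = seq ξ m

      upper : Above (+ suc B) 1
      upper = [ (λ b → ⊥-elim (absurd (eventually-once (both b (proj₂ bounded))))) , (λ b → b) ]′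
        (side (+ suc B) 1 ℕ.≤-refl)
        where
        absurd : ¬ (∃ λ m → ι (+ suc B) * ιₙ 1 + c ≤ ιₙ 1 * ιₙ 1 * seq ξ m × ∣ seq ξ m ∣ ≤ ιₙ B)
        absurd (m , h , bd) = ℚ.<-irrefl refl (ℚ.<-≤-trans
          (<-by-difference (c + 1ℚ + (ιₙ B - x)) (ℚ.<-≤-trans 0<c (ℚ.≤-trans (p≤p+q 0≤1ℚ)
            (p≤p+q (0≤difference (ℚ.≤-trans (p≤∣p∣ x) bd)))))
            (solve 3 (λ c x b → (con 1ℚ :+ b) :* con 1ℚ :+ c := con 1ℚ :* con 1ℚ :* x :+ (c :+ con 1ℚ :+ (b :- x))) refl c x (ιₙ B)))
          (subst₂ (λ o z → z * o + c ≤ o * o * x) ι-1 (trans (ιₙ-+ 1 B) (cong (_+ ιₙ B) ι-1)) h))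
          where x = seq ξ m

      start : State
      start = record
        { p = proj₁ found ; p′ = proj₁ found ℤ.+ + 1 ; q = 1 ; q′ = 1 ; 1≤q = ℕ.≤-refl ; 1≤q′ = ℕ.≤-refl
        ; det = solveᶻ 1 (λ a → (a :+ᶻ conᶻ (+ 1)) :*ᶻ conᶻ (+ 1) :-ᶻ a :*ᶻ conᶻ (+ 1) :=ᶻ conᶻ (+ 1)) refl (proj₁ found)
        ; below = proj₁ (proj₂ found) ; above = proj₂ (proj₂ found) }
        where
        found = search (B ℕ.+ suc B) (ℤ.- + suc B) lower (subst (λ z → Above z 1) (sym eq) upper)
          where
          eq : ℤ.- + suc B ℤ.+ + (suc B ℕ.+ suc B) ≡ + suc B
          eq = trans (cong (λ z → ℤ.- + suc B ℤ.+ z) (ℤ.pos-+ (suc B) (suc B)))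
            (solveᶻ 1 (λ a → :⊖ᶻ a :+ᶻ (a :+ᶻ a) :=ᶻ a) refl (+ suc B))

      stepLeft : (b : State) → Below (p b ℤ.+ p′ b) (q b ℕ.+ q′ b) → State
      stepLeft b h = record
        { p = p b ℤ.+ p′ b ; p′ = p′ b ; q = q b ℕ.+ q′ b ; q′ = q′ b
        ; 1≤q = ℕ.≤-trans (1≤q b) (ℕ.m≤m+n (q b) (q′ b)) ; 1≤q′ = 1≤q′ b
        ; det = trans (cong (λ z → p′ b ℤ.* z ℤ.- (p b ℤ.+ p′ b) ℤ.* + q′ b) (ℤ.pos-+ (q b) (q′ b)))
            (trans (solveᶻ 4 (λ p r q s → r :*ᶻ (q :+ᶻ s) :-ᶻ (p :+ᶻ r) :*ᶻ s :=ᶻ r :*ᶻ q :-ᶻ p :*ᶻ s) refl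
              (p b) (p′ b) (+ q b) (+ q′ b)) (det b))
        ; below = h ; above = above b }

      stepRight : (b : State) → Above (p b ℤ.+ p′ b) (q b ℕ.+ q′ b) → State
      stepRight b h = record
        { p = p b ; p′ = p b ℤ.+ p′ b ; q = q b ; q′ = q b ℕ.+ q′ b
        ; 1≤q = 1≤q b ; 1≤q′ = ℕ.≤-trans (1≤q b) (ℕ.m≤m+n (q b) (q′ b))
        ; det = trans (cong (λ z → (p b ℤ.+ p′ b) ℤ.* + q b ℤ.- p b ℤ.* z) (ℤ.pos-+ (q b) (q′ b)))
            (trans (solveᶻ 4 (λ p r q s → (p :+ᶻ r) :*ᶻ q :-ᶻ p :*ᶻ (q :+ᶻ s) :=ᶻ r :*ᶻ q :-ᶻ p :*ᶻ s) refl
              (p b) (p′ b) (+ q b) (+ q′ b)) (det b))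
        ; below = below b ; above = h }

      -- When both numerators are odd, the mediant reached here has an even one.
      step : (b : State) → ∃ λ b′ → width b ℕ.< width b′ × width b′ ℕ.≤ 2 ℕ.* width b ×
        (p b′ ≡ p b ℤ.+ p′ b ⊎ p′ b′ ≡ p b ℤ.+ p′ b)
      step b = [ (λ h → stepLeft b h , grow (q′ b) (1≤q′ b) , double (q′ b) (ℕ.m≤n+m (q′ b) (q b)) , inj₁ refl)
               , (λ h → stepRight b h , subst (w ℕ.<_) (ℕ.+-comm w (q b)) (grow (q b) (1≤q b))
                 , subst (ℕ._≤ 2 ℕ.* w) (ℕ.+-comm w (q b)) (double (q b) (ℕ.m≤m+n (q b) (q′ b))) , inj₂ refl) ]′
        (side (p b ℤ.+ p′ b) w (ℕ.≤-trans (1≤q b) (ℕ.m≤m+n (q b) (q′ b))))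
        where
        w = q b ℕ.+ q′ b
        grow : ∀ r → 1 ℕ.≤ r → w ℕ.< w ℕ.+ r
        grow r 1≤r = subst (ℕ._≤ w ℕ.+ r) (ℕ.+-comm w 1) (ℕ.+-monoʳ-≤ w 1≤r)
        double : ∀ r → r ℕ.≤ w → w ℕ.+ r ℕ.≤ 2 ℕ.* w
        double r r≤w = ℕ.+-monoʳ-≤ w (subst (r ℕ.≤_) (sym (ℕ.+-identityʳ w)) r≤w)

    -- The walk stops at the first width w with T ≤ wⁿ. Before the last step wⁿ < T, and doubling w
    -- costs the factor 2ⁿ. The fuel `k` suffices because w increases in each step and w ≤ wⁿ.
    reach : ∀ n .{{_ : NonZero n}} T → 1 ℕ.≤ T → ∃ λ b → T ℕ.≤ width {ξ} {c} b ℕ.^ n × width b ℕ.^ n ℕ.≤ 2 ℕ.^ n ℕ.* T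
    reach n T 1≤T = go T start (ℕ.m≤n+m T (width start)) (ℕ.≤-trans (ℕ.≤-reflexive (sym (ℕ.*-identityʳ (2 ℕ.^ n)))) (ℕ.*-monoʳ-≤ (2 ℕ.^ n) 1≤T))
      where
      1≤w : (b : State) → 1 ℕ.≤ width b
      1≤w b = ℕ.≤-trans (1≤q b) (ℕ.m≤m+n (q b) (q′ b))
      w≤w^ : ∀ w → 1 ℕ.≤ w → ∀ n .{{_ : NonZero n}} → w ℕ.≤ w ℕ.^ n
      w≤w^ w 1≤w (suc n) = subst (ℕ._≤ w ℕ.^ suc n) (ℕ.*-identityʳ w) (ℕ.*-monoʳ-≤ w (1≤^ₙ n))
        where
        1≤^ₙ : ∀ n → 1 ℕ.≤ w ℕ.^ n
        1≤^ₙ zero    = ℕ.≤-refl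
        1≤^ₙ (suc n) = ℕ.*-mono-≤ 1≤w (1≤^ₙ n)
      go : ∀ k (b : State) → T ℕ.≤ width b ℕ.+ k → width b ℕ.^ n ℕ.≤ 2 ℕ.^ n ℕ.* T →
        ∃ λ b → T ℕ.≤ width {ξ} {c} b ℕ.^ n × width b ℕ.^ n ℕ.≤ 2 ℕ.^ n ℕ.* T
      go zero b T≤ ≤2T = b , ℕ.≤-trans (subst (T ℕ.≤_) (ℕ.+-identityʳ (width b)) T≤) (w≤w^ (width b) (1≤w b) n) , ≤2T
      go (suc k) b T≤ ≤2T = [ (λ T≤w → b , T≤w , ≤2T) , (λ w<T → continue (step b) w<T) ]′ (ℕ.≤-<-connex T (width b ℕ.^ n))
        where
        continue : (∃ λ b′ → width b ℕ.< width b′ × width b′ ℕ.≤ 2 ℕ.* width b ×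
          (p b′ ≡ p b ℤ.+ p′ b ⊎ p′ b′ ≡ p b ℤ.+ p′ b)) → width b ℕ.^ n ℕ.< T →
          ∃ λ b → T ℕ.≤ width {ξ} {c} b ℕ.^ n × width b ℕ.^ n ℕ.≤ 2 ℕ.^ n ℕ.* T
        continue (b′ , w< , w≤ , _) w<T = go k b′
          (ℕ.≤-trans T≤ (subst (ℕ._≤ width b′ ℕ.+ k) (sym (ℕ.+-suc (width b) k)) (ℕ.+-monoˡ-≤ k w<)))
          (ℕ.≤-trans (ℕ.^-monoˡ-≤ n w≤) (ℕ.≤-trans (ℕ.≤-reflexive (ℕ^-distrib-* 2 (width b) n))
            (ℕ.*-monoʳ-≤ (2 ℕ.^ n) (ℕ.<⇒≤ w<T))))

    private
      even⊎odd : ∀ i → + 2 ℤ.∣ i ⊎ + 2 ℤ.∣ i ℤ.- + 1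
      even⊎odd i = by-remainder (i ℤ.% + 2) (ℤ.n%d<d i (+ 2)) (ℤ.a≡a%n+[a/n]*n i (+ 2))
        where
        by-remainder : ∀ r → r ℕ.< 2 → i ≡ + r ℤ.+ (i ℤ./ + 2) ℤ.* + 2 → + 2 ℤ.∣ i ⊎ + 2 ℤ.∣ i ℤ.- + 1
        by-remainder 0 _ eq = inj₁ (divides (i ℤ./ + 2) (trans eq (ℤ.+-identityˡ _)))
        by-remainder 1 _ eq = inj₂ (divides (i ℤ./ + 2) (trans (cong (ℤ._- + 1) eq)
          (solveᶻ 1 (λ a → (conᶻ (+ 1) :+ᶻ a) :-ᶻ conᶻ (+ 1) :=ᶻ a) refl ((i ℤ./ + 2) ℤ.* + 2))))
        by-remainder (suc (suc r)) (ℕ.s≤s (ℕ.s≤s ())) _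

      odd+odd : ∀ i j → + 2 ℤ.∣ i ℤ.- + 1 → + 2 ℤ.∣ j ℤ.- + 1 → + 2 ℤ.∣ i ℤ.+ j
      odd+odd i j 2∣i 2∣j = subst (+ 2 ℤ.∣_)
        (solveᶻ 2 (λ i j → (i :-ᶻ conᶻ (+ 1)) :+ᶻ (j :-ᶻ conᶻ (+ 1)) :+ᶻ conᶻ (+ 2) :=ᶻ i :+ᶻ j) refl i j)
        (ℤ.∣m∣n⇒∣m+n (ℤ.∣m∣n⇒∣m+n 2∣i 2∣j) ℤ.∣-refl)

    -- If both numerators are odd, their sum is even and becomes a numerator after one more step.
    -- This step costs a second factor 2ⁿ, hence 4ⁿ.
    reach-even : ∀ n .{{_ : NonZero n}} T → 1 ℕ.≤ T → ∃ λ b →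
      (+ 2 ℤ.∣ p {ξ} {c} b ⊎ + 2 ℤ.∣ p′ b) × T ℕ.≤ width b ℕ.^ n × width b ℕ.^ n ℕ.≤ 4 ℕ.^ n ℕ.* T
    reach-even n T 1≤T = choose (even⊎odd (p b)) (even⊎odd (p′ b))
      where
      reached = reach n T 1≤T
      b = proj₁ reached
      T≤ = proj₁ (proj₂ reached)
      ≤2T = proj₂ (proj₂ reached)
      4^ : 4 ℕ.^ n ≡ 2 ℕ.^ n ℕ.* 2 ℕ.^ n
      4^ = ℕ^-distrib-* 2 2 n
      ≤4T : width b ℕ.^ n ℕ.≤ 4 ℕ.^ n ℕ.* T
      ≤4T = ℕ.≤-trans ≤2T (ℕ.*-monoˡ-≤ T (ℕ.^-monoˡ-≤ n {2} {4} (ℕ.s≤s (ℕ.s≤s ℕ.z≤n))))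
      choose : + 2 ℤ.∣ p b ⊎ + 2 ℤ.∣ p b ℤ.- + 1 → + 2 ℤ.∣ p′ b ⊎ + 2 ℤ.∣ p′ b ℤ.- + 1 →
        ∃ λ b → (+ 2 ℤ.∣ p {ξ} {c} b ⊎ + 2 ℤ.∣ p′ b) × T ℕ.≤ width b ℕ.^ n × width b ℕ.^ n ℕ.≤ 4 ℕ.^ n ℕ.* T
      choose (inj₁ e) _ = b , inj₁ e , T≤ , ≤4T
      choose (inj₂ _) (inj₁ e) = b , inj₂ e , T≤ , ≤4T
      choose (inj₂ o) (inj₂ o′) = next (step b)
        where
        next : (∃ λ b′ → width b ℕ.< width b′ × width b′ ℕ.≤ 2 ℕ.* width b ×
          (p b′ ≡ p b ℤ.+ p′ b ⊎ p′ b′ ≡ p b ℤ.+ p′ b)) →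
          ∃ λ b → (+ 2 ℤ.∣ p {ξ} {c} b ⊎ + 2 ℤ.∣ p′ b) × T ℕ.≤ width b ℕ.^ n × width b ℕ.^ n ℕ.≤ 4 ℕ.^ n ℕ.* T
        next (b′ , w< , w≤ , mediant) = b′ ,
          [ (λ eq → inj₁ (subst (+ 2 ℤ.∣_) (sym eq) (odd+odd (p b) (p′ b) o o′)))
          , (λ eq → inj₂ (subst (+ 2 ℤ.∣_) (sym eq) (odd+odd (p b) (p′ b) o o′))) ]′ mediant ,
          ℕ.≤-trans T≤ (ℕ.^-monoˡ-≤ n (ℕ.<⇒≤ w<)) ,
          ℕ.≤-trans (ℕ.^-monoˡ-≤ n w≤) (ℕ.≤-trans (ℕ.≤-reflexive (ℕ^-distrib-* 2 (width b) n))
            (ℕ.≤-trans (ℕ.*-monoʳ-≤ (2 ℕ.^ n) ≤2T) (ℕ.≤-reflexive (trans (sym (ℕ.*-assoc (2 ℕ.^ n) (2 ℕ.^ n) T))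
              (cong (ℕ._* T) (sym 4^))))))

-- Real zeros by bisection

evalq : ℤ[T] → ℚ → ℚ
evalq []      t = 0ℚ
evalq (a ∷ P) t = ι a + t * evalq P t

evalᵍ-evalq : ∀ P t → evalᵍ P ⌜ t ⌝ ≡ ⌜ evalq P t ⌝
evalᵍ-evalq []      t = refl
evalᵍ-evalq (a ∷ P) t = trans (cong (λ w → ⌜ ι a ⌝ +ᵍ ⌜ t ⌝ *ᵍ w) (evalᵍ-evalq P t))
  (trans (cong (⌜ ι a ⌝ +ᵍ_) (sym (⌜⌝-* t (evalq P t)))) (sym (⌜⌝-+ (ι a) (t * evalq P t))))

evalᵍ-horner : ∀ P z → evalᵍ P z ≡ horner (map ι P) z
evalᵍ-horner []      z = refl
evalᵍ-horner (a ∷ P) z = cong (λ w → ⌜ ι a ⌝ +ᵍ z *ᵍ w) (evalᵍ-horner P z)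

coefficients≤height : ∀ P → All (λ e → ∣ e ∣ ≤ ιₙ (polyHeight P)) (map ι P)
coefficients≤height []      = []
coefficients≤height (a ∷ P) =
  ℚ.≤-trans (ℚ.≤-reflexive (ι-∣∣ a)) (ιₙ-mono (ℕ.m≤m⊔n ℤ.∣ a ∣ (polyHeight P))) ∷
  All.map (λ h → ℚ.≤-trans h (ιₙ-mono (ℕ.m≤n⊔m ℤ.∣ a ∣ (polyHeight P)))) (coefficients≤height P)

evalq-lipschitz : ∀ P ρ → 0ℚ ≤ ρ → ∃ λ L → 0ℚ ≤ L × (∀ s t → ∣ s ∣ ≤ ρ → ∣ t ∣ ≤ ρ →
  ∣ evalq P s - evalq P t ∣ ≤ L * ∣ s - t ∣)
evalq-lipschitz P ρ 0≤ρ = L , hornerLipschitz-nonneg S ρ 0≤S 0≤ρ (length (map ι P)) , bound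
  where
  S = ιₙ (polyHeight P)
  0≤S : 0ℚ ≤ S
  0≤S = ιₙ-nonneg (polyHeight P)
  L = hornerLipschitz S ρ (length (map ι P))
  norm-⌜⌝ : ∀ a b → ‖ ⌜ a ⌝ -ᵍ ⌜ b ⌝ ‖ ≡ ∣ a - b ∣
  norm-⌜⌝ a b = ℚ.+-identityʳ ∣ a - b ∣
  bound : ∀ s t → ∣ s ∣ ≤ ρ → ∣ t ∣ ≤ ρ → ∣ evalq P s - evalq P t ∣ ≤ L * ∣ s - t ∣
  bound s t s≤ t≤ = subst₂ _≤_
    (trans (cong₂ (λ z w → ‖ z -ᵍ w ‖) (hornerValue s) (hornerValue t)) (norm-⌜⌝ (evalq P s) (evalq P t)))
    (cong (L *_) (norm-⌜⌝ s t))
    (horner-lipschitz S ρ 0≤S 0≤ρ {es = map ι P} (coefficients≤height P) {⌜ s ⌝} {⌜ t ⌝}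
      (subst (_≤ ρ) (sym (‖⌜⌝‖ s)) s≤) (subst (_≤ ρ) (sym (‖⌜⌝‖ t)) t≤))
    where
    hornerValue : ∀ s → horner (map ι P) ⌜ s ⌝ ≡ ⌜ evalq P s ⌝
    hornerValue s = trans (sym (evalᵍ-horner P ⌜ s ⌝)) (evalᵍ-evalq P s)

module Bisection (P : ℤ[T]) (a b : ℚ) (Pa≤0 : evalq P a ≤ 0ℚ) (0≤Pb : 0ℚ ≤ evalq P b) where

  -- `lo` is the end with P ≤ 0, not the smaller end, since the order of a and b is left open. Hence
  -- the position is recorded through common upper and lower bounds of a and b.
  record Interval : Set where
    field
      lo hi : ℚ
      lo≤0  : evalq P lo ≤ 0ℚ
      0≤hi  : 0ℚ ≤ evalq P hi
      upper : ∀ c → a ≤ c → b ≤ c → lo ≤ c × hi ≤ c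
      lower : ∀ c → c ≤ a → c ≤ b → c ≤ lo × c ≤ hi
    size : ℚ
    size = ∣ hi - lo ∣
  open Interval

  private
    mid : Interval → ℚ
    mid J = ½ * lo J + ½ * hi J

    mid≤ : ∀ {x y c} → x ≤ c → y ≤ c → ½ * x + ½ * y ≤ c
    mid≤ {x} {y} {c} h₁ h₂ = subst (½ * x + ½ * y ≤_) (½+½ c)
      (ℚ.+-mono-≤ (*-monoˡ ½ (ℚ.<⇒≤ 0<½) h₁) (*-monoˡ ½ (ℚ.<⇒≤ 0<½) h₂))

    mid≥ : ∀ {x y c} → c ≤ x → c ≤ y → c ≤ ½ * x + ½ * y
    mid≥ {x} {y} {c} h₁ h₂ = subst (_≤ ½ * x + ½ * y) (½+½ c)
      (ℚ.+-mono-≤ (*-monoˡ ½ (ℚ.<⇒≤ 0<½) h₁) (*-monoˡ ½ (ℚ.<⇒≤ 0<½) h₂))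

    ∣½*∣ : ∀ x → ∣ ½ * x ∣ ≡ ½ * ∣ x ∣
    ∣½*∣ x = trans (ℚ.∣p*q∣≡∣p∣*∣q∣ ½ x) (cong (_* ∣ x ∣) (ℚ.0≤p⇒∣p∣≡p (ℚ.<⇒≤ 0<½)))

  bisect : (J : Interval) → ∃ λ K → size K ≡ ½ * size J × ∣ lo K - lo J ∣ ≤ ½ * size J
  bisect J = [ keepLo , keepHi ]′ (ℚ.≤-total 0ℚ (evalq P (mid J)))
    where
    keepLo : 0ℚ ≤ evalq P (mid J) → ∃ λ K → size K ≡ ½ * size J × ∣ lo K - lo J ∣ ≤ ½ * size J
    keepLo 0≤ = record
      { lo = lo J ; hi = mid J ; lo≤0 = lo≤0 J ; 0≤hi = 0≤
      ; upper = λ c a≤ b≤ → proj₁ (upper J c a≤ b≤) , mid≤ (proj₁ (upper J c a≤ b≤)) (proj₂ (upper J c a≤ b≤))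
      ; lower = λ c ≤a ≤b → proj₁ (lower J c ≤a ≤b) , mid≥ (proj₁ (lower J c ≤a ≤b)) (proj₂ (lower J c ≤a ≤b)) } ,
      trans (cong ∣_∣ (solve 2 (λ l h → (con ½ :* l :+ con ½ :* h) :- l := con ½ :* (h :- l)) refl (lo J) (hi J)))
        (∣½*∣ (hi J - lo J)) ,
      subst (_≤ ½ * size J) (cong ∣_∣ (sym (ℚ.+-inverseʳ (lo J)))) (*-nonneg (ℚ.<⇒≤ 0<½) (ℚ.0≤∣p∣ (hi J - lo J)))
    keepHi : evalq P (mid J) ≤ 0ℚ → ∃ λ K → size K ≡ ½ * size J × ∣ lo K - lo J ∣ ≤ ½ * size J
    keepHi ≤0 = record
      { lo = mid J ; hi = hi J ; lo≤0 = ≤0 ; 0≤hi = 0≤hi J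
      ; upper = λ c a≤ b≤ → mid≤ (proj₁ (upper J c a≤ b≤)) (proj₂ (upper J c a≤ b≤)) , proj₂ (upper J c a≤ b≤)
      ; lower = λ c ≤a ≤b → mid≥ (proj₁ (lower J c ≤a ≤b)) (proj₂ (lower J c ≤a ≤b)) , proj₂ (lower J c ≤a ≤b) } ,
      trans (cong ∣_∣ (solve 2 (λ l h → h :- (con ½ :* l :+ con ½ :* h) := con ½ :* (h :- l)) refl (lo J) (hi J)))
        (∣½*∣ (hi J - lo J)) ,
      ℚ.≤-reflexive (trans (cong ∣_∣ (solve 2 (λ l h → (con ½ :* l :+ con ½ :* h) :- l := con ½ :* (h :- l)) refl (lo J) (hi J)))
        (∣½*∣ (hi J - lo J)))

  interval : ℕ → Interval
  interval zero    = record { lo = a ; hi = b ; lo≤0 = Pa≤0 ; 0≤hi = 0≤Pb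
    ; upper = λ c a≤ b≤ → a≤ , b≤ ; lower = λ c ≤a ≤b → ≤a , ≤b }
  interval (suc k) = proj₁ (bisect (interval k))

  private
    l : ℕ → ℚ
    l k = lo (interval k)

    D : ℕ → ℚ
    D k = size (interval k)

    D-nonneg : ∀ k → 0ℚ ≤ D k
    D-nonneg k = ℚ.0≤∣p∣ (hi (interval k) - lo (interval k))

    D-half : ∀ k → D (suc k) ≡ ½ * D k
    D-half k = proj₁ (proj₂ (bisect (interval k)))

    l-step : ∀ k → ∣ l (suc k) - l k ∣ ≤ ½ * D k
    l-step k = proj₂ (proj₂ (bisect (interval k)))

    -- Each move of `l` is at most the half by which the size shrinks, so carrying the remaining
    -- size along in the sum makes the induction close.
    drift : ∀ N j → ∣ l (N ℕ.+ j) - l N ∣ + D (N ℕ.+ j) ≤ D N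
    drift N zero = subst (λ k → ∣ l k - l N ∣ + D k ≤ D N) (sym (ℕ.+-identityʳ N))
      (ℚ.≤-reflexive (trans (cong (_+ D N) (cong ∣_∣ (ℚ.+-inverseʳ (l N)))) (ℚ.+-identityˡ (D N))))
    drift N (suc j) = subst (λ k → ∣ l k - l N ∣ + D k ≤ D N) (sym (ℕ.+-suc N j))
      (ℚ.≤-trans (ℚ.+-mono-≤ triangle (ℚ.≤-reflexive (D-half k)))
        (ℚ.≤-trans (ℚ.≤-reflexive (trans (ℚ.+-assoc ∣ l k - l N ∣ (½ * D k) (½ * D k))
          (cong (λ z → ∣ l k - l N ∣ + z) (½+½ (D k))))) (drift N j)))
      where
      k = N ℕ.+ j
      telescope : ∀ x y z → (y - z) + (x - y) ≡ x - z
      telescope = solve 3 (λ x y z → (y :- z) :+ (x :- y) := x :- z) refl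
      triangle : ∣ l (suc k) - l N ∣ ≤ ∣ l k - l N ∣ + ½ * D k
      triangle = subst (_≤ ∣ l k - l N ∣ + ½ * D k)
        (cong ∣_∣ (telescope (l (suc k)) (l k) (l N)))
        (∣p+q∣≤ (l k - l N) (l (suc k) - l k) {∣ l k - l N ∣} {½ * D k} ℚ.≤-refl (l-step k))

    -- Halving compensates the growth from k + 1 to k + 2. Linear decay is the form that `1/n→0`
    -- turns into a modulus of convergence.
    D-decay : ∀ k → D k * ιₙ (suc k) ≤ D 0
    D-decay zero    = ℚ.≤-reflexive (trans (cong (D 0 *_) ι-1) (ℚ.*-identityʳ (D 0)))
    D-decay (suc k) = ℚ.≤-trans
      (≤-by-difference (½ * D k * ιₙ k) (*-nonneg (*-nonneg (ℚ.<⇒≤ 0<½) (D-nonneg k)) (ιₙ-nonneg k)) eq) (D-decay k)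
      where
      open ≡-Reasoning
      eq : D k * ιₙ (suc k) ≡ D (suc k) * ιₙ (suc (suc k)) + ½ * D k * ιₙ k
      eq = begin
        D k * ιₙ (suc k)
          ≡⟨ cong (D k *_) (trans (ιₙ-+ 1 k) (cong (_+ ιₙ k) ι-1)) ⟩
        D k * (1ℚ + ιₙ k)
          ≡⟨ solve 2 (λ d k → d :* (con 1ℚ :+ k) := con ½ :* d :* ((con 1ℚ :+ con 1ℚ) :+ k) :+ con ½ :* d :* k) refl (D k) (ιₙ k) ⟩
        ½ * D k * ((1ℚ + 1ℚ) + ιₙ k) + ½ * D k * ιₙ k
          ≡⟨ cong₂ (λ x y → x * y + ½ * D k * ιₙ k) (sym (D-half k))
            (trans (ℚ.+-assoc 1ℚ 1ℚ (ιₙ k)) (sym (trans (ιₙ-+ 1 (suc k)) (cong₂ _+_ ι-1 (trans (ιₙ-+ 1 k) (cong (_+ ιₙ k) ι-1)))))) ⟩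
        D (suc k) * ιₙ (suc (suc k)) + ½ * D k * ιₙ k ∎

    D→0 : ∀ ε → 0ℚ < ε → Eventually λ k → D k ≤ ε
    D→0 ε 0<ε = eventually-map (λ k 1/k≤η → *-cancelʳ (ιₙ (suc k)) (ιₙ-pos (ℕ.s≤s ℕ.z≤n)) (ℚ.≤-trans (D-decay k)
        (ℚ.≤-trans (p≤p+q {D 0} {1ℚ} 0≤1ℚ) (bound k 1/k≤η))))
      (1/n→0 η 0<η)
      where
      0<D+1 : 0ℚ < D 0 + 1ℚ
      0<D+1 = ℚ.+-mono-≤-< (D-nonneg 0) 0<1ℚ
      η = proj₁ (quotient ε 0<D+1 0<ε)
      0<η : 0ℚ < η
      0<η = proj₁ (proj₂ (quotient ε 0<D+1 0<ε))
      Dη≡ε : (D 0 + 1ℚ) * η ≡ ε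
      Dη≡ε = proj₂ (proj₂ (quotient ε 0<D+1 0<ε))
      bound : ∀ k → + 1 ℚ./ suc k ≤ η → D 0 + 1ℚ ≤ ε * ιₙ (suc k)
      bound k h = ℚ.≤-trans
        (ℚ.≤-reflexive (sym (trans (cong ((D 0 + 1ℚ) *_) (1/n*n (suc k))) (ℚ.*-identityʳ (D 0 + 1ℚ)))))
        (ℚ.≤-trans (*-monoˡ (D 0 + 1ℚ) (ℚ.<⇒≤ 0<D+1) (*-monoʳ (ιₙ (suc k)) (ιₙ-nonneg (suc k)) h))
          (ℚ.≤-reflexive (trans (sym (ℚ.*-assoc (D 0 + 1ℚ) η (ιₙ (suc k)))) (cong (_* ιₙ (suc k)) Dη≡ε))))

  bisection-cauchy : IsCauchy l
  bisection-cauchy ε 0<ε = N , λ m n N≤m N≤n → subst₂ _≤_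
      (cong ∣_∣ (solve 3 (λ x y z → (x :- z) :+ (:- (y :- z)) := x :- y) refl (l m) (l n) (l N)))
      (½+½ ε)
      (∣p+q∣≤ (l m - l N) (- (l n - l N)) (near m N≤m)
        (subst (_≤ ½ * ε) (sym (ℚ.∣-p∣≡∣p∣ (l n - l N))) (near n N≤n)))
    where
    N = proj₁ (D→0 (½ * ε) (*-pos 0<½ 0<ε))
    near : ∀ m → N ℕ.≤ m → ∣ l m - l N ∣ ≤ ½ * ε
    near m N≤m = ℚ.≤-trans (ℚ.≤-trans (p≤p+q (D-nonneg m))
      (subst (λ k → ∣ l k - l N ∣ + D k ≤ D N) (ℕ.m+[n∸m]≡n N≤m) (drift N (m ℕ.∸ N))))
      (proj₂ (D→0 (½ * ε) (*-pos 0<½ 0<ε)) N ℕ.≤-refl)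

  zeroPoint : ℝ
  zeroPoint = mkℝ l bisection-cauchy

  zeroPoint-upper : ∀ c → a ≤ c → b ≤ c → ∀ m → seq zeroPoint m ≤ c
  zeroPoint-upper c a≤ b≤ m = proj₁ (upper (interval m) c a≤ b≤)

  -- The values at the two ends have opposite signs, so |P(lo)| ≤ |P(hi) - P(lo)|, which the
  -- Lipschitz bound makes as small as the interval.
  zeroPoint-zero : eval P (fromℝ zeroPoint) ≈ℂ 0ℂ
  zeroPoint-zero = small⇒≈0 (eval P (fromℝ zeroPoint)) λ ε 0<ε →
    eventually-map (λ m → subst (_≤ ε) (sym (norm-value m))) (P→0 ε 0<ε)
    where
    ρ = ∣ a ∣ + ∣ b ∣
    lip = evalq-lipschitz P ρ (+-nonneg (ℚ.0≤∣p∣ a) (ℚ.0≤∣p∣ b))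
    L = proj₁ lip
    0≤L : 0ℚ ≤ L
    0≤L = proj₁ (proj₂ lip)
    norm-value : ∀ m → ‖ at (eval P (fromℝ zeroPoint)) m ‖ ≡ ∣ evalq P (l m) ∣
    norm-value m = trans (cong ‖_‖ (trans (at-eval P (fromℝ zeroPoint) m) (evalᵍ-evalq P (l m)))) (‖⌜⌝‖ (evalq P (l m)))
    lo-bound : ∀ x → -_ ρ ≤ x → x ≤ ρ → ∣ x ∣ ≤ ρ
    lo-bound x ≤x x≤ = ∣p∣≤ x≤ (≤-by-difference (x - - ρ) (0≤difference ≤x)
      (solve 2 (λ x r → r := (:- x) :+ (x :- :- r)) refl x ρ))
    -ρ≤a : - ρ ≤ a
    -ρ≤a = ≤-by-difference ((∣ a ∣ - - a) + ∣ b ∣) (+-nonneg (0≤difference (-p≤∣p∣ a)) (ℚ.0≤∣p∣ b))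
      (solve 3 (λ a x y → a := (:- (x :+ y)) :+ ((x :- :- a) :+ y)) refl a (∣ a ∣) (∣ b ∣))
    -ρ≤b : - ρ ≤ b
    -ρ≤b = ≤-by-difference ((∣ b ∣ - - b) + ∣ a ∣) (+-nonneg (0≤difference (-p≤∣p∣ b)) (ℚ.0≤∣p∣ a))
      (solve 3 (λ b x y → b := (:- (x :+ y)) :+ ((y :- :- b) :+ x)) refl b (∣ a ∣) (∣ b ∣))
    a≤ρ : a ≤ ρ
    a≤ρ = ℚ.≤-trans (p≤∣p∣ a) (p≤p+q (ℚ.0≤∣p∣ b))
    b≤ρ : b ≤ ρ
    b≤ρ = ℚ.≤-trans (p≤∣p∣ b) (q≤p+q (ℚ.0≤∣p∣ a))
    P≤ : ∀ m → ∣ evalq P (l m) ∣ ≤ L * D m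
    P≤ m = ℚ.≤-trans (∣p∣≤ (ℚ.≤-trans (lo≤0 J) (ℚ.0≤∣p∣ (evalq P (hi J) - evalq P (lo J))))
        (ℚ.≤-trans (≤-by-difference (evalq P (hi J)) (0≤hi J) (ℚ.+-comm (evalq P (hi J)) (- evalq P (lo J))))
          (p≤∣p∣ (evalq P (hi J) - evalq P (lo J)))))
      (proj₂ (proj₂ lip) (hi J) (lo J)
        (lo-bound (hi J) (proj₂ (lower J (- ρ) -ρ≤a -ρ≤b)) (proj₂ (upper J ρ a≤ρ b≤ρ)))
        (lo-bound (lo J) (proj₁ (lower J (- ρ) -ρ≤a -ρ≤b)) (proj₁ (upper J ρ a≤ρ b≤ρ))))
      where J = interval m
    P→0 : ∀ ε → 0ℚ < ε → Eventually λ m → ∣ evalq P (l m) ∣ ≤ ε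
    P→0 ε 0<ε = eventually-map (λ m D≤ → ℚ.≤-trans (P≤ m) (ℚ.≤-trans
        (ℚ.≤-trans (*-monoˡ L 0≤L D≤) (*-monoʳ η (ℚ.<⇒≤ 0<η) (p≤p+q {L} {1ℚ} 0≤1ℚ))) (ℚ.≤-reflexive Lη≡ε)))
      (D→0 η 0<η)
      where
      0<L+1 : 0ℚ < L + 1ℚ
      0<L+1 = ℚ.+-mono-≤-< 0≤L 0<1ℚ
      η = proj₁ (quotient ε 0<L+1 0<ε)
      0<η : 0ℚ < η
      0<η = proj₁ (proj₂ (quotient ε 0<L+1 0<ε))
      Lη≡ε : (L + 1ℚ) * η ≡ ε
      Lη≡ε = proj₂ (proj₂ (quotient ε 0<L+1 0<ε))

-- Two unimodular approximations of ξ

-- (p, q) is the end of the bracket with even numerator, and the sign `s` remembers whether it lies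
-- below or above ξ. `C` and `R` are the same for all targets `T`, so all later constants depend on
-- them and `n` only.
record Frame (ξ : ℝ) (C R n T : ℕ) : Set where
  field
    p p′ s  : ℤ
    q q′    : ℕ
    1≤q     : 1 ℕ.≤ q
    1≤q′    : 1 ℕ.≤ q′
    det     : + q ℤ.* p′ ℤ.- + q′ ℤ.* p ≡ s
    unit    : s ≡ + 1 ⊎ s ≡ -[1+ 0 ]
    even    : + 2 ℤ.∣ p
    q≤Cq′   : q ℕ.≤ C ℕ.* q′
    q′≤Cq   : q′ ℕ.≤ C ℕ.* q
    near    : Eventually λ m → ∣ ιₙ q * ιₙ q * seq ξ m - ι p * ιₙ q ∣ ≤ ιₙ C
    ∣p∣≤Rq  : ∣ ι p ∣ ≤ ιₙ R * ιₙ q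
    ∣p′∣≤Rq′ : ∣ ι p′ ∣ ≤ ιₙ R * ιₙ q′
    T≤      : T ℕ.≤ (suc C ℕ.* q) ℕ.^ n
    qⁿ≤     : q ℕ.^ n ℕ.≤ 4 ℕ.^ n ℕ.* T

module _ {ξ : ℝ} {c : ℚ} (0<c : 0ℚ < c) (C B : ℕ) (1≤cC : 1ℚ ≤ c * ιₙ C)
  (bounded : Eventually λ m → ∣ seq ξ m ∣ ≤ ιₙ B) (b : Bracket ξ c) where

  private
    open Bracket b using (below; above; width) renaming
      (p to pL; p′ to pR; q to qL; q′ to qR; 1≤q to 1≤qL; 1≤q′ to 1≤qR; det to detLR)

    P P′ Q Q′ : ℚ
    P  = ι pL
    P′ = ι pR
    Q  = ιₙ qL
    Q′ = ιₙ qR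

    0<Q : 0ℚ < Q
    0<Q = ιₙ-pos 1≤qL

    0<Q′ : 0ℚ < Q′
    0<Q′ = ιₙ-pos 1≤qR

    P′Q-PQ′≡1 : P′ * Q - P * Q′ ≡ 1ℚ
    P′Q-PQ′≡1 = trans (sym (trans (ι-+ (pR ℤ.* + qL) (ℤ.- (pL ℤ.* + qR))) (cong₂ _+_ (ι-* pR (+ qL))
      (trans (ι-neg (pL ℤ.* + qR)) (cong -_ (ι-* pL (+ qR))))))) (trans (cong ι detLR) ι-1)

    both-sides : Eventually λ m → P * Q + c ≤ Q * Q * seq ξ m × Q′ * Q′ * seq ξ m + c ≤ P′ * Q′
    both-sides = both below above

    -- Subtracting the two margins after multiplication by q′² and q².
    gap-bound : c * (Q * Q + Q′ * Q′) ≤ Q * Q′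
    gap-bound = conclude (eventually-once both-sides)
      where
      conclude : (∃ λ m → P * Q + c ≤ Q * Q * seq ξ m × Q′ * Q′ * seq ξ m + c ≤ P′ * Q′) → c * (Q * Q + Q′ * Q′) ≤ Q * Q′
      conclude (m , h , h′) = ≤-by-difference
        (Q′ * Q′ * (Q * Q * x - (P * Q + c)) + Q * Q * (P′ * Q′ - (Q′ * Q′ * x + c)))
        (+-nonneg (*-nonneg (*-nonneg (ℚ.<⇒≤ 0<Q′) (ℚ.<⇒≤ 0<Q′)) (0≤difference h))
          (*-nonneg (*-nonneg (ℚ.<⇒≤ 0<Q) (ℚ.<⇒≤ 0<Q)) (0≤difference h′)))
        (trans (sym (ℚ.*-identityˡ (Q * Q′))) (trans (cong (_* (Q * Q′)) (sym P′Q-PQ′≡1))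
          (solve 6 (λ c Q S P R x → (R :* Q :- P :* S) :* (Q :* S) := c :* (Q :* Q :+ S :* S) :+
            (S :* S :* (Q :* Q :* x :- (P :* Q :+ c)) :+ Q :* Q :* (R :* S :- (S :* S :* x :+ c)))) refl c Q Q′ P P′ x)))
        where x = seq ξ m

    comparable : ∀ X Y → 0ℚ < X → 0ℚ < Y → c * (X * X) ≤ X * Y → X ≤ ιₙ C * Y
    comparable X Y 0<X 0<Y h = ℚ.≤-trans
      (subst (_≤ c * ιₙ C * X) (ℚ.*-identityˡ X) (*-monoʳ X (ℚ.<⇒≤ 0<X) 1≤cC))
      (ℚ.≤-trans (ℚ.≤-reflexive (solve 3 (λ c C X → c :* C :* X := C :* (c :* X)) refl c (ιₙ C) X))
        (*-monoˡ (ιₙ C) (ιₙ-nonneg C) (*-cancelˡ X 0<X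
          (subst (_≤ X * Y) (solve 2 (λ c X → c :* (X :* X) := X :* (c :* X)) refl c X) h))))

    Q≤CQ′ : Q ≤ ιₙ C * Q′
    Q≤CQ′ = comparable Q Q′ 0<Q 0<Q′ (ℚ.≤-trans (*-monoˡ c (ℚ.<⇒≤ 0<c)
      (p≤p+q (*-nonneg (ℚ.<⇒≤ 0<Q′) (ℚ.<⇒≤ 0<Q′)))) gap-bound)

    Q′≤CQ : Q′ ≤ ιₙ C * Q
    Q′≤CQ = comparable Q′ Q 0<Q′ 0<Q (ℚ.≤-trans (*-monoˡ c (ℚ.<⇒≤ 0<c)
      (q≤p+q (*-nonneg (ℚ.<⇒≤ 0<Q) (ℚ.<⇒≤ 0<Q)))) (ℚ.≤-trans gap-bound (ℚ.≤-reflexive (ℚ.*-comm Q Q′))))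

    ιₙ-cancel : ∀ {a b} → ιₙ a ≤ ιₙ C * ιₙ b → a ℕ.≤ C ℕ.* b
    ιₙ-cancel {a} {b} h = ℤ.drop‿+≤+ (ι-cancel-≤ (subst (ιₙ a ≤_) (sym (ιₙ-* C b)) h))

    -- As ξ lies below p′/q′ and the determinant is 1, q² (ξ - p/q) ≤ q² (p′/q′ - p/q) = q/q′ ≤ C.
    nearL : Eventually λ m → ∣ Q * Q * seq ξ m - P * Q ∣ ≤ ιₙ C
    nearL = eventually-map bound both-sides
      where
      bound : ∀ m → P * Q + c ≤ Q * Q * seq ξ m × Q′ * Q′ * seq ξ m + c ≤ P′ * Q′ → ∣ Q * Q * seq ξ m - P * Q ∣ ≤ ιₙ C
      bound m (h , h′) = subst (_≤ ιₙ C) (sym (ℚ.0≤p⇒∣p∣≡p 0≤y)) (*-cancelˡ Q′ 0<Q′ (ℚ.≤-trans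
          (*-cancelˡ Q′ 0<Q′ (≤-by-difference (Q * Q * c + Q * Q * (P′ * Q′ - (Q′ * Q′ * x + c)))
            (+-nonneg (*-nonneg QQ (ℚ.<⇒≤ 0<c)) (*-nonneg QQ (0≤difference h′)))
            (trans (trans (ℚ.*-comm Q′ Q) (trans (sym (ℚ.*-identityˡ (Q * Q′))) (cong (_* (Q * Q′)) (sym P′Q-PQ′≡1))))
              (solve 6 (λ c Q S P R x → (R :* Q :- P :* S) :* (Q :* S) := S :* (S :* (Q :* Q :* x :- P :* Q)) :+
                (Q :* Q :* c :+ Q :* Q :* (R :* S :- (S :* S :* x :+ c)))) refl c Q Q′ P P′ x))))
          (subst (Q ≤_) (ℚ.*-comm (ιₙ C) Q′) Q≤CQ′)))
        where
        x = seq ξ m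
        QQ = *-nonneg (ℚ.<⇒≤ 0<Q) (ℚ.<⇒≤ 0<Q)
        0≤y : 0ℚ ≤ Q * Q * x - P * Q
        0≤y = 0≤difference (ℚ.≤-trans (p≤p+q (ℚ.<⇒≤ 0<c)) h)

    nearR : Eventually λ m → ∣ Q′ * Q′ * seq ξ m - P′ * Q′ ∣ ≤ ιₙ C
    nearR = eventually-map bound both-sides
      where
      bound : ∀ m → P * Q + c ≤ Q * Q * seq ξ m × Q′ * Q′ * seq ξ m + c ≤ P′ * Q′ → ∣ Q′ * Q′ * seq ξ m - P′ * Q′ ∣ ≤ ιₙ C
      bound m (h , h′) = subst (_≤ ιₙ C) (sym (trans (∣p-q∣≡∣q-p∣ (Q′ * Q′ * x) (P′ * Q′)) (ℚ.0≤p⇒∣p∣≡p 0≤y))) (*-cancelˡ Q 0<Q (ℚ.≤-trans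
          (*-cancelˡ Q 0<Q (≤-by-difference (Q′ * Q′ * c + Q′ * Q′ * (Q * Q * x - (P * Q + c)))
            (+-nonneg (*-nonneg QQ (ℚ.<⇒≤ 0<c)) (*-nonneg QQ (0≤difference h)))
            (trans (trans (sym (ℚ.*-identityˡ (Q * Q′))) (cong (_* (Q * Q′)) (sym P′Q-PQ′≡1)))
              (solve 6 (λ c Q S P R x → (R :* Q :- P :* S) :* (Q :* S) := Q :* (Q :* (R :* S :- S :* S :* x)) :+
                (S :* S :* c :+ S :* S :* (Q :* Q :* x :- (P :* Q :+ c)))) refl c Q Q′ P P′ x))))
          (subst (Q′ ≤_) (ℚ.*-comm (ιₙ C) Q) Q′≤CQ)))
        where
        x = seq ξ m
        QQ = *-nonneg (ℚ.<⇒≤ 0<Q′) (ℚ.<⇒≤ 0<Q′)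
        0≤y : 0ℚ ≤ P′ * Q′ - Q′ * Q′ * x
        0≤y = 0≤difference (ℚ.≤-trans (p≤p+q (ℚ.<⇒≤ 0<c)) h′)

    numerator-bound : ∀ M q → 1 ℕ.≤ q → (Eventually λ m → ∣ ιₙ q * ιₙ q * seq ξ m - M * ιₙ q ∣ ≤ ιₙ C) →
      ∣ M ∣ ≤ ιₙ (B ℕ.+ C) * ιₙ q
    numerator-bound M q 1≤q near = conclude (eventually-once (both near bounded))
      where
      D = ιₙ q
      0<D : 0ℚ < D
      0<D = ιₙ-pos 1≤q
      0≤D : 0ℚ ≤ D
      0≤D = ℚ.<⇒≤ 0<D
      conclude : (∃ λ m → ∣ D * D * seq ξ m - M * D ∣ ≤ ιₙ C × ∣ seq ξ m ∣ ≤ ιₙ B) → ∣ M ∣ ≤ ιₙ (B ℕ.+ C) * D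
      conclude (m , near , x≤) = *-cancelʳ D 0<D (ℚ.≤-trans (ℚ.≤-reflexive
          (trans (cong (∣ M ∣ *_) (sym (ℚ.0≤p⇒∣p∣≡p 0≤D))) (trans (sym (ℚ.∣p*q∣≡∣p∣*∣q∣ M D))
            (cong ∣_∣ (solve 3 (λ M D x → M :* D := D :* D :* x :- (D :* D :* x :- M :* D)) refl M D x)))))
        (ℚ.≤-trans (ℚ.∣p-q∣≤∣p∣+∣q∣ (D * D * x) (D * D * x - M * D))
          (ℚ.≤-trans (ℚ.+-mono-≤
            (subst (_≤ D * D * ιₙ B) (sym (trans (ℚ.∣p*q∣≡∣p∣*∣q∣ (D * D) x) (cong (_* ∣ x ∣) (ℚ.0≤p⇒∣p∣≡p 0≤DD))))
              (*-monoˡ (D * D) 0≤DD x≤))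
            (ℚ.≤-trans near (subst (_≤ D * D * ιₙ C) (ℚ.*-identityˡ (ιₙ C))
              (*-monoʳ (ιₙ C) (ιₙ-nonneg C) (*-mono 0≤1ℚ 0≤D (1≤ιₙ 1≤q) (1≤ιₙ 1≤q))))))
            (ℚ.≤-reflexive (trans (solve 3 (λ D B C → D :* D :* B :+ D :* D :* C := (B :+ C) :* D :* D) refl D (ιₙ B) (ιₙ C))
              (cong (λ z → z * D * D) (sym (ιₙ-+ B C))))))))
        where
        x = seq ξ m
        0≤DD : 0ℚ ≤ D * D
        0≤DD = *-nonneg 0≤D 0≤D

  frame : ∀ n T → + 2 ℤ.∣ pL ⊎ + 2 ℤ.∣ pR → T ℕ.≤ width ℕ.^ n → width ℕ.^ n ℕ.≤ 4 ℕ.^ n ℕ.* T →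
    Frame ξ C (B ℕ.+ C) n T
  frame n T (inj₁ 2∣pL) T≤ ≤T = record
    { p = pL ; p′ = pR ; s = + 1 ; q = qL ; q′ = qR ; 1≤q = 1≤qL ; 1≤q′ = 1≤qR
    ; det = trans (cong₂ ℤ._-_ (ℤ.*-comm (+ qL) pR) (ℤ.*-comm (+ qR) pL)) detLR
    ; unit = inj₁ refl ; even = 2∣pL ; q≤Cq′ = ιₙ-cancel {qL} {qR} Q≤CQ′ ; q′≤Cq = ιₙ-cancel {qR} {qL} Q′≤CQ
    ; near = nearL ; ∣p∣≤Rq = numerator-bound P qL 1≤qL nearL ; ∣p′∣≤Rq′ = numerator-bound P′ qR 1≤qR nearR
    ; T≤ = ℕ.≤-trans T≤ (ℕ.^-monoˡ-≤ n (ℕ.+-monoʳ-≤ qL (ιₙ-cancel {qR} {qL} Q′≤CQ)))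
    ; qⁿ≤ = ℕ.≤-trans (ℕ.^-monoˡ-≤ n (ℕ.m≤m+n qL qR)) ≤T }
  frame n T (inj₂ 2∣pR) T≤ ≤T = record
    { p = pR ; p′ = pL ; s = -[1+ 0 ] ; q = qR ; q′ = qL ; 1≤q = 1≤qR ; 1≤q′ = 1≤qL
    ; det = trans (solveᶻ 4 (λ a b c d → a :*ᶻ b :-ᶻ c :*ᶻ d :=ᶻ :⊖ᶻ (d :*ᶻ c :-ᶻ b :*ᶻ a)) refl (+ qR) pL (+ qL) pR)
        (cong ℤ.-_ detLR)
    ; unit = inj₂ refl ; even = 2∣pR ; q≤Cq′ = ιₙ-cancel {qR} {qL} Q′≤CQ ; q′≤Cq = ιₙ-cancel {qL} {qR} Q≤CQ′
    ; near = nearR ; ∣p∣≤Rq = numerator-bound P′ qR 1≤qR nearR ; ∣p′∣≤Rq′ = numerator-bound P qL 1≤qL nearL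
    ; T≤ = ℕ.≤-trans T≤ (ℕ.^-monoˡ-≤ n (ℕ.≤-trans (ℕ.≤-reflexive (ℕ.+-comm qL qR))
        (ℕ.+-monoʳ-≤ qR (ιₙ-cancel {qL} {qR} Q≤CQ′))))
    ; qⁿ≤ = ℕ.≤-trans (ℕ.^-monoˡ-≤ n (ℕ.m≤n+m qR qL)) ≤T }

frames : ∀ ξ → BadlyApproximable ξ → ∃ λ C → ∃ λ R → 1 ℕ.≤ C ×
  (∀ n .{{_ : NonZero n}} T → 1 ℕ.≤ T → Frame ξ C R n T)
frames ξ (_ , c , 0<c , apart) = C , B ℕ.+ C , 1≤C , λ n T 1≤T →
  let b , even , T≤ , ≤T = reach-even n T 1≤T
  in frame 0<m C B 1≤cC (proj₂ bounded) b n T even T≤ ≤T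
  where
  μ = margin ξ c 0<c apart
  0<m : 0ℚ < μ
  0<m = margin-pos ξ c 0<c apart
  open Farey ξ μ 0<m (side ξ c 0<c apart)
  B = proj₁ bounded
  inv = reciprocal 0<m
  C = suc (proj₁ (ceiling (proj₁ inv)))
  1≤C : 1 ℕ.≤ C
  1≤C = ℕ.s≤s ℕ.z≤n
  1≤cC : 1ℚ ≤ μ * ιₙ C
  1≤cC = subst (_≤ μ * ιₙ C) (proj₂ (proj₂ inv)) (*-monoˡ μ (ℚ.<⇒≤ 0<m)
    (ℚ.≤-trans (proj₂ (ceiling (proj₁ inv))) (ιₙ-mono (ℕ.n≤1+n (proj₁ (ceiling (proj₁ inv)))))))

-- Coefficients of the polynomials

coeff-linear-0 : ∀ q p f → coeff (linear q p *ₚ f) 0 ≡ ℤ.- p ℤ.* coeff f 0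
coeff-linear-0 q p f = trans (coeff-*-∷ (ℤ.- p) (q ∷ []) f 0) (ℤ.+-identityʳ _)

coeff-linear-suc : ∀ q p f k → coeff (linear q p *ₚ f) (suc k) ≡ ℤ.- p ℤ.* coeff f (suc k) ℤ.+ q ℤ.* coeff f k
coeff-linear-suc q p f k = trans (coeff-*-∷ (ℤ.- p) (q ∷ []) f (suc k))
  (cong (λ z → ℤ.- p ℤ.* coeff f (suc k) ℤ.+ z) (constant-*ₚ (q ∷ []) f (λ _ → refl) k))

linear^-above : ∀ q p n k → n ℕ.< k → coeff (linear^ q p n) k ≡ + 0
linear^-above q p zero    (suc k) _ = refl
linear^-above q p (suc n) (suc k) (ℕ.s≤s n<k) = trans (coeff-linear-suc q p (linear^ q p n) k)
  (trans (cong₂ (λ x y → ℤ.- p ℤ.* x ℤ.+ q ℤ.* y) (linear^-above q p n (suc k) (ℕ.m<n⇒m<1+n n<k)) (linear^-above q p n k n<k))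
    (solveᶻ 2 (λ p q → :⊖ᶻ p :*ᶻ conᶻ (+ 0) :+ᶻ q :*ᶻ conᶻ (+ 0) :=ᶻ conᶻ (+ 0)) refl p q))

linear^-leading : ∀ q p n → coeff (linear^ q p n) n ≡ q ℤ.^ n
linear^-leading q p zero    = refl
linear^-leading q p (suc n) = trans (coeff-linear-suc q p (linear^ q p n) n)
  (trans (cong₂ (λ x y → ℤ.- p ℤ.* x ℤ.+ q ℤ.* y) (linear^-above q p n (suc n) ℕ.≤-refl) (linear^-leading q p n))
    (trans (cong (ℤ._+ q ℤ.* q ℤ.^ n) (ℤ.*-zeroʳ (ℤ.- p))) (ℤ.+-identityˡ (q ℤ.* q ℤ.^ n))))

linear^-constant : ∀ q p n → coeff (linear^ q p n) 0 ≡ (ℤ.- p) ℤ.^ n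
linear^-constant q p zero    = refl
linear^-constant q p (suc n) = trans (coeff-linear-0 q p (linear^ q p n)) (cong (ℤ.- p ℤ.*_) (linear^-constant q p n))

-- Modulo a divisor of p the linear polynomial is q T, whose n-th power is a monomial.
linear^-divisible : ∀ m q p → m ℤ.∣ p → ∀ n k → k ℕ.< n → m ℤ.∣ coeff (linear^ q p n) k
linear^-divisible m q p m∣p (suc n) zero    _ = subst (m ℤ.∣_) (sym (coeff-linear-0 q p (linear^ q p n)))
  (ℤ.∣m⇒∣m*n (coeff (linear^ q p n) 0) (ℤ.∣m⇒∣-m m∣p))
linear^-divisible m q p m∣p (suc n) (suc k) (ℕ.s≤s k<n) = subst (m ℤ.∣_) (sym (coeff-linear-suc q p (linear^ q p n) k))
  (ℤ.∣m∣n⇒∣m+n (ℤ.∣m⇒∣m*n (coeff (linear^ q p n) (suc k)) (ℤ.∣m⇒∣-m m∣p))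
    (ℤ.∣n⇒∣m*n q (linear^-divisible m q p m∣p n k k<n)))

2∣-neg : ∀ a → + 2 ℤ.∣ ℤ.- a → + 2 ℤ.∣ a
2∣-neg a h = subst (+ 2 ℤ.∣_) (ℤ.neg-involutive a) (ℤ.∣m⇒∣-m h)

2∤unit : ∀ {s} → s ≡ + 1 ⊎ s ≡ -[1+ 0 ] → ¬ + 2 ℤ.∣ s
2∤unit {s} unit h = 2∤1 ([ (λ eq → subst (+ 2 ℤ.∣_) eq h) , (λ eq → 2∣-neg (+ 1) (subst (+ 2 ℤ.∣_) eq h)) ]′ unit)
  where
  2∤1 : ¬ + 2 ℤ.∣ + 1
  2∤1 h = ℕ.<⇒≱ {1} {2} ℕ.≤-refl (ℕ.∣⇒≤ (ℤ.∣⇒∣ᵤ h))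

2∣^⇒2∣ : ∀ a n → + 2 ℤ.∣ a ℤ.^ n → + 2 ℤ.∣ a
2∣^⇒2∣ a zero    h = ⊥-elim (2∤unit (inj₁ refl) h)
2∣^⇒2∣ a (suc n) h = [ (λ x → x) , 2∣^⇒2∣ a n ]′ (2∣*⇒2∣⊎2∣ a (a ℤ.^ n) h)

-- Σ fₖ Xᵏ Yⁿ⁻ᵏ; at (p′ , q′) the pencil below takes the value ∓1, so it is primitive.
homogeneous : ℤ → ℤ → ℕ → (ℕ → ℤ) → ℤ
homogeneous X Y zero    f = f 0
homogeneous X Y (suc n) f = Y ℤ.^ suc n ℤ.* f 0 ℤ.+ X ℤ.* homogeneous X Y n (λ k → f (suc k))

homogeneous-divisible : ∀ m X Y n f → (∀ k → m ℤ.∣ f k) → m ℤ.∣ homogeneous X Y n f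
homogeneous-divisible m X Y zero    f h = h 0
homogeneous-divisible m X Y (suc n) f h = ℤ.∣m∣n⇒∣m+n (ℤ.∣n⇒∣m*n (Y ℤ.^ suc n) (h 0))
  (ℤ.∣n⇒∣m*n X (homogeneous-divisible m X Y n (λ k → f (suc k)) (λ k → h (suc k))))

homogeneous-combine : ∀ X Y n a b f g h → (∀ k → h k ≡ a ℤ.* f k ℤ.+ b ℤ.* g k) →
  homogeneous X Y n h ≡ a ℤ.* homogeneous X Y n f ℤ.+ b ℤ.* homogeneous X Y n g
homogeneous-combine X Y zero    a b f g h eq = eq 0
homogeneous-combine X Y (suc n) a b f g h eq = trans
  (cong₂ (λ u v → Y ℤ.^ suc n ℤ.* u ℤ.+ X ℤ.* v) (eq 0)
    (homogeneous-combine X Y n a b (λ k → f (suc k)) (λ k → g (suc k)) (λ k → h (suc k)) (λ k → eq (suc k))))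
  (solveᶻ 8 (λ y x a b f g u v → y :*ᶻ (a :*ᶻ f :+ᶻ b :*ᶻ g) :+ᶻ x :*ᶻ (a :*ᶻ u :+ᶻ b :*ᶻ v)
    :=ᶻ a :*ᶻ (y :*ᶻ f :+ᶻ x :*ᶻ u) :+ᶻ b :*ᶻ (y :*ᶻ g :+ᶻ x :*ᶻ v)) refl
    (Y ℤ.^ suc n) X a b (f 0) (g 0) (homogeneous X Y n (λ k → f (suc k))) (homogeneous X Y n (λ k → g (suc k))))

homogeneous-extend : ∀ X Y n f → f (suc n) ≡ + 0 → homogeneous X Y (suc n) f ≡ Y ℤ.* homogeneous X Y n f
homogeneous-extend X Y zero    f f₁≡0 = trans (cong (λ z → Y ℤ.* + 1 ℤ.* f 0 ℤ.+ X ℤ.* z) f₁≡0)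
  (solveᶻ 3 (λ y x f → y :*ᶻ conᶻ (+ 1) :*ᶻ f :+ᶻ x :*ᶻ conᶻ (+ 0) :=ᶻ y :*ᶻ f) refl Y X (f 0))
homogeneous-extend X Y (suc n) f f≡0 = trans
  (cong (λ z → Y ℤ.^ suc (suc n) ℤ.* f 0 ℤ.+ X ℤ.* z) (homogeneous-extend X Y n (λ k → f (suc k)) f≡0))
  (solveᶻ 5 (λ y z f x h → y :*ᶻ z :*ᶻ f :+ᶻ x :*ᶻ (y :*ᶻ h) :=ᶻ y :*ᶻ (z :*ᶻ f :+ᶻ x :*ᶻ h)) refl
    Y (Y ℤ.^ suc n) (f 0) X (homogeneous X Y n (λ k → f (suc k))))

homogeneous-linear^ : ∀ X Y q p n → homogeneous X Y n (coeff (linear^ q p n)) ≡ (q ℤ.* X ℤ.- p ℤ.* Y) ℤ.^ n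
homogeneous-linear^ X Y q p zero    = refl
homogeneous-linear^ X Y q p (suc n) = begin
  homogeneous X Y (suc n) (coeff (linear^ q p (suc n)))
    ≡⟨ homogeneous-combine X Y (suc n) (ℤ.- p) q f shifted (coeff (linear^ q p (suc n))) split ⟩
  ℤ.- p ℤ.* homogeneous X Y (suc n) f ℤ.+ q ℤ.* homogeneous X Y (suc n) shifted
    ≡⟨ cong₂ (λ u v → ℤ.- p ℤ.* u ℤ.+ q ℤ.* v)
      (homogeneous-extend X Y n f (linear^-above q p n (suc n) ℕ.≤-refl))
      (trans (cong (ℤ._+ X ℤ.* h) (ℤ.*-zeroʳ (Y ℤ.^ suc n))) (ℤ.+-identityˡ (X ℤ.* h))) ⟩
  ℤ.- p ℤ.* (Y ℤ.* h) ℤ.+ q ℤ.* (X ℤ.* h)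
    ≡⟨ solveᶻ 5 (λ p y h q x → :⊖ᶻ p :*ᶻ (y :*ᶻ h) :+ᶻ q :*ᶻ (x :*ᶻ h) :=ᶻ (q :*ᶻ x :-ᶻ p :*ᶻ y) :*ᶻ h) refl p Y h q X ⟩
  (q ℤ.* X ℤ.- p ℤ.* Y) ℤ.* h
    ≡⟨ cong ((q ℤ.* X ℤ.- p ℤ.* Y) ℤ.*_) (homogeneous-linear^ X Y q p n) ⟩
  (q ℤ.* X ℤ.- p ℤ.* Y) ℤ.^ suc n ∎
  where
  open ≡-Reasoning
  f = coeff (linear^ q p n)
  h = homogeneous X Y n f
  shifted : ℕ → ℤ
  shifted zero    = + 0
  shifted (suc k) = f k
  split : ∀ k → coeff (linear^ q p (suc n)) k ≡ ℤ.- p ℤ.* f k ℤ.+ q ℤ.* shifted k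
  split zero    = trans (coeff-linear-0 q p (linear^ q p n))
    (solveᶻ 2 (λ a q → a :=ᶻ a :+ᶻ q :*ᶻ conᶻ (+ 0)) refl (ℤ.- p ℤ.* f 0) q)
  split (suc k) = coeff-linear-suc q p (linear^ q p n) k

0^ : ∀ n .{{_ : NonZero n}} → (+ 0) ℤ.^ n ≡ + 0
0^ (suc n) = ℤ.*-zeroˡ ((+ 0) ℤ.^ n)

unit-^ : ∀ {s} → s ≡ + 1 ⊎ s ≡ -[1+ 0 ] → ∀ n → s ℤ.^ n ≡ + 1 ⊎ s ℤ.^ n ≡ -[1+ 0 ]
unit-^ unit zero    = inj₁ refl
unit-^ {s} unit (suc n) = unit-* unit (unit-^ unit n)
  where
  unit-* : ∀ {a b} → a ≡ + 1 ⊎ a ≡ -[1+ 0 ] → b ≡ + 1 ⊎ b ≡ -[1+ 0 ] → a ℤ.* b ≡ + 1 ⊎ a ℤ.* b ≡ -[1+ 0 ]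
  unit-* (inj₁ refl) (inj₁ refl) = inj₁ refl
  unit-* (inj₁ refl) (inj₂ refl) = inj₂ refl
  unit-* (inj₂ refl) (inj₁ refl) = inj₂ refl
  unit-* (inj₂ refl) (inj₂ refl) = inj₁ refl

∣unit⇒∣1 : ∀ {c s} → s ≡ + 1 ⊎ s ≡ -[1+ 0 ] → c ℤ.∣ s → c ℤ.∣ + 1
∣unit⇒∣1 (inj₁ refl) h = h
∣unit⇒∣1 (inj₂ refl) h = ℤ.∣m⇒∣-m h

-- The coefficients, by increasing powers of B, of forms that are Eisenstein at 2
-- once a monic term is added.
data TwiceOddLast : List ℤ → Set where
  last : ∀ k → TwiceOddLast (+ 4 ℤ.* k ℤ.+ + 2 ∷ [])
  _∷_  : ∀ {ys} k → TwiceOddLast ys → TwiceOddLast (+ 2 ℤ.* k ∷ ys)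

-- The two polynomials and their irreducibility

module Polynomials {ξ : ℝ} {C R n T : ℕ} (F : Frame ξ C R n T) where
  open Frame F

  private
    det′ : (+ q ℤ.* p′ ℤ.- p ℤ.* + q′) ≡ s
    det′ = trans (cong (λ z → + q ℤ.* p′ ℤ.- z) (ℤ.*-comm p (+ q′))) det

    -- The determinant is a unit and p is even, so the product q p′ is odd.
    2∣*⇒⊥ : + 2 ℤ.∣ + q ℤ.* p′ → ⊥
    2∣*⇒⊥ h = 2∤unit unit (subst (+ 2 ℤ.∣_) det (ℤ.∣m∣n⇒∣m-n h (ℤ.∣n⇒∣m*n (+ q′) even)))

  q-odd : ¬ + 2 ℤ.∣ + q
  q-odd h = 2∣*⇒⊥ (ℤ.∣m⇒∣m*n p′ h)

  p′-odd : ¬ + 2 ℤ.∣ p′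
  p′-odd h = 2∣*⇒⊥ (ℤ.∣n⇒∣m*n (+ q) h)

  module _ (K : ℤ) (K-odd : ¬ + 2 ℤ.∣ K) where
    -- 2 Kⁿ Bⁿ - Aⁿ for A = q T - p and B = q′ T - p′.
    pencil : ℤ[T]
    pencil = map (+ 2 ℤ.* K ℤ.^ n ℤ.*_) (linear^ (+ q′) p′ n) +ₚ map (-[1+ 0 ] ℤ.*_) (linear^ (+ q) p n)

    pencil-coeff : ∀ k → coeff pencil k ≡
      + 2 ℤ.* K ℤ.^ n ℤ.* coeff (linear^ (+ q′) p′ n) k ℤ.+ -[1+ 0 ] ℤ.* coeff (linear^ (+ q) p n) k
    pencil-coeff k = trans (coeff-+ (map (+ 2 ℤ.* K ℤ.^ n ℤ.*_) (linear^ (+ q′) p′ n)) (map (-[1+ 0 ] ℤ.*_) (linear^ (+ q) p n)) k)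
      (cong₂ ℤ._+_ (coeff-map (+ 2 ℤ.* K ℤ.^ n) (linear^ (+ q′) p′ n) k) (coeff-map -[1+ 0 ] (linear^ (+ q) p n) k))

    pencil-above : ∀ k → n ℕ.< k → coeff pencil k ≡ + 0
    pencil-above k n<k = trans (pencil-coeff k) (trans
      (cong₂ (λ u v → + 2 ℤ.* K ℤ.^ n ℤ.* u ℤ.+ -[1+ 0 ] ℤ.* v) (linear^-above (+ q′) p′ n k n<k) (linear^-above (+ q) p n k n<k))
      (cong (ℤ._+ + 0) (ℤ.*-zeroʳ (+ 2 ℤ.* K ℤ.^ n))))

    pencil-leading : coeff pencil n ≡ + 2 ℤ.* K ℤ.^ n ℤ.* (+ q′) ℤ.^ n ℤ.- (+ q) ℤ.^ n
    pencil-leading = trans (pencil-coeff n) (cong₂ ℤ._+_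
      (cong (+ 2 ℤ.* K ℤ.^ n ℤ.*_) (linear^-leading (+ q′) p′ n))
      (trans (cong (-[1+ 0 ] ℤ.*_) (linear^-leading (+ q) p n)) (ℤ.-1*i≡-i ((+ q) ℤ.^ n))))

    private
      2∣2K : + 2 ℤ.∣ + 2 ℤ.* K ℤ.^ n
      2∣2K = ℤ.∣m⇒∣m*n (K ℤ.^ n) ℤ.∣-refl

    pencil-odd : ¬ + 2 ℤ.∣ coeff pencil n
    pencil-odd h = q-odd (2∣^⇒2∣ (+ q) n (2∣-neg ((+ q) ℤ.^ n) (ℤ.∣m+n∣m⇒∣n (subst (+ 2 ℤ.∣_) pencil-leading h)
      (ℤ.∣m⇒∣m*n ((+ q′) ℤ.^ n) 2∣2K))))

    pencil-even : ∀ k → k ℕ.< n → + 2 ℤ.∣ coeff pencil k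
    pencil-even k k<n = subst (+ 2 ℤ.∣_) (sym (pencil-coeff k)) (ℤ.∣m∣n⇒∣m+n
      (ℤ.∣m⇒∣m*n (coeff (linear^ (+ q′) p′ n) k) 2∣2K)
      (ℤ.∣n⇒∣m*n -[1+ 0 ] (linear^-divisible (+ 2) (+ q) p even n k k<n)))

    -- For n ≥ 2 the even number p contributes pⁿ divisible by 4, so modulo 4 the constant
    -- coefficient is 2 Kⁿ (-p′)ⁿ, twice an odd number.
    pencil-constant : 2 ℕ.≤ n → ¬ + 4 ℤ.∣ coeff pencil 0
    pencil-constant 2≤n h = [ (λ h → K-odd (2∣^⇒2∣ K n h)) , (λ h → p′-odd (2∣-neg p′ (2∣^⇒2∣ (ℤ.- p′) n h))) ]′
      (2∣*⇒2∣⊎2∣ (K ℤ.^ n) ((ℤ.- p′) ℤ.^ n) (ℤ.*-cancelˡ-∣ (+ 2) (subst (+ 4 ℤ.∣_)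
        (ℤ.*-assoc (+ 2) (K ℤ.^ n) ((ℤ.- p′) ℤ.^ n))
        (ℤ.∣m+n∣n⇒∣m (subst (+ 4 ℤ.∣_) (trans (pencil-coeff 0) (cong₂ (λ u v → + 2 ℤ.* K ℤ.^ n ℤ.* u ℤ.+ -[1+ 0 ] ℤ.* v)
            (linear^-constant (+ q′) p′ n) (linear^-constant (+ q) p n))) h)
          (ℤ.∣n⇒∣m*n -[1+ 0 ] (4∣^ n 2≤n))))))
      where
      2∣-p : + 2 ℤ.∣ ℤ.- p
      2∣-p = ℤ.∣m⇒∣-m even
      4∣^ : ∀ n → 2 ℕ.≤ n → + 4 ℤ.∣ (ℤ.- p) ℤ.^ n
      4∣^ 1 (ℕ.s≤s ())
      4∣^ (suc (suc n)) _ = subst (+ 4 ℤ.∣_) (ℤ.*-assoc (ℤ.- p) (ℤ.- p) ((ℤ.- p) ℤ.^ n))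
        (ℤ.∣m⇒∣m*n ((ℤ.- p) ℤ.^ n) (ℤ.∣-trans (ℤ.*-monoʳ-∣ (+ 2) 2∣-p) (ℤ.*-monoˡ-∣ (ℤ.- p) 2∣-p)))

    -- At (p′ , q′) the form B vanishes and A takes the value s. The homogenised pencil is therefore
    -- -sⁿ there, a unit divisible by every common divisor of the coefficients.
    pencil-primitive : .{{_ : NonZero n}} → Primitive pencil
    pencil-primitive c c∣ = ∣unit⇒∣1 (unit-^ unit n) (subst (c ℤ.∣_)
      (trans (cong ℤ.-_ value₁) (ℤ.neg-involutive (s ℤ.^ n))) (ℤ.∣m⇒∣-m (homogeneous-divisible c p′ (+ q′) n (coeff pencil) c∣)))
      where
      value₁ : homogeneous p′ (+ q′) n (coeff pencil) ≡ ℤ.- (s ℤ.^ n)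
      value₁ = trans (homogeneous-combine p′ (+ q′) n (+ 2 ℤ.* K ℤ.^ n) -[1+ 0 ]
          (coeff (linear^ (+ q′) p′ n)) (coeff (linear^ (+ q) p n)) (coeff pencil) pencil-coeff)
        (trans (cong₂ (λ u v → + 2 ℤ.* K ℤ.^ n ℤ.* u ℤ.+ -[1+ 0 ] ℤ.* v)
            (trans (homogeneous-linear^ p′ (+ q′) (+ q′) p′ n) (trans (cong (ℤ._^ n)
              (solveᶻ 2 (λ a b → a :*ᶻ b :-ᶻ b :*ᶻ a :=ᶻ conᶻ (+ 0)) refl (+ q′) p′)) (0^ n)))
            (trans (homogeneous-linear^ p′ (+ q′) (+ q) p n) (cong (ℤ._^ n) det′)))
          (trans (cong₂ ℤ._+_ (ℤ.*-zeroʳ (+ 2 ℤ.* K ℤ.^ n)) (ℤ.-1*i≡-i (s ℤ.^ n))) (ℤ.+-identityˡ (ℤ.- (s ℤ.^ n)))))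

    pencil-irreducible : .{{_ : NonZero n}} → Irreducible pencil
    pencil-irreducible = eisenstein₂ pencil n (ℕ.>-nonZero⁻¹ n) pencil-above pencil-odd pencil-even pencil-constant pencil-primitive

  form′ : List ℤ → ℤ[T]
  form′ = formₚ (+ q) p (+ q′) p′

  form-divisible : ∀ m {ys} → (∀ k → m ℤ.∣ coeff ys k) → ∀ k → m ℤ.∣ coeff (form′ ys) k
  form-divisible m {[]}     h k = ∣0 m
  form-divisible m {y ∷ ys} h k = subst (m ℤ.∣_)
    (sym (trans (coeff-+ (map (y ℤ.*_) (linear^ (+ q) p (length ys))) (linear (+ q′) p′ *ₚ form′ ys) k)
      (cong (ℤ._+ coeff (linear (+ q′) p′ *ₚ form′ ys) k) (coeff-map y (linear^ (+ q) p (length ys)) k))))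
    (ℤ.∣m∣n⇒∣m+n (ℤ.∣m⇒∣m*n (coeff (linear^ (+ q) p (length ys)) k) (h 0))
      (∣-coeff-*ₚ m (linear (+ q′) p′) (form′ ys) k (λ i _ → form-divisible m {ys} (λ k → h (suc k)) i)))

  form-above : ∀ ys k → length ys ℕ.≤ k → coeff (form′ ys) k ≡ + 0
  form-above []       k       _ = refl
  form-above (y ∷ ys) (suc k) (ℕ.s≤s l≤k) = trans
    (coeff-+ (map (y ℤ.*_) (linear^ (+ q) p (length ys))) (linear (+ q′) p′ *ₚ form′ ys) (suc k))
    (trans (cong₂ ℤ._+_
      (trans (coeff-map y (linear^ (+ q) p (length ys)) (suc k))
        (trans (cong (y ℤ.*_) (linear^-above (+ q) p (length ys) (suc k) (ℕ.s≤s l≤k))) (ℤ.*-zeroʳ y)))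
      (trans (coeff-linear-suc (+ q′) p′ (form′ ys) k)
        (cong₂ (λ u v → ℤ.- p′ ℤ.* u ℤ.+ + q′ ℤ.* v) (form-above ys (suc k) (ℕ.m≤n⇒m≤1+n l≤k)) (form-above ys k l≤k))))
      (solveᶻ 2 (λ a b → conᶻ (+ 0) :+ᶻ (a :*ᶻ conᶻ (+ 0) :+ᶻ b :*ᶻ conᶻ (+ 0)) :=ᶻ conᶻ (+ 0)) refl (ℤ.- p′) (+ q′)))

  private
    odd-p′ : ∃ λ j → ℤ.- p′ ≡ + 2 ℤ.* j ℤ.+ + 1
    odd-p′ = by-remainder (ℤ.- p′ ℤ.% + 2) (ℤ.n%d<d (ℤ.- p′) (+ 2)) (ℤ.a≡a%n+[a/n]*n (ℤ.- p′) (+ 2))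
      where
      d = ℤ.- p′ ℤ./ + 2
      by-remainder : ∀ r → r ℕ.< 2 → ℤ.- p′ ≡ + r ℤ.+ d ℤ.* + 2 → ∃ λ j → ℤ.- p′ ≡ + 2 ℤ.* j ℤ.+ + 1
      by-remainder 0 _ eq = ⊥-elim (p′-odd (2∣-neg p′ (divides d (trans eq (ℤ.+-identityˡ (d ℤ.* + 2))))))
      by-remainder 1 _ eq = d , trans eq (solveᶻ 1 (λ d → conᶻ (+ 1) :+ᶻ d :*ᶻ conᶻ (+ 2) :=ᶻ conᶻ (+ 2) :*ᶻ d :+ᶻ conᶻ (+ 1)) refl d)
      by-remainder (suc (suc r)) (ℕ.s≤s (ℕ.s≤s ())) _

  -- Modulo 4 only the last coefficient matters. Every earlier term carries an even coefficient and
  -- a positive power of the even p, while the inner constant 4 l + 2 is multiplied by the odd -p′.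
  form-constant : ∀ {ys} → TwiceOddLast ys → ∃ λ k → coeff (form′ ys) 0 ≡ + 4 ℤ.* k ℤ.+ + 2
  form-constant (last k) = k , trans
    (coeff-+ (map (y ℤ.*_) (+ 1 ∷ [])) (linear (+ q′) p′ *ₚ []) 0)
    (trans (cong (λ z → y ℤ.* + 1 ℤ.+ z) (trans (coeff-linear-0 (+ q′) p′ []) (ℤ.*-zeroʳ (ℤ.- p′))))
      (trans (ℤ.+-identityʳ (y ℤ.* + 1)) (ℤ.*-identityʳ y)))
    where y = + 4 ℤ.* k ℤ.+ + 2
  form-constant (_∷_ {ys} k rest) = step ys rest (form-constant rest) even odd-p′
    where
    step : ∀ ys → TwiceOddLast ys → (∃ λ l → coeff (form′ ys) 0 ≡ + 4 ℤ.* l ℤ.+ + 2) → + 2 ℤ.∣ p →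
      (∃ λ j → ℤ.- p′ ≡ + 2 ℤ.* j ℤ.+ + 1) → ∃ λ m → coeff (form′ (+ 2 ℤ.* k ∷ ys)) 0 ≡ + 4 ℤ.* m ℤ.+ + 2
    -- The tail is nonempty, so the power of -p in the new term has exponent at least 1.
    step (y ∷ ys) _ (l , eq) (divides h p≡) (j , -p′≡) = m , trans
      (coeff-+ (map (+ 2 ℤ.* k ℤ.*_) (linear^ (+ q) p (suc (length ys)))) (linear (+ q′) p′ *ₚ form′ (y ∷ ys)) 0)
      (trans (cong₂ ℤ._+_
        (trans (coeff-map (+ 2 ℤ.* k) (linear^ (+ q) p (suc (length ys))) 0)
          (cong (+ 2 ℤ.* k ℤ.*_) (trans (linear^-constant (+ q) p (suc (length ys))) (cong (λ z → ℤ.- z ℤ.* w) p≡))))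
        (trans (coeff-linear-0 (+ q′) p′ (form′ (y ∷ ys))) (cong₂ ℤ._*_ -p′≡ eq)))
        (solveᶻ 5 (λ k h w j l →
          conᶻ (+ 2) :*ᶻ k :*ᶻ ((:⊖ᶻ (h :*ᶻ conᶻ (+ 2))) :*ᶻ w) :+ᶻ
            (conᶻ (+ 2) :*ᶻ j :+ᶻ conᶻ (+ 1)) :*ᶻ (conᶻ (+ 4) :*ᶻ l :+ᶻ conᶻ (+ 2))
          :=ᶻ conᶻ (+ 4) :*ᶻ (:⊖ᶻ (k :*ᶻ h :*ᶻ w) :+ᶻ conᶻ (+ 2) :*ᶻ j :*ᶻ l :+ᶻ j :+ᶻ l) :+ᶻ conᶻ (+ 2))
          refl k h w j l))
      where
      w = (ℤ.- p) ℤ.^ length ys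
      m = ℤ.- (k ℤ.* h ℤ.* w) ℤ.+ + 2 ℤ.* j ℤ.* l ℤ.+ j ℤ.+ l

  module _ (ys : List ℤ) (len : length ys ≡ suc n) (tol : TwiceOddLast ys) where
    monic : ℤ[T]
    monic = T^ (suc n) +ₚ form′ ys

    private
      T^-other : ∀ m k → k ≢ m → coeff (T^ m) k ≡ + 0
      T^-other zero    zero    k≢m = ⊥-elim (k≢m refl)
      T^-other zero    (suc k) k≢m = refl
      T^-other (suc m) zero    k≢m = refl
      T^-other (suc m) (suc k) k≢m = T^-other m k (λ eq → k≢m (cong suc eq))

      T^-leading : ∀ m → coeff (T^ m) m ≡ + 1
      T^-leading zero    = refl
      T^-leading (suc m) = T^-leading m

      all-even : ∀ {ys} → TwiceOddLast ys → ∀ k → + 2 ℤ.∣ coeff ys k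
      all-even (last k) zero    = divides (+ 2 ℤ.* k ℤ.+ + 1)
        (solveᶻ 1 (λ k → conᶻ (+ 4) :*ᶻ k :+ᶻ conᶻ (+ 2) :=ᶻ (conᶻ (+ 2) :*ᶻ k :+ᶻ conᶻ (+ 1)) :*ᶻ conᶻ (+ 2)) refl k)
      all-even (last k) (suc i) = ∣0 (+ 2)
      all-even (k ∷ t)  zero    = ℤ.∣m⇒∣m*n k ℤ.∣-refl
      all-even (k ∷ t)  (suc i) = all-even t i

    monic-leading : coeff monic (suc n) ≡ + 1
    monic-leading = trans (coeff-+ (T^ (suc n)) (form′ ys) (suc n))
      (cong₂ ℤ._+_ (T^-leading n) (form-above ys (suc n) (ℕ.≤-reflexive len)))

    monic-above : ∀ k → suc n ℕ.< k → coeff monic k ≡ + 0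
    monic-above k n<k = trans (coeff-+ (T^ (suc n)) (form′ ys) k)
      (cong₂ ℤ._+_ (T^-other (suc n) k (λ eq → ℕ.<-irrefl (sym eq) n<k))
        (form-above ys k (ℕ.≤-trans (ℕ.≤-reflexive len) (ℕ.<⇒≤ n<k))))

    monic-below : ∀ k → k ℕ.< suc n → coeff monic k ≡ coeff (form′ ys) k
    monic-below k k<n = trans (coeff-+ (T^ (suc n)) (form′ ys) k)
      (trans (cong (ℤ._+ coeff (form′ ys) k) (T^-other (suc n) k (λ eq → ℕ.<-irrefl eq k<n))) (ℤ.+-identityˡ (coeff (form′ ys) k)))

    monic-irreducible : Irreducible monic
    monic-irreducible = eisenstein₂ monic (suc n) (ℕ.s≤s ℕ.z≤n) monic-above
      (λ h → 2∤unit (inj₁ refl) (subst (+ 2 ℤ.∣_) monic-leading h))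
      (λ k k<n → subst (+ 2 ℤ.∣_) (sym (monic-below k k<n)) (form-divisible (+ 2) {ys} (all-even tol) k))
      (λ _ h → constant (form-constant tol) (subst (+ 4 ℤ.∣_) (monic-below 0 (ℕ.s≤s ℕ.z≤n)) h))
      (λ c c∣ → subst (c ℤ.∣_) monic-leading (c∣ (suc n)))
      where
      constant : (∃ λ k → coeff (form′ ys) 0 ≡ + 4 ℤ.* k ℤ.+ + 2) → ¬ + 4 ℤ.∣ coeff (form′ ys) 0
      constant (k , eq) h = ℕ.<⇒≱ {2} {4} (ℕ.s≤s (ℕ.s≤s (ℕ.s≤s ℕ.z≤n))) (ℕ.∣⇒≤
        (ℤ.∣⇒∣ᵤ (ℤ.∣m+n∣m⇒∣n {m = + 4 ℤ.* k} {+ 2} (subst (+ 4 ℤ.∣_) eq h) (ℤ.∣m⇒∣m*n k ℤ.∣-refl))))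


-- Coefficient sequences and heights

shift : (ℕ → ℚ) → ℕ → ℚ
shift f zero    = 0ℚ
shift f (suc k) = f k

coefficientModule : Module
coefficientModule = record
  { I = ℕ
  ; T = shift
  ; one = λ where zero → 1ℚ ; (suc k) → 0ℚ
  ; T-cong = λ where f≗g zero → refl ; f≗g (suc k) → f≗g k
  ; T-linear = λ where
      a b f g zero    → solve 2 (λ a b → con 0ℚ := a :* con 0ℚ :+ b :* con 0ℚ) refl a b
      a b f g (suc k) → refl }

module _ where
  open Evaluation coefficientModule

  ev-coeff : ∀ P k → ev P k ≡ ι (coeff P k)
  ev-coeff []      k       = sym ι-0
  ev-coeff (a ∷ P) zero    = solve 1 (λ a → a :* con 1ℚ :+ con 0ℚ := a) refl (ι a)
  ev-coeff (a ∷ P) (suc k) = trans (cong (λ z → ι a * 0ℚ + z) (ev-coeff P k))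
    (solve 2 (λ a x → a :* con 0ℚ :+ x := x) refl (ι a) (ι (coeff P k)))

  height-upper : ∀ P M → 0ℚ ≤ M → (∀ k → ∣ ι (coeff P k) ∣ ≤ M) → ιₙ (polyHeight P) ≤ M
  height-upper []      M 0≤M h = subst (_≤ M) (sym ι-0) 0≤M
  height-upper (a ∷ P) M 0≤M h = [ (λ eq → subst (λ m → ιₙ m ≤ M) (sym eq) (subst (_≤ M) (ι-∣∣ a) (h 0)))
                                 , (λ eq → subst (λ m → ιₙ m ≤ M) (sym eq) (height-upper P M 0≤M (λ k → h (suc k)))) ]′
    (ℕ.⊔-sel ℤ.∣ a ∣ (polyHeight P))

  coeff≤height : ∀ P k → ℤ.∣ coeff P k ∣ ℕ.≤ polyHeight P
  coeff≤height []      k       = ℕ.z≤n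
  coeff≤height (a ∷ P) zero    = ℕ.m≤m⊔n ℤ.∣ a ∣ (polyHeight P)
  coeff≤height (a ∷ P) (suc k) = ℕ.≤-trans (coeff≤height P k) (ℕ.m≤n⊔m ℤ.∣ a ∣ (polyHeight P))

  coeff≤height-ι : ∀ P k → ∣ ι (coeff P k) ∣ ≤ ιₙ (polyHeight P)
  coeff≤height-ι P k = subst (_≤ ιₙ (polyHeight P)) (sym (ι-∣∣ (coeff P k))) (ιₙ-mono (coeff≤height P k))

  shift-bound : ∀ f {M} → 0ℚ ≤ M → (∀ k → ∣ f k ∣ ≤ M) → ∀ k → ∣ shift f k ∣ ≤ M
  shift-bound f 0≤M h zero    = 0≤M
  shift-bound f 0≤M h (suc k) = h k

  lin-bound : ∀ q p f {M W} → 0ℚ ≤ M → ∣ q ∣ + ∣ p ∣ ≤ W → (∀ k → ∣ f k ∣ ≤ M) → ∀ k → ∣ lin q p f k ∣ ≤ W * M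
  lin-bound q p f {M} {W} 0≤M ≤W h k = ℚ.≤-trans (ℚ.∣p-q∣≤∣p∣+∣q∣ (q * shift f k) (p * f k))
    (ℚ.≤-trans (ℚ.+-mono-≤ (∣p*q∣≤ q (shift f k) 0≤M ℚ.≤-refl (shift-bound f 0≤M h k)) (∣p*q∣≤ p (f k) 0≤M ℚ.≤-refl (h k)))
      (ℚ.≤-trans (ℚ.≤-reflexive (sym (ℚ.*-distribʳ-+ M (∣ q ∣) (∣ p ∣)))) (*-monoʳ M 0≤M ≤W)))

  lin^-bound : ∀ q p {W} → 0ℚ ≤ W → ∣ q ∣ + ∣ p ∣ ≤ W → ∀ n k → ∣ lin^ q p n k ∣ ≤ W ^ℚ n
  lin^-bound q p 0≤W ≤W zero    zero    = ℚ.≤-refl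
  lin^-bound q p 0≤W ≤W zero    (suc k) = 0≤1ℚ
  lin^-bound q p 0≤W ≤W (suc n) k       =
    lin-bound q p (lin^ q p n) (^-nonneg n 0≤W) ≤W (lin^-bound q p 0≤W ≤W n) k

  lin^-above : ∀ q p n k → n ℕ.< k → lin^ q p n k ≡ 0ℚ
  lin^-above q p zero    (suc k) _ = refl
  lin^-above q p (suc n) (suc k) (ℕ.s≤s n<k) = trans
    (cong₂ (λ x y → q * x - p * y) (lin^-above q p n k n<k) (lin^-above q p n (suc k) (ℕ.m<n⇒m<1+n n<k)))
    (solve 2 (λ q p → q :* con 0ℚ :- p :* con 0ℚ := con 0ℚ) refl q p)

  lin^-top : ∀ q p n → lin^ q p n n ≡ q ^ℚ n
  lin^-top q p zero    = refl
  lin^-top q p (suc n) = trans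
    (cong₂ (λ x y → q * x - p * y) (lin^-top q p n) (lin^-above q p n (suc n) ℕ.≤-refl))
    (solve 3 (λ q x p → q :* x :- p :* con 0ℚ := q :* x) refl q (q ^ℚ n) p)

  -- Multiplied by q⁻ⁿ⁻¹ this becomes -(n + 1) p/q, the bounded disturbance that the term ε Aⁿ⁺¹
  -- causes in the coefficient of Tⁿ.
  lin^-subtop : ∀ q p n → lin^ q p (suc n) n ≡ - (ιₙ (suc n) * p * q ^ℚ n)
  lin^-subtop q p zero    = trans (solve 2 (λ q p → q :* con 0ℚ :- p :* con 1ℚ := :- (con 1ℚ :* p :* con 1ℚ)) refl q p)
    (cong (λ z → - (z * p * 1ℚ)) (sym ι-1))
  lin^-subtop q p (suc n) = trans
    (cong₂ (λ x y → q * x - p * y) (lin^-subtop q p n) (lin^-top q p (suc n)))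
    (trans (solve 4 (λ q p m x → q :* (:- (m :* p :* x)) :- p :* (q :* x) := :- ((con 1ℚ :+ m) :* p :* (q :* x))) refl q p (ιₙ (suc n)) (q ^ℚ n))
      (cong (λ z → - (z * p * (q * q ^ℚ n))) (sym (trans (ιₙ-+ 1 (suc n)) (cong (_+ ιₙ (suc n)) ι-1)))))

  -- The last entry belongs to the pure power of B. With no negative entries nothing cancels, which
  -- gives lower bounds both for E at κ and for the top coefficient of the form.
  data Positive : List ℚ → Set where
    last : ∀ {e} → 1ℚ ≤ e → Positive (e ∷ [])
    _∷_  : ∀ {e es} → 0ℚ ≤ e → Positive es → Positive (e ∷ es)

  module _ (q p q′ p′ : ℚ) where
    open Form q p q′ p′

    form-bound : ∀ {S W} → 0ℚ ≤ S → 0ℚ ≤ W → ∣ q ∣ + ∣ p ∣ ≤ W → ∣ q′ ∣ + ∣ p′ ∣ ≤ W →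
      ∀ t ts → All (λ t → ∣ t ∣ ≤ S) (t ∷ ts) → ∀ k → ∣ form (t ∷ ts) k ∣ ≤ S * ιₙ (suc (length ts)) * W ^ℚ length ts
    form-bound {S} {W} 0≤S 0≤W ≤W ≤W′ t [] (t≤ ∷ []) k = subst₂ _≤_
      (cong ∣_∣ (sym (trans (cong (λ z → t * one k + z) (lin-0 q′ p′ k)) (ℚ.+-identityʳ (t * one k)))))
      (cong (λ z → S * z * 1ℚ) (sym ι-1))
      (ℚ.≤-trans (∣p*q∣≤ t (one k) 0≤1ℚ t≤ (one≤1 k)) (ℚ.≤-reflexive (sym (ℚ.*-identityʳ (S * 1ℚ)))))
      where
      one≤1 : ∀ k → ∣ one k ∣ ≤ 1ℚ
      one≤1 zero    = ℚ.≤-refl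
      one≤1 (suc k) = 0≤1ℚ
    form-bound {S} {W} 0≤S 0≤W ≤W ≤W′ t (t′ ∷ ts) (t≤ ∷ ts≤) k = ℚ.≤-trans
      (∣p+q∣≤ (t * A^ (suc m) k) (B (form (t′ ∷ ts)) k)
        (∣p*q∣≤ t (A^ (suc m) k) (^-nonneg (suc m) 0≤W) t≤ (lin^-bound q p 0≤W ≤W (suc m) k))
        (lin-bound q′ p′ (form (t′ ∷ ts)) (*-nonneg (*-nonneg 0≤S (ιₙ-nonneg (suc m))) (^-nonneg m 0≤W)) ≤W′
          (form-bound 0≤S 0≤W ≤W ≤W′ t′ ts ts≤) k))
      (ℚ.≤-reflexive (trans (solve 4 (λ S W x m → S :* (W :* x) :+ W :* (S :* m :* x) := S :* (con 1ℚ :+ m) :* (W :* x)) refl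
          S W (W ^ℚ m) (ιₙ (suc m)))
        (cong (λ z → S * z * (W * W ^ℚ m)) (sym (trans (ιₙ-+ 1 (suc m)) (cong (_+ ιₙ (suc m)) ι-1))))))
      where m = length ts

    form-above : ∀ ts k → length ts ℕ.≤ k → form ts k ≡ 0ℚ
    form-above []       k       _ = refl
    form-above (t ∷ ts) (suc k) (ℕ.s≤s l≤k) = trans
      (cong₂ (λ x y → t * x + y) (lin^-above q p (length ts) (suc k) (ℕ.s≤s l≤k))
        (cong₂ (λ x y → q′ * x - p′ * y) (form-above ts k l≤k) (form-above ts (suc k) (ℕ.m≤n⇒m≤1+n l≤k))))
      (solve 3 (λ t q p → t :* con 0ℚ :+ (q :* con 0ℚ :- p :* con 0ℚ) := con 0ℚ) refl t q′ p′)

    -- The coefficient of Tⁿ is Σ eⱼ qⁿ⁻ʲ q′ʲ; all terms are nonnegative, and the last one is at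
    -- least q′ⁿ.
    form-top : 0ℚ ≤ q → 0ℚ ≤ q′ → ∀ e es → Positive (e ∷ es) → q′ ^ℚ length es ≤ form (e ∷ es) (length es)
    form-top 0≤q 0≤q′ e [] (last 1≤e) = ℚ.≤-trans 1≤e (ℚ.≤-reflexive
      (sym (trans (cong (λ z → e * 1ℚ + z) (lin-0 q′ p′ 0)) (solve 1 (λ e → e :* con 1ℚ :+ con 0ℚ := e) refl e))))
    form-top 0≤q 0≤q′ e (e′ ∷ es) (0≤e ∷ pos) = ℚ.≤-trans
      (*-monoˡ q′ 0≤q′ (form-top 0≤q 0≤q′ e′ es pos))
      (ℚ.≤-trans (q≤p+q (*-nonneg 0≤e (^-nonneg (suc m) 0≤q)))
        (ℚ.≤-reflexive (cong₂ (λ x y → e * x + y) (sym (lin^-top q p (suc m)))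
          (trans (solve 3 (λ q x p → q :* x := q :* x :- p :* con 0ℚ) refl q′ (form (e′ ∷ es) m) p′)
            (cong (λ z → q′ * form (e′ ∷ es) m - p′ * z) (sym (form-above (e′ ∷ es) (suc m) ℕ.≤-refl)))))))
      where m = length es

-- Zeros near ξ

hornerq : List ℚ → ℚ → ℚ
hornerq []       y = 0ℚ
hornerq (e ∷ es) y = e + y * hornerq es y

horner-⌜⌝ : ∀ es y → horner es ⌜ y ⌝ ≡ ⌜ hornerq es y ⌝
horner-⌜⌝ []       y = refl
horner-⌜⌝ (e ∷ es) y = trans (cong (λ w → ⌜ e ⌝ +ᵍ ⌜ y ⌝ *ᵍ w) (horner-⌜⌝ es y))
  (trans (cong (⌜ e ⌝ +ᵍ_) (sym (⌜⌝-* y (hornerq es y)))) (sym (⌜⌝-+ e (y * hornerq es y))))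

hornerq-positive : ∀ {y} → 0ℚ ≤ y → ∀ e es → Positive (e ∷ es) → y ^ℚ length es ≤ hornerq (e ∷ es) y
hornerq-positive {y} 0≤y e []        (last 1≤e)  = ℚ.≤-trans 1≤e
  (ℚ.≤-reflexive (solve 2 (λ e y → e := e :+ y :* con 0ℚ) refl e y))
hornerq-positive {y} 0≤y e (e′ ∷ es) (0≤e ∷ pos) = ℚ.≤-trans (*-monoˡ y 0≤y (hornerq-positive 0≤y e′ es pos)) (q≤p+q 0≤e)

-- `sign-change` compares two negative points; what matters is that the k-th powers of both have the
-- same sign.
negative-powers : ∀ k → (∀ u → u < 0ℚ → 0ℚ < u ^ℚ k) ⊎ (∀ u → u < 0ℚ → u ^ℚ k < 0ℚ)
negative-powers zero    = inj₁ λ u _ → 0<1ℚ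
negative-powers (suc k) = [ (λ pos → inj₂ λ u u<0 → subst (_< 0ℚ) (neg* u (u ^ℚ k)) (ℚ.neg-antimono-< (*-pos (ℚ.neg-antimono-< u<0) (pos u u<0))))
                          , (λ neg → inj₁ λ u u<0 → subst (0ℚ <_) (neg*neg u (u ^ℚ k)) (*-pos (ℚ.neg-antimono-< u<0) (ℚ.neg-antimono-< (neg u u<0)))) ]′
  (negative-powers k)
  where
  neg* : ∀ a b → - ((- a) * b) ≡ a * b
  neg* = solve 2 (λ a b → :- ((:- a) :* b) := a :* b) refl
  neg*neg : ∀ a b → (- a) * (- b) ≡ a * b
  neg*neg = solve 2 (λ a b → (:- a) :* (:- b) := a :* b) refl

pos-*-≤0 : ∀ {a f} → 0ℚ < a → a * f ≤ 0ℚ → f ≤ 0ℚ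
pos-*-≤0 {a} {f} 0<a h = *-cancelˡ a 0<a (subst (a * f ≤_) (sym (ℚ.*-zeroʳ a)) h)

pos-*-≥0 : ∀ {a f} → 0ℚ < a → 0ℚ ≤ a * f → 0ℚ ≤ f
pos-*-≥0 {a} {f} 0<a h = *-cancelˡ a 0<a (subst (_≤ a * f) (sym (ℚ.*-zeroʳ a)) h)

neg-*-≤0 : ∀ {a f} → a < 0ℚ → a * f ≤ 0ℚ → 0ℚ ≤ f
neg-*-≤0 {a} {f} a<0 h = pos-*-≥0 (ℚ.neg-antimono-< a<0) (subst (0ℚ ≤_) (ℚ.neg-distribˡ-* a f) (ℚ.neg-antimono-≤ h))

neg-*-≥0 : ∀ {a f} → a < 0ℚ → 0ℚ ≤ a * f → f ≤ 0ℚ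
neg-*-≥0 {a} {f} a<0 h = pos-*-≤0 (ℚ.neg-antimono-< a<0) (subst (_≤ 0ℚ) (ℚ.neg-distribˡ-* a f) (ℚ.neg-antimono-≤ h))

1≤ιₙ1+ : ∀ n → 1ℚ ≤ ιₙ (suc n)
1≤ιₙ1+ n = 1≤ιₙ (ℕ.s≤s ℕ.z≤n)

1≤* : ∀ {a b} → 1ℚ ≤ a → 1ℚ ≤ b → 1ℚ ≤ a * b
1≤* 1≤a 1≤b = *-mono 0≤1ℚ (ℚ.≤-trans 0≤1ℚ 1≤b) 1≤a 1≤b

a≤ab : ∀ {a b} → 0ℚ ≤ a → 1ℚ ≤ b → a ≤ a * b
a≤ab {a} {b} 0≤a 1≤b = subst (_≤ a * b) (ℚ.*-identityʳ a) (*-monoˡ a 0≤a 1≤b)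

-- Constants that depend on C and n only

module Constants (C n : ℕ) (1≤C : 1 ℕ.≤ C) where
  -- Odd for the sake of Eisenstein's criterion. From K ≥ C + 1 and κ ≥ 1/C follows K κ ≥ 1 + κ, so
  -- 2 (K κ)ⁿ - 1 ≥ 1 and κ - 1/K > 0.
  K : ℕ
  K = suc (2 ℕ.* C)

  -- ψ is injective on the disc of radius δ in u = 1/x, that is, for x outside the
  -- disc of radius V = 2/δ; the factor 2 comes from ‖z‖‖w‖ ≤ 2‖zw‖.
  S ρ Λ Cⁿ g₀ D δ V HB : ℚ
  -- One bound for both parts: rounded coefficients are at most 5, and those of the pencil are 2 Kⁿ,
  -- 0 and -1.
  S = ιₙ (5 ℕ.+ 2 ℕ.* K ℕ.^ n)
  ρ = ιₙ C + 1ℚ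
  Λ = hornerLipschitz S ρ (suc n) + 1ℚ
  HB = hornerBound S ρ (suc n) + 1ℚ
  Cⁿ = ιₙ C ^ℚ n

  0≤S : 0ℚ ≤ S
  0≤S = ιₙ-nonneg (5 ℕ.+ 2 ℕ.* K ℕ.^ n)

  0≤ρ : 0ℚ ≤ ρ
  0≤ρ = +-nonneg (ιₙ-nonneg C) 0≤1ℚ

  1≤Λ : 1ℚ ≤ Λ
  1≤Λ = q≤p+q (hornerLipschitz-nonneg S ρ 0≤S 0≤ρ (suc n))

  1≤HB : 1ℚ ≤ HB
  1≤HB = q≤p+q (hornerBound-nonneg S ρ 0≤S 0≤ρ (suc n))

  1≤Cⁿ : 1ℚ ≤ Cⁿ
  1≤Cⁿ = 1≤^ n (1≤ιₙ 1≤C)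

  g₀ = proj₁ (reciprocal (ℚ.<-≤-trans 0<1ℚ 1≤Cⁿ))

  0<g₀ : 0ℚ < g₀
  0<g₀ = proj₁ (proj₂ (reciprocal (ℚ.<-≤-trans 0<1ℚ 1≤Cⁿ)))

  Cⁿg₀≡1 : Cⁿ * g₀ ≡ 1ℚ
  Cⁿg₀≡1 = proj₂ (proj₂ (reciprocal (ℚ.<-≤-trans 0<1ℚ 1≤Cⁿ)))

  private
    4Λ = (Λ + Λ) + (Λ + Λ)
    1≤4Λ : 1ℚ ≤ 4Λ
    1≤4Λ = ℚ.≤-trans 1≤Λ (ℚ.≤-trans (p≤p+q 0≤Λ) (p≤p+q (+-nonneg 0≤Λ 0≤Λ)))
      where 0≤Λ = ℚ.≤-trans 0≤1ℚ 1≤Λ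

  -- 4 Λ Cⁿ makes 4 Λ δ ≤ g₀ = C⁻ⁿ, and the further factor C makes δ ≤ 1/C ≤ κ, so that κ - s u
  -- stays nonnegative for real u with |u| ≤ δ.
  D = 4Λ * Cⁿ * ιₙ C

  1≤D : 1ℚ ≤ D
  1≤D = 1≤* (1≤* 1≤4Λ 1≤Cⁿ) (1≤ιₙ 1≤C)

  0<D : 0ℚ < D
  0<D = ℚ.<-≤-trans 0<1ℚ 1≤D

  δ = proj₁ (reciprocal 0<D)

  0<δ : 0ℚ < δ
  0<δ = proj₁ (proj₂ (reciprocal 0<D))

  Dδ≡1 : D * δ ≡ 1ℚ
  Dδ≡1 = proj₂ (proj₂ (reciprocal 0<D))

  δ≤1 : δ ≤ 1ℚ
  δ≤1 = *-cancelˡ D 0<D (ℚ.≤-trans (ℚ.≤-reflexive Dδ≡1) (subst (1ℚ ≤_) (sym (ℚ.*-identityʳ D)) 1≤D))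

  V = D + D

  Vδ≡2 : V * δ ≡ 1ℚ + 1ℚ
  Vδ≡2 = trans (ℚ.*-distribʳ-+ δ D D) (cong₂ _+_ Dδ≡1 Dδ≡1)

  0<V : 0ℚ < V
  0<V = +-pos 0<D 0<D

  Λδ≤g₀ : (Λ * δ + Λ * δ) + (Λ * δ + Λ * δ) ≤ g₀
  Λδ≤g₀ = *-cancelˡ Cⁿ (ℚ.<-≤-trans 0<1ℚ 1≤Cⁿ) (ℚ.≤-trans
    (a≤ab (*-nonneg (ℚ.≤-trans 0≤1ℚ 1≤Cⁿ) (+-nonneg (+-nonneg 0≤Λδ 0≤Λδ) (+-nonneg 0≤Λδ 0≤Λδ))) (1≤ιₙ 1≤C))
    (ℚ.≤-reflexive (trans (solve 4 (λ c l d C → c :* ((l :* d :+ l :* d) :+ (l :* d :+ l :* d)) :* C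
        := ((l :+ l) :+ (l :+ l)) :* c :* C :* d) refl Cⁿ Λ δ (ιₙ C))
      (trans Dδ≡1 (sym Cⁿg₀≡1)))))
    where
    0≤Λδ : 0ℚ ≤ Λ * δ
    0≤Λδ = *-nonneg (ℚ.≤-trans 0≤1ℚ 1≤Λ) (ℚ.<⇒≤ 0<δ)

  Cδ≤1 : ιₙ C * δ ≤ 1ℚ
  Cδ≤1 = ℚ.≤-trans (*-monoʳ δ (ℚ.<⇒≤ 0<δ) (subst (_≤ D) (ℚ.*-identityˡ (ιₙ C)) (*-monoʳ (ιₙ C) (ιₙ-nonneg C) (1≤* 1≤4Λ 1≤Cⁿ))))
    (ℚ.≤-reflexive Dδ≡1)

module Analysis {ξ : ℝ} {C R n T : ℕ} (1≤C : 1 ℕ.≤ C) (F : Frame ξ C R n T) where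
  open Constants C n 1≤C public
  open Frame F using (1≤q; 1≤q′; near) renaming (q to qₙ; q′ to qₙ′; p to pᵢ; p′ to pᵢ′; s to sᵢ)

  q q′ p p′ s c κ : ℚ
  q = ιₙ qₙ
  q′ = ιₙ qₙ′
  p = ι pᵢ
  p′ = ι pᵢ′
  s = ι sᵢ

  0<q : 0ℚ < q
  0<q = ιₙ-pos 1≤q

  c = proj₁ (reciprocal 0<q)

  0<c : 0ℚ < c
  0<c = proj₁ (proj₂ (reciprocal 0<q))

  cq≡1 : c * q ≡ 1ℚ
  cq≡1 = trans (ℚ.*-comm c q) (proj₂ (proj₂ (reciprocal 0<q)))

  c≤1 : c ≤ 1ℚ
  c≤1 = ℚ.≤-trans (a≤ab (ℚ.<⇒≤ 0<c) (1≤ιₙ 1≤q)) (ℚ.≤-reflexive cq≡1)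

  κ = q′ * c

  0≤κ : 0ℚ ≤ κ
  0≤κ = *-nonneg (ιₙ-nonneg qₙ′) (ℚ.<⇒≤ 0<c)

  κ≤C : κ ≤ ιₙ C
  κ≤C = ℚ.≤-trans (*-monoʳ c (ℚ.<⇒≤ 0<c) (subst (q′ ≤_) (ιₙ-* C qₙ) (ιₙ-mono (Frame.q′≤Cq F))))
    (ℚ.≤-reflexive (trans (solve 3 (λ C q c → C :* q :* c := C :* (c :* q)) refl (ιₙ C) q c)
      (trans (cong (ιₙ C *_) cq≡1) (ℚ.*-identityʳ (ιₙ C)))))

  1≤Cκ : 1ℚ ≤ ιₙ C * κ
  1≤Cκ = subst₂ _≤_ (trans (ℚ.*-comm q c) cq≡1) (ℚ.*-assoc (ιₙ C) q′ c)
    (*-monoʳ c (ℚ.<⇒≤ 0<c) (subst (q ≤_) (ιₙ-* C qₙ′) (ιₙ-mono (Frame.q≤Cq′ F))))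

  ∣κ∣+1≤ρ : ∣ κ ∣ + 1ℚ ≤ ρ
  ∣κ∣+1≤ρ = ℚ.+-monoˡ-≤ 1ℚ (subst (_≤ ιₙ C) (sym (ℚ.0≤p⇒∣p∣≡p 0≤κ)) κ≤C)

  s-unit : s ≡ 1ℚ ⊎ s ≡ - 1ℚ
  s-unit = [ (λ eq → inj₁ (trans (cong ι eq) ι-1)) , (λ eq → inj₂ (trans (cong ι eq) (trans (ι-neg (+ 1)) (cong -_ ι-1)))) ]′ (Frame.unit F)

  s²≡1 : s * s ≡ 1ℚ
  s²≡1 = [ (λ eq → trans (cong (λ s → s * s) eq) (ℚ.*-identityˡ 1ℚ)) , (λ eq → cong (λ s → s * s) eq) ]′ s-unit

  ∣s∣≤1 : ∣ s ∣ ≤ 1ℚ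
  ∣s∣≤1 = ℚ.≤-reflexive ([ (λ eq → cong ∣_∣ eq) , (λ eq → cong ∣_∣ eq) ]′ s-unit)

  det : q * p′ - q′ * p ≡ s
  det = trans (sym (trans (ι-+ (+ qₙ ℤ.* pᵢ′) (ℤ.- (+ qₙ′ ℤ.* pᵢ))) (cong₂ _+_ (ι-* (+ qₙ) pᵢ′)
    (trans (ι-neg (+ qₙ′ ℤ.* pᵢ)) (cong -_ (ι-* (+ qₙ′) pᵢ)))))) (cong ι (Frame.det F))

  g₀≤κⁿ : g₀ ≤ κ ^ℚ n
  g₀≤κⁿ = *-cancelˡ Cⁿ (ℚ.<-≤-trans 0<1ℚ 1≤Cⁿ) (ℚ.≤-trans (ℚ.≤-reflexive Cⁿg₀≡1)
    (subst (1ℚ ≤_) (^-distrib-* (ιₙ C) κ n) (1≤^ n 1≤Cκ)))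

  -- The point at which x = q (q T - p) takes the value X.
  point : ℚ → ℚ
  point X = (p + X * c) * c

  -- `evP` is required in every `Module`, so that one identity serves both the zeros, through
  -- `numberModule`, and the heights, through `coefficientModule`.
  module Zone (e₀ : ℚ) (es : List ℚ) (len : length es ≡ n) (e≤S : All (λ e → ∣ e ∣ ≤ S) (e₀ ∷ es))
    (g₀≤ : g₀ ≤ ∣ hornerq (e₀ ∷ es) κ ∣) (P : ℤ[T]) (ε : ℚ)
    (evP : ∀ M i → Evaluation.ev M P i ≡
      ε * Evaluation.Form.A^ M q p q′ p′ (suc n) i + Evaluation.Form.form M q p q′ p′ (e₀ ∷ es) i) where

    open FarZone q p q′ p′ c s κ 0<q cq≡1 refl det ∣s∣≤1 e₀ es n len S ρ 0≤S e≤S ∣κ∣+1≤ρ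
      Λ (subst (λ m → hornerLipschitz S ρ (suc m) ≤ Λ) (sym len) (p≤p+q 0≤1ℚ))
      (hornerq (e₀ ∷ es) κ) g₀ (horner-⌜⌝ (e₀ ∷ es) κ) 0<g₀ g₀≤ δ V 0<δ δ≤1 Λδ≤g₀ Vδ≡2
      P ε (λ z → evalᵍ-form z q p q′ p′ P ε (suc n) (e₀ ∷ es) (evP (numberModule z))) public
      using (x; identity; expanding; no-far-zero; far-zeros-close)

    x-scale : ∀ z w → ‖ x z -ᵍ x w ‖ ≡ (q * q) * ‖ z -ᵍ w ‖
    x-scale z w = trans (cong ‖_‖ (trans
        (solveᵍ 4 (λ q z w p → q :*ᵍ (q :*ᵍ z :-ᵍ p) :-ᵍ q :*ᵍ (q :*ᵍ w :-ᵍ p) :=ᵍ (q :*ᵍ q) :*ᵍ (z :-ᵍ w)) refl ⌜ q ⌝ z w ⌜ p ⌝)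
        (cong (_*ᵍ (z -ᵍ w)) (sym (⌜⌝-* q q)))))
      (trans (‖⌜⌝*‖ (q * q) (z -ᵍ w)) (cong (_* ‖ z -ᵍ w ‖) (ℚ.0≤p⇒∣p∣≡p (*-nonneg (ℚ.<⇒≤ 0<q) (ℚ.<⇒≤ 0<q)))))

    x-real : ∀ t → x ⌜ t ⌝ ≡ ⌜ q * (q * t - p) ⌝
    x-real t = sym (trans (⌜⌝-* q (q * t - p)) (cong (⌜ q ⌝ *ᵍ_) (trans (⌜⌝-+ (q * t) (- p))
      (cong₂ _+ᵍ_ (⌜⌝-* q t) (⌜⌝-neg p)))))

    x-point : ∀ X → q * (q * point X - p) ≡ X
    x-point X = begin
      q * (q * ((p + X * c) * c) - p)
        ≡⟨ solve 4 (λ q p X c → q :* (q :* ((p :+ X :* c) :* c) :- p) := q :* (p :* (c :* q) :- p) :+ X :* (c :* q) :* (c :* q)) refl q p X c ⟩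
      q * (p * (c * q) - p) + X * (c * q) * (c * q)
        ≡⟨ cong (λ z → q * (p * z - p) + X * z * z) cq≡1 ⟩
      q * (p * 1ℚ - p) + X * 1ℚ * 1ℚ
        ≡⟨ solve 3 (λ q p X → q :* (p :* con 1ℚ :- p) :+ X :* con 1ℚ :* con 1ℚ := X) refl q p X ⟩
      X ∎
      where open ≡-Reasoning

    Θ : ℚ → ℚ
    Θ u = ε * c + u * hornerq (e₀ ∷ es) (κ - s * u)

    ψ-real : ∀ u → ψ (horner (e₀ ∷ es)) ⌜ κ ⌝ ⌜ s ⌝ ⌜ u ⌝ ≡ ⌜ u * hornerq (e₀ ∷ es) (κ - s * u) ⌝
    ψ-real u = begin
      ⌜ u ⌝ *ᵍ horner (e₀ ∷ es) (⌜ κ ⌝ -ᵍ ⌜ s ⌝ *ᵍ ⌜ u ⌝)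
        ≡⟨ cong (λ y → ⌜ u ⌝ *ᵍ horner (e₀ ∷ es) y) (sym (trans (⌜⌝-+ κ (- (s * u)))
          (cong (⌜ κ ⌝ +ᵍ_) (trans (⌜⌝-neg (s * u)) (cong ⊖_ (⌜⌝-* s u)))))) ⟩
      ⌜ u ⌝ *ᵍ horner (e₀ ∷ es) ⌜ κ - s * u ⌝
        ≡⟨ cong (⌜ u ⌝ *ᵍ_) (horner-⌜⌝ (e₀ ∷ es) (κ - s * u)) ⟩
      ⌜ u ⌝ *ᵍ ⌜ hornerq (e₀ ∷ es) (κ - s * u) ⌝
        ≡⟨ ⌜⌝-* u (hornerq (e₀ ∷ es) (κ - s * u)) ⟨
      ⌜ u * hornerq (e₀ ∷ es) (κ - s * u) ⌝ ∎
      where open ≡-Reasoning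

    real-identity : ∀ u X → X * u ≡ 1ℚ → q ^ℚ n * (u ^ℚ suc n * evalq P (point X)) ≡ Θ u
    real-identity u X Xu≡1 = cong 𝔾.Re (begin
      ⌜ q ^ℚ n * (u ^ℚ suc n * evalq P (point X)) ⌝
        ≡⟨ trans (⌜⌝-* (q ^ℚ n) (u ^ℚ suc n * evalq P (point X))) (cong (⌜ q ^ℚ n ⌝ *ᵍ_) (trans
          (⌜⌝-* (u ^ℚ suc n) (evalq P (point X))) (cong₂ _*ᵍ_ (⌜⌝-^ u (suc n)) (sym (evalᵍ-evalq P (point X)))))) ⟩
      ⌜ q ^ℚ n ⌝ *ᵍ (⌜ u ⌝ ^ᵍ suc n *ᵍ evalᵍ P ⌜ point X ⌝)
        ≡⟨ identity ⌜ point X ⌝ ⌜ u ⌝ xu≡1 ⟩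
      ⌜ ε * c ⌝ +ᵍ ψ (horner (e₀ ∷ es)) ⌜ κ ⌝ ⌜ s ⌝ ⌜ u ⌝
        ≡⟨ trans (cong (⌜ ε * c ⌝ +ᵍ_) (ψ-real u)) (sym (⌜⌝-+ (ε * c) (u * hornerq (e₀ ∷ es) (κ - s * u)))) ⟩
      ⌜ Θ u ⌝ ∎)
      where
      open ≡-Reasoning
      xu≡1 : x ⌜ point X ⌝ *ᵍ ⌜ u ⌝ ≡ 1ᵍ
      xu≡1 = trans (cong (_*ᵍ ⌜ u ⌝) (trans (x-real (point X)) (cong ⌜_⌝ (x-point X))))
        (trans (sym (⌜⌝-* X u)) (cong ⌜_⌝ Xu≡1))

    -- The bound holds for every approximation, not only in the limit; in (b) it keeps the whole
    -- sequence in the far zone.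
    RealZero : ℚ → ℚ → Set
    RealZero a b = ∃ λ t → eval P (fromℝ t) ≈ℂ 0ℂ × (∀ d → a ≤ d → b ≤ d → ∀ m → seq t m ≤ d)

    -- By `real-identity` the sign of Θ is that of P times a power of u. Since u and u′ have the
    -- same sign, so do their powers, and a sign change of Θ is one of P, possibly reversed.
    sign-change : ∀ u u′ X X′ → X * u ≡ 1ℚ → X′ * u′ ≡ 1ℚ → (0ℚ < u × 0ℚ < u′) ⊎ (u < 0ℚ × u′ < 0ℚ) →
      Θ u ≤ 0ℚ → 0ℚ ≤ Θ u′ → RealZero (point X) (point X′)
    sign-change u u′ X X′ Xu Xu′ signs Θu≤0 0≤Θu′ =
      [ (λ (0<u , 0<u′) → rising (^-pos (suc n) 0<u) (^-pos (suc n) 0<u′))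
      , (λ (u<0 , u′<0) → [ (λ pos → rising (pos u u<0) (pos u′ u′<0)) , (λ neg → falling (neg u u<0) (neg u′ u′<0)) ]′
          (negative-powers (suc n))) ]′ signs
      where
      0<qⁿ : 0ℚ < q ^ℚ n
      0<qⁿ = ^-pos n 0<q
      below : u ^ℚ suc n * evalq P (point X) ≤ 0ℚ
      below = pos-*-≤0 0<qⁿ (subst (_≤ 0ℚ) (sym (real-identity u X Xu)) Θu≤0)
      above : 0ℚ ≤ u′ ^ℚ suc n * evalq P (point X′)
      above = pos-*-≥0 0<qⁿ (subst (0ℚ ≤_) (sym (real-identity u′ X′ Xu′)) 0≤Θu′)
      rising : 0ℚ < u ^ℚ suc n → 0ℚ < u′ ^ℚ suc n → RealZero (point X) (point X′)
      rising pos pos′ = zeroPoint , zeroPoint-zero , zeroPoint-upper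
        where open Bisection P (point X) (point X′) (pos-*-≤0 pos below) (pos-*-≥0 pos′ above)
      falling : u ^ℚ suc n < 0ℚ → u′ ^ℚ suc n < 0ℚ → RealZero (point X) (point X′)
      falling neg neg′ = zeroPoint , zeroPoint-zero , (λ d a≤ b≤ → zeroPoint-upper d b≤ a≤)
        where open Bisection P (point X′) (point X) (neg-*-≥0 neg′ above) (neg-*-≤0 neg below)

    open Zeros P x (q * q) V (*-pos 0<q 0<q) x-scale public

    ξ-x : ∀ z W′ → Eventually (λ m → ‖ x (at z m) ‖ ≤ W′) → Eventually λ m → q * q * ‖ at (fromℝ ξ -ℂ z) m ‖ ≤ ιₙ C + W′
    ξ-x z W′ h = eventually-map step (both near h)
      where
      step : ∀ m → ∣ q * q * seq ξ m - p * q ∣ ≤ ιₙ C × ‖ x (at z m) ‖ ≤ W′ → q * q * ‖ at (fromℝ ξ -ℂ z) m ‖ ≤ ιₙ C + W′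
      step m (near , small) = subst (_≤ ιₙ C + W′) (trans (x-scale ⌜ seq ξ m ⌝ (at z m)) refl)
        (ℚ.≤-trans (‖+‖≤ (x ⌜ seq ξ m ⌝) (⊖ x (at z m))) (ℚ.+-mono-≤
          (subst (_≤ ιₙ C) (sym (trans (cong ‖_‖ (x-real (seq ξ m))) (trans (‖⌜⌝‖ (q * (q * seq ξ m - p)))
            (cong ∣_∣ (solve 3 (λ q x p → q :* (q :* x :- p) := q :* q :* x :- p :* q) refl q (seq ξ m) p))))) near)
          (subst (_≤ W′) (sym (‖-‖ (x (at z m)))) small)))

-- Rounding and height bounds

opaque
  floor-bounds : ∀ x → ∃ λ k → ι k ≤ x × x ≤ ι k + 1ℚ
  floor-bounds x = k , *-cancelʳ (ιₙ d) 0<d lower , *-cancelʳ (ιₙ d) 0<d upper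
    where
    n : ℤ
    n = ℚ.↥ x
    d : ℕ
    d = ℚ.↧ₙ x
    k : ℤ
    k = n ℤ./ + d
    r : ℕ
    r = n ℤ.% + d
    0<d : 0ℚ < ιₙ d
    0<d = ιₙ-pos (ℕ.s≤s ℕ.z≤n)
    xd : x * ιₙ d ≡ ιₙ r + ι k * ιₙ d
    xd = trans (cong (_* ιₙ d) (sym (ℚ.↥p/↧p≡p x))) (trans (/-* n d)
      (trans (cong ι (ℤ.a≡a%n+[a/n]*n n (+ d))) (trans (ι-+ (+ r) (k ℤ.* + d)) (cong (λ z → ιₙ r + z) (ι-* k (+ d))))))
    lower : ι k * ιₙ d ≤ x * ιₙ d
    lower = subst (ι k * ιₙ d ≤_) (sym xd) (q≤p+q (ιₙ-nonneg r))
    upper : x * ιₙ d ≤ (ι k + 1ℚ) * ιₙ d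
    upper = subst₂ _≤_ (sym xd) (solve 2 (λ k d → d :+ k :* d := (k :+ con 1ℚ) :* d) refl (ι k) (ιₙ d))
      (ℚ.+-monoˡ-≤ (ι k * ιₙ d) (ιₙ-mono (ℕ.<⇒≤ (ℤ.n%d<d n (+ d)))))

ι-2 : ι (+ 2) ≡ 1ℚ + 1ℚ
ι-2 = trans (ιₙ-+ 1 1) (cong₂ _+_ ι-1 ι-1)

ι-4 : ι (+ 4) ≡ (1ℚ + 1ℚ) + (1ℚ + 1ℚ)
ι-4 = trans (ιₙ-+ 2 2) (cong₂ _+_ ι-2 ι-2)

-- Take k = - ⌊t/2⌋, which leaves the residue of t modulo 2.
round-even : ∀ t → ∃ λ k → 0ℚ ≤ t + ι (+ 2 ℤ.* k) × t + ι (+ 2 ℤ.* k) ≤ 1ℚ + 1ℚ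
round-even t = ℤ.- k , ≤-via (sym eq) (+-nonneg h₁ h₁) , ℚ.≤-trans (ℚ.≤-reflexive eq)
    (≤-by-difference ((k′ + 1ℚ - ½ * t) + (k′ + 1ℚ - ½ * t)) (+-nonneg h₂ h₂)
      (solve 2 (λ t k → con 1ℚ :+ con 1ℚ := ((con ½ :* t :- k) :+ (con ½ :* t :- k)) :+ ((k :+ con 1ℚ :- con ½ :* t) :+ (k :+ con 1ℚ :- con ½ :* t))) refl t k′))
  where
  k = proj₁ (floor-bounds (½ * t))
  k′ = ι k
  h₁ : 0ℚ ≤ ½ * t - k′
  h₁ = 0≤difference (proj₁ (proj₂ (floor-bounds (½ * t))))
  h₂ : 0ℚ ≤ k′ + 1ℚ - ½ * t
  h₂ = 0≤difference (proj₂ (proj₂ (floor-bounds (½ * t))))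
  ≤-via : ∀ {a b} → a ≡ b → 0ℚ ≤ a → 0ℚ ≤ b
  ≤-via eq = subst (0ℚ ≤_) eq
  eq : t + ι (+ 2 ℤ.* ℤ.- k) ≡ (½ * t - k′) + (½ * t - k′)
  eq = trans (cong (λ z → t + z) (trans (ι-* (+ 2) (ℤ.- k)) (cong₂ _*_ ι-2 (ι-neg k))))
    (solve 2 (λ t k → t :+ (con 1ℚ :+ con 1ℚ) :* (:- k) := (con ½ :* t :- k) :+ (con ½ :* t :- k)) refl t k′)

4ℚ : ℚ
4ℚ = (1ℚ + 1ℚ) + (1ℚ + 1ℚ)

0≤4ℚ : 0ℚ ≤ 4ℚ
0≤4ℚ = +-nonneg (+-nonneg 0≤1ℚ 0≤1ℚ) (+-nonneg 0≤1ℚ 0≤1ℚ)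

¼ : ℚ
¼ = ½ * ½

5ℚ : ℚ
5ℚ = 1ℚ + ((1ℚ + 1ℚ) + (1ℚ + 1ℚ))

-- Subtracting 4 ⌊(t + 1)/4⌋ from t + 1 leaves a number in [0, 4]; the added 2 instead of 1 then
-- gives [1, 5]. The shift by 1 before the floor produces the lower end 1 that `Positive` asks for.
round-last : ∀ t → ∃ λ k → 1ℚ ≤ t + ι (+ 4 ℤ.* k ℤ.+ + 2) × t + ι (+ 4 ℤ.* k ℤ.+ + 2) ≤ 5ℚ
round-last t = ℤ.- k ,
    ≤-by-difference ((h₁′ + h₁′) + (h₁′ + h₁′)) (+-nonneg (+-nonneg h₁ h₁) (+-nonneg h₁ h₁)) (trans eq
      (solve 2 (λ t k → t :+ ((con 1ℚ :+ con 1ℚ) :+ (con 1ℚ :+ con 1ℚ)) :* (:- k) :+ (con 1ℚ :+ con 1ℚ)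
        := con 1ℚ :+ (((con ¼ :* (t :+ con 1ℚ) :- k) :+ (con ¼ :* (t :+ con 1ℚ) :- k)) :+ ((con ¼ :* (t :+ con 1ℚ) :- k) :+ (con ¼ :* (t :+ con 1ℚ) :- k)))) refl t k′)) ,
    ℚ.≤-trans (ℚ.≤-reflexive eq) (≤-by-difference ((h₂′ + h₂′) + (h₂′ + h₂′)) (+-nonneg (+-nonneg h₂ h₂) (+-nonneg h₂ h₂))
      (solve 2 (λ t k → con 5ℚ := (t :+ ((con 1ℚ :+ con 1ℚ) :+ (con 1ℚ :+ con 1ℚ)) :* (:- k) :+ (con 1ℚ :+ con 1ℚ))
        :+ (((k :+ con 1ℚ :- con ¼ :* (t :+ con 1ℚ)) :+ (k :+ con 1ℚ :- con ¼ :* (t :+ con 1ℚ))) :+ ((k :+ con 1ℚ :- con ¼ :* (t :+ con 1ℚ)) :+ (k :+ con 1ℚ :- con ¼ :* (t :+ con 1ℚ))))) refl t k′))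
  where
  k = proj₁ (floor-bounds (¼ * (t + 1ℚ)))
  k′ = ι k
  h₁′ = ¼ * (t + 1ℚ) - k′
  h₂′ = k′ + 1ℚ - ¼ * (t + 1ℚ)
  h₁ : 0ℚ ≤ h₁′
  h₁ = 0≤difference (proj₁ (proj₂ (floor-bounds (¼ * (t + 1ℚ)))))
  h₂ : 0ℚ ≤ h₂′
  h₂ = 0≤difference (proj₂ (proj₂ (floor-bounds (¼ * (t + 1ℚ)))))
  eq : t + ι (+ 4 ℤ.* ℤ.- k ℤ.+ + 2) ≡ t + ((1ℚ + 1ℚ) + (1ℚ + 1ℚ)) * (- k′) + (1ℚ + 1ℚ)
  eq = trans (cong (λ z → t + z) (trans (ι-+ (+ 4 ℤ.* ℤ.- k) (+ 2)) (cong₂ _+_ (trans (ι-* (+ 4) (ℤ.- k)) (cong₂ _*_ ι-4 (ι-neg k))) ι-2)))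
    (sym (ℚ.+-assoc t (((1ℚ + 1ℚ) + (1ℚ + 1ℚ)) * (- k′)) (1ℚ + 1ℚ)))

record Rounding (ts : List ℚ) : Set where
  field
    ys       : List ℤ
    e₀       : ℚ
    es       : List ℚ
    sum≡     : zipWith _+_ ts (map ι ys) ≡ e₀ ∷ es
    lengthʸ  : length ys ≡ length ts
    lengthᵉ  : suc (length es) ≡ length ts
    twiceOdd : TwiceOddLast ys
    positive : Positive (e₀ ∷ es)
    ≤5       : All (λ e → ∣ e ∣ ≤ 5ℚ) (e₀ ∷ es)

rounding : ∀ t ts → Rounding (t ∷ ts)
rounding t [] = record
  { ys = (+ 4 ℤ.* k ℤ.+ + 2) ∷ [] ; e₀ = t + ι (+ 4 ℤ.* k ℤ.+ + 2) ; es = []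
  ; sum≡ = refl ; lengthʸ = refl ; lengthᵉ = refl ; twiceOdd = last k ; positive = last 1≤
  ; ≤5 = subst (_≤ 5ℚ) (sym (ℚ.0≤p⇒∣p∣≡p (ℚ.≤-trans 0≤1ℚ 1≤))) (proj₂ (proj₂ (round-last t))) ∷ [] }
  where
  k = proj₁ (round-last t)
  1≤ : 1ℚ ≤ t + ι (+ 4 ℤ.* k ℤ.+ + 2)
  1≤ = proj₁ (proj₂ (round-last t))
rounding t (t′ ∷ ts) = record
  { ys = + 2 ℤ.* k ∷ ys ; e₀ = t + ι (+ 2 ℤ.* k) ; es = e₀ ∷ es
  ; sum≡ = cong (t + ι (+ 2 ℤ.* k) ∷_) sum≡ ; lengthʸ = cong suc lengthʸ ; lengthᵉ = cong suc lengthᵉ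
  ; twiceOdd = k ∷ twiceOdd ; positive = 0≤ ∷ positive
  ; ≤5 = subst (_≤ 5ℚ) (sym (ℚ.0≤p⇒∣p∣≡p 0≤)) (ℚ.≤-trans (proj₂ (proj₂ (round-even t))) 2≤5) ∷ ≤5 }
  where
  open Rounding (rounding t′ ts)
  k = proj₁ (round-even t)
  0≤ : 0ℚ ≤ t + ι (+ 2 ℤ.* k)
  0≤ = proj₁ (proj₂ (round-even t))
  2≤5 : 1ℚ + 1ℚ ≤ 5ℚ
  2≤5 = ℚ.≤-trans (p≤p+q (+-nonneg 0≤1ℚ 0≤1ℚ)) (q≤p+q 0≤1ℚ)

roundingOf : ∀ ts n → length ts ≡ suc n → Rounding ts
roundingOf (t ∷ ts) n _ = rounding t ts

-- The coefficient list of a Bᵐ.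
spike : ℚ → ℕ → List ℚ
spike a zero    = a ∷ []
spike a (suc m) = 0ℚ ∷ spike a m

length-spike : ∀ a m → length (spike a m) ≡ suc m
length-spike a zero    = refl
length-spike a (suc m) = cong suc (length-spike a m)

hornerq-spike : ∀ a m y → hornerq (spike a m) y ≡ a * y ^ℚ m
hornerq-spike a zero    y = solve 2 (λ a y → a :+ y :* con 0ℚ := a :* con 1ℚ) refl a y
hornerq-spike a (suc m) y = trans (cong (λ z → 0ℚ + y * z) (hornerq-spike a m y))
  (solve 3 (λ a y z → con 0ℚ :+ y :* (a :* z) := a :* (y :* z)) refl a y (y ^ℚ m))

spike-bound : ∀ a m {S} → 0ℚ ≤ S → ∣ a ∣ ≤ S → All (λ e → ∣ e ∣ ≤ S) (spike a m)
spike-bound a zero    0≤S a≤ = a≤ ∷ []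
spike-bound a (suc m) 0≤S a≤ = 0≤S ∷ spike-bound a m 0≤S a≤

form-spike : ∀ M q p q′ p′ a m i → Evaluation.Form.form M q p q′ p′ (spike a m) i ≡ a * Evaluation.lin^ M q′ p′ m i
form-spike M q p q′ p′ a zero i = trans (cong (λ z → a * one i + z) (lin-0 q′ p′ i)) (ℚ.+-identityʳ (a * one i))
  where
  open Evaluation M
  open Form q p q′ p′
form-spike M q p q′ p′ a (suc m) i = begin
  0ℚ * A^ (length (spike a m)) i + B (form (spike a m)) i
    ≡⟨ solve 2 (λ x y → con 0ℚ :* x :+ y := y) refl (A^ (length (spike a m)) i) (B (form (spike a m)) i) ⟩
  B (form (spike a m)) i
    ≡⟨ lin-cong q′ p′ (form-spike M q p q′ p′ a m) i ⟩
  B (λ j → a * lin^ q′ p′ m j) i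
    ≡⟨ cong (λ z → q′ * z - p′ * (a * lin^ q′ p′ m i)) (T-* a (lin^ q′ p′ m) i) ⟩
  q′ * (a * T (lin^ q′ p′ m) i) - p′ * (a * lin^ q′ p′ m i)
    ≡⟨ solve 5 (λ q p a x y → q :* (a :* x) :- p :* (a :* y) := a :* (q :* x :- p :* y)) refl q′ p′ a (T (lin^ q′ p′ m) i) (lin^ q′ p′ m i) ⟩
  a * lin^ q′ p′ (suc m) i ∎
  where
  open Evaluation M
  open Form q p q′ p′
  open ≡-Reasoning

ι-^ : ∀ a n → ι (a ℤ.^ n) ≡ ι a ^ℚ n
ι-^ a zero    = ι-1
ι-^ a (suc n) = trans (ι-* a (a ℤ.^ n)) (cong (ι a *_) (ι-^ a n))

-- Upper and lower bounds for heights

module HeightConstants (C R n : ℕ) (1≤C : 1 ℕ.≤ C) where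
  open Constants C n 1≤C

  -- W₀ q bounds both |q| + |p| and |q′| + |p′|. The first summand of G comes from the form, the
  -- second from ε Aⁿ⁺¹.
  W₀ G : ℚ
  W₀ = ιₙ (suc R) * ιₙ C
  G = S * ιₙ (suc n) * W₀ ^ℚ n + W₀ ^ℚ suc n

  1≤W₀ : 1ℚ ≤ W₀
  1≤W₀ = 1≤* (1≤ιₙ1+ R) (1≤ιₙ 1≤C)

  0≤W₀ : 0ℚ ≤ W₀
  0≤W₀ = ℚ.≤-trans 0≤1ℚ 1≤W₀

  1≤G : 1ℚ ≤ G
  1≤G = ℚ.≤-trans (1≤^ (suc n) 1≤W₀)
    (q≤p+q (*-nonneg (*-nonneg 0≤S (ιₙ-nonneg (suc n))) (^-nonneg n 0≤W₀)))

module Heights {ξ : ℝ} {C R n T : ℕ} (1≤C : 1 ℕ.≤ C) (F : Frame ξ C R n T) where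
  open Analysis 1≤C F
  open HeightConstants C R n 1≤C

  private
    W = W₀ * q
    0≤q : 0ℚ ≤ q
    0≤q = ℚ.<⇒≤ 0<q
    0≤W : 0ℚ ≤ W
    0≤W = *-nonneg 0≤W₀ 0≤q

    sum≤ : ∀ x y → ∣ y ∣ ≤ ιₙ R * x → 0ℚ ≤ x → x ≤ ιₙ C * q → ∣ x ∣ + ∣ y ∣ ≤ W
    sum≤ x y y≤ 0≤x x≤ = ℚ.≤-trans (ℚ.+-mono-≤ (ℚ.≤-reflexive (ℚ.0≤p⇒∣p∣≡p 0≤x)) y≤)
      (ℚ.≤-trans (ℚ.≤-reflexive (trans (solve 2 (λ x r → x :+ r :* x := (con 1ℚ :+ r) :* x) refl x (ιₙ R))
          (cong (_* x) (sym (trans (ιₙ-+ 1 R) (cong (_+ ιₙ R) ι-1))))))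
        (ℚ.≤-trans (*-monoˡ (ιₙ (suc R)) (ιₙ-nonneg (suc R)) x≤) (ℚ.≤-reflexive (sym (ℚ.*-assoc (ιₙ (suc R)) (ιₙ C) q)))))

    ≤W : ∣ q ∣ + ∣ p ∣ ≤ W
    ≤W = sum≤ q p (Frame.∣p∣≤Rq F) 0≤q (subst (_≤ ιₙ C * q) (ℚ.*-identityˡ q) (*-monoʳ q 0≤q (1≤ιₙ 1≤C)))

    ≤W′ : ∣ q′ ∣ + ∣ p′ ∣ ≤ W
    ≤W′ = sum≤ q′ p′ (Frame.∣p′∣≤Rq′ F) (ιₙ-nonneg (Frame.q′ F)) (subst (q′ ≤_) (ιₙ-* C (Frame.q F)) (ιₙ-mono (Frame.q′≤Cq F)))

  1≤qⁿ : 1ℚ ≤ q ^ℚ n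
  1≤qⁿ = 1≤^ n (1≤ιₙ (Frame.1≤q F))

  cⁿqⁿ≡1 : ∀ k → c ^ℚ k * q ^ℚ k ≡ 1ℚ
  cⁿqⁿ≡1 k = trans (sym (^-distrib-* c q k)) (trans (cong (_^ℚ k) cq≡1) (1^ k))

  -- The coefficients of ε Aⁿ⁺¹ are at most c^(n+1) (W₀ q)ⁿ⁺¹ = W₀ⁿ⁺¹, because c = 1/q; the form
  -- contributes the order qⁿ.
  upper : ∀ P ε e₀ es → length es ≡ n → All (λ e → ∣ e ∣ ≤ S) (e₀ ∷ es) → ∣ ε ∣ ≤ c ^ℚ suc n →
    (∀ M i → Evaluation.ev M P i ≡
      ε * Evaluation.Form.A^ M q p q′ p′ (suc n) i + Evaluation.Form.form M q p q′ p′ (e₀ ∷ es) i) →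
    ιₙ (polyHeight P) ≤ G * q ^ℚ n
  upper P ε e₀ es len e≤S ε≤ evP = height-upper P (G * q ^ℚ n) (*-nonneg (ℚ.≤-trans 0≤1ℚ 1≤G) (ℚ.≤-trans 0≤1ℚ 1≤qⁿ)) λ k →
    subst (_≤ G * q ^ℚ n) (cong ∣_∣ (trans (sym (evP coefficientModule k)) (ev-coeff P k)))
      (ℚ.≤-trans (∣p+q∣≤ (ε * lin^ q p (suc n) k) (form (e₀ ∷ es) k) (first k) (second k)) (ℚ.≤-reflexive total))
    where
    open Evaluation coefficientModule
    open Form q p q′ p′
    first : ∀ k → ∣ ε * lin^ q p (suc n) k ∣ ≤ W₀ ^ℚ suc n * q ^ℚ n
    first k = ℚ.≤-trans (∣p*q∣≤ ε (lin^ q p (suc n) k) (^-nonneg (suc n) 0≤W) ε≤ (lin^-bound q p 0≤W ≤W (suc n) k))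
      (ℚ.≤-trans (ℚ.≤-reflexive (trans (cong (c ^ℚ suc n *_) (^-distrib-* W₀ q (suc n)))
          (trans (solve 3 (λ c w q → c :* (w :* q) := w :* (c :* q)) refl (c ^ℚ suc n) (W₀ ^ℚ suc n) (q ^ℚ suc n))
            (trans (cong (W₀ ^ℚ suc n *_) (cⁿqⁿ≡1 (suc n))) (ℚ.*-identityʳ (W₀ ^ℚ suc n))))))
        (a≤ab (^-nonneg (suc n) 0≤W₀) 1≤qⁿ))
    second : ∀ k → ∣ form (e₀ ∷ es) k ∣ ≤ S * ιₙ (suc n) * (W₀ ^ℚ n * q ^ℚ n)
    second k = subst (∣ form (e₀ ∷ es) k ∣ ≤_)
      (trans (cong (λ m → S * ιₙ (suc m) * W ^ℚ m) len) (cong (S * ιₙ (suc n) *_) (^-distrib-* W₀ q n)))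
      (form-bound q p q′ p′ 0≤S 0≤W ≤W ≤W′ e₀ es e≤S k)
    total : W₀ ^ℚ suc n * q ^ℚ n + S * ιₙ (suc n) * (W₀ ^ℚ n * q ^ℚ n) ≡ G * q ^ℚ n
    total = solve 5 (λ w q S m v → w :* q :+ S :* m :* (v :* q) := (S :* m :* v :+ w) :* q) refl
      (W₀ ^ℚ suc n) (q ^ℚ n) S (ιₙ (suc n)) (W₀ ^ℚ n)

  qⁿ≤Cⁿq′ⁿ : q ^ℚ n ≤ Cⁿ * q′ ^ℚ n
  qⁿ≤Cⁿq′ⁿ = subst (q ^ℚ n ≤_) (^-distrib-* (ιₙ C) q′ n)
    (^-mono n 0≤q (subst (q ≤_) (ιₙ-* C (Frame.q′ F)) (ιₙ-mono (Frame.q≤Cq′ F))))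

  -- The coefficient of Tⁿ is at least q′ⁿ, up to an error (n + 1) |p|/q ≤ (n + 1) R from c^(n+1)
  -- Aⁿ⁺¹. The threshold makes this error at most half of q′ⁿ, and q ≤ C q′.
  lower : ∀ P e₀ es → length es ≡ n → Positive (e₀ ∷ es) →
    (∀ M i → Evaluation.ev M P i ≡
      c ^ℚ suc n * Evaluation.Form.A^ M q p q′ p′ (suc n) i + Evaluation.Form.form M q p q′ p′ (e₀ ∷ es) i) →
    (ιₙ (suc n) * ιₙ R + ιₙ (suc n) * ιₙ R) * Cⁿ ≤ q ^ℚ n → q ^ℚ n ≤ (Cⁿ + Cⁿ) * ιₙ (polyHeight P)
  lower P e₀ es len pos evP threshold = ℚ.≤-trans qⁿ≤Cⁿq′ⁿ (ℚ.≤-trans (*-monoˡ Cⁿ 0≤Cⁿ q′ⁿ≤2H)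
      (ℚ.≤-reflexive (solve 2 (λ c h → c :* (h :+ h) := (c :+ c) :* h) refl Cⁿ H)))
    where
    open Evaluation coefficientModule
    open Form q p q′ p′
    H = ιₙ (polyHeight P)
    N = ιₙ (suc n) * ιₙ R
    0≤Cⁿ : 0ℚ ≤ Cⁿ
    0≤Cⁿ = ℚ.≤-trans 0≤1ℚ 1≤Cⁿ
    2N≤q′ⁿ : N + N ≤ q′ ^ℚ n
    2N≤q′ⁿ = *-cancelˡ Cⁿ (ℚ.<-≤-trans 0<1ℚ 1≤Cⁿ)
      (ℚ.≤-trans (ℚ.≤-reflexive (ℚ.*-comm Cⁿ (N + N))) (ℚ.≤-trans threshold qⁿ≤Cⁿq′ⁿ))
    error = c ^ℚ suc n * lin^ q p (suc n) n
    error≤ : ∣ error ∣ ≤ N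
    error≤ = subst (_≤ N) (sym (trans (cong ∣_∣ error≡) (ℚ.∣-p∣≡∣p∣ (ιₙ (suc n) * (c * p)))))
      (∣p*q∣≤ (ιₙ (suc n)) (c * p) (ιₙ-nonneg R) (ℚ.≤-reflexive (ℚ.0≤p⇒∣p∣≡p (ιₙ-nonneg (suc n))))
        (subst (∣ c * p ∣ ≤_) cRq≡R (∣p*q∣≤ c p (*-nonneg (ιₙ-nonneg R) 0≤q) (ℚ.≤-reflexive (ℚ.0≤p⇒∣p∣≡p (ℚ.<⇒≤ 0<c))) (Frame.∣p∣≤Rq F))))
      where
      cRq≡R : c * (ιₙ R * q) ≡ ιₙ R
      cRq≡R = trans (solve 3 (λ c r q → c :* (r :* q) := r :* (c :* q)) refl c (ιₙ R) q)
        (trans (cong (ιₙ R *_) cq≡1) (ℚ.*-identityʳ (ιₙ R)))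
      error≡ : error ≡ - (ιₙ (suc n) * (c * p))
      error≡ = trans (cong (c ^ℚ suc n *_) (lin^-subtop q p n))
        (trans (solve 5 (λ c d m p q → c :* d :* (:- (m :* p :* q)) := :- (m :* (c :* p) :* (d :* q))) refl c (c ^ℚ n) (ιₙ (suc n)) p (q ^ℚ n))
          (cong -_ (trans (cong (ιₙ (suc n) * (c * p) *_) (cⁿqⁿ≡1 n)) (ℚ.*-identityʳ (ιₙ (suc n) * (c * p))))))
    top : q′ ^ℚ n ≤ form (e₀ ∷ es) n
    top = subst (λ m → q′ ^ℚ m ≤ form (e₀ ∷ es) m) len (form-top q p q′ p′ 0≤q (ιₙ-nonneg (Frame.q′ F)) e₀ es pos)
    value≡ : ι (coeff P n) ≡ error + form (e₀ ∷ es) n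
    value≡ = trans (sym (ev-coeff P n)) (evP coefficientModule n)
    q′ⁿ≤H+N : q′ ^ℚ n ≤ H + N
    q′ⁿ≤H+N = ℚ.≤-trans top (≤-by-difference ((H - (error + form (e₀ ∷ es) n)) + (N - - error))
      (+-nonneg (0≤difference (subst (_≤ H) value≡ (ℚ.≤-trans (p≤∣p∣ (ι (coeff P n))) (coeff≤height-ι P n))))
        (0≤difference (ℚ.≤-trans (-p≤∣p∣ error) error≤)))
      (solve 4 (λ H N e f → H :+ N := f :+ ((H :- (e :+ f)) :+ (N :- :- e))) refl H N error (form (e₀ ∷ es) n)))
    q′ⁿ≤2H : q′ ^ℚ n ≤ H + H
    q′ⁿ≤2H = ≤-by-difference ((H + N - q′ ^ℚ n) + (H + N - q′ ^ℚ n) + (q′ ^ℚ n - (N + N)))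
      (+-nonneg (+-nonneg (0≤difference q′ⁿ≤H+N) (0≤difference q′ⁿ≤H+N)) (0≤difference 2N≤q′ⁿ))
      (solve 3 (λ H N x → H :+ H := x :+ ((H :+ N :- x) :+ (H :+ N :- x) :+ (x :- (N :+ N)))) refl H N (q′ ^ℚ n))

-- The algebraic numbers

module RationalNumber {ξ : ℝ} {C R n Y : ℕ} .{{_ : NonZero n}} (1≤C : 1 ℕ.≤ C) (F : Frame ξ C R n Y) where
  open Analysis 1≤C F
  open HeightConstants C R n 1≤C
  open Heights 1≤C F
  open Polynomials F

  private
    K-odd : ¬ + 2 ℤ.∣ + K
    K-odd h = 2∤unit (inj₁ refl) (ℤ.∣m+n∣n⇒∣m (subst (+ 2 ℤ.∣_) (ℤ.pos-+ 1 (2 ℕ.* C)) h)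
      (subst (+ 2 ℤ.∣_) (sym (ℤ.pos-* 2 C)) (ℤ.∣m⇒∣m*n (+ C) ℤ.∣-refl)))

    P = pencil (+ K) K-odd

    m = ℕ.pred n

    sucm≡n : suc m ≡ n
    sucm≡n = ℕ.suc-pred n

    k = ιₙ K

    0<k : 0ℚ < k
    0<k = ιₙ-pos (ℕ.s≤s ℕ.z≤n)

    a = ι (+ 2 ℤ.* (+ K) ℤ.^ n)

    a≡ : a ≡ (1ℚ + 1ℚ) * k ^ℚ n
    a≡ = trans (ι-* (+ 2) ((+ K) ℤ.^ n)) (cong₂ _*_ ι-2 (ι-^ (+ K) n))

    a≤S : ∣ a ∣ ≤ S
    a≤S = ℚ.≤-trans (ℚ.≤-reflexive (trans (ℚ.0≤p⇒∣p∣≡p 0≤a) a≡ιₙ)) (ιₙ-mono (ℕ.m≤n+m (2 ℕ.* K ℕ.^ n) 5))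
      where
      a≡ιₙ : a ≡ ιₙ (2 ℕ.* K ℕ.^ n)
      a≡ιₙ = trans a≡ (sym (trans (ιₙ-* 2 (K ℕ.^ n)) (cong₂ _*_ ι-2 (ιₙ-^ K n))))
      0≤a : 0ℚ ≤ a
      0≤a = subst (0ℚ ≤_) (sym a≡ιₙ) (ιₙ-nonneg (2 ℕ.* K ℕ.^ n))

    -- In `- 1ℚ ∷ es` the head belongs to -Aⁿ and the tail places a = 2 Kⁿ at Bⁿ; the head shifts
    -- the index, hence m = n - 1.
    es = spike a m

    len : length es ≡ n
    len = trans (length-spike a m) sucm≡n

    e≤S : All (λ e → ∣ e ∣ ≤ S) (- 1ℚ ∷ es)
    e≤S = 1≤S ∷ spike-bound a m 0≤S a≤S
      where
      1≤S : ∣ - 1ℚ ∣ ≤ S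
      1≤S = 1≤ιₙ {5 ℕ.+ 2 ℕ.* K ℕ.^ n} (ℕ.s≤s ℕ.z≤n)

    value-at : ∀ y → hornerq (- 1ℚ ∷ es) y ≡ (1ℚ + 1ℚ) * (k * y) ^ℚ n - 1ℚ
    value-at y = begin
      - 1ℚ + y * hornerq es y         ≡⟨ cong (λ z → - 1ℚ + y * z) (hornerq-spike a m y) ⟩
      - 1ℚ + y * (a * y ^ℚ m)         ≡⟨ solve 3 (λ y a z → (:- con 1ℚ) :+ y :* (a :* z) := a :* (y :* z) :- con 1ℚ) refl y a (y ^ℚ m) ⟩
      a * y ^ℚ suc m - 1ℚ             ≡⟨ cong₂ (λ b i → b * y ^ℚ i - 1ℚ) a≡ sucm≡n ⟩
      (1ℚ + 1ℚ) * k ^ℚ n * y ^ℚ n - 1ℚ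
        ≡⟨ cong (_- 1ℚ) (trans (ℚ.*-assoc (1ℚ + 1ℚ) (k ^ℚ n) (y ^ℚ n)) (cong ((1ℚ + 1ℚ) *_) (sym (^-distrib-* k y n)))) ⟩
      (1ℚ + 1ℚ) * (k * y) ^ℚ n - 1ℚ   ∎
      where open ≡-Reasoning

    C≤k : ιₙ C + 1ℚ ≤ k
    C≤k = subst (_≤ k) (trans (ιₙ-+ C 1) (cong (λ z → ιₙ C + z) ι-1))
      (ιₙ-mono (ℕ.≤-trans (ℕ.≤-reflexive (ℕ.+-comm C 1)) (ℕ.s≤s (ℕ.m≤m+n C (C ℕ.+ 0)))))

    0<κ : 0ℚ < κ
    0<κ = *-pos (ιₙ-pos (Frame.1≤q′ F)) 0<c

    1+κ≤kκ : 1ℚ + κ ≤ k * κ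
    1+κ≤kκ = ℚ.≤-trans (ℚ.+-monoˡ-≤ κ 1≤Cκ) (ℚ.≤-trans
      (ℚ.≤-reflexive (solve 2 (λ C κ → C :* κ :+ κ := (C :+ con 1ℚ) :* κ) refl (ιₙ C) κ)) (*-monoʳ κ 0≤κ C≤k))

    g₀≤ : g₀ ≤ ∣ hornerq (- 1ℚ ∷ es) κ ∣
    g₀≤ = ℚ.≤-trans (ℚ.≤-trans (a≤ab (ℚ.<⇒≤ 0<g₀) 1≤Cⁿ) (ℚ.≤-reflexive (trans (ℚ.*-comm g₀ Cⁿ) Cⁿg₀≡1)))
      (ℚ.≤-trans (≤-by-difference (((k * κ) ^ℚ n - 1ℚ) + ((k * κ) ^ℚ n - 1ℚ)) (+-nonneg h h)
          (trans (value-at κ) (solve 1 (λ x → (con 1ℚ :+ con 1ℚ) :* x :- con 1ℚ := con 1ℚ :+ ((x :- con 1ℚ) :+ (x :- con 1ℚ))) refl ((k * κ) ^ℚ n))))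
        (p≤∣p∣ (hornerq (- 1ℚ ∷ es) κ)))
      where
      h : 0ℚ ≤ (k * κ) ^ℚ n - 1ℚ
      h = 0≤difference (1≤^ n (ℚ.≤-trans (p≤p+q 0≤κ) 1+κ≤kκ))

    evP : ∀ M i → Evaluation.ev M P i ≡
      0ℚ * Evaluation.Form.A^ M q p q′ p′ (suc n) i + Evaluation.Form.form M q p q′ p′ (- 1ℚ ∷ es) i
    evP M i = begin
      ev P i
        ≡⟨ ev-+ (map (+ 2 ℤ.* (+ K) ℤ.^ n ℤ.*_) L′) (map (-[1+ 0 ] ℤ.*_) L) i ⟩
      ev (map (+ 2 ℤ.* (+ K) ℤ.^ n ℤ.*_) L′) i + ev (map (-[1+ 0 ] ℤ.*_) L) i
        ≡⟨ cong₂ _+_ (trans (ev-map (+ 2 ℤ.* (+ K) ℤ.^ n) L′ i) (cong (a *_) (ev-linear^ (+ Frame.q′ F) (Frame.p′ F) n i)))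
          (trans (ev-map -[1+ 0 ] L i) (cong₂ _*_ (trans (ι-neg (+ 1)) (cong -_ ι-1)) (ev-linear^ (+ Frame.q F) (Frame.p F) n i))) ⟩
      a * lin^ q′ p′ n i + (- 1ℚ) * lin^ q p n i
        ≡⟨ solve 3 (λ x y z → x :+ (:- con 1ℚ) :* y := con 0ℚ :* z :+ ((:- con 1ℚ) :* y :+ x)) refl
          (a * lin^ q′ p′ n i) (lin^ q p n i) (A^ (suc n) i) ⟩
      0ℚ * A^ (suc n) i + ((- 1ℚ) * lin^ q p n i + a * lin^ q′ p′ n i)
        ≡⟨ cong₂ (λ j z → 0ℚ * A^ (suc n) i + ((- 1ℚ) * lin^ q p j i + z)) (sym len) (sym spike≡) ⟩
      0ℚ * A^ (suc n) i + form (- 1ℚ ∷ es) i ∎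
      where
      open Evaluation M
      open Form q p q′ p′
      open ≡-Reasoning
      L′ = linear^ (+ Frame.q′ F) (Frame.p′ F) n
      L = linear^ (+ Frame.q F) (Frame.p F) n
      spike≡ : B (form es) i ≡ a * lin^ q′ p′ n i
      spike≡ = trans (lin-cong q′ p′ (form-spike M q p q′ p′ a m) i)
        (trans (cong (λ z → q′ * z - p′ * (a * lin^ q′ p′ m i)) (T-* a (lin^ q′ p′ m) i))
          (trans (solve 5 (λ q p a x y → q :* (a :* x) :- p :* (a :* y) := a :* (q :* x :- p :* y)) refl
              q′ p′ a (T (lin^ q′ p′ m) i) (lin^ q′ p′ m i))
            (cong (λ j → a * lin^ q′ p′ j i) sucm≡n)))

    open Zone (- 1ℚ) es len e≤S g₀≤ P 0ℚ evP

    -- E(0) = -1 and E(1/K) = 1, at u = sκ and u = s(κ - 1/K).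
    invert : ∀ {y} → 0ℚ < y → ∃ λ X → X * (s * y) ≡ 1ℚ
    invert {y} 0<y = s * r , trans (solve 3 (λ s r y → s :* r :* (s :* y) := (s :* s) :* (y :* r)) refl s r y)
      (trans (cong₂ _*_ s²≡1 (proj₂ (proj₂ (reciprocal 0<y)))) (ℚ.*-identityˡ 1ℚ))
      where r = proj₁ (reciprocal 0<y)

    k⁻¹ = proj₁ (reciprocal 0<k)

    kk⁻¹≡1 : k * k⁻¹ ≡ 1ℚ
    kk⁻¹≡1 = proj₂ (proj₂ (reciprocal 0<k))

    d = κ - k⁻¹

    0<d : 0ℚ < d
    0<d = *-cancel-<ˡ k 0<k (subst₂ _<_ (sym (ℚ.*-zeroʳ k))
      (sym (trans (solve 3 (λ k κ i → k :* (κ :- i) := k :* κ :- k :* i) refl k κ k⁻¹) (cong (λ z → k * κ - z) kk⁻¹≡1)))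
      (0<difference {1ℚ} {k * κ} (ℚ.<-≤-trans (<-by-difference {1ℚ} {1ℚ + κ} κ 0<κ refl) 1+κ≤kκ)))

    -- As s² = 1, the substitution u = s y turns κ - s u into κ - y for either sign of the
    -- determinant.
    Θ-value : ∀ y w v → κ - y ≡ w → hornerq (- 1ℚ ∷ es) w ≡ v → Θ (s * y) ≡ s * y * v
    Θ-value y w v eq val = trans (cong₂ _+_ (ℚ.*-zeroˡ c) (cong (s * y *_) (trans (cong (hornerq (- 1ℚ ∷ es))
        (trans (solve 3 (λ κ s y → κ :- s :* (s :* y) := κ :- (s :* s) :* y) refl κ s y)
          (trans (cong (λ z → κ - z * y) s²≡1) (trans (cong (λ z → κ - z) (ℚ.*-identityˡ y)) eq)))) val)))
      (ℚ.+-identityˡ (s * y * v))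

    Θκ : Θ (s * κ) ≡ s * κ * - 1ℚ
    Θκ = Θ-value κ 0ℚ (- 1ℚ) (ℚ.+-inverseʳ κ)
      (trans (cong (λ z → - 1ℚ + z) (ℚ.*-zeroˡ (hornerq es 0ℚ))) (ℚ.+-identityʳ (- 1ℚ)))

    Θd : Θ (s * d) ≡ s * d * 1ℚ
    Θd = Θ-value d k⁻¹ 1ℚ (solve 2 (λ κ i → κ :- (κ :- i) := i) refl κ k⁻¹)
      (trans (value-at k⁻¹) (cong (λ z → (1ℚ + 1ℚ) * z - 1ℚ) (trans (cong (_^ℚ n) kk⁻¹≡1) (1^ n))))

    1*pos : ∀ {y} → s ≡ 1ℚ → 0ℚ < y → 0ℚ < s * y
    1*pos {y} s≡1 0<y = subst (0ℚ <_) (sym (trans (cong (_* y) s≡1) (ℚ.*-identityˡ y))) 0<y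

    -1*pos : ∀ {y} → s ≡ - 1ℚ → 0ℚ < y → s * y < 0ℚ
    -1*pos {y} s≡-1 0<y = subst (_< 0ℚ) (sym (trans (cong (_* y) s≡-1) (solve 1 (λ y → (:- con 1ℚ) :* y := :- y) refl y)))
      (ℚ.neg-antimono-< 0<y)

    negated : ∀ x → - x ≡ x * - 1ℚ
    negated = solve 1 (λ x → :- x := x :* (:- con 1ℚ)) refl

    zero-of-pencil : ∃ λ t → eval P (fromℝ t) ≈ℂ 0ℂ
    zero-of-pencil = [ (λ s≡1 → forget (sign-change (s * κ) (s * d) (proj₁ Xκ) (proj₁ Xd) (proj₂ Xκ) (proj₂ Xd)
          (inj₁ (1*pos s≡1 0<κ , 1*pos s≡1 0<d))
          (subst (_≤ 0ℚ) (trans (negated (s * κ)) (sym Θκ)) (ℚ.neg-antimono-≤ (ℚ.<⇒≤ (1*pos s≡1 0<κ))))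
          (subst (0ℚ ≤_) (trans (sym (ℚ.*-identityʳ (s * d))) (sym Θd)) (ℚ.<⇒≤ (1*pos s≡1 0<d)))))
      , (λ s≡-1 → forget (sign-change (s * d) (s * κ) (proj₁ Xd) (proj₁ Xκ) (proj₂ Xd) (proj₂ Xκ)
          (inj₂ (-1*pos s≡-1 0<d , -1*pos s≡-1 0<κ))
          (subst (_≤ 0ℚ) (trans (sym (ℚ.*-identityʳ (s * d))) (sym Θd)) (ℚ.<⇒≤ (-1*pos s≡-1 0<d)))
          (subst (0ℚ ≤_) (trans (negated (s * κ)) (sym Θκ)) (ℚ.neg-antimono-≤ (ℚ.<⇒≤ (-1*pos s≡-1 0<κ)))))) ]′ s-unit
      where
      Xκ = invert 0<κ
      Xd = invert 0<d
      forget : ∀ {a b} → RealZero a b → ∃ λ t → eval P (fromℝ t) ≈ℂ 0ℂ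
      forget (t , Pt≈0 , _) = t , Pt≈0

  opaque
    number : AlgebraicNumber
    number = record
      { value = fromℝ (proj₁ zero-of-pencil) ; minPoly = P
      ; irreducible = pencil-irreducible (+ K) K-odd ; isRoot = proj₂ zero-of-pencil }

    number-degree : Degree number n
    number-degree = (λ eq → pencil-odd (+ K) K-odd (subst (+ 2 ℤ.∣_) (sym eq) (∣0 (+ 2)))) , pencil-above (+ K) K-odd

    height-≤ : ιₙ (height number) ≤ G * q ^ℚ n
    height-≤ = upper P 0ℚ (- 1ℚ) es len e≤S (^-nonneg (suc n) (ℚ.<⇒≤ 0<c)) evP

    -- The leading coefficient 2 (K q′)ⁿ - qⁿ is at least qⁿ because q ≤ C q′ ≤ K q′. The weaker
    -- factor 2 Cⁿ is the one shared with (b).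
    height-≥ : q ^ℚ n ≤ (Cⁿ + Cⁿ) * ιₙ (height number)
    height-≥ = ℚ.≤-trans qⁿ≤H (subst (_≤ (Cⁿ + Cⁿ) * H) (ℚ.*-identityˡ H)
      (*-monoʳ H (ιₙ-nonneg (polyHeight P)) (ℚ.≤-trans 1≤Cⁿ (p≤p+q (ℚ.≤-trans 0≤1ℚ 1≤Cⁿ)))))
      where
      H : ℚ
      H = ιₙ (polyHeight P)
      leading : ι (coeff P n) ≡ (1ℚ + 1ℚ) * (k * q′) ^ℚ n - q ^ℚ n
      leading = trans (cong ι (pencil-leading (+ K) K-odd)) (trans
        (ι-+ (+ 2 ℤ.* (+ K) ℤ.^ n ℤ.* (+ Frame.q′ F) ℤ.^ n) (ℤ.- ((+ Frame.q F) ℤ.^ n)))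
        (cong₂ _+_
          (trans (ι-* (+ 2 ℤ.* (+ K) ℤ.^ n) ((+ Frame.q′ F) ℤ.^ n)) (trans (cong₂ _*_ a≡ (ι-^ (+ Frame.q′ F) n))
            (trans (ℚ.*-assoc (1ℚ + 1ℚ) (k ^ℚ n) (q′ ^ℚ n)) (cong ((1ℚ + 1ℚ) *_) (sym (^-distrib-* k q′ n))))))
          (trans (ι-neg ((+ Frame.q F) ℤ.^ n)) (cong -_ (ι-^ (+ Frame.q F) n)))))
      q≤kq′ : q ≤ k * q′
      q≤kq′ = ℚ.≤-trans (subst (q ≤_) (ιₙ-* C (Frame.q′ F)) (ιₙ-mono (Frame.q≤Cq′ F)))
        (*-monoʳ q′ (ιₙ-nonneg (Frame.q′ F)) (ℚ.≤-trans (p≤p+q {ιₙ C} {1ℚ} 0≤1ℚ) C≤k))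
      h : 0ℚ ≤ (k * q′) ^ℚ n - q ^ℚ n
      h = 0≤difference (^-mono n (ℚ.<⇒≤ 0<q) q≤kq′)
      qⁿ≤H : q ^ℚ n ≤ H
      qⁿ≤H = ℚ.≤-trans (≤-by-difference (((k * q′) ^ℚ n - q ^ℚ n) + ((k * q′) ^ℚ n - q ^ℚ n)) (+-nonneg h h)
          (trans leading (solve 2 (λ x y → (con 1ℚ :+ con 1ℚ) :* x :- y := y :+ ((x :- y) :+ (x :- y))) refl ((k * q′) ^ℚ n) (q ^ℚ n))))
        (ℚ.≤-trans (p≤∣p∣ (ι (coeff P n))) (coeff≤height-ι P n))

    conjugate-near : ∀ z → Conjugate number z → Eventually λ i → q * q * ‖ at (fromℝ ξ -ℂ z) i ‖ ≤ ιₙ C + V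
    conjugate-near z Pz≈0 = ξ-x z V (zeros-near η 0<η far z Pz≈0)
      where
      2qⁿ : ℚ
      2qⁿ = q ^ℚ n + q ^ℚ n
      0<2qⁿ : 0ℚ < 2qⁿ
      0<2qⁿ = +-pos (^-pos n 0<q) (^-pos n 0<q)
      -- `no-far-zero` bounds 2 qⁿ ‖P‖ from below by g₀.
      η : ℚ
      η = proj₁ (quotient g₀ 0<2qⁿ 0<g₀)
      0<η : 0ℚ < η
      0<η = proj₁ (proj₂ (quotient g₀ 0<2qⁿ 0<g₀))
      far : ∀ z → V ≤ ‖ x z ‖ → η ≤ ‖ evalᵍ P z ‖
      far z V≤ = *-cancelˡ 2qⁿ 0<2qⁿ (ℚ.≤-trans (ℚ.≤-reflexive (proj₂ (proj₂ (quotient g₀ 0<2qⁿ 0<g₀))))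
        (ℚ.≤-trans (no-far-zero refl z V≤) (ℚ.≤-reflexive (sym (ℚ.*-distribʳ-+ (‖ evalᵍ P z ‖) (q ^ℚ n) (q ^ℚ n))))))

    result : ∃ λ α → Degree α n × q ^ℚ n ≤ (Cⁿ + Cⁿ) * ιₙ (height α) × ιₙ (height α) ≤ G * q ^ℚ n ×
      (∀ z → Conjugate α z → Eventually λ i → q * q * ‖ at (fromℝ ξ -ℂ z) i ‖ ≤ ιₙ C + V)
    result = number , number-degree , height-≥ , height-≤ , conjugate-near

-- The first threshold lets the height dominate the disturbance by Aⁿ⁺¹. The second makes ε so small
-- that ε c + ψ is already nonpositive at u = -δ/2.
module MonicNumber {ξ : ℝ} {C R n Y : ℕ} (1≤C : 1 ℕ.≤ C) (F : Frame ξ C R n Y)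
  (threshold₁ : (ιₙ (suc n) * ιₙ R + ιₙ (suc n) * ιₙ R) * (ιₙ C ^ℚ n) ≤ ιₙ (Frame.q F) ^ℚ n)
  (threshold₂ : 4ℚ * (Constants.D C n 1≤C * (ιₙ C ^ℚ n)) ≤ ιₙ (Frame.q F) ^ℚ n) where
  open Analysis 1≤C F
  open HeightConstants C R n 1≤C
  open Heights 1≤C F
  open Polynomials F

  private
    r x₀ y₀ : ℚ
    r = c * p
    -- Cramer's rule for T = x₀ A + y₀ B; the determinant s is its own inverse.
    x₀ = s * p′
    y₀ = - (s * p)

    ts = map (r *_) (powerSum x₀ y₀ c n)

    open Rounding (roundingOf ts n (trans (length-map (r *_) (powerSum x₀ y₀ c n)) (length-powerSum x₀ y₀ c n)))

    length-ts : length ts ≡ suc n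
    length-ts = trans (length-map (r *_) (powerSum x₀ y₀ c n)) (length-powerSum x₀ y₀ c n)

    len : length es ≡ n
    len = ℕ.suc-injective (trans lengthᵉ length-ts)

    length-ys : length ys ≡ suc n
    length-ys = trans lengthʸ length-ts

    Q = monic ys length-ys twiceOdd
    ε = c ^ℚ suc n

    0<ε : 0ℚ < ε
    0<ε = ^-pos (suc n) 0<c

    e≤S : All (λ e → ∣ e ∣ ≤ S) (e₀ ∷ es)
    e≤S = All.map (λ h → ℚ.≤-trans h 5≤S) ≤5
      where
      5≤S : 5ℚ ≤ S
      5≤S = subst (_≤ S) (trans (ιₙ-+ 1 4) (cong₂ _+_ ι-1 ι-4)) (ιₙ-mono (ℕ.m≤m+n 5 (2 ℕ.* K ℕ.^ n)))

    g₀≤ : g₀ ≤ ∣ hornerq (e₀ ∷ es) κ ∣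
    g₀≤ = ℚ.≤-trans g₀≤κⁿ (ℚ.≤-trans (subst (λ m → κ ^ℚ m ≤ hornerq (e₀ ∷ es) κ) len (hornerq-positive 0≤κ e₀ es positive))
      (p≤∣p∣ (hornerq (e₀ ∷ es) κ)))

    evQ : ∀ M i → Evaluation.ev M Q i ≡
      ε * Evaluation.Form.A^ M q p q′ p′ (suc n) i + Evaluation.Form.form M q p q′ p′ (e₀ ∷ es) i
    evQ M i = begin
      ev Q i
        ≡⟨ ev-+ (T^ (suc n)) (form′ ys) i ⟩
      ev (T^ (suc n)) i + ev (form′ ys) i
        ≡⟨ cong₂ _+_ (T-power {x₀} {y₀} {c} {r} cq≡1 refl xy₁ xy₀ n i) (ev-formₚ (+ Frame.q F) (Frame.p F) (+ Frame.q′ F) (Frame.p′ F) M ys i) ⟩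
      ε * A^ (suc n) i + r * form (powerSum x₀ y₀ c n) i + form (map ι ys) i
        ≡⟨ cong (λ z → ε * A^ (suc n) i + z + form (map ι ys) i) (form-scale r (powerSum x₀ y₀ c n) i) ⟩
      ε * A^ (suc n) i + form ts i + form (map ι ys) i
        ≡⟨ ℚ.+-assoc (ε * A^ (suc n) i) (form ts i) (form (map ι ys) i) ⟩
      ε * A^ (suc n) i + (form ts i + form (map ι ys) i)
        ≡⟨ cong (λ z → ε * A^ (suc n) i + z) (sym (form-zipWith ts (map ι ys) (trans (sym lengthʸ) (sym (length-map ι ys))) i)) ⟩
      ε * A^ (suc n) i + form (zipWith _+_ ts (map ι ys)) i
        ≡⟨ cong (λ es → ε * A^ (suc n) i + form es i) sum≡ ⟩
      ε * A^ (suc n) i + form (e₀ ∷ es) i ∎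
      where
      open Evaluation M
      open Form q p q′ p′
      open ≡-Reasoning
      xy₁ : x₀ * q + y₀ * q′ ≡ 1ℚ
      xy₁ = trans (solve 5 (λ s r p q t → s :* r :* q :+ (:- (s :* p)) :* t := s :* (q :* r :- t :* p)) refl s p′ p q q′)
        (trans (cong (s *_) det) s²≡1)
      xy₀ : x₀ * p + y₀ * p′ ≡ 0ℚ
      xy₀ = solve 3 (λ s r p → s :* r :* p :+ (:- (s :* p)) :* r := con 0ℚ) refl s p′ p

    open Zone e₀ es len e≤S g₀≤ Q ε evQ

    E : ℚ → ℚ
    E = hornerq (e₀ ∷ es)

    0≤εc : 0ℚ ≤ ε * c
    0≤εc = *-nonneg (ℚ.<⇒≤ 0<ε) (ℚ.<⇒≤ 0<c)

    0<εc : 0ℚ < ε * c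
    0<εc = *-pos 0<ε 0<c

    c^≤1 : ∀ j → c ^ℚ j ≤ 1ℚ
    c^≤1 j = subst (c ^ℚ j ≤_) (1^ j) (^-mono j (ℚ.<⇒≤ 0<c) c≤1)

    εc≤cⁿ : ε * c ≤ c ^ℚ n
    εc≤cⁿ = ℚ.≤-trans (*-mono (ℚ.<⇒≤ 0<ε) 0≤1ℚ
      (subst (c ^ℚ suc n ≤_) (ℚ.*-identityˡ (c ^ℚ n)) (*-monoʳ (c ^ℚ n) (^-nonneg n (ℚ.<⇒≤ 0<c)) c≤1)) c≤1)
      (ℚ.≤-reflexive (ℚ.*-identityʳ (c ^ℚ n)))

    -- ε c = q⁻ⁿ⁻² ≤ q⁻ⁿ, and the second threshold bounds 4 q⁻ⁿ by 1/(D Cⁿ) = δ g₀.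
    4εc≤δg₀ : 4ℚ * (ε * c) ≤ δ * g₀
    4εc≤δg₀ = *-cancelˡ (D * Cⁿ) (*-pos 0<D (ℚ.<-≤-trans 0<1ℚ 1≤Cⁿ)) (ℚ.≤-trans
      (ℚ.≤-trans (*-monoˡ (D * Cⁿ) 0≤DCⁿ (*-monoˡ 4ℚ 0≤4ℚ εc≤cⁿ))
        (ℚ.≤-trans (ℚ.≤-reflexive (solve 3 (λ d f c → d :* (f :* c) := c :* (f :* d)) refl (D * Cⁿ) 4ℚ (c ^ℚ n)))
          (*-monoˡ (c ^ℚ n) (^-nonneg n (ℚ.<⇒≤ 0<c)) threshold₂)))
      (ℚ.≤-reflexive (trans (cⁿqⁿ≡1 n) (sym (trans (solve 4 (λ d c e g → d :* c :* (e :* g) := (d :* e) :* (c :* g)) refl D Cⁿ δ g₀)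
        (trans (cong₂ _*_ Dδ≡1 Cⁿg₀≡1) (ℚ.*-identityˡ 1ℚ)))))))
      where
      0≤DCⁿ : 0ℚ ≤ D * Cⁿ
      0≤DCⁿ = *-nonneg (ℚ.<⇒≤ 0<D) (ℚ.≤-trans 0≤1ℚ 1≤Cⁿ)

    ½δ = ½ * δ

    0<½δ : 0ℚ < ½δ
    0<½δ = *-pos 0<½ 0<δ

    ½δ≤δ : ½δ ≤ δ
    ½δ≤δ = ≤-by-difference ½δ (ℚ.<⇒≤ 0<½δ) (sym (½+½ δ))

    s*≤ : ∀ u → 0ℚ ≤ u → ∣ s * - u ∣ ≤ u
    s*≤ u 0≤u = ℚ.≤-trans (∣p*q∣≤ s (- u) 0≤u ∣s∣≤1 (ℚ.≤-reflexive (trans (ℚ.∣-p∣≡∣p∣ u) (ℚ.0≤p⇒∣p∣≡p 0≤u))))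
      (ℚ.≤-reflexive (ℚ.*-identityˡ u))

    -- Where ε + ψ changes sign: at u₁ = -δ/2 because ε is small against ψ, and near
    -- 0 at u₂ = -η because ψ is small against ε.
    u₁ = - ½δ
    y₁ = κ - s * u₁

    Vu₁≡1 : (- V) * u₁ ≡ 1ℚ
    Vu₁≡1 = trans (solve 3 (λ v h d → (:- v) :* (:- (h :* d)) := h :* (v :* d)) refl V ½ δ) (trans (cong (½ *_) Vδ≡2) refl)

    δ≤κ : δ ≤ κ
    δ≤κ = *-cancelˡ (ιₙ C) (ιₙ-pos 1≤C) (ℚ.≤-trans Cδ≤1 1≤Cκ)

    0≤y₁ : 0ℚ ≤ y₁
    0≤y₁ = 0≤difference (ℚ.≤-trans (∣p∣-upper (s*≤ ½δ (ℚ.<⇒≤ 0<½δ))) (ℚ.≤-trans ½δ≤δ δ≤κ))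

    0≤E : 0ℚ ≤ E y₁
    0≤E = ℚ.≤-trans (^-nonneg (length es) 0≤y₁) (hornerq-positive 0≤y₁ e₀ es positive)

    -- `expanding` between u₁ and 0, where ψ vanishes, reads as the lower bound g₀/2 for E(y₁).
    g₀½δ≤ : g₀ * ½δ ≤ ½δ * E y₁ + ½δ * E y₁
    g₀½δ≤ = subst₂ _≤_ (cong (g₀ *_) (trans (cong ‖_‖ u₁-0) (trans (‖⌜⌝‖ u₁) ∣u₁∣))) (cong (λ z → z + z) ψ-norm)
      (expanding ⌜ u₁ ⌝ 0ᵍ (subst (_≤ δ) (sym (trans (‖⌜⌝‖ u₁) ∣u₁∣)) ½δ≤δ) (ℚ.<⇒≤ 0<δ))
      where
      ∣u₁∣ : ∣ u₁ ∣ ≡ ½δ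
      ∣u₁∣ = trans (ℚ.∣-p∣≡∣p∣ ½δ) (ℚ.0≤p⇒∣p∣≡p (ℚ.<⇒≤ 0<½δ))
      u₁-0 : ⌜ u₁ ⌝ -ᵍ 0ᵍ ≡ ⌜ u₁ ⌝
      u₁-0 = solveᵍ 1 (λ u → u :-ᵍ conᵍ 0ᵍ :=ᵍ u) refl ⌜ u₁ ⌝
      Ψ = ψ (horner (e₀ ∷ es)) ⌜ κ ⌝ ⌜ s ⌝
      Ψ0≡0 : Ψ 0ᵍ ≡ 0ᵍ
      Ψ0≡0 = *ᵍ-zeroˡ (horner (e₀ ∷ es) (⌜ κ ⌝ -ᵍ ⌜ s ⌝ *ᵍ 0ᵍ))
      ψ-norm : ‖ Ψ ⌜ u₁ ⌝ -ᵍ Ψ 0ᵍ ‖ ≡ ½δ * E y₁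
      ψ-norm = trans (cong ‖_‖ (trans (cong₂ _-ᵍ_ (ψ-real u₁) Ψ0≡0)
          (solveᵍ 1 (λ u → u :-ᵍ conᵍ 0ᵍ :=ᵍ u) refl ⌜ u₁ * E y₁ ⌝)))
        (trans (‖⌜⌝‖ (u₁ * E y₁)) (trans (ℚ.∣p*q∣≡∣p∣*∣q∣ u₁ (E y₁)) (cong₂ _*_ ∣u₁∣ (ℚ.0≤p⇒∣p∣≡p 0≤E))))

    Θ₁≤0 : Θ u₁ ≤ 0ℚ
    Θ₁≤0 = *-cancelˡ 4ℚ (ℚ.<-≤-trans 0<1ℚ (ℚ.≤-trans (p≤p+q 0≤1ℚ) (p≤p+q (+-nonneg 0≤1ℚ 0≤1ℚ)))) (≤-by-difference
      ((δ * g₀ - 4ℚ * (ε * c)) + ((½δ * E y₁ + ½δ * E y₁ - g₀ * ½δ) + (½δ * E y₁ + ½δ * E y₁ - g₀ * ½δ)))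
      (+-nonneg (0≤difference 4εc≤δg₀) (+-nonneg (0≤difference g₀½δ≤) (0≤difference g₀½δ≤)))
      (solve 4 (λ e d g E → con 4ℚ :* con 0ℚ := con 4ℚ :* (e :+ (:- (con ½ :* d)) :* E) :+ ((d :* g :- con 4ℚ :* e) :+
        ((con ½ :* d :* E :+ con ½ :* d :* E :- g :* (con ½ :* d)) :+ (con ½ :* d :* E :+ con ½ :* d :* E :- g :* (con ½ :* d))))) refl
        (ε * c) δ g₀ (E y₁)))

    0<HB : 0ℚ < HB
    0<HB = ℚ.<-≤-trans 0<1ℚ 1≤HB

    -- η = ε c δ/(2 HB) gives η E(y₂) ≤ ε c, and η ≤ δ/2 because ε c ≤ 1 ≤ HB. The second bound
    -- keeps y₂ in the disc of radius ρ and gives 1/η ≥ V.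
    solution = quotient (ε * c * ½δ) 0<HB (*-pos 0<εc 0<½δ)
    η = proj₁ solution

    0<η : 0ℚ < η
    0<η = proj₁ (proj₂ solution)

    HBη≡ : HB * η ≡ ε * c * ½δ
    HBη≡ = proj₂ (proj₂ solution)

    εc≤1 : ε * c ≤ 1ℚ
    εc≤1 = ℚ.≤-trans εc≤cⁿ (c^≤1 n)

    η≤½δ : η ≤ ½δ
    η≤½δ = ℚ.≤-trans (subst (_≤ HB * η) (ℚ.*-identityˡ η) (*-monoʳ η (ℚ.<⇒≤ 0<η) 1≤HB))
      (ℚ.≤-trans (ℚ.≤-reflexive HBη≡) (ℚ.≤-trans (*-monoʳ ½δ (ℚ.<⇒≤ 0<½δ) εc≤1) (ℚ.≤-reflexive (ℚ.*-identityˡ ½δ))))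

    u₂ = - η
    y₂ = κ - s * u₂
    X = proj₁ (reciprocal 0<η)

    0<X : 0ℚ < X
    0<X = proj₁ (proj₂ (reciprocal 0<η))

    ηX≡1 : η * X ≡ 1ℚ
    ηX≡1 = proj₂ (proj₂ (reciprocal 0<η))

    Xu₂≡1 : (- X) * u₂ ≡ 1ℚ
    Xu₂≡1 = trans (solve 2 (λ x e → (:- x) :* (:- e) := e :* x) refl X η) ηX≡1

    V≤X : V ≤ X
    V≤X = *-cancelˡ η 0<η (ℚ.≤-trans (*-monoʳ V (ℚ.<⇒≤ 0<V) η≤½δ) (ℚ.≤-reflexive (trans
      (trans (solve 3 (λ v h d → h :* d :* v := (:- v) :* (:- (h :* d))) refl V ½ δ) Vu₁≡1) (sym ηX≡1))))

    E₂≤HB : E y₂ ≤ HB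
    E₂≤HB = ℚ.≤-trans (p≤∣p∣ (E y₂)) (ℚ.≤-trans (ℚ.≤-reflexive (sym (trans (cong ‖_‖ (horner-⌜⌝ (e₀ ∷ es) y₂)) (‖⌜⌝‖ (E y₂)))))
      (ℚ.≤-trans (subst (λ m → ‖ horner (e₀ ∷ es) ⌜ y₂ ⌝ ‖ ≤ hornerBound S ρ (suc m)) len
        (horner-bound S ρ 0≤S 0≤ρ e≤S {⌜ y₂ ⌝} (subst (_≤ ρ) (sym (‖⌜⌝‖ y₂)) y₂≤ρ))) (p≤p+q 0≤1ℚ)))
      where
      y₂≤ρ : ∣ y₂ ∣ ≤ ρ
      y₂≤ρ = ℚ.≤-trans (ℚ.∣p-q∣≤∣p∣+∣q∣ κ (s * u₂)) (ℚ.≤-trans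
        (ℚ.+-monoʳ-≤ ∣ κ ∣ (ℚ.≤-trans (s*≤ η (ℚ.<⇒≤ 0<η)) (ℚ.≤-trans η≤½δ (ℚ.≤-trans ½δ≤δ δ≤1)))) ∣κ∣+1≤ρ)

    0≤Θ₂ : 0ℚ ≤ Θ u₂
    0≤Θ₂ = subst (0ℚ ≤_) (solve 3 (λ e n y → e :- n :* y := e :+ (:- n) :* y) refl (ε * c) η (E y₂))
      (0≤difference (ℚ.≤-trans (*-monoˡ η (ℚ.<⇒≤ 0<η) E₂≤HB) (ℚ.≤-trans (ℚ.≤-reflexive (trans (ℚ.*-comm η HB) HBη≡))
        (ℚ.≤-trans (*-monoˡ (ε * c) 0≤εc (ℚ.≤-trans ½δ≤δ δ≤1)) (ℚ.≤-reflexive (ℚ.*-identityʳ (ε * c)))))))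

    zero-of-monic : RealZero (point (- V)) (point (- X))
    zero-of-monic = sign-change u₁ u₂ (- V) (- X) Vu₁≡1 Xu₂≡1
      (inj₂ (ℚ.neg-antimono-< 0<½δ , ℚ.neg-antimono-< 0<η)) Θ₁≤0 0≤Θ₂

    t = proj₁ zero-of-monic

    -- At both ends of the bisection x ≤ -V, since X ≥ V, and no approximation exceeds the larger
    -- end.
    t-far : ∀ m → V ≤ ‖ x (at (fromℝ t) m) ‖
    t-far m = subst (V ≤_) (sym (trans (cong ‖_‖ (x-real τ)) (‖⌜⌝‖ (q * (q * τ - p)))))
      (ℚ.≤-trans (≤-by-difference (- V - q * (q * τ - p)) (0≤difference xτ≤-V)
        (solve 2 (λ v y → :- y := v :+ ((:- v) :- y)) refl V (q * (q * τ - p)))) (-p≤∣p∣ (q * (q * τ - p))))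
      where
      τ = seq t m
      τ≤ : τ ≤ point (- V)
      τ≤ = proj₂ (proj₂ zero-of-monic) (point (- V)) ℚ.≤-refl
        (*-monoʳ c (ℚ.<⇒≤ 0<c) (ℚ.+-monoʳ-≤ p (*-monoʳ c (ℚ.<⇒≤ 0<c) (ℚ.neg-antimono-≤ V≤X)))) m
      xτ≤-V : q * (q * τ - p) ≤ - V
      xτ≤-V = subst (q * (q * τ - p) ≤_) (x-point (- V))
        (*-monoˡ q (ℚ.<⇒≤ 0<q) (ℚ.+-monoˡ-≤ (- p) (*-monoˡ q (ℚ.<⇒≤ 0<q) τ≤)))

  opaque
    number : AlgebraicNumber
    number = record
      { value = fromℝ t ; minPoly = Q
      ; irreducible = monic-irreducible ys length-ys twiceOdd ; isRoot = proj₁ (proj₂ zero-of-monic) }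

    number-degree : Degree number (suc n)
    number-degree = (λ eq → 2∤unit (inj₁ refl) (subst (+ 2 ℤ.∣_) (trans (sym eq) (monic-leading ys length-ys twiceOdd)) (∣0 (+ 2)))) ,
      monic-above ys length-ys twiceOdd

    number-integer : AlgebraicInteger number
    number-integer = Q , (suc n , monic-leading ys length-ys twiceOdd , monic-above ys length-ys twiceOdd) , proj₁ (proj₂ zero-of-monic)

    height-≤ : ιₙ (height number) ≤ G * q ^ℚ n
    height-≤ = upper Q ε e₀ es len e≤S (ℚ.≤-reflexive (ℚ.0≤p⇒∣p∣≡p (ℚ.<⇒≤ 0<ε))) evQ

    height-≥ : q ^ℚ n ≤ (Cⁿ + Cⁿ) * ιₙ (height number)
    height-≥ = lower Q e₀ es len positive evQ threshold₁

    conjugate-near : ∀ z → Conjugate number z → z ≉ℂ value number →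
      Eventually λ i → q * q * ‖ at (fromℝ ξ -ℂ z) i ‖ ≤ ιₙ C + (V + 1ℚ + 1ℚ)
    conjugate-near z Qz≈0 z≉α = ξ-x z (V + 1ℚ + 1ℚ)
      (other-zeros-near (g₀ * (q * q)) (q ^ℚ n + q ^ℚ n) (*-pos 0<g₀ (*-pos 0<q 0<q)) (+-pos (^-pos n 0<q) (^-pos n 0<q))
        close (fromℝ t) (proj₁ (proj₂ zero-of-monic)) t-far z Qz≈0 z≉α)
      where
      close : ∀ z w → V ≤ ‖ x z ‖ → V ≤ ‖ x w ‖ → g₀ * (q * q) * ‖ z -ᵍ w ‖ ≤
        (‖ x z ‖ * ‖ x w ‖) * ((q ^ℚ n + q ^ℚ n) * (‖ evalᵍ Q z ‖ + ‖ evalᵍ Q w ‖))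
      close z w V≤z V≤w = ℚ.≤-trans (ℚ.≤-reflexive (ℚ.*-assoc g₀ (q * q) ‖ z -ᵍ w ‖)) (ℚ.≤-trans (far-zeros-close z w V≤z V≤w)
        (ℚ.≤-reflexive (cong (‖ x z ‖ * ‖ x w ‖ *_) (solve 3 (λ q a b → (q :* a :+ q :* b) :+ (q :* a :+ q :* b) := (q :+ q) :* (a :+ b)) refl
          (q ^ℚ n) (‖ evalᵍ Q z ‖) (‖ evalᵍ Q w ‖)))))

    result : ∃ λ α → AlgebraicInteger α × Degree α (suc n) × q ^ℚ n ≤ (Cⁿ + Cⁿ) * ιₙ (height α) × ιₙ (height α) ≤ G * q ^ℚ n ×
      (∀ z → Conjugate α z → z ≉ℂ value α → Eventually λ i → q * q * ‖ at (fromℝ ξ -ℂ z) i ‖ ≤ ιₙ C + (V + 1ℚ + 1ℚ))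
    result = number , number-integer , number-degree , height-≥ , height-≤ , conjugate-near

-- The integer scale and the final constants

fromℚ-pos : ∀ {a} → 0ℚ < a → 0ℝ <ℝ fromℚ a
fromℚ-pos {a} 0<a = mk< a 0<a (0 , λ _ _ → ℚ.≤-reflexive (ℚ.+-identityˡ a))

≤ℝ-intro : ∀ x y → (Eventually λ m → seq x m ≤ seq y m) → x ≤ℝ y
≤ℝ-intro x y h = mk≤ λ ε 0<ε → eventually-map (λ m le → ℚ.≤-trans le (p≤p+q (ℚ.<⇒≤ 0<ε))) h

-- The floor is taken of one approximation x within 1/4 of all later ones, and 2 is added. Then Y ≤
-- x + 2 ≤ X + 9/4, and X ≥ 3/4 along the tail gives 9/4 ≤ 3 X.
integer-scale : ∀ X → 1ℝ ≤ℝ X → ∃ λ Y → 1 ℕ.≤ Y × (Eventually λ m → seq X m ≤ ιₙ Y × ιₙ Y ≤ 4ℚ * seq X m)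
integer-scale X 1≤X = ℤ.∣ y ∣ , 1≤∣y∣ , bounds′
  where
  0<¼ : 0ℚ < ¼
  0<¼ = *-pos 0<½ 0<½
  N = proj₁ (cauchy X ¼ 0<¼)
  close : ∀ m n → N ℕ.≤ m → N ℕ.≤ n → ∣ seq X m - seq X n ∣ ≤ ¼
  close = proj₂ (cauchy X ¼ 0<¼)
  x = seq X N
  k = proj₁ (floor-bounds x)
  k≤x : ι k ≤ x
  k≤x = proj₁ (proj₂ (floor-bounds x))
  x≤k+1 : x ≤ ι k + 1ℚ
  x≤k+1 = proj₂ (proj₂ (floor-bounds x))
  y = k ℤ.+ + 2
  ιy : ι y ≡ ι k + (1ℚ + 1ℚ)
  ιy = trans (ι-+ k (+ 2)) (cong (λ z → ι k + z) ι-2)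
  bounds : Eventually λ m → seq X m ≤ ι y × ι y ≤ 4ℚ * seq X m
  bounds = eventually-map step (both (un≤ 1≤X ¼ 0<¼) (N , λ m h → h))
    where
    step : ∀ m → 1ℚ ≤ seq X m + ¼ × N ℕ.≤ m → seq X m ≤ ι y × ι y ≤ 4ℚ * seq X m
    step m (1≤ , N≤m) =
      ≤-by-difference ((x + ¼ - z) + (ι k + 1ℚ - x) + (1ℚ - ¼))
        (+-nonneg (+-nonneg (0≤difference (∣p-q∣-upper {z} {x} near)) (0≤difference x≤k+1)) (0≤difference ¼≤1))
        (trans ιy (solve 4 (λ x z k f → k :+ (con 1ℚ :+ con 1ℚ) := z :+ ((x :+ f :- z) :+ (k :+ con 1ℚ :- x) :+ (con 1ℚ :- f))) refl x z (ι k) ¼)) ,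
      ℚ.≤-trans (ℚ.≤-reflexive ιy) (≤-by-difference
        ((z + ¼ - x) + (x - ι k) + ((z + ¼ - 1ℚ) + (z + ¼ - 1ℚ) + (z + ¼ - 1ℚ)))
        (+-nonneg (+-nonneg (0≤difference (∣p-q∣-lower {z} {x} near)) (0≤difference k≤x)) (+-nonneg (+-nonneg h h) h))
        (solve 3 (λ x z k → con 4ℚ :* z := (k :+ (con 1ℚ :+ con 1ℚ)) :+
          ((z :+ con ¼ :- x) :+ (x :- k) :+ ((z :+ con ¼ :- con 1ℚ) :+ (z :+ con ¼ :- con 1ℚ) :+ (z :+ con ¼ :- con 1ℚ)))) refl x z (ι k)))
      where
      z = seq X m
      near : ∣ z - x ∣ ≤ ¼
      near = close m N N≤m ℕ.≤-refl
      h : 0ℚ ≤ z + ¼ - 1ℚ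
      h = 0≤difference 1≤
      ¼≤1 : ¼ ≤ 1ℚ
      ¼≤1 = ≤-by-difference (1ℚ - ¼) (ℚ.nonNegative⁻¹ (1ℚ - ¼)) refl
  1≤y : + 1 ℤ.≤ y
  1≤y = ℤ.i<j⇒suc[i]≤j (ι-cancel-< (subst (_< ι y) (sym ι-0) (conclude (eventually-once (both bounds (un≤ 1≤X ½ 0<½))))))
    where
    conclude : (∃ λ m → (seq X m ≤ ι y × ι y ≤ 4ℚ * seq X m) × 1ℚ ≤ seq X m + ½) → 0ℚ < ι y
    conclude (m , (X≤y , _) , 1≤X+½) = ℚ.<-≤-trans 0<½ (ℚ.≤-trans
      (≤-by-difference (seq X m + ½ - 1ℚ) (0≤difference 1≤X+½)
        (solve 1 (λ x → x := con ½ :+ (x :+ con ½ :- con 1ℚ)) refl (seq X m))) X≤y)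
  y≡ : + ℤ.∣ y ∣ ≡ y
  y≡ = ℤ.0≤i⇒+∣i∣≡i (ℤ.≤-trans (ℤ.+≤+ ℕ.z≤n) 1≤y)
  ιy≡ : ι y ≡ ιₙ ℤ.∣ y ∣
  ιy≡ = cong ι (sym y≡)

  1≤∣y∣ : 1 ℕ.≤ ℤ.∣ y ∣
  1≤∣y∣ = ℤ.drop‿+≤+ (subst (+ 1 ℤ.≤_) (sym y≡) 1≤y)
  bounds′ : Eventually λ m → seq X m ≤ ιₙ ℤ.∣ y ∣ × ιₙ ℤ.∣ y ∣ ≤ 4ℚ * seq X m
  bounds′ = subst (λ b → Eventually λ m → seq X m ≤ b × b ≤ 4ℚ * seq X m) ιy≡ bounds

module Main (ξ : ℝ) (C R : ℕ) (1≤C : 1 ℕ.≤ C) (n : ℕ) .{{_ : NonZero n}}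
  (frame : ∀ T → 1 ℕ.≤ T → Frame ξ C R n T) where
  open Constants C n 1≤C
  open HeightConstants C R n 1≤C

  private
    0<G : 0ℚ < G
    0<G = ℚ.<-≤-trans 0<1ℚ 1≤G

    θ₁ θ₂ : ℚ
    θ₁ = (ιₙ (suc n) * ιₙ R + ιₙ (suc n) * ιₙ R) * Cⁿ
    θ₂ = 4ℚ * (D * Cⁿ)

    0≤Cⁿ : 0ℚ ≤ Cⁿ
    0≤Cⁿ = ℚ.≤-trans 0≤1ℚ 1≤Cⁿ

    0≤θ₁ : 0ℚ ≤ θ₁
    0≤θ₁ = *-nonneg (+-nonneg (*-nonneg (ιₙ-nonneg (suc n)) (ιₙ-nonneg R)) (*-nonneg (ιₙ-nonneg (suc n)) (ιₙ-nonneg R))) 0≤Cⁿ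

    0≤θ₂ : 0ℚ ≤ θ₂
    0≤θ₂ = *-nonneg 0≤4ℚ (*-nonneg (ℚ.<⇒≤ 0<D) 0≤Cⁿ)

    M₁ = suc (proj₁ (ceiling (θ₁ + θ₂)))

    θ≤M₁ : θ₁ + θ₂ ≤ ιₙ M₁
    θ≤M₁ = ℚ.≤-trans (proj₂ (ceiling (θ₁ + θ₂))) (ιₙ-mono (ℕ.n≤1+n (proj₁ (ceiling (θ₁ + θ₂)))))

    Bⁿ = suc C ℕ.^ n
    -- The target is T = M Y. From T ≤ Bⁿ qⁿ follows M₁ ≤ qⁿ, so both thresholds hold for every X ≥
    -- 1, small ones included; the price is the factor M in `γ₄`.
    M = M₁ ℕ.* Bⁿ

    1≤Bⁿ : 1 ℕ.≤ Bⁿ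
    1≤Bⁿ = ℕ.m^n>0 (suc C) n

    1≤M : 1 ℕ.≤ M
    1≤M = ℕ.*-mono-≤ {1} {M₁} (ℕ.s≤s ℕ.z≤n) 1≤Bⁿ

    a₃ = (Cⁿ + Cⁿ) * ιₙ Bⁿ

    0<a₃ : 0ℚ < a₃
    0<a₃ = *-pos (+-pos (ℚ.<-≤-trans 0<1ℚ 1≤Cⁿ) (ℚ.<-≤-trans 0<1ℚ 1≤Cⁿ)) (ιₙ-pos 1≤Bⁿ)

  -- The chains are X ≤ Y ≤ Bⁿ qⁿ ≤ Bⁿ 2 Cⁿ H for γ₃ and H ≤ G qⁿ ≤ G 4ⁿ M Y with Y ≤ 4 X for γ₄.
  γ₃ γ₄ : ℚ
  γ₃ = proj₁ (reciprocal 0<a₃)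

  0<γ₃ : 0ℚ < γ₃
  0<γ₃ = proj₁ (proj₂ (reciprocal 0<a₃))

  γ₄ = G * ιₙ (4 ℕ.^ n ℕ.* M) * 4ℚ

  0<γ₄ : 0ℚ < γ₄
  0<γ₄ = *-pos (*-pos 0<G (ιₙ-pos (ℕ.*-mono-≤ (ℕ.m^n>0 4 n) 1≤M))) (+-pos (+-pos 0<1ℚ 0<1ℚ) (+-pos 0<1ℚ 0<1ℚ))

  private
    W₁ W₂ : ℚ
    W₁ = ιₙ C + V
    W₂ = ιₙ C + (V + 1ℚ + 1ℚ)

    0<W₁ : 0ℚ < W₁
    0<W₁ = ℚ.+-mono-≤-< (ιₙ-nonneg C) 0<V

    0<W₂ : 0ℚ < W₂
    0<W₂ = ℚ.+-mono-≤-< (ιₙ-nonneg C) (+-pos (+-pos 0<V 0<1ℚ) 0<1ℚ)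

  γ₁ γ₂ : ℚ
  γ₁ = W₁ * (G * G)
  γ₂ = W₂ * (G * G)

  0<γ₁ : 0ℚ < γ₁
  0<γ₁ = *-pos 0<W₁ (*-pos 0<G 0<G)

  0<γ₂ : 0ℚ < γ₂
  0<γ₂ = *-pos 0<W₂ (*-pos 0<G 0<G)

  module _ (X : ℝ) (1≤X : 1ℝ ≤ℝ X) where
    private
      Y = proj₁ (integer-scale X 1≤X)

      1≤Y : 1 ℕ.≤ Y
      1≤Y = proj₁ (proj₂ (integer-scale X 1≤X))

      X∼Y : Eventually λ m → seq X m ≤ ιₙ Y × ιₙ Y ≤ 4ℚ * seq X m
      X∼Y = proj₂ (proj₂ (integer-scale X 1≤X))

      F : Frame ξ C R n (M ℕ.* Y)
      F = frame (M ℕ.* Y) (ℕ.*-mono-≤ 1≤M 1≤Y)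

      qₙ = Frame.q F
      q = ιₙ qₙ

      0<q : 0ℚ < q
      0<q = ιₙ-pos (Frame.1≤q F)

      MY≤ : M ℕ.* Y ℕ.≤ Bⁿ ℕ.* qₙ ℕ.^ n
      MY≤ = ℕ.≤-trans (Frame.T≤ F) (ℕ.≤-reflexive (ℕ^-distrib-* (suc C) qₙ n))

      M₁≤qⁿ : ιₙ M₁ ≤ q ^ℚ n
      M₁≤qⁿ = subst (ιₙ M₁ ≤_) (ιₙ-^ qₙ n) (ιₙ-mono (ℕ.*-cancelˡ-≤ Bⁿ {{ℕ.>-nonZero 1≤Bⁿ}}
        (ℕ.≤-trans (ℕ.≤-reflexive (ℕ.*-comm Bⁿ M₁)) (ℕ.≤-trans (subst (ℕ._≤ M ℕ.* Y) (ℕ.*-identityʳ M) (ℕ.*-monoʳ-≤ M 1≤Y)) MY≤))))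

      Y≤ : ιₙ Y ≤ ιₙ Bⁿ * q ^ℚ n
      Y≤ = subst (ιₙ Y ≤_) (trans (ιₙ-* Bⁿ (qₙ ℕ.^ n)) (cong (ιₙ Bⁿ *_) (ιₙ-^ qₙ n)))
        (ιₙ-mono (ℕ.≤-trans (subst (ℕ._≤ M ℕ.* Y) (ℕ.*-identityˡ Y) (ℕ.*-monoˡ-≤ Y 1≤M)) MY≤))

      qⁿ≤ : q ^ℚ n ≤ ιₙ (4 ℕ.^ n ℕ.* M) * ιₙ Y
      qⁿ≤ = subst₂ _≤_ (ιₙ-^ qₙ n) (trans (cong ιₙ (sym (ℕ.*-assoc (4 ℕ.^ n) M Y))) (ιₙ-* (4 ℕ.^ n ℕ.* M) Y)) (ιₙ-mono (Frame.qⁿ≤ F))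

      height-lower : ∀ H → q ^ℚ n ≤ (Cⁿ + Cⁿ) * ιₙ H → fromℚ γ₃ *ℝ X ≤ℝ fromℕ H
      height-lower H h = ≤ℝ-intro (fromℚ γ₃ *ℝ X) (fromℕ H) (eventually-map step X∼Y)
        where
        step : ∀ m → seq X m ≤ ιₙ Y × ιₙ Y ≤ 4ℚ * seq X m → γ₃ * seq X m ≤ (+ H) ℚ./ 1
        step m (X≤Y , _) = ℚ.≤-trans (*-monoˡ γ₃ (ℚ.<⇒≤ 0<γ₃)
          (ℚ.≤-trans X≤Y (ℚ.≤-trans Y≤ (*-monoˡ (ιₙ Bⁿ) (ιₙ-nonneg Bⁿ) h))))
          (ℚ.≤-reflexive (trans (solve 4 (λ g b c H → g :* (b :* (c :* H)) := (c :* b :* g) :* H) refl γ₃ (ιₙ Bⁿ) (Cⁿ + Cⁿ) (ιₙ H))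
            (trans (cong (_* ιₙ H) (proj₂ (proj₂ (reciprocal 0<a₃)))) (trans (ℚ.*-identityˡ (ιₙ H)) (ι≡/1 (+ H))))))

      height-upper′ : ∀ H → ιₙ H ≤ G * q ^ℚ n → fromℕ H ≤ℝ fromℚ γ₄ *ℝ X
      height-upper′ H h = ≤ℝ-intro (fromℕ H) (fromℚ γ₄ *ℝ X) (eventually-map step X∼Y)
        where
        step : ∀ m → seq X m ≤ ιₙ Y × ιₙ Y ≤ 4ℚ * seq X m → (+ H) ℚ./ 1 ≤ γ₄ * seq X m
        step m (_ , Y≤4X) = ℚ.≤-trans (ℚ.≤-reflexive (sym (ι≡/1 (+ H)))) (ℚ.≤-trans h (ℚ.≤-trans
          (*-monoˡ G (ℚ.<⇒≤ 0<G) (ℚ.≤-trans qⁿ≤ (*-monoˡ (ιₙ (4 ℕ.^ n ℕ.* M)) (ιₙ-nonneg (4 ℕ.^ n ℕ.* M)) Y≤4X)))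
          (ℚ.≤-reflexive (solve 4 (λ g m f x → g :* (m :* (f :* x)) := g :* m :* f :* x) refl G (ιₙ (4 ℕ.^ n ℕ.* M)) 4ℚ (seq X m)))))

    part-a : ∃[ α ] (Degree α n ×
      (∀ z → Conjugate α z → ∣ fromℝ ξ -ℂ z ∣ℂ ≤ℝ fromℚ γ₁ *ℝ height^-2/ α n) ×
      fromℚ γ₃ *ℝ X ≤ℝ fromℕ (height α) × fromℕ (height α) ≤ℝ fromℚ γ₄ *ℝ X)
    part-a = finish (RationalNumber.result 1≤C F)
      where
      finish : (∃ λ α → Degree α n × q ^ℚ n ≤ (Cⁿ + Cⁿ) * ιₙ (height α) × ιₙ (height α) ≤ G * q ^ℚ n ×
          (∀ z → Conjugate α z → Eventually λ i → q * q * ‖ at (fromℝ ξ -ℂ z) i ‖ ≤ W₁)) →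
        ∃[ α ] (Degree α n × (∀ z → Conjugate α z → ∣ fromℝ ξ -ℂ z ∣ℂ ≤ℝ fromℚ γ₁ *ℝ height^-2/ α n) ×
          fromℚ γ₃ *ℝ X ≤ℝ fromℕ (height α) × fromℕ (height α) ≤ℝ fromℚ γ₄ *ℝ X)
      finish (α , degree , lower , upper , near) = α , degree ,
        (λ z Pz≈0 → distance-bound (fromℝ ξ -ℂ z) n α q G W₁ γ₁ refl 0<q 1≤G 0<W₁ upper (near z Pz≈0)) ,
        height-lower (height α) lower , height-upper′ (height α) upper

    part-b : ∃[ α ] (AlgebraicInteger α × Degree α (suc n) ×
      (∀ z → Conjugate α z → z ≉ℂ value α → ∣ fromℝ ξ -ℂ z ∣ℂ ≤ℝ fromℚ γ₂ *ℝ height^-2/ α n) ×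
      fromℚ γ₃ *ℝ X ≤ℝ fromℕ (height α) × fromℕ (height α) ≤ℝ fromℚ γ₄ *ℝ X)
    part-b = finish (MonicNumber.result 1≤C F
        (ℚ.≤-trans (p≤p+q 0≤θ₂) (ℚ.≤-trans θ≤M₁ M₁≤qⁿ)) (ℚ.≤-trans (q≤p+q 0≤θ₁) (ℚ.≤-trans θ≤M₁ M₁≤qⁿ)))
      where
      finish : (∃ λ α → AlgebraicInteger α × Degree α (suc n) × q ^ℚ n ≤ (Cⁿ + Cⁿ) * ιₙ (height α) × ιₙ (height α) ≤ G * q ^ℚ n ×
          (∀ z → Conjugate α z → z ≉ℂ value α → Eventually λ i → q * q * ‖ at (fromℝ ξ -ℂ z) i ‖ ≤ W₂)) →
        ∃[ α ] (AlgebraicInteger α × Degree α (suc n) ×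
          (∀ z → Conjugate α z → z ≉ℂ value α → ∣ fromℝ ξ -ℂ z ∣ℂ ≤ℝ fromℚ γ₂ *ℝ height^-2/ α n) ×
          fromℚ γ₃ *ℝ X ≤ℝ fromℕ (height α) × fromℕ (height α) ≤ℝ fromℚ γ₄ *ℝ X)
      finish (α , integer , degree , lower , upper , near) = α , integer , degree ,
        (λ z Qz≈0 z≉α → distance-bound (fromℝ ξ -ℂ z) n α q G W₂ γ₂ refl 0<q 1≤G 0<W₂ upper (near z Qz≈0 z≉α)) ,
        height-lower (height α) lower , height-upper′ (height α) upper

theoremB : (ξ : ℝ) → Irrational ξ → BadlyApproximable ξ →
    (n : ℕ) .{{_ : NonZero n}} →
    ∃[ c₁ ] ∃[ c₂ ] ∃[ c₃ ] ∃[ c₄ ]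
    (0ℝ <ℝ c₁ × 0ℝ <ℝ c₂ × 0ℝ <ℝ c₃ × 0ℝ <ℝ c₄ ×
    ((X : ℝ) → 1ℝ ≤ℝ X →
    (∃[ α ] (Degree α n ×
    (∀ z → Conjugate α z →
    ∣ fromℝ ξ -ℂ z ∣ℂ ≤ℝ c₁ *ℝ height^-2/ α n) ×
    c₃ *ℝ X ≤ℝ fromℕ (height α) ×
    fromℕ (height α) ≤ℝ c₄ *ℝ X)) ×
    (∃[ α ] (AlgebraicInteger α ×
    Degree α (suc n) ×
    (∀ z → Conjugate α z → z ≉ℂ value α →
    ∣ fromℝ ξ -ℂ z ∣ℂ ≤ℝ c₂ *ℝ height^-2/ α n) ×
    c₃ *ℝ X ≤ℝ fromℕ (height α) ×
    fromℕ (height α) ≤ℝ c₄ *ℝ X))))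
theoremB ξ _ bad n = fromℚ γ₁ , fromℚ γ₂ , fromℚ γ₃ , fromℚ γ₄ ,
  fromℚ-pos 0<γ₁ , fromℚ-pos 0<γ₂ , fromℚ-pos 0<γ₃ , fromℚ-pos 0<γ₄ , λ X 1≤X → part-a X 1≤X , part-b X 1≤X
  where
  C = proj₁ (frames ξ bad)
  R = proj₁ (proj₂ (frames ξ bad))
  open Main ξ C R (proj₁ (proj₂ (proj₂ (frames ξ bad)))) n (proj₂ (proj₂ (proj₂ (frames ξ bad))) n)
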